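{- Let $d\ge 2$ be a squarefree integer, $K=\mathbb{Q}(\sqrt d)$, and let $f\in\mathbb{N}$ be squarefree such that $f$ is divisible by a ramified prime, $f$ is not divisible by a split prime and $|\mathrm{Pic}(\mathcal{O}_f)|=|\mathrm{Pic}(\mathcal{O}_K)|=2$. Suppose that for each $\alpha\in\{ -1,1\}$ and each ramified $p\in\mathbb{P}$ with $p\mid f$, at least one of the following holds: ($p$ is odd and $\left(\frac{\alpha d/p}{p}\right)=-1$), or (there is some odd $q\in\mathbb{P}$ such that $q\mid df$ and $\left(\frac{ -\alpha p}{q}\right)=-1$). Then $\min\Delta(\mathcal{O}_f)=2$.
   Context: $\mathbb{P}$ is the set of primes, $\mathbb{N}$ the positive integers, and $\left(\frac{a}{b}\right)$ is the Kronecker symbol. For squarefree $d\ge2$ and $K=\mathbb{Q}(\sqrt d)$: $\mathcal{O}_K$ is the ring of integers; $\omega=\sqrt d$ if $d\equiv 2,3 \bmod 4$ and $\omega=\frac{1+\sqrt d}{2}$ if $d\equiv 1\bmod 4$; $\mathsf{d}_K=4d$ if $d\equiv 2,3\bmod 4$ and $\mathsf{d}_K=d$ if $d\equiv1\bmod 4$. For $f\in\mathbb{N}$, $\mathcal{O}_f=\mathbb{Z}+f\omega\mathbb{Z}$ is the order in $K$ with conductor $f$. A prime $p$ is inert, ramified, split if $\left(\frac{\mathsf{d}_K}{p}\right)$ equals $-1,0,1$ respectively. $\mathrm{Pic}(R)$ is the Picard group of $R$. Set of distances: let $D$ be an integral domain. An atom of $D$ is a nonzero nonunit that is not a product of two nonunits.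 For nonzero $a\in D$, $\mathsf{L}(a)$ is the set of all integers $k\ge 0$ such that $a=\eta u_1\cdots u_k$ with $\eta$ a unit and $u_i$ atoms. $\Delta(\mathsf{L}(a))$ is the set of all $n\in\mathbb{N}$ such that there are $k<\ell$ in $\mathsf{L}(a)$ with $n=\ell-k$ and no element of $\mathsf{L}(a)$ strictly between $k$ and $\ell$. $\Delta(D)=\bigcup_{0\ne a\in D}\Delta(\mathsf{L}(a))$. Convention: $\min\Delta(D)=0$ if $\Delta(D)=\emptyset$. -}

module Defs where

open import Algebra.Bundles using (CommutativeRing)
import Algebra.Properties.CommutativeSemigroup as CommutativeSemigroupProperties
open import Data.Fin.Base using (Fin; toℕ)
open import Data.Fin.Properties using (any?)
open import Data.Integer.Base as ℤ using (ℤ; +_; 0ℤ; 1ℤ; -1ℤ)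
open import Data.Integer.Divisibility.Signed using () renaming (_∣?_ to _∣ℤ?_)
open import Data.List.Base using (List; foldr)
open import Data.Nat.Base as ℕ using (ℕ; _<_; _≤_)
open import Data.Nat.Divisibility using (_∣_)
open import Data.Nat.Primality using (Prime; prime⇒nonZero)
open import Data.Product.Base using (∃-syntax; _×_; _,_)
open import Data.Rational.Base as ℚ using (ℚ; 0ℚ; 1ℚ; ½)
open import Data.Rational.Properties using () renaming
  ( +-assoc to ℚ+-assoc; +-comm to ℚ+-comm; +-identityˡ to ℚ+-identityˡ
  ; +-identityʳ to ℚ+-identityʳ; +-inverseˡ to ℚ+-inverseˡ; +-inverseʳ to ℚ+-inverseʳ )
open import Data.Rational.Solver using (module +-*-Solver)
open import Data.Sum.Base using (_⊎_)
open import Data.Vec.Base as Vec using (Vec)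
open import Data.Vec.Relation.Unary.All using (All)
open import Function.Bundles using (Inverse)
open import Level using (0ℓ) renaming (suc to lsuc)
open import Relation.Binary.Bundles using (Setoid)
open import Relation.Binary.PropositionalEquality
  using (_≡_; _≢_; refl; sym; trans; cong; cong₂; subst; setoid; isEquivalence)
open import Relation.Nullary.Decidable using (yes; no)
open import Relation.Nullary.Negation using (¬_)
open import Relation.Unary using (Pred; _∈_; _⊆_; _≐_)

Squarefree : ℕ → Set
Squarefree n = ∀ m → m ℕ.* m ∣ n → m ≡ 1

Odd : ℕ → Set
Odd n = ¬ 2 ∣ n

kronecker₂ : ℤ → ℤ
kronecker₂ a with a ℤ.%ℕ 8
... | 1 = 1ℤ
... | 7 = 1ℤ
... | 3 = -1ℤ
... | 5 = -1ℤ
... | _ = 0ℤ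

legendre : ℤ → ℕ → ℤ
legendre a p with + p ∣ℤ? a
... | yes _ = 0ℤ
... | no  _ with any? {n = p} (λ x → + p ∣ℤ? (+ (toℕ x ℕ.* toℕ x) ℤ.- a))
...   | yes _ = 1ℤ
...   | no  _ = -1ℤ

-- The Kronecker symbol (a / p), meaningful only for prime p; no other lower
-- argument is ever needed.
kronecker : ℤ → ℕ → ℤ
kronecker a 2 = kronecker₂ a
kronecker a p = legendre a p

infix 6 _+_√

-- `a + b √` stands for a + b√d.  Equality of coordinates is the right equality
-- when d is not a perfect square.
record 𝕂 (d : ℕ) : Set where
  constructor _+_√
  field
    rat irr : ℚ

module _ {d : ℕ} where

  infixl 8 _⊗_
  infixl 7 _⊕_
  infix  9 ⊖_

  0𝕂 1𝕂 : 𝕂 d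
  0𝕂 = 0ℚ + 0ℚ √
  1𝕂 = 1ℚ + 0ℚ √

  _⊕_ _⊗_ : 𝕂 d → 𝕂 d → 𝕂 d
  (a + b √) ⊕ (a′ + b′ √) = (a ℚ.+ a′) + (b ℚ.+ b′) √
  (a + b √) ⊗ (a′ + b′ √) =
    (a ℚ.* a′ ℚ.+ (+ d ℚ./ 1) ℚ.* (b ℚ.* b′)) + (a ℚ.* b′ ℚ.+ b ℚ.* a′) √

  ⊖_ : 𝕂 d → 𝕂 d
  ⊖ (a + b √) = (ℚ.- a) + (ℚ.- b) √

  fromℤ : ℤ → 𝕂 d
  fromℤ n = (n ℚ./ 1) + 0ℚ √

  private
    open +-*-Solver

    ⊗-assoc : ∀ x y z → (x ⊗ y) ⊗ z ≡ x ⊗ (y ⊗ z)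
    ⊗-assoc (a + b √) (a′ + b′ √) (a″ + b″ √) = cong₂ _+_√
      (solve 7 (λ D a b a′ b′ a″ b″ →
         (a :* a′ :+ D :* (b :* b′)) :* a″ :+ D :* ((a :* b′ :+ b :* a′) :* b″)
         := a :* (a′ :* a″ :+ D :* (b′ :* b″)) :+ D :* (b :* (a′ :* b″ :+ b′ :* a″)))
         refl (+ d ℚ./ 1) a b a′ b′ a″ b″)
      (solve 7 (λ D a b a′ b′ a″ b″ →
         (a :* a′ :+ D :* (b :* b′)) :* b″ :+ (a :* b′ :+ b :* a′) :* a″
         := a :* (a′ :* b″ :+ b′ :* a″) :+ b :* (a′ :* a″ :+ D :* (b′ :* b″)))
         refl (+ d ℚ./ 1) a b a′ b′ a″ b″)

    ⊗-comm : ∀ x y → x ⊗ y ≡ y ⊗ x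
    ⊗-comm (a + b √) (a′ + b′ √) = cong₂ _+_√
      (solve 5 (λ D a b a′ b′ →
         a :* a′ :+ D :* (b :* b′) := a′ :* a :+ D :* (b′ :* b))
         refl (+ d ℚ./ 1) a b a′ b′)
      (solve 4 (λ a b a′ b′ → a :* b′ :+ b :* a′ := a′ :* b :+ b′ :* a)
         refl a b a′ b′)

    ⊗-identityˡ : ∀ x → 1𝕂 ⊗ x ≡ x
    ⊗-identityˡ (a + b √) = cong₂ _+_√
      (solve 3 (λ D a b → con 1ℚ :* a :+ D :* (con 0ℚ :* b) := a)
         refl (+ d ℚ./ 1) a b)
      (solve 2 (λ a b → con 1ℚ :* b :+ con 0ℚ :* a := b) refl a b)

    ⊗-distribˡ-⊕ : ∀ x y z → x ⊗ (y ⊕ z) ≡ (x ⊗ y) ⊕ (x ⊗ z)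
    ⊗-distribˡ-⊕ (a + b √) (a′ + b′ √) (a″ + b″ √) = cong₂ _+_√
      (solve 7 (λ D a b a′ b′ a″ b″ →
         a :* (a′ :+ a″) :+ D :* (b :* (b′ :+ b″))
         := (a :* a′ :+ D :* (b :* b′)) :+ (a :* a″ :+ D :* (b :* b″)))
         refl (+ d ℚ./ 1) a b a′ b′ a″ b″)
      (solve 6 (λ a b a′ b′ a″ b″ →
         a :* (b′ :+ b″) :+ b :* (a′ :+ a″)
         := (a :* b′ :+ b :* a′) :+ (a :* b″ :+ b :* a″))
         refl a b a′ b′ a″ b″)

  𝕂-commutativeRing : CommutativeRing 0ℓ 0ℓ
  𝕂-commutativeRing = record
    { Carrier = 𝕂 d
    ; _≈_ = _≡_
    ; _+_ = _⊕_
    ; _*_ = _⊗_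
    ; -_  = ⊖_
    ; 0#  = 0𝕂
    ; 1#  = 1𝕂
    ; isCommutativeRing = record
      { isRing = record
        { +-isAbelianGroup = record
          { isGroup = record
            { isMonoid = record
              { isSemigroup = record
                { isMagma = record { isEquivalence = isEquivalence ; ∙-cong = cong₂ _⊕_ }
                ; assoc = λ (a + b √) (a′ + b′ √) (a″ + b″ √) →
                    cong₂ _+_√ (ℚ+-assoc a a′ a″) (ℚ+-assoc b b′ b″)
                }
              ; identity = (λ (a + b √) → cong₂ _+_√ (ℚ+-identityˡ a) (ℚ+-identityˡ b))
                         , (λ (a + b √) → cong₂ _+_√ (ℚ+-identityʳ a) (ℚ+-identityʳ b))
              }
            ; inverse = (λ (a + b √) → cong₂ _+_√ (ℚ+-inverseˡ a) (ℚ+-inverseˡ b))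
                      , (λ (a + b √) → cong₂ _+_√ (ℚ+-inverseʳ a) (ℚ+-inverseʳ b))
            ; ⁻¹-cong = cong ⊖_
            }
          ; comm = λ (a + b √) (a′ + b′ √) → cong₂ _+_√ (ℚ+-comm a a′) (ℚ+-comm b b′)
          }
        ; *-cong = cong₂ _⊗_
        ; *-assoc = ⊗-assoc
        ; *-identity = ⊗-identityˡ
                     , (λ x → trans (⊗-comm x 1𝕂) (⊗-identityˡ x))
        ; distrib = ⊗-distribˡ-⊕
                  , (λ x y z → trans (⊗-comm (y ⊕ z) x)
                       (trans (⊗-distribˡ-⊕ x y z) (cong₂ _⊕_ (⊗-comm x y) (⊗-comm x z))))
        }
      ; *-comm = ⊗-comm
      }
    }

ω : ∀ d → 𝕂 d
ω d with d ℕ.% 4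
... | 1 = ½ + ½ √
... | _ = 0ℚ + 1ℚ √

discriminant : ℕ → ℕ
discriminant d with d ℕ.% 4
... | 1 = d
... | _ = 4 ℕ.* d

-- The value at x of the monic polynomial c₀ + c₁X + ⋯ + cₙ₋₁Xⁿ⁻¹ + Xⁿ.
evalMonic : ∀ {d} → List ℤ → 𝕂 d → 𝕂 d
evalMonic cs x = foldr (λ c v → fromℤ c ⊕ x ⊗ v) 1𝕂 cs

𝒪K : ∀ d → Pred (𝕂 d) 0ℓ
𝒪K d x = ∃[ cs ] evalMonic cs x ≡ 0𝕂

𝒪 : ∀ d → ℕ → Pred (𝕂 d) 0ℓ
𝒪 d f x = ∃[ a ] ∃[ b ] x ≡ fromℤ a ⊕ fromℤ b ⊗ (fromℤ (+ f) ⊗ ω d)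

Ramified Split : ℕ → Pred ℕ 0ℓ
Ramified d p = Prime p × kronecker (+ discriminant d) p ≡ 0ℤ
Split    d p = Prime p × kronecker (+ discriminant d) p ≡ 1ℤ

module _ {d : ℕ} (R : Pred (𝕂 d) 0ℓ) where

  -- R is meant to be a subring of ℚ(√d) with quotient field ℚ(√d).
  record IsFractionalIdeal (I : Pred (𝕂 d) 0ℓ) : Set where
    field
      0∈          : 0𝕂 ∈ I
      ⊕-closed    : ∀ {x y} → x ∈ I → y ∈ I → x ⊕ y ∈ I
      ⊗-closed    : ∀ {r x} → r ∈ R → x ∈ I → r ⊗ x ∈ I
      denominator : ∃[ c ] c ∈ R × c ≢ 0𝕂 × (∀ {x} → x ∈ I → c ⊗ x ∈ R)

-- The product of ideals: all finite sums of products.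
data _·_ {d : ℕ} (I J : Pred (𝕂 d) 0ℓ) : Pred (𝕂 d) 0ℓ where
  zero : 0𝕂 ∈ I · J
  add  : ∀ {x y z} → x ∈ I → y ∈ J → z ∈ I · J → x ⊗ y ⊕ z ∈ I · J

_•_ : ∀ {d} → 𝕂 d → Pred (𝕂 d) 0ℓ → Pred (𝕂 d) 0ℓ
(x • I) y = ∃[ z ] z ∈ I × y ≡ x ⊗ z

record InvertibleFractionalIdeal {d : ℕ} (R : Pred (𝕂 d) 0ℓ) : Set (lsuc 0ℓ) where
  field
    ideal             : Pred (𝕂 d) 0ℓ
    isFractionalIdeal : IsFractionalIdeal R ideal
    inverse           : ∃[ J ] IsFractionalIdeal R J × (ideal · J) ≐ R

open InvertibleFractionalIdeal public using (ideal)

-- Invertible fractional ideals modulo principal ones: I and J are in the same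
-- class iff I = xJ for some x in the multiplicative group of ℚ(√d).
Pic : ∀ {d} → Pred (𝕂 d) 0ℓ → Setoid (lsuc 0ℓ) 0ℓ
Pic {d} R = record
  { Carrier       = InvertibleFractionalIdeal R
  ; _≈_           = λ I J → ideal I ∼ ideal J
  ; isEquivalence = record
    { refl  = λ {I} → ∼-refl {ideal I}
    ; sym   = λ {I} {J} → ∼-sym {ideal I} {ideal J}
    ; trans = λ {I} {J} {L} → ∼-trans {ideal I} {ideal J} {ideal L}
    }
  }
  where
  open CommutativeRing (𝕂-commutativeRing {d})
    using (*-assoc; *-comm; *-identityˡ; *-commutativeSemigroup)
  open CommutativeSemigroupProperties *-commutativeSemigroup using (interchange)

  _∼_ : Pred (𝕂 d) 0ℓ → Pred (𝕂 d) 0ℓ → Set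
  I ∼ J = ∃[ x ] (∃[ y ] x ⊗ y ≡ 1𝕂) × I ≐ (x • J)

  cancel : ∀ x y z → x ⊗ y ≡ 1𝕂 → x ⊗ (y ⊗ z) ≡ z
  cancel x y z xy≡1 =
    trans (sym (*-assoc x y z)) (trans (cong (_⊗ z) xy≡1) (*-identityˡ z))

  ∼-refl : ∀ {I} → I ∼ I
  ∼-refl {I} = 1𝕂 , (1𝕂 , *-identityˡ 1𝕂)
         , (λ {z} z∈I → z , z∈I , sym (*-identityˡ z))
         , (λ { (z , z∈I , refl) → subst I (sym (*-identityˡ z)) z∈I })

  ∼-sym : ∀ {I J} → I ∼ J → J ∼ I
  ∼-sym {I} {J} (x , (y , xy≡1) , I⊆xJ , xJ⊆I) = y , (x , yx≡1)
    , (λ {z} z∈J → x ⊗ z , xJ⊆I (z , z∈J , refl) , sym (cancel y x z yx≡1))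
    , λ { (w , w∈I , refl) → back w (I⊆xJ w∈I) }
    where
    yx≡1 : y ⊗ x ≡ 1𝕂
    yx≡1 = trans (*-comm y x) xy≡1

    back : ∀ w → w ∈ (x • J) → y ⊗ w ∈ J
    back _ (z , z∈J , refl) = subst J (sym (cancel y x z yx≡1)) z∈J

  ∼-trans : ∀ {I J L} → I ∼ J → J ∼ L → I ∼ L
  ∼-trans {I} {J} {L} (x , (y , xy≡1) , I⊆xJ , xJ⊆I) (x′ , (y′ , x′y′≡1) , J⊆x′L , x′L⊆J) =
    x ⊗ x′
    , (y ⊗ y′ , trans (interchange x x′ y y′) (trans (cong₂ _⊗_ xy≡1 x′y′≡1) (*-identityˡ 1𝕂)))
    , (λ z∈I → forth (I⊆xJ z∈I))
    , λ { (z , z∈L , refl) →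
          subst I (sym (*-assoc x x′ z)) (xJ⊆I (x′ ⊗ z , x′L⊆J (z , z∈L , refl) , refl)) }
    where
    forth : ∀ {z} → z ∈ (x • J) → z ∈ ((x ⊗ x′) • L)
    forth (w , w∈J , refl) with J⊆x′L w∈J
    ... | u , u∈L , refl = u , u∈L , sym (*-assoc x x′ u)

HasCardinality : ∀ {a ℓ} → Setoid a ℓ → ℕ → Set _
HasCardinality S n = Inverse S (setoid (Fin n))

module _ {d : ℕ} (D : Pred (𝕂 d) 0ℓ) where

  IsUnit NonUnit IsAtom : Pred (𝕂 d) 0ℓ
  IsUnit  x = x ∈ D × ∃[ y ] y ∈ D × x ⊗ y ≡ 1𝕂
  NonUnit x = x ∈ D × ¬ IsUnit x
  IsAtom  u = NonUnit u × u ≢ 0𝕂 × ¬ (∃[ a ] ∃[ b ] NonUnit a × NonUnit b × u ≡ a ⊗ b)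

  𝖫 : 𝕂 d → Pred ℕ 0ℓ
  𝖫 a k = ∃[ η ] ∃[ us ] IsUnit η × All IsAtom {k} us × a ≡ η ⊗ Vec.foldr′ _⊗_ 1𝕂 us

Distances : Pred ℕ 0ℓ → Pred ℕ 0ℓ
Distances L n = 1 ≤ n × ∃[ k ] ∃[ ℓ ]
  k < ℓ × k ∈ L × ℓ ∈ L × ℓ ≡ k ℕ.+ n × (∀ m → k < m → m < ℓ → ¬ m ∈ L)

Δ : ∀ {d} → Pred (𝕂 d) 0ℓ → Pred ℕ 0ℓ
Δ D n = ∃[ a ] a ∈ D × a ≢ 0𝕂 × n ∈ Distances (𝖫 D a)

-- min Δ(D) = m, where the minimum of the empty set is 0 by convention.
MinΔ≡ : ∀ {d} → Pred (𝕂 d) 0ℓ → ℕ → Set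
MinΔ≡ D m = (m ∈ Δ D × (∀ n → n ∈ Δ D → m ≤ n))
          ⊎ (m ≡ 0 × (∀ n → ¬ n ∈ Δ D))

-- For a sign α and a ramified prime p.  When p is odd, p divides d, so d / p is the exact quotient.
ResidueCondition : (d f : ℕ) (α : ℤ) (p : ℕ) → Prime p → Set
ResidueCondition d f α p p-prime =
    (Odd p × kronecker (α ℤ.* + (d ℕ./ p)) p ≡ -1ℤ)
  ⊎ (∃[ q ] Prime q × Odd q × q ∣ d ℕ.* f × kronecker (ℤ.- α ℤ.* + p) q ≡ -1ℤ)
  where instance _ = prime⇒nonZero p-prime

-- Write 𝒪 for the order of conductor f.  An atom of 𝒪 factors into invertible primary ideals, and
-- as |Pic 𝒪| = 2, it involves one principal or two nonprincipal ones.  A prime q not dividing f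
-- contributes a prime ideal; an inert q ∣ f contributes norm q²; a ramified p ∣ f contributes norm
-- p² or p³.  The ideals of norm q² with q ∣ f extend to q in the maximal order, so they are
-- principal: otherwise every class of 𝒪 would become trivial in Pic 𝒪_K, although extension of
-- classes is onto and |Pic 𝒪_K| = 2.  Those of norm p³ are not principal, because by the residue
-- conditions ±p is not the norm of an element of the order of conductor f / p.
--
-- Give a prime number weight 2 if it is ± a norm from 𝒪, 3 if it is ramified and divides f, and 1
-- otherwise.  By the above the norm of every atom has weight 2 modulo 4 (the cases are 2, 1 + 1,
-- 3 + 3, 9 + 1 and 9 + 9), so all lengths of an element have the same parity, and no distance
-- is 1.  Conversely some x ∈ 𝒪 has norm ±p³q, where p ∣ f is ramified and q ∤ f is not a norm; then
-- x, conj x, p and q are atoms, and x (conj x) = ±p p p q has lengths 2 and 4 but not 3.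
module Submission where

open import Defs
open import Algebra.Bundles using (CommutativeRing)
import Algebra.Solver.Ring.NaturalCoefficients.Default as NaturalSolver
open import Data.Empty using (⊥; ⊥-elim)
open import Data.Fin.Base using (Fin; zero; suc; toℕ; fromℕ<)
open import Data.Fin.Properties as Finₚ using (any?; toℕ-fromℕ<)
open import Data.Integer.Base as ℤ using (ℤ; +_; -[1+_]; 0ℤ; 1ℤ; -1ℤ; ∣_∣; _+_; _*_; _-_; -_; _^_)
import Data.Integer.DivMod as ℤ÷
open import Data.Integer.Divisibility.Signed using (divides; ∣ᵤ⇒∣; ∣⇒∣ᵤ; ∣-refl; ∣-trans; ∣m∣n⇒∣m+n; ∣m∣n⇒∣m-n; ∣m⇒∣-m; ∣m+n∣m⇒∣n; ∣m+n∣n⇒∣m; ∣n⇒∣m*n; ∣m⇒∣m*n; *-monoʳ-∣; *-cancelˡ-∣; *-cancelʳ-∣) renaming (_∣_ to _∣ℤ_; _∣?_ to _∣ℤ?_)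
import Data.Integer.Properties as ℤₚ
open import Data.Integer.Tactic.RingSolver using (solve-∀)
open import Data.List.Base as List using (List; []; _∷_; _++_)
open import Data.List.Relation.Binary.Permutation.Propositional as Perm using (_↭_)
open import Data.List.Relation.Unary.All using (All; []; _∷_)
import Data.List.Relation.Unary.All.Properties as Allₚ
open import Data.Nat.Base as ℕ using (ℕ; zero; suc; _≤_; _<_; s≤s; z≤n)
open import Data.Nat.Divisibility as ℕ∣ using (_∣_)
import Data.Nat.DivMod as ℕ÷
open import Data.Nat.GCD using (module GCD; module Bézout; gcd; gcd[m,n]∣m; gcd[m,n]∣n; gcd-greatest)
open import Data.Nat.ListAction using (product)
open import Data.Nat.ListAction.Properties using (product-++)
open import Data.Nat.Primality using (Prime; prime?; prime[2]; ¬prime[0]; ¬prime[1]; euclidsLemma; prime⇒irreducible; prime⇒nonTrivial; prime⇒nonZero)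
open import Data.Nat.Primality.Factorisation using (factorise; factorisationUnique)
import Data.Nat.Properties as ℕₚ
open import Data.Nat.Tactic.RingSolver using () renaming (solve-∀ to ℕ-solve-∀)
open import Data.Product.Base using (∃-syntax; _×_; _,_; proj₁; proj₂)
open import Data.Rational.Base as ℚ using (ℚ; 0ℚ; 1ℚ; ½; mkℚ; toℚᵘ; ↥_; ↧_)
import Data.Rational.Properties as ℚₚ
open import Data.Rational.Solver using (module +-*-Solver)
open import Data.Rational.Unnormalised.Base as ℚᵘ using (mkℚᵘ; *≡*) renaming (_≃_ to _≃ᵘ_)
import Data.Rational.Unnormalised.Properties as ℚᵘₚ
open import Data.Sum.Base as Sum using (_⊎_; inj₁; inj₂)
open import Data.Vec.Base as Vec using (Vec; []; _∷_)
import Data.Vec.Relation.Unary.All as VecAll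
open import Function.Base using (case_of_)
open import Function.Bundles using (Inverse)
open import Level using (0ℓ)
open import Relation.Binary.Bundles using (Setoid)
open import Relation.Binary.PropositionalEquality
open import Relation.Nullary.Decidable using (Dec; yes; no; _×-dec_; map′; decidable-stable; from-no)
open import Relation.Nullary.Negation using (¬_; contradiction)
open import Relation.Unary using (Pred; _∈_; _≐_)

-- Integers and Kronecker symbols

-- Ideals are never factored. An ideal of 𝒪_f is handled as (u , m) for an element u and an integer
-- m dividing its norm; it is invertible when m, trace u and norm u / m are coprime. It is principal
-- exactly when u = γ δ with norm γ = ±m, so for an irreducible u principality of (u , m) with m ≠ 1
-- pins down |norm u| = m. The hypothesis on Pic 𝒪_f enters in two ways: principality is decidable,
-- and (u , m n) is principal when (u , m) and (u , n) are not. Primes of ℤ in norms stand in for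
-- prime ideals, so that weights live on ℕ and rest on unique factorisation there. Weight 3 at a
-- ramified p ∣ f is forced: the block of norm p³ must count like one nonprincipal prime, and 3 w ≡
-- 1 mod 4 gives w = 3; then p² weighs 6 ≡ 2. The obstacle is Pic 𝒪_K, whose ideals are arbitrary
-- predicates: bringing them into the form (a , m) takes 𝒪_K as a concrete lattice and generators of
-- subgroups of ℤ that exist only up to double negation. This is harmless because that hypothesis
-- serves only to reach a contradiction.

prime-∣* : ∀ {q} → Prime q → ∀ i j → + q ∣ℤ i * j → + q ∣ℤ i ⊎ + q ∣ℤ j
prime-∣* {q} q-prime i j q∣ij = Sum.map ∣ᵤ⇒∣ ∣ᵤ⇒∣
  (euclidsLemma ∣ i ∣ ∣ j ∣ q-prime (subst (q ∣_) (ℤₚ.abs-* i j) (∣⇒∣ᵤ q∣ij)))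

prime-∣² : ∀ {q} → Prime q → ∀ i → + q ∣ℤ i * i → + q ∣ℤ i
prime-∣² q-prime i q∣i² = Sum.reduce (prime-∣* q-prime i i q∣i²)

prime-≢1 : ∀ {q} → Prime q → q ≢ 1
prime-≢1 q-prime refl = ¬prime[1] q-prime

prime-∤1 : ∀ {q} → Prime q → ¬ + q ∣ℤ 1ℤ
prime-∤1 q-prime q∣1 = prime-≢1 q-prime (ℕ∣.∣1⇒≡1 (∣⇒∣ᵤ q∣1))

prime-∣prime : ∀ {q r} → Prime q → Prime r → + q ∣ℤ + r → q ≡ r
prime-∣prime q-prime r-prime q∣r with prime⇒irreducible r-prime (∣⇒∣ᵤ q∣r)
... | inj₁ q≡1 = contradiction q≡1 (prime-≢1 q-prime)
... | inj₂ q≡r = q≡r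

+prime≢0 : ∀ {q} → Prime q → + q ≢ 0ℤ
+prime≢0 q-prime refl = ¬prime[0] q-prime

square-∣-∣ : ∀ q {i} → + q * + q ∣ℤ i → + q ∣ℤ i
square-∣-∣ q (divides k eq) = divides (k * + q) (trans eq (sym (ℤₚ.*-assoc k (+ q) (+ q))))

prime-square-∣* : ∀ {q} → Prime q → ∀ i j → ¬ + q ∣ℤ j → + q * + q ∣ℤ i * j → + q * + q ∣ℤ i
prime-square-∣* {q} q-prime i j q∤j q²∣ij =
  descend (Sum.fromInj₁ (λ q∣j → contradiction q∣j q∤j) (prime-∣* q-prime i j (square-∣-∣ q q²∣ij)))
  where
  instance _ = ℤ.≢-nonZero (+prime≢0 q-prime)

  rearrange : ∀ k q j → k * q * j ≡ q * (k * j)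
  rearrange = solve-∀

  q∣kj : ∀ k → i ≡ k * + q → + q ∣ℤ k * j
  q∣kj k eq = *-cancelˡ-∣ (+ q) (subst (+ q * + q ∣ℤ_) (trans (cong (_* j) eq) (rearrange k (+ q) j)) q²∣ij)

  descend : + q ∣ℤ i → + q * + q ∣ℤ i
  descend (divides k eq) = subst (+ q * + q ∣ℤ_) (sym (trans eq (ℤₚ.*-comm k (+ q))))
    (*-monoʳ-∣ (+ q) (Sum.fromInj₁ (λ q∣j → contradiction q∣j q∤j) (prime-∣* q-prime k j (q∣kj k eq))))

prime-divisor : ∀ n → n ≢ 1 → ∃[ q ] Prime q × q ∣ n
prime-divisor zero _ = 2 , prime[2] , 2 ℕ∣.∣0
prime-divisor (suc n) n≢1 with factorise (suc n)
... | record { factors = [] ; isFactorisation = eq } = contradiction eq n≢1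
... | record { factors = q ∷ qs ; isFactorisation = eq ; factorsPrime = q-prime ∷ _ } =
  q , q-prime , ℕ∣.divides (product qs) (trans eq (ℕₚ.*-comm q (product qs)))

-- The identity for the absolute values comes in two subtraction-free forms over ℕ. `signed` gives a
-- sign e with e i = |i|, and `shift` moves one product across the equation.
bezout-identity : ∀ i j → ∃[ g ] ∃[ r ] ∃[ s ] r * i + s * j ≡ + g × + g ∣ℤ i × + g ∣ℤ j
bezout-identity i j with Bézout.lemma ∣ i ∣ ∣ j ∣
... | Bézout.result g (GCD.is (g∣i , g∣j) _) identity = g , go identity
  where
  signed : ∀ i → ∃[ e ] e * i ≡ + ∣ i ∣
  signed (+ n)    = 1ℤ , ℤₚ.*-identityˡ (+ n)
  signed -[1+ n ] = -1ℤ , ℤₚ.-1*i≡-i -[1+ n ]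

  shift : ∀ x i e y j e′ g → e * i ≡ x → e′ * j ≡ y → ∀ u v → g + v * y ≡ u * x →
    u * e * i + - (v * e′) * j ≡ g
  shift x i e y j e′ g refl refl u v eq = trans (collect u e i v e′ j)
    (trans (cong (_- v * (e′ * j)) (sym eq)) (cancel g (v * (e′ * j))))
    where
    collect : ∀ u e i v e′ j → u * e * i + - (v * e′) * j ≡ u * (e * i) - v * (e′ * j)
    collect = solve-∀
    cancel : ∀ g w → g + w - w ≡ g
    cancel = solve-∀

  lift : ∀ {g u x v y} → g ℕ.+ v ℕ.* y ≡ u ℕ.* x → + g + + v * + y ≡ + u * + x
  lift {g} {u} {x} {v} {y} eq = trans (cong (λ z → + g + z) (sym (ℤₚ.pos-* v y)))
    (trans (cong +_ eq) (ℤₚ.pos-* u x))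

  go : Bézout.Identity.Identity g ∣ i ∣ ∣ j ∣ → ∃[ r ] ∃[ s ] r * i + s * j ≡ + g × + g ∣ℤ i × + g ∣ℤ j
  go (Bézout.+- u v eq) with signed i | signed j
  ... | e , ei | e′ , e′j =
    + u * e , - (+ v * e′)
    , shift _ i e _ j e′ (+ g) ei e′j (+ u) (+ v) (lift {g} {u} {_} {v} eq) , ∣ᵤ⇒∣ g∣i , ∣ᵤ⇒∣ g∣j
  go (Bézout.-+ u v eq) with signed i | signed j
  ... | e , ei | e′ , e′j =
    - (+ u * e) , + v * e′
    , trans (ℤₚ.+-comm (- (+ u * e) * i) (+ v * e′ * j))
        (shift _ j e′ _ i e (+ g) e′j ei (+ v) (+ u) (lift {g} {v} {_} {u} eq)) , ∣ᵤ⇒∣ g∣i , ∣ᵤ⇒∣ g∣j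

-- Coprimality is stated through common primes because divisibility by a prime is what the later
-- arithmetic produces and refutes. A prime factor of the gcd h would divide all three integers.
bezout₃ : ∀ i j k → (∀ q → Prime q → + q ∣ℤ i → + q ∣ℤ j → + q ∣ℤ k → ⊥) →
  ∃[ r ] ∃[ s ] ∃[ u ] r * i + s * j + u * k ≡ 1ℤ
bezout₃ i j k coprime with bezout-identity i j
... | g , r , s , ri+sj≡g , g∣i , g∣j with bezout-identity (+ g) k
... | h , r′ , s′ , r′g+s′k≡h , h∣g , h∣k with h ℕₚ.≟ 1
... | no h≢1 = let q , q-prime , q∣h = prime-divisor h h≢1
                   q∣g = ∣-trans (∣ᵤ⇒∣ q∣h) h∣g
               in ⊥-elim (coprime q q-prime (∣-trans q∣g g∣i) (∣-trans q∣g g∣j) (∣-trans (∣ᵤ⇒∣ q∣h) h∣k))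
... | yes refl = r′ * r , r′ * s , s′ , trans (collect r′ r i s j s′ k)
    (trans (cong (λ z → r′ * z + s′ * k) ri+sj≡g) r′g+s′k≡h)
  where
  collect : ∀ r′ r i s j s′ k → r′ * r * i + r′ * s * j + s′ * k ≡ r′ * (r * i + s * j) + s′ * k
  collect = solve-∀

bezout₂ : ∀ i j → (∀ q → Prime q → + q ∣ℤ i → + q ∣ℤ j → ⊥) → ∃[ r ] ∃[ s ] r * i + s * j ≡ 1ℤ
bezout₂ i j coprime = drop (bezout₃ i j 0ℤ λ q q-prime q∣i q∣j _ → coprime q q-prime q∣i q∣j)
  where
  vanish : ∀ z u → z ≡ z + u * 0ℤ
  vanish = solve-∀
  drop : ∃[ r ] ∃[ s ] ∃[ u ] r * i + s * j + u * 0ℤ ≡ 1ℤ → ∃[ r ] ∃[ s ] r * i + s * j ≡ 1ℤ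
  drop (r , s , u , eq) = r , s , trans (vanish (r * i + s * j) u) eq

odd-prime-∤2 : ∀ {q} → Prime q → Odd q → ¬ + q ∣ℤ + 2
odd-prime-∤2 q-prime odd q∣2 with prime-∣prime q-prime prime[2] q∣2
... | refl = odd ℕ∣.∣-refl

≢2⇒odd : ∀ {q} → Prime q → q ≢ 2 → Odd q
≢2⇒odd q-prime q≢2 2∣q = q≢2 (sym (prime-∣prime prime[2] q-prime (∣ᵤ⇒∣ 2∣q)))

legendre≡0⇒∣ : ∀ a p → legendre a p ≡ 0ℤ → + p ∣ℤ a
legendre≡0⇒∣ a p eq with + p ∣ℤ? a
... | yes p∣a = p∣a
... | no _ with any? {n = p} (λ x → + p ∣ℤ? (+ (toℕ x ℕ.* toℕ x) - a))
...   | yes _ with () ← eq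
...   | no  _ with () ← eq

legendre≡-1⇒nonsquare : ∀ a p → legendre a p ≡ -1ℤ → ∀ (x : Fin p) → ¬ + p ∣ℤ + (toℕ x ℕ.* toℕ x) - a
legendre≡-1⇒nonsquare a p eq x p∣x²-a with + p ∣ℤ? a
... | yes _ with () ← eq
... | no _ with any? {n = p} (λ x → + p ∣ℤ? (+ (toℕ x ℕ.* toℕ x) - a))
...   | yes _ with () ← eq
...   | no ∄x = ∄x (x , p∣x²-a)

kronecker-odd : ∀ a {p} → Odd p → kronecker a p ≡ legendre a p
kronecker-odd a {0} odd = refl
kronecker-odd a {1} odd = refl
kronecker-odd a {2} odd = ⊥-elim (odd ℕ∣.∣-refl)
kronecker-odd a {suc (suc (suc _))} odd = refl

-- If q did not divide u, then u would have an inverse v modulo q, and s v would be a square root of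
-- a modulo q.
nonresidue : ∀ {q} → Prime q → ∀ a → legendre a q ≡ -1ℤ →
  ∀ s u → + q ∣ℤ s * s - a * (u * u) → + q ∣ℤ u
nonresidue {q} q-prime a eq s u q∣s²-au² = decidable-stable (+ q ∣ℤ? u) λ q∤u →
  from-inverse (bezout₂ (+ q) u λ r r-prime r∣q r∣u →
    q∤u (subst (λ r → + r ∣ℤ u) (prime-∣prime r-prime q-prime r∣q) r∣u))
  where
  instance _ = prime⇒nonZero q-prime

  -- `legendre` searches only the residues below q, so y is replaced by its remainder x; x² - a
  -- differs from y² - a by (y + x) (y - x), a multiple of q.
  reduce : ∀ y → + q ∣ℤ y * y - a → ⊥
  reduce y q∣y²-a = legendre≡-1⇒nonsquare a q eq (fromℕ< x<q)
    (subst (λ x → + q ∣ℤ + (x ℕ.* x) - a) (sym (toℕ-fromℕ< x<q)) q∣x²-a)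
    where
    x : ℕ
    x = y ℤ÷.%ℕ q
    x<q : x < q
    x<q = ℤ÷.n%ℕd<d y q
    expand : ∀ x k q a → x * x - a ≡ (x + k * q) * (x + k * q) - a - (x + k * q + x) * (k * q)
    expand = solve-∀
    square : ∀ x k → y ≡ x + k * + q → x * x - a ≡ y * y - a - (y + x) * (k * + q)
    square x k y≡ = trans (expand x k (+ q) a)
      (cong (λ y → y * y - a - (y + x) * (k * + q)) (sym y≡))
    q∣x²-a : + q ∣ℤ + (x ℕ.* x) - a
    q∣x²-a = subst (+ q ∣ℤ_)
      (sym (trans (cong (_- a) (ℤₚ.pos-* x x)) (square (+ x) (y ℤ÷./ℕ q) (ℤ÷.a≡a%ℕn+[a/ℕn]*n y q))))
      (∣m∣n⇒∣m-n q∣y²-a (∣n⇒∣m*n (y + + x) (∣n⇒∣m*n (y ℤ÷./ℕ q) ∣-refl)))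

  from-inverse : ∃[ k ] ∃[ v ] k * + q + v * u ≡ 1ℤ → ⊥
  from-inverse (k , v , kq+vu≡1) = reduce (s * v) (subst (+ q ∣ℤ_) (sym (split s v a u))
    (∣m∣n⇒∣m-n (∣n⇒∣m*n (v * v) q∣s²-au²) (∣n⇒∣m*n (a * (1ℤ + v * u)) q∣1-vu)))
    where
    cancel : ∀ i j → i ≡ i + j - j
    cancel = solve-∀
    q∣1-vu : + q ∣ℤ 1ℤ - v * u
    q∣1-vu = subst (+ q ∣ℤ_) (trans (cancel (k * + q) (v * u)) (cong (_- v * u) kq+vu≡1)) (∣n⇒∣m*n k ∣-refl)
    split : ∀ s v a u → s * v * (s * v) - a ≡ v * v * (s * s - a * (u * u)) - a * (1ℤ + v * u) * (1ℤ - v * u)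
    split = solve-∀

-- Quadratic integers in coordinates

IsSign : ℤ → Set
IsSign ε = ε ≡ -1ℤ ⊎ ε ≡ 1ℤ

sign² : ∀ {ε} → IsSign ε → ε * ε ≡ 1ℤ
sign² (inj₁ refl) = refl
sign² (inj₂ refl) = refl

∣i∣≡∣j∣⇒i≡±j : ∀ i j → ∣ i ∣ ≡ ∣ j ∣ → ∃[ ε ] IsSign ε × i ≡ ε * j
∣i∣≡∣j∣⇒i≡±j (+ m)    (+ n)    eq = 1ℤ , inj₂ refl , trans (cong +_ eq) (sym (ℤₚ.*-identityˡ (+ n)))
∣i∣≡∣j∣⇒i≡±j (+ m)    -[1+ n ] eq = -1ℤ , inj₁ refl , trans (cong +_ eq) (sym (ℤₚ.-1*i≡-i -[1+ n ]))
∣i∣≡∣j∣⇒i≡±j -[1+ m ] (+ n)    eq = -1ℤ , inj₁ refl , trans (cong (λ k → - (+ k)) eq) (sym (ℤₚ.-1*i≡-i (+ n)))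
∣i∣≡∣j∣⇒i≡±j -[1+ m ] -[1+ n ] eq = 1ℤ , inj₂ refl ,
  trans (cong (λ k → - (+ k)) eq) (sym (ℤₚ.*-identityˡ -[1+ n ]))

∣∣-antisym : ∀ {i j} → i ∣ℤ j → j ∣ℤ i → ∣ i ∣ ≡ ∣ j ∣
∣∣-antisym i∣j j∣i = ℕ∣.∣-antisym (∣⇒∣ᵤ i∣j) (∣⇒∣ᵤ j∣i)

∣-coprime-cancel : ∀ {i j k} → ∃[ r ] ∃[ s ] r * i + s * j ≡ 1ℤ → i ∣ℤ j * k → i ∣ℤ k
∣-coprime-cancel {i} {j} {k} (r , s , ri+sj≡1) i∣jk = subst (i ∣ℤ_)
  (trans (sym (expand r i s j k)) (trans (cong (_* k) ri+sj≡1) (ℤₚ.*-identityˡ k)))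
  (∣m∣n⇒∣m+n (∣m⇒∣m*n (r * k) ∣-refl) (∣n⇒∣m*n s i∣jk))
  where
  expand : ∀ r i s j k → (r * i + s * j) * k ≡ i * (r * k) + s * (j * k)
  expand = solve-∀

∤⇒bezout : ∀ {q i} → Prime q → ¬ + q ∣ℤ i → ∃[ r ] ∃[ s ] r * i + s * + q ≡ 1ℤ
∤⇒bezout {q} {i} q-prime q∤i = bezout₂ i (+ q) λ r r-prime r∣i r∣q →
  q∤i (subst (λ r → + r ∣ℤ i) (prime-∣prime r-prime q-prime r∣q) r∣i)

𝒵 : Set
𝒵 = ℤ × ℤ

-- (x , y) stands for x + yω, where ω² = tω − n.
module Quadratic (t n : ℤ) where

  infixl 8 _∙_
  infixl 7 _⊞_

  ⟦_⟧ : ℤ → 𝒵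
  ⟦ m ⟧ = m , 0ℤ

  opaque

    _⊞_ _∙_ : 𝒵 → 𝒵 → 𝒵
    (x , y) ⊞ (x′ , y′) = x + x′ , y + y′
    (x , y) ∙ (x′ , y′) = x * x′ - n * (y * y′) , x * y′ + y * x′ + t * (y * y′)

    neg conj : 𝒵 → 𝒵
    neg (x , y) = - x , - y
    conj (x , y) = x + t * y , - y

    norm trace : 𝒵 → ℤ
    norm (x , y) = x * x + t * (x * y) + n * (y * y)
    trace (x , y) = + 2 * x + t * y

  -- x + yω belongs to the order of conductor g iff g ∣ y.
  record InOrder (g : ℕ) (u : 𝒵) : Set where
    constructor inOrder
    field ∣im : + g ∣ℤ proj₂ u

  ⟦⟧-inOrder : ∀ {g} m → InOrder g ⟦ m ⟧
  ⟦⟧-inOrder m = inOrder (divides 0ℤ refl)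

  opaque
    unfolding _∙_

    ⊞-assoc : ∀ u v w → (u ⊞ v) ⊞ w ≡ u ⊞ (v ⊞ w)
    ⊞-assoc (x , y) (x′ , y′) (x″ , y″) = cong₂ _,_ (ℤₚ.+-assoc x x′ x″) (ℤₚ.+-assoc y y′ y″)

    ⊞-comm : ∀ u v → u ⊞ v ≡ v ⊞ u
    ⊞-comm (x , y) (x′ , y′) = cong₂ _,_ (ℤₚ.+-comm x x′) (ℤₚ.+-comm y y′)

    ⊞-identityˡ : ∀ u → ⟦ 0ℤ ⟧ ⊞ u ≡ u
    ⊞-identityˡ (x , y) = cong₂ _,_ (ℤₚ.+-identityˡ x) (ℤₚ.+-identityˡ y)

    ⊞-inverseˡ : ∀ u → neg u ⊞ u ≡ ⟦ 0ℤ ⟧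
    ⊞-inverseˡ (x , y) = cong₂ _,_ (ℤₚ.+-inverseˡ x) (ℤₚ.+-inverseˡ y)

    ⟦⟧-⊞ : ∀ m k → ⟦ m ⟧ ⊞ ⟦ k ⟧ ≡ ⟦ m + k ⟧
    ⟦⟧-⊞ m k = refl

    ∙-assoc : ∀ u v w → (u ∙ v) ∙ w ≡ u ∙ (v ∙ w)
    ∙-assoc (x , y) (x′ , y′) (x″ , y″) = cong₂ _,_ (re t n x y x′ y′ x″ y″) (im t n x y x′ y′ x″ y″)
      where
      re : ∀ t n x y x′ y′ x″ y″ →
        (x * x′ - n * (y * y′)) * x″ - n * ((x * y′ + y * x′ + t * (y * y′)) * y″)
        ≡ x * (x′ * x″ - n * (y′ * y″)) - n * (y * (x′ * y″ + y′ * x″ + t * (y′ * y″)))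
      re = solve-∀
      im : ∀ t n x y x′ y′ x″ y″ →
        (x * x′ - n * (y * y′)) * y″ + (x * y′ + y * x′ + t * (y * y′)) * x″ + t *
          ((x * y′ + y * x′ + t * (y * y′)) * y″)
        ≡ x * (x′ * y″ + y′ * x″ + t * (y′ * y″)) + y * (x′ * x″ - n * (y′ * y″)) + t *
          (y * (x′ * y″ + y′ * x″ + t * (y′ * y″)))
      im = solve-∀

    ∙-comm : ∀ u v → u ∙ v ≡ v ∙ u
    ∙-comm (x , y) (x′ , y′) = cong₂ _,_ (re n x y x′ y′) (im t x y x′ y′)
      where
      re : ∀ n x y x′ y′ → x * x′ - n * (y * y′) ≡ x′ * x - n * (y′ * y)
      re = solve-∀
      im : ∀ t x y x′ y′ → x * y′ + y * x′ + t * (y * y′) ≡ x′ * y + y′ * x + t * (y′ * y)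
      im = solve-∀

    ∙-distribˡ-⊞ : ∀ u v w → u ∙ (v ⊞ w) ≡ u ∙ v ⊞ u ∙ w
    ∙-distribˡ-⊞ (x , y) (x′ , y′) (x″ , y″) = cong₂ _,_ (re n x y x′ y′ x″ y″) (im t x y x′ y′ x″ y″)
      where
      re : ∀ n x y x′ y′ x″ y″ → x * (x′ + x″) - n * (y * (y′ + y″)) ≡ (x * x′ - n * (y * y′)) +
        (x * x″ - n * (y * y″))
      re = solve-∀
      im : ∀ t x y x′ y′ x″ y″ → x * (y′ + y″) + y * (x′ + x″) + t * (y * (y′ + y″))
        ≡ (x * y′ + y * x′ + t * (y * y′)) + (x * y″ + y * x″ + t * (y * y″))
      im = solve-∀

    ⟦⟧-∙ : ∀ m u → ⟦ m ⟧ ∙ u ≡ (m * proj₁ u , m * proj₂ u)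
    ⟦⟧-∙ m (x , y) = cong₂ _,_ (re n m x y) (im t m x y)
      where
      re : ∀ n m x y → m * x - n * (0ℤ * y) ≡ m * x
      re = solve-∀
      im : ∀ t m x y → m * y + 0ℤ * x + t * (0ℤ * y) ≡ m * y
      im = solve-∀

    ∙-identityˡ : ∀ u → ⟦ 1ℤ ⟧ ∙ u ≡ u
    ∙-identityˡ u = trans (⟦⟧-∙ 1ℤ u) (cong₂ _,_ (ℤₚ.*-identityˡ (proj₁ u)) (ℤₚ.*-identityˡ (proj₂ u)))

    norm-∙ : ∀ u v → norm (u ∙ v) ≡ norm u * norm v
    norm-∙ (x , y) (x′ , y′) = identity t n x y x′ y′
      where
      identity : ∀ t n x y x′ y′ →
        (x * x′ - n * (y * y′)) * (x * x′ - n * (y * y′))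
          + t * ((x * x′ - n * (y * y′)) * (x * y′ + y * x′ + t * (y * y′)))
          + n * ((x * y′ + y * x′ + t * (y * y′)) * (x * y′ + y * x′ + t * (y * y′)))
        ≡ (x * x + t * (x * y) + n * (y * y)) * (x′ * x′ + t * (x′ * y′) + n * (y′ * y′))
      identity = solve-∀

    norm-⟦⟧ : ∀ m → norm ⟦ m ⟧ ≡ m * m
    norm-⟦⟧ m = identity t n m
      where
      identity : ∀ t n m → m * m + t * (m * 0ℤ) + n * 0ℤ ≡ m * m
      identity = solve-∀

    conj-∙ : ∀ u v → conj (u ∙ v) ≡ conj u ∙ conj v
    conj-∙ (x , y) (x′ , y′) = cong₂ _,_ (re t n x y x′ y′) (im t x y x′ y′)
      where
      re : ∀ t n x y x′ y′ → x * x′ - n * (y * y′) + t * (x * y′ + y * x′ + t * (y * y′))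
        ≡ (x + t * y) * (x′ + t * y′) - n * (- y * - y′)
      re = solve-∀
      im : ∀ t x y x′ y′ → - (x * y′ + y * x′ + t * (y * y′))
        ≡ (x + t * y) * - y′ + - y * (x′ + t * y′) + t * (- y * - y′)
      im = solve-∀

    conj-⊞ : ∀ u v → conj (u ⊞ v) ≡ conj u ⊞ conj v
    conj-⊞ (x , y) (x′ , y′) = cong₂ _,_ (re t x y x′ y′) (ℤₚ.neg-distrib-+ y y′)
      where
      re : ∀ t x y x′ y′ → x + x′ + t * (y + y′) ≡ (x + t * y) + (x′ + t * y′)
      re = solve-∀

    conj-⟦⟧ : ∀ m → conj ⟦ m ⟧ ≡ ⟦ m ⟧
    conj-⟦⟧ m = cong (_, 0ℤ) (identity t m)
      where
      identity : ∀ t m → m + t * 0ℤ ≡ m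
      identity = solve-∀

    norm-conj : ∀ u → norm (conj u) ≡ norm u
    norm-conj (x , y) = identity t n x y
      where
      identity : ∀ t n x y → (x + t * y) * (x + t * y) + t * ((x + t * y) * - y) + n * (- y * - y)
        ≡ x * x + t * (x * y) + n * (y * y)
      identity = solve-∀

    trace-conj : ∀ u → trace (conj u) ≡ trace u
    trace-conj (x , y) = identity t x y
      where
      identity : ∀ t x y → + 2 * (x + t * y) + t * - y ≡ + 2 * x + t * y
      identity = solve-∀

    ∙-conj : ∀ u → u ∙ conj u ≡ ⟦ norm u ⟧
    ∙-conj (x , y) = cong₂ _,_ (re t n x y) (im t x y)
      where
      re : ∀ t n x y → x * (x + t * y) - n * (y * - y) ≡ x * x + t * (x * y) + n * (y * y)
      re = solve-∀
      im : ∀ t x y → x * - y + y * (x + t * y) + t * (y * - y) ≡ 0ℤ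
      im = solve-∀

    ⊞-conj : ∀ u → u ⊞ conj u ≡ ⟦ trace u ⟧
    ⊞-conj (x , y) = cong₂ _,_ (re t x y) (ℤₚ.+-inverseʳ y)
      where
      re : ∀ t x y → x + (x + t * y) ≡ + 2 * x + t * y
      re = solve-∀

    norm-⊞ : ∀ u v → norm (u ⊞ v) ≡ norm u + trace (u ∙ conj v) + norm v
    norm-⊞ (x , y) (x′ , y′) = identity t n x y x′ y′
      where
      identity : ∀ t n x y x′ y′ →
        (x + x′) * (x + x′) + t * ((x + x′) * (y + y′)) + n * ((y + y′) * (y + y′))
        ≡ (x * x + t * (x * y) + n * (y * y))
          + (+ 2 * (x * (x′ + t * y′) - n * (y * - y′)) + t * (x * - y′ + y * (x′ + t * y′) + t * (y * - y′)))
          + (x′ * x′ + t * (x′ * y′) + n * (y′ * y′))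
      identity = solve-∀

    trace-⟦⟧-∙ : ∀ m u → trace (⟦ m ⟧ ∙ u) ≡ m * trace u
    trace-⟦⟧-∙ m u = trans (cong trace (⟦⟧-∙ m u)) (identity t m (proj₁ u) (proj₂ u))
      where
      identity : ∀ t m x y → + 2 * (m * x) + t * (m * y) ≡ m * (+ 2 * x + t * y)
      identity = solve-∀

    trace²-4norm : ∀ u → trace u * trace u - + 4 * norm u ≡ (t * t - + 4 * n) * (proj₂ u * proj₂ u)
    trace²-4norm (x , y) = identity t n x y
      where
      identity : ∀ t n x y → (+ 2 * x + t * y) * (+ 2 * x + t * y) - + 4 * (x * x + t * (x * y) + n * (y * y))
        ≡ (t * t - + 4 * n) * (y * y)
      identity = solve-∀

    ⊞-inOrder : ∀ {g u v} → InOrder g u → InOrder g v → InOrder g (u ⊞ v)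
    ⊞-inOrder (inOrder g∣y) (inOrder g∣y′) = inOrder (∣m∣n⇒∣m+n g∣y g∣y′)

    ∙-inOrder : ∀ {g u v} → InOrder g u → InOrder g v → InOrder g (u ∙ v)
    ∙-inOrder {u = x , y} {x′ , y′} (inOrder g∣y) (inOrder g∣y′) = inOrder
      (∣m∣n⇒∣m+n (∣m∣n⇒∣m+n (∣n⇒∣m*n x g∣y′) (∣m⇒∣m*n x′ g∣y)) (∣n⇒∣m*n t (∣m⇒∣m*n y′ g∣y)))

    conj-inOrder : ∀ {g u} → InOrder g u → InOrder g (conj u)
    conj-inOrder (inOrder g∣y) = inOrder (∣m⇒∣-m g∣y)

  𝒵-commutativeRing : CommutativeRing 0ℓ 0ℓ
  𝒵-commutativeRing = record
    { Carrier = 𝒵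
    ; _≈_ = _≡_
    ; _+_ = _⊞_
    ; _*_ = _∙_
    ; -_  = neg
    ; 0#  = ⟦ 0ℤ ⟧
    ; 1#  = ⟦ 1ℤ ⟧
    ; isCommutativeRing = record
      { isRing = record
        { +-isAbelianGroup = record
          { isGroup = record
            { isMonoid = record
              { isSemigroup = record
                { isMagma = record { isEquivalence = isEquivalence ; ∙-cong = cong₂ _⊞_ }
                ; assoc = ⊞-assoc
                }
              ; identity = ⊞-identityˡ , λ u → trans (⊞-comm u ⟦ 0ℤ ⟧) (⊞-identityˡ u)
              }
            ; inverse = ⊞-inverseˡ , λ u → trans (⊞-comm u (neg u)) (⊞-inverseˡ u)
            ; ⁻¹-cong = cong neg
            }
          ; comm = ⊞-comm
          }
        ; *-cong = cong₂ _∙_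
        ; *-assoc = ∙-assoc
        ; *-identity = ∙-identityˡ , (λ u → trans (∙-comm u ⟦ 1ℤ ⟧) (∙-identityˡ u))
        ; distrib = ∙-distribˡ-⊞
                  , (λ u v w → trans (∙-comm (v ⊞ w) u)
                       (trans (∙-distribˡ-⊞ u v w) (cong₂ _⊞_ (∙-comm u v) (∙-comm u w))))
        }
      ; *-comm = ∙-comm
      }
    }

  open NaturalSolver (CommutativeRing.commutativeSemiring 𝒵-commutativeRing) public
    using (_:=_; _:+_; _:*_) renaming (solve to solve𝒵)

  ∙-swap : ∀ u v w → u ∙ (v ∙ w) ≡ v ∙ (u ∙ w)
  ∙-swap = solve𝒵 3 (λ u v w → (u :* (v :* w)) := (v :* (u :* w))) refl

  ⟦⟧-* : ∀ m k → ⟦ m ⟧ ∙ ⟦ k ⟧ ≡ ⟦ m * k ⟧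
  ⟦⟧-* m k = trans (⟦⟧-∙ m ⟦ k ⟧) (cong (m * k ,_) (ℤₚ.*-zeroʳ m))

  ⟦⟧-cancel : ∀ m → m ≢ 0ℤ → ∀ u v → ⟦ m ⟧ ∙ u ≡ ⟦ m ⟧ ∙ v → u ≡ v
  ⟦⟧-cancel m m≢0 u v eq = cong₂ _,_
    (ℤₚ.*-cancelˡ-≡ m (proj₁ u) (proj₁ v) (cong proj₁ eq′))
      (ℤₚ.*-cancelˡ-≡ m (proj₂ u) (proj₂ v) (cong proj₂ eq′))
    where
    instance _ = ℤ.≢-nonZero m≢0
    eq′ : (m * proj₁ u , m * proj₂ u) ≡ (m * proj₁ v , m * proj₂ v)
    eq′ = trans (sym (⟦⟧-∙ m u)) (trans eq (⟦⟧-∙ m v))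

  conj-∙-self : ∀ u → conj u ∙ u ≡ ⟦ norm u ⟧
  conj-∙-self u = trans (∙-comm (conj u) u) (∙-conj u)

  norm-⟦⟧-∙ : ∀ m u → norm (⟦ m ⟧ ∙ u) ≡ m * m * norm u
  norm-⟦⟧-∙ m u = trans (norm-∙ ⟦ m ⟧ u) (cong (_* norm u) (norm-⟦⟧ m))

  -- The ideal (a , m) is then invertible: its product with (conj a , m)
  -- contains m times each of m, trace a and cofactor, hence m itself.
  record Primitive (g : ℕ) (a : 𝒵) (m : ℤ) : Set where
    field
      ∈order   : InOrder g a
      nonzero  : m ≢ 0ℤ
      cofactor : ℤ
      norm≡    : norm a ≡ m * cofactor
      r s k    : ℤ
      bezout   : r * m + s * trace a + k * cofactor ≡ 1ℤ

  -- m, trace a and c are the coefficients of the binary quadratic form norm (x m + y a) / m; having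
  -- no common prime is primitivity of this form.
  mkPrimitive : ∀ {g a m} c → InOrder g a → m ≢ 0ℤ → norm a ≡ m * c →
    (∀ q → Prime q → + q ∣ℤ m → + q ∣ℤ trace a → + q ∣ℤ c → ⊥) → Primitive g a m
  mkPrimitive {a = a} {m} c a∈ m≢0 eq coprime = let r , s , k , rm+sT+kc≡1 = bezout₃ m (trace a) c coprime in
    record { ∈order = a∈ ; nonzero = m≢0 ; cofactor = c ; norm≡ = eq ; r = r ; s = s ; k = k ; bezout =
      rm+sT+kc≡1 }

  -- For primitive (a , m) this says that the ideal (a , m) is principal.
  Splits : ℕ → 𝒵 → ℤ → Set
  Splits g a m = ∃[ γ ] ∃[ δ ] InOrder g γ × InOrder g δ × a ≡ γ ∙ δ × ∣ norm γ ∣ ≡ ∣ m ∣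

  module _ {g a m} (P : Primitive g a m) where
    open Primitive P

    -- The trace is split as a + conj a because the summands are treated differently: a is a
    -- generator of the ideal, while products of conj a with elements of the ideal are multiples of
    -- m.
    bezout-⟦⟧ : ⟦ 1ℤ ⟧ ≡ ⟦ r ⟧ ∙ ⟦ m ⟧ ⊞ ⟦ s ⟧ ∙ (a ⊞ conj a) ⊞ ⟦ k ⟧ ∙ ⟦ cofactor ⟧
    bezout-⟦⟧ = sym (begin
      ⟦ r ⟧ ∙ ⟦ m ⟧ ⊞ ⟦ s ⟧ ∙ (a ⊞ conj a) ⊞ ⟦ k ⟧ ∙ ⟦ cofactor ⟧
        ≡⟨ cong₂ _⊞_ (cong₂ _⊞_ (⟦⟧-* r m) (trans (cong (⟦ s ⟧ ∙_) (⊞-conj a)) (⟦⟧-* s (trace a))))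
          (⟦⟧-* k cofactor) ⟩
      ⟦ r * m ⟧ ⊞ ⟦ s * trace a ⟧ ⊞ ⟦ k * cofactor ⟧
        ≡⟨ cong (_⊞ ⟦ k * cofactor ⟧) (⟦⟧-⊞ (r * m) (s * trace a)) ⟩
      ⟦ r * m + s * trace a ⟧ ⊞ ⟦ k * cofactor ⟧ ≡⟨ ⟦⟧-⊞ (r * m + s * trace a) (k * cofactor) ⟩
      ⟦ r * m + s * trace a + k * cofactor ⟧ ≡⟨ cong ⟦_⟧ bezout ⟩
      ⟦ 1ℤ ⟧ ∎)
      where open ≡-Reasoning

    module _ {γ δ μ u v} (γ≡ : γ ≡ a ∙ u ⊞ ⟦ m ⟧ ∙ v) (a≡ : a ≡ γ ∙ δ) (m≡ : ⟦ m ⟧ ≡ γ ∙ μ) where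

      -- The equations say that γ generates (a , m). Its norm divides m², m trace a and norm a = m
      -- cofactor, and m is the Bézout combination of these three. Conversely each term in the
      -- expansion of norm (a u + m v) is divisible by m.
      generator-norm : ∣ norm γ ∣ ≡ ∣ m ∣
      generator-norm = ∣∣-antisym (subst (norm γ ∣ℤ_) Σ≡m
          (∣m∣n⇒∣m+n (∣m∣n⇒∣m+n (∣n⇒∣m*n r N∣m²) (∣n⇒∣m*n s N∣mT)) (∣n⇒∣m*n k N∣mC)))
        (subst (m ∣ℤ_) (sym (trans (cong norm γ≡) (norm-⊞ (a ∙ u) (⟦ m ⟧ ∙ v))))
          (∣m∣n⇒∣m+n (∣m∣n⇒∣m+n m∣Nau m∣T)
            (subst (m ∣ℤ_) (sym (norm-⟦⟧-∙ m v)) (∣m⇒∣m*n (norm v) (∣m⇒∣m*n m ∣-refl)))))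
        where
        collect : ∀ r m s T k c → r * (m * m) + s * (m * T) + k * (m * c) ≡ (r * m + s * T + k * c) * m
        collect = solve-∀
        Σ≡m : r * (m * m) + s * (m * trace a) + k * (m * cofactor) ≡ m
        Σ≡m = trans (collect r m s (trace a) k cofactor) (trans (cong (_* m) bezout) (ℤₚ.*-identityˡ m))
        N∣m² : norm γ ∣ℤ m * m
        N∣m² = subst (norm γ ∣ℤ_) (trans (sym (norm-∙ γ μ)) (trans (cong norm (sym m≡)) (norm-⟦⟧ m)))
          (∣m⇒∣m*n (norm μ) ∣-refl)
        N∣mC : norm γ ∣ℤ m * cofactor
        N∣mC = subst (norm γ ∣ℤ_) (trans (sym (norm-∙ γ δ)) (trans (cong norm (sym a≡)) norm≡))
          (∣m⇒∣m*n (norm δ) ∣-refl)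
        swap : ∀ γ γ̄ δ μ̄ → γ ∙ δ ∙ (γ̄ ∙ μ̄) ≡ γ ∙ γ̄ ∙ (δ ∙ μ̄)
        swap = solve𝒵 4 (λ γ γ̄ δ μ̄ → (γ :* δ :* (γ̄ :* μ̄)) := (γ :* γ̄ :* (δ :* μ̄))) refl
        -- As m is its own conjugate, a m = γ δ conj (γ μ) contains γ conj γ = norm γ; taking traces
        -- gives norm γ ∣ m trace a.
        ma≡ : ⟦ m ⟧ ∙ a ≡ ⟦ norm γ ⟧ ∙ (δ ∙ conj μ)
        ma≡ = begin
          ⟦ m ⟧ ∙ a                        ≡⟨ ∙-comm ⟦ m ⟧ a ⟩
          a ∙ ⟦ m ⟧                        ≡⟨ cong (a ∙_) (conj-⟦⟧ m) ⟨
          a ∙ conj ⟦ m ⟧                   ≡⟨ cong₂ (λ a m → a ∙ conj m) a≡ m≡ ⟩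
          γ ∙ δ ∙ conj (γ ∙ μ)             ≡⟨ cong (γ ∙ δ ∙_) (conj-∙ γ μ) ⟩
          γ ∙ δ ∙ (conj γ ∙ conj μ)        ≡⟨ swap γ (conj γ) δ (conj μ) ⟩
          γ ∙ conj γ ∙ (δ ∙ conj μ)        ≡⟨ cong (_∙ (δ ∙ conj μ)) (∙-conj γ) ⟩
          ⟦ norm γ ⟧ ∙ (δ ∙ conj μ)        ∎
          where open ≡-Reasoning
        N∣mT : norm γ ∣ℤ m * trace a
        N∣mT = subst (norm γ ∣ℤ_) (trans (sym (trace-⟦⟧-∙ (norm γ) _))
          (trans (cong trace (sym ma≡)) (trace-⟦⟧-∙ m a))) (∣m⇒∣m*n _ ∣-refl)
        m∣Nau : m ∣ℤ norm (a ∙ u)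
        m∣Nau = subst (m ∣ℤ_) (sym (trans (norm-∙ a u) (cong (_* norm u) norm≡)))
          (∣m⇒∣m*n (norm u) (∣m⇒∣m*n cofactor ∣-refl))
        pull : ∀ au m v̄ → au ∙ (m ∙ v̄) ≡ m ∙ (au ∙ v̄)
        pull = solve𝒵 3 (λ au m v̄ → (au :* (m :* v̄)) := (m :* (au :* v̄))) refl
        m∣T : m ∣ℤ trace (a ∙ u ∙ conj (⟦ m ⟧ ∙ v))
        m∣T = subst (λ w → m ∣ℤ trace w)
          (sym (trans (cong (a ∙ u ∙_) (trans (conj-∙ ⟦ m ⟧ v) (cong (_∙ conj v) (conj-⟦⟧ m))))
            (pull (a ∙ u) ⟦ m ⟧ (conj v))))
          (subst (m ∣ℤ_) (sym (trace-⟦⟧-∙ m (a ∙ u ∙ conj v))) (∣m⇒∣m*n _ ∣-refl))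

    -- With norm γ = ε m one has conj a γ = m ε conj δ and cofactor γ = a ε conj δ. Hence 1 = r m +
    -- s (a + conj a) + k cofactor, multiplied by γ, exhibits γ as a combination of a and m. The
    -- multiplier taking γ to m is ε conj γ.
    splits⇒generator : ((γ , _) : Splits g a m) → ∃[ u ] ∃[ v ] ∃[ μ ]
      InOrder g u × InOrder g v × InOrder g μ × γ ≡ a ∙ u ⊞ ⟦ m ⟧ ∙ v × ⟦ m ⟧ ≡ γ ∙ μ
    splits⇒generator (γ , δ , γ∈ , δ∈ , a≡γδ , ∣Nγ∣≡∣m∣) = go (∣i∣≡∣j∣⇒i≡±j (norm γ) m ∣Nγ∣≡∣m∣)
      where
      open ≡-Reasoning
      go : ∃[ ε ] IsSign ε × norm γ ≡ ε * m → ∃[ u ] ∃[ v ] ∃[ μ ]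
        InOrder g u × InOrder g v × InOrder g μ × γ ≡ a ∙ u ⊞ ⟦ m ⟧ ∙ v × ⟦ m ⟧ ≡ γ ∙ μ
      go (ε , ε-sign , Nγ≡εm) =
        ⟦ s ⟧ ∙ γ ⊞ ⟦ k ⟧ ∙ (⟦ ε ⟧ ∙ conj δ) , ⟦ r ⟧ ∙ γ ⊞ ⟦ s ⟧ ∙ (⟦ ε ⟧ ∙ conj δ) , ⟦ ε ⟧ ∙ conj γ ,
        ⊞-inOrder (∙-inOrder (⟦⟧-inOrder s) γ∈) (∙-inOrder (⟦⟧-inOrder k) εδ̄∈) ,
        ⊞-inOrder (∙-inOrder (⟦⟧-inOrder r) γ∈) (∙-inOrder (⟦⟧-inOrder s) εδ̄∈) ,
        ∙-inOrder (⟦⟧-inOrder ε) (conj-inOrder γ∈) ,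
        γ≡ , sym (trans (∙-swap γ ⟦ ε ⟧ (conj γ)) (trans (cong (⟦ ε ⟧ ∙_) (∙-conj γ))
          (trans (⟦⟧-* ε (norm γ)) (cong ⟦_⟧ εNγ≡m))))
        where
        εδ̄∈ : InOrder g (⟦ ε ⟧ ∙ conj δ)
        εδ̄∈ = ∙-inOrder (⟦⟧-inOrder ε) (conj-inOrder δ∈)
        εNγ≡m : ε * norm γ ≡ m
        εNγ≡m = begin
          ε * norm γ  ≡⟨ cong (ε *_) Nγ≡εm ⟩
          ε * (ε * m) ≡⟨ ℤₚ.*-assoc ε ε m ⟨
          ε * ε * m   ≡⟨ cong (_* m) (sign² ε-sign) ⟩
          1ℤ * m      ≡⟨ ℤₚ.*-identityˡ m ⟩
          m           ∎
        C≡εNδ : cofactor ≡ ε * norm δ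
        C≡εNδ = ℤₚ.*-cancelˡ-≡ m cofactor (ε * norm δ) (begin
          m * cofactor      ≡⟨ norm≡ ⟨
          norm a            ≡⟨ cong norm a≡γδ ⟩
          norm (γ ∙ δ)      ≡⟨ norm-∙ γ δ ⟩
          norm γ * norm δ   ≡⟨ cong (_* norm δ) Nγ≡εm ⟩
          ε * m * norm δ    ≡⟨ cong (_* norm δ) (ℤₚ.*-comm ε m) ⟩
          m * ε * norm δ    ≡⟨ ℤₚ.*-assoc m ε (norm δ) ⟩
          m * (ε * norm δ)  ∎)
          where instance _ = ℤ.≢-nonZero nonzero
        āγ : conj a ∙ γ ≡ ⟦ m ⟧ ∙ (⟦ ε ⟧ ∙ conj δ)
        āγ = begin
          conj a ∙ γ                    ≡⟨ cong (λ a → conj a ∙ γ) a≡γδ ⟩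
          conj (γ ∙ δ) ∙ γ              ≡⟨ cong (_∙ γ) (conj-∙ γ δ) ⟩
          conj γ ∙ conj δ ∙ γ           ≡⟨ rotate (conj γ) (conj δ) γ ⟩
          γ ∙ conj γ ∙ conj δ           ≡⟨ cong (_∙ conj δ)
            (trans (∙-conj γ) (cong ⟦_⟧ (trans Nγ≡εm (ℤₚ.*-comm ε m)))) ⟩
          ⟦ m * ε ⟧ ∙ conj δ            ≡⟨ cong (_∙ conj δ) (⟦⟧-* m ε) ⟨
          ⟦ m ⟧ ∙ ⟦ ε ⟧ ∙ conj δ        ≡⟨ ∙-assoc ⟦ m ⟧ ⟦ ε ⟧ (conj δ) ⟩
          ⟦ m ⟧ ∙ (⟦ ε ⟧ ∙ conj δ)      ∎
          where
          rotate : ∀ u v w → u ∙ v ∙ w ≡ w ∙ u ∙ v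
          rotate = solve𝒵 3 (λ u v w → (u :* v :* w) := (w :* u :* v)) refl
        Cγ : ⟦ cofactor ⟧ ∙ γ ≡ a ∙ (⟦ ε ⟧ ∙ conj δ)
        Cγ = begin
          ⟦ cofactor ⟧ ∙ γ              ≡⟨ cong (λ c → ⟦ c ⟧ ∙ γ) C≡εNδ ⟩
          ⟦ ε * norm δ ⟧ ∙ γ            ≡⟨ cong (_∙ γ) (⟦⟧-* ε (norm δ)) ⟨
          ⟦ ε ⟧ ∙ ⟦ norm δ ⟧ ∙ γ        ≡⟨ cong (λ z → ⟦ ε ⟧ ∙ z ∙ γ) (∙-conj δ) ⟨
          ⟦ ε ⟧ ∙ (δ ∙ conj δ) ∙ γ      ≡⟨ regroup ⟦ ε ⟧ δ (conj δ) γ ⟩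
          γ ∙ δ ∙ (⟦ ε ⟧ ∙ conj δ)      ≡⟨ cong (_∙ (⟦ ε ⟧ ∙ conj δ)) a≡γδ ⟨
          a ∙ (⟦ ε ⟧ ∙ conj δ)          ∎
          where
          regroup : ∀ e δ δ̄ γ → e ∙ (δ ∙ δ̄) ∙ γ ≡ γ ∙ δ ∙ (e ∙ δ̄)
          regroup = solve𝒵 4 (λ e δ δ̄ γ → (e :* (δ :* δ̄) :* γ) := (γ :* δ :* (e :* δ̄))) refl
        γ≡ : γ ≡ a ∙ (⟦ s ⟧ ∙ γ ⊞ ⟦ k ⟧ ∙ (⟦ ε ⟧ ∙ conj δ)) ⊞ ⟦ m ⟧ ∙ (⟦ r ⟧ ∙ γ ⊞ ⟦ s ⟧ ∙ (⟦ ε ⟧ ∙ conj δ))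
        γ≡ = begin
          γ          ≡⟨ ∙-identityˡ γ ⟨
          ⟦ 1ℤ ⟧ ∙ γ ≡⟨ cong (_∙ γ) bezout-⟦⟧ ⟩
          (⟦ r ⟧ ∙ ⟦ m ⟧ ⊞ ⟦ s ⟧ ∙ (a ⊞ conj a) ⊞ ⟦ k ⟧ ∙ ⟦ cofactor ⟧) ∙ γ
            ≡⟨ expand ⟦ r ⟧ ⟦ m ⟧ ⟦ s ⟧ a (conj a) ⟦ k ⟧ ⟦ cofactor ⟧ γ ⟩
          ⟦ r ⟧ ∙ ⟦ m ⟧ ∙ γ ⊞ ⟦ s ⟧ ∙ a ∙ γ ⊞ ⟦ s ⟧ ∙ (conj a ∙ γ) ⊞ ⟦ k ⟧ ∙ (⟦ cofactor ⟧ ∙ γ)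
            ≡⟨ cong₂ (λ z w → ⟦ r ⟧ ∙ ⟦ m ⟧ ∙ γ ⊞ ⟦ s ⟧ ∙ a ∙ γ ⊞ ⟦ s ⟧ ∙ z ⊞ ⟦ k ⟧ ∙ w) āγ Cγ ⟩
          ⟦ r ⟧ ∙ ⟦ m ⟧ ∙ γ ⊞ ⟦ s ⟧ ∙ a ∙ γ ⊞ ⟦ s ⟧ ∙ (⟦ m ⟧ ∙ (⟦ ε ⟧ ∙ conj δ)) ⊞
            ⟦ k ⟧ ∙ (a ∙ (⟦ ε ⟧ ∙ conj δ))
            ≡⟨ gather ⟦ r ⟧ ⟦ m ⟧ ⟦ s ⟧ a ⟦ k ⟧ (⟦ ε ⟧ ∙ conj δ) γ ⟩
          a ∙ (⟦ s ⟧ ∙ γ ⊞ ⟦ k ⟧ ∙ (⟦ ε ⟧ ∙ conj δ)) ⊞ ⟦ m ⟧ ∙ (⟦ r ⟧ ∙ γ ⊞ ⟦ s ⟧ ∙ (⟦ ε ⟧ ∙ conj δ)) ∎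
          where
          expand : ∀ r m s a ā k c γ → (r ∙ m ⊞ s ∙ (a ⊞ ā) ⊞ k ∙ c) ∙ γ ≡ r ∙ m ∙ γ ⊞ s ∙ a ∙ γ ⊞
            s ∙ (ā ∙ γ) ⊞ k ∙ (c ∙ γ)
          expand = solve𝒵 8 (λ r m s a ā k c γ →
            ((r :* m :+ s :* (a :+ ā) :+ k :* c) :* γ) :=
            (r :* m :* γ :+ s :* a :* γ :+ s :* (ā :* γ) :+ k :* (c :* γ))) refl
          gather : ∀ r m s a k δ̄ γ → r ∙ m ∙ γ ⊞ s ∙ a ∙ γ ⊞ s ∙ (m ∙ δ̄) ⊞
            k ∙ (a ∙ δ̄) ≡ a ∙ (s ∙ γ ⊞ k ∙ δ̄) ⊞ m ∙ (r ∙ γ ⊞ s ∙ δ̄)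
          gather = solve𝒵 7 (λ r m s a k δ̄ γ →
            (r :* m :* γ :+ s :* a :* γ :+ s :* (m :* δ̄) :+ k :* (a :* δ̄)) :=
            (a :* (s :* γ :+ k :* δ̄) :+ m :* (r :* γ :+ s :* δ̄))) refl

-- The discriminant

parity : ∀ i → + 2 ∣ℤ i ⊎ ∃[ k ] i ≡ 1ℤ + + 2 * k
parity i = go (i ℤ÷.%ℕ 2) (i ℤ÷./ℕ 2) (ℤ÷.n%ℕd<d i 2) (ℤ÷.a≡a%ℕn+[a/ℕn]*n i 2)
  where
  go : ∀ r k → r < 2 → i ≡ + r + k * + 2 → + 2 ∣ℤ i ⊎ ∃[ k ] i ≡ 1ℤ + + 2 * k
  go 0 k _ eq = inj₁ (divides k (trans eq (ℤₚ.+-identityˡ (k * + 2))))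
  go 1 k _ eq = inj₂ (k , trans eq (cong (λ z → 1ℤ + z) (ℤₚ.*-comm k (+ 2))))
  go (suc (suc _)) k (s≤s (s≤s ())) eq

%4≡1 : ∀ d → + 4 ∣ℤ 1ℤ - + d → d ℕ.% 4 ≡ 1
%4≡1 d 4∣1-d = go (d ℕ.% 4) (ℕ÷.m%n<n d 4)
  (subst (+ 4 ∣ℤ_) (eq (+ d) (+ (d ℕ.% 4)) (+ (d ℕ./ 4)) split)
  (∣m∣n⇒∣m+n 4∣1-d (∣n⇒∣m*n (+ (d ℕ./ 4)) ∣-refl)))
  where
  split : + d ≡ + (d ℕ.% 4) + + (d ℕ./ 4) * + 4
  split = trans (cong +_ (ℕ÷.m≡m%n+[m/n]*n d 4)) (cong (λ z → + (d ℕ.% 4) + z) (ℤₚ.pos-* (d ℕ./ 4) 4))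
  collect : ∀ r k → 1ℤ - (r + k * + 4) + k * + 4 ≡ 1ℤ - r
  collect = solve-∀
  eq : ∀ d r k → d ≡ r + k * + 4 → 1ℤ - d + k * + 4 ≡ 1ℤ - r
  eq d r k d≡ = trans (cong (λ d → 1ℤ - d + k * + 4) d≡) (collect r k)
  go : ∀ r → r < 4 → + 4 ∣ℤ 1ℤ - + r → r ≡ 1
  go 0 _ h = contradiction (∣⇒∣ᵤ h) (from-no (4 ℕ∣.∣? 1))
  go 1 _ h = refl
  go 2 _ h = contradiction (∣⇒∣ᵤ h) (from-no (4 ℕ∣.∣? 1))
  go 3 _ h = contradiction (∣⇒∣ᵤ h) (from-no (4 ℕ∣.∣? 2))
  go (suc (suc (suc (suc _)))) (s≤s (s≤s (s≤s (s≤s ())))) h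

-- For d ≡ 1 mod 4 the norm (1 - d) / 4 of ω equals minus the floor of d / 4.
trω nω : ℕ → ℤ
trω d with d ℕ.% 4
... | 1 = 1ℤ
... | _ = 0ℤ
nω d with d ℕ.% 4
... | 1 = - (+ (d ℕ./ 4))
... | _ = - (+ d)

-- `trω`, `nω` and `discriminant` all branch on d mod 4; the values belonging to one branch are
-- collected so that they can be used together as equations.
data Shape (d : ℕ) : Set where
  quarter : d ℕ.% 4 ≡ 1 → trω d ≡ 1ℤ → + d ≡ 1ℤ - + 4 * nω d → discriminant d ≡ d → Shape d
  whole   : d ℕ.% 4 ≢ 1 → trω d ≡ 0ℤ → nω d ≡ - (+ d) → discriminant d ≡ 4 ℕ.* d → Shape d

shape : ∀ d → Shape d
shape d with d ℕ.% 4 in eq | quarter {d} | whole {d}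
... | 0 | _ | whole′ = whole′ (λ ()) refl refl refl
... | 1 | quarter′ | _ = quarter′ refl refl (trans split (expand (+ (d ℕ./ 4)))) refl
  where
  split : + d ≡ + 1 + + (d ℕ./ 4) * + 4
  split = trans (cong +_ (trans (ℕ÷.m≡m%n+[m/n]*n d 4) (cong (ℕ._+ d ℕ./ 4 ℕ.* 4) eq)))
    (cong (λ z → + 1 + z) (ℤₚ.pos-* (d ℕ./ 4) 4))
  expand : ∀ k → 1ℤ + k * + 4 ≡ 1ℤ - + 4 * - k
  expand = solve-∀
... | suc (suc _) | _ | whole′ = whole′ (λ ()) refl refl refl

kronecker₂≡0⇒2∣ : ∀ a → kronecker₂ a ≡ 0ℤ → + 2 ∣ℤ a
kronecker₂≡0⇒2∣ a eq with a ℤ.%ℕ 8 | ℤ÷.n%ℕd<d a 8 | ℤ÷.a≡a%ℕn+[a/ℕn]*n a 8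
... | 0 | _ | a≡ = subst (+ 2 ∣ℤ_) (sym a≡)
  (∣m∣n⇒∣m+n {m = + 0} (divides (+ 0) refl) (∣n⇒∣m*n (a ℤ÷./ℕ 8) (divides (+ 4) refl)))
... | 2 | _ | a≡ = subst (+ 2 ∣ℤ_) (sym a≡)
  (∣m∣n⇒∣m+n {m = + 2} (divides (+ 1) refl) (∣n⇒∣m*n (a ℤ÷./ℕ 8) (divides (+ 4) refl)))
... | 4 | _ | a≡ = subst (+ 2 ∣ℤ_) (sym a≡)
  (∣m∣n⇒∣m+n {m = + 4} (divides (+ 2) refl) (∣n⇒∣m*n (a ℤ÷./ℕ 8) (divides (+ 4) refl)))
... | 6 | _ | a≡ = subst (+ 2 ∣ℤ_) (sym a≡)
  (∣m∣n⇒∣m+n {m = + 6} (divides (+ 3) refl) (∣n⇒∣m*n (a ℤ÷./ℕ 8) (divides (+ 4) refl)))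
... | 1 | _ | _ with () ← eq
... | 3 | _ | _ with () ← eq
... | 5 | _ | _ with () ← eq
... | 7 | _ | _ with () ← eq
... | suc (suc (suc (suc (suc (suc (suc (suc _))))))) | s≤s (s≤s (s≤s (s≤s (s≤s (s≤s (s≤s (s≤s ()))))))) | _

kronecker₂≡-1⇒%8 : ∀ a → kronecker₂ a ≡ -1ℤ → ∃[ k ] (a ≡ + 3 + k * + 8 ⊎ a ≡ + 5 + k * + 8)
kronecker₂≡-1⇒%8 a eq with a ℤ.%ℕ 8 | ℤ÷.a≡a%ℕn+[a/ℕn]*n a 8
... | 3 | a≡ = a ℤ÷./ℕ 8 , inj₁ a≡
... | 5 | a≡ = a ℤ÷./ℕ 8 , inj₂ a≡
... | 0 | _ with () ← eq
... | 1 | _ with () ← eq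
... | 2 | _ with () ← eq
... | 4 | _ with () ← eq
... | 6 | _ with () ← eq
... | 7 | _ with () ← eq
... | suc (suc (suc (suc (suc (suc (suc (suc _))))))) | _ with () ← eq

legendre-values : ∀ a p → legendre a p ≡ 0ℤ ⊎ legendre a p ≡ 1ℤ ⊎ legendre a p ≡ -1ℤ
legendre-values a p with + p ∣ℤ? a
... | yes _ = inj₁ refl
... | no  _ with any? {n = p} (λ x → + p ∣ℤ? (+ (toℕ x ℕ.* toℕ x) - a))
...   | yes _ = inj₂ (inj₁ refl)
...   | no  _ = inj₂ (inj₂ refl)

kronecker₂-values : ∀ a → kronecker₂ a ≡ 0ℤ ⊎ kronecker₂ a ≡ 1ℤ ⊎ kronecker₂ a ≡ -1ℤ
kronecker₂-values a with a ℤ.%ℕ 8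
... | 0 = inj₁ refl
... | 1 = inj₂ (inj₁ refl)
... | 2 = inj₁ refl
... | 3 = inj₂ (inj₂ refl)
... | 4 = inj₁ refl
... | 5 = inj₂ (inj₂ refl)
... | 6 = inj₁ refl
... | 7 = inj₂ (inj₁ refl)
... | suc (suc (suc (suc (suc (suc (suc (suc _))))))) = inj₁ refl

kronecker-values : ∀ a p → kronecker a p ≡ 0ℤ ⊎ kronecker a p ≡ 1ℤ ⊎ kronecker a p ≡ -1ℤ
kronecker-values a 0 = legendre-values a 0
kronecker-values a 1 = legendre-values a 1
kronecker-values a 2 = kronecker₂-values a
kronecker-values a p@(suc (suc (suc _))) = legendre-values a p

kronecker≡0⇒∣ : ∀ a p → kronecker a p ≡ 0ℤ → + p ∣ℤ a
kronecker≡0⇒∣ a 0 = legendre≡0⇒∣ a 0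
kronecker≡0⇒∣ a 1 = legendre≡0⇒∣ a 1
kronecker≡0⇒∣ a 2 = kronecker₂≡0⇒2∣ a
kronecker≡0⇒∣ a p@(suc (suc (suc _))) = legendre≡0⇒∣ a p

squarefree-∤ : ∀ {d q} → Squarefree d → Prime q → ¬ + q * + q ∣ℤ + d
squarefree-∤ {d} {q} d-squarefree q-prime q²∣d =
  prime-≢1 q-prime (d-squarefree q (subst (_∣ d) (ℤₚ.abs-* (+ q) (+ q)) (∣⇒∣ᵤ q²∣d)))

prime-square-∣d*y² : ∀ {d q} → Squarefree d → Prime q → ∀ y → + q * + q ∣ℤ + d * (y * y) → + q ∣ℤ y
prime-square-∣d*y² {d} {q} d-squarefree q-prime y q²∣ = decidable-stable (+ q ∣ℤ? y) λ q∤y →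
  squarefree-∤ {d} d-squarefree q-prime
    (prime-square-∣* q-prime (+ d) (y * y) (λ q∣y² → q∤y (prime-∣² q-prime y q∣y²)) q²∣)

-- Irrationality of √d. After division of s and v by their gcd, a prime q ∣ d divides s′ because s′²
-- = d v′²; then q² ∣ d v′² with d squarefree makes q divide v′ as well.
squarefree-nonsquare : ∀ {d} → 2 ≤ d → Squarefree d → ∀ s v → s * s ≡ + d * (v * v) → v ≡ 0ℤ
squarefree-nonsquare {d} 2≤d d-squarefree s v s²≡dv² =
  go (prime-divisor d λ d≡1 → ℕₚ.<⇒≢ 2≤d (sym d≡1)) (bezout-identity s v)
  where
  go : ∃[ q ] Prime q × q ∣ d → ∃[ g ] ∃[ r ] ∃[ w ] r * s + w * v ≡ + g × + g ∣ℤ s × + g ∣ℤ v → v ≡ 0ℤ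
  go (q , q-prime , q∣d) (g , r , w , rs+wv≡g , divides s′ s≡ , divides v′ v≡) =
    decidable-stable (v ℤₚ.≟ 0ℤ) λ v≢0 →
      contra (λ g≡0 → v≢0 (trans v≡ (trans (cong (v′ *_) g≡0) (ℤₚ.*-zeroʳ v′))))
    where
    contra : + g ≢ 0ℤ → ⊥
    contra g≢0 = prime-∤1 q-prime (subst (+ q ∣ℤ_) rs′+wv′≡1 (∣m∣n⇒∣m+n (∣n⇒∣m*n r q∣s′) (∣n⇒∣m*n w q∣v′)))
      where
      instance _ = ℤ.≢-nonZero g≢0
      collect : ∀ r s w v g → g * (r * s + w * v) ≡ r * (s * g) + w * (v * g)
      collect = solve-∀
      rs′+wv′≡1 : r * s′ + w * v′ ≡ 1ℤ
      rs′+wv′≡1 = ℤₚ.*-cancelˡ-≡ (+ g) _ _ (trans (collect r s′ w v′ (+ g))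
        (trans (cong₂ (λ s v → r * s + w * v) (sym s≡) (sym v≡))
          (trans rs+wv≡g (sym (ℤₚ.*-identityʳ (+ g))))))
      squares : ∀ s g → s * g * (s * g) ≡ g * (g * (s * s))
      squares = solve-∀
      squares′ : ∀ d v g → d * (v * g * (v * g)) ≡ g * (g * (d * (v * v)))
      squares′ = solve-∀
      s′²≡dv′² : s′ * s′ ≡ + d * (v′ * v′)
      s′²≡dv′² = ℤₚ.*-cancelˡ-≡ (+ g) _ _ (ℤₚ.*-cancelˡ-≡ (+ g) _ _ (trans (sym (squares s′ (+ g)))
        (trans (cong₂ _*_ (sym s≡) (sym s≡))
          (trans s²≡dv² (trans (cong (λ v → + d * (v * v)) v≡) (squares′ (+ d) v′ (+ g)))))))
      q∣s′ : + q ∣ℤ s′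
      q∣s′ = prime-∣² q-prime s′ (subst (+ q ∣ℤ_) (sym s′²≡dv′²) (∣m⇒∣m*n {m = + d} (v′ * v′) (∣ᵤ⇒∣ q∣d)))
      q∣v′ : + q ∣ℤ v′
      q∣v′ = prime-square-∣d*y² {d} d-squarefree q-prime v′ (subst (+ q * + q ∣ℤ_) s′²≡dv′²
        (∣-trans (*-monoʳ-∣ (+ q) q∣s′) (subst (_∣ℤ s′ * s′) (ℤₚ.*-comm s′ (+ q)) (*-monoʳ-∣ s′ q∣s′))))

module Integers (d : ℕ) where

  open Quadratic (trω d) (nω d) public

  +disc : ℤ
  +disc = + discriminant d

  disc≡ : trω d * trω d - + 4 * nω d ≡ +disc
  disc≡ = go (shape d)
    where
    go : Shape d → trω d * trω d - + 4 * nω d ≡ +disc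
    go (quarter _ t≡1 d≡ D≡) = trans (cong (λ t → t * t - + 4 * nω d) t≡1) (trans (sym d≡) (cong +_ (sym D≡)))
    go (whole _ t≡0 n≡ D≡) = trans (cong₂ (λ t n → t * t - + 4 * n) t≡0 n≡)
      (trans (identity (+ d)) (trans (sym (ℤₚ.pos-* 4 d)) (cong +_ (sym D≡))))
      where
      identity : ∀ d → 0ℤ * 0ℤ - + 4 * - d ≡ + 4 * d
      identity = solve-∀

  -- c is 1 or 2, so away from 2 the discriminant and d have the same prime divisors and the same
  -- square class.
  disc≡c²d : ∃[ c ] c * c * + d ≡ +disc × c ≢ 0ℤ × (∀ q → Prime q → Odd q → ¬ + q ∣ℤ c)
  disc≡c²d = go (shape d)
    where
    go : Shape d → ∃[ c ] c * c * + d ≡ +disc × c ≢ 0ℤ × (∀ q → Prime q → Odd q → ¬ + q ∣ℤ c)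
    go (quarter _ _ _ D≡) = 1ℤ , trans (ℤₚ.*-identityˡ (+ d)) (cong +_ (sym D≡)) , (λ ()) , λ q q-prime _ →
      prime-∤1 q-prime
    go (whole _ _ _ D≡) = + 2 , trans (sym (ℤₚ.pos-* 4 d)) (cong +_ (sym D≡)) , (λ ()) , λ q → odd-prime-∤2

  trace²-4norm≡disc : ∀ u → trace u * trace u - + 4 * norm u ≡ +disc * (proj₂ u * proj₂ u)
  trace²-4norm≡disc u = trans (trace²-4norm u) (cong (_* (proj₂ u * proj₂ u)) disc≡)

  opaque
    unfolding _∙_

    norm-coordinates : ∀ u → norm u ≡ proj₁ u * proj₁ u + trω d * (proj₁ u * proj₂ u) + nω d *
      (proj₂ u * proj₂ u)
    norm-coordinates u = refl

  ∣im∣norm⇒∣re : ∀ {q} → Prime q → ∀ u → + q ∣ℤ proj₂ u → + q ∣ℤ norm u → + q ∣ℤ proj₁ u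
  ∣im∣norm⇒∣re {q} q-prime u q∣y q∣N = prime-∣² q-prime x (∣m+n∣n⇒∣m
    (subst (+ q ∣ℤ_) (trans (norm-coordinates u) (ℤₚ.+-assoc (x * x) (trω d * (x * y)) (nω d * (y * y)))) q∣N)
    (∣m∣n⇒∣m+n (∣n⇒∣m*n (trω d) (∣n⇒∣m*n x q∣y)) (∣n⇒∣m*n (nω d) (∣n⇒∣m*n y q∣y))))
    where
    x y : ℤ
    x = proj₁ u
    y = proj₂ u

  -- The equation trace² - 4 norm = disc y² turns norm 0 into (trace u)² = d (c y)², which the
  -- irrationality of √d allows only for y = 0.
  norm≡0⇒≡0 : 2 ≤ d → Squarefree d → ∀ u → norm u ≡ 0ℤ → u ≡ ⟦ 0ℤ ⟧
  norm≡0⇒≡0 2≤d d-squarefree u@(x , y) Nu≡0 = go disc≡c²d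
    where
    go : ∃[ c ] c * c * + d ≡ +disc × c ≢ 0ℤ × (∀ q → Prime q → Odd q → ¬ + q ∣ℤ c) → u ≡ ⟦ 0ℤ ⟧
    go (c , c²d≡D , c≢0 , _) = cong₂ _,_ x≡0 y≡0
      where
      drop : ∀ T N → N ≡ 0ℤ → T ≡ T - + 4 * N
      drop T _ refl = identity T
        where
        identity : ∀ T → T ≡ T - + 4 * 0ℤ
        identity = solve-∀
      regroup : ∀ c d y → c * c * d * (y * y) ≡ d * (c * y * (c * y))
      regroup = solve-∀
      T²≡ : trace u * trace u ≡ + d * (c * y * (c * y))
      T²≡ = trans (drop (trace u * trace u) (norm u) Nu≡0) (trans (trace²-4norm≡disc u)
        (trans (cong (_* (y * y)) (sym c²d≡D)) (regroup c (+ d) y)))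
      y≡0 : y ≡ 0ℤ
      y≡0 = Sum.fromInj₂ (λ c≡0 → ⊥-elim (c≢0 c≡0))
        (ℤₚ.i*j≡0⇒i≡0∨j≡0 c (squarefree-nonsquare 2≤d d-squarefree (trace u) (c * y) T²≡))
      identity : ∀ x t n → x * x ≡ x * x + t * (x * 0ℤ) + n * (0ℤ * 0ℤ)
      identity = solve-∀
      x²≡0 : x * x ≡ 0ℤ
      x²≡0 = trans (identity x (trω d) (nω d)) (trans (sym (trans (norm-coordinates u)
        (cong (λ y → x * x + trω d * (x * y) + nω d * (y * y)) y≡0))) Nu≡0)
      x≡0 : x ≡ 0ℤ
      x≡0 = Sum.reduce (ℤₚ.i*j≡0⇒i≡0∨j≡0 x x²≡0)

  module _ (d-squarefree : Squarefree d) where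

    -- u / q is an integer of the field as soon as its trace and norm are integers.
    integrality : ∀ {q} → Prime q → ∀ u → + q ∣ℤ trace u → + q * + q ∣ℤ norm u → + q ∣ℤ proj₁ u ×
      + q ∣ℤ proj₂ u
    integrality {q} q-prime u@(x , y) q∣T q²∣N = ∣im∣norm⇒∣re q-prime u q∣y (square-∣-∣ q q²∣N) , q∣y
      where
      q²∣T² : + q * + q ∣ℤ trace u * trace u
      q²∣T² = ∣-trans (*-monoʳ-∣ (+ q) q∣T)
        (subst (_∣ℤ trace u * trace u) (ℤₚ.*-comm (trace u) (+ q)) (*-monoʳ-∣ (trace u) q∣T))
      q²∣Dy² : + q * + q ∣ℤ +disc * (y * y)
      q²∣Dy² = subst (+ q * + q ∣ℤ_) (trace²-4norm≡disc u) (∣m∣n⇒∣m-n q²∣T² (∣n⇒∣m*n (+ 4) q²∣N))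

      -- Only q = 2 with discriminant 4 d escapes the argument from q² ∣ disc y², because the factor
      -- 4 absorbs q². Here 4 ∣ x² - d y²: an even x leaves 4 ∣ d y², and x, y both odd would force
      -- d ≡ 1 mod 4.
      even-case : d ℕ.% 4 ≢ 1 → trω d ≡ 0ℤ → nω d ≡ - (+ d) → q ≡ 2 → + q ∣ℤ y
      even-case d≢1 t≡0 n≡ refl = go (parity x) (parity y)
        where
        4∣N : + 4 ∣ℤ x * x - + d * (y * y)
        4∣N = subst (+ 4 ∣ℤ_) (trans (norm-coordinates u)
          (trans (cong₂ (λ t n → x * x + t * (x * y) + n * (y * y)) t≡0 n≡) (simplify x y (+ d)))) q²∣N
          where
          simplify : ∀ x y d → x * x + 0ℤ * (x * y) + - d * (y * y) ≡ x * x - d * (y * y)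
          simplify = solve-∀
        go : + 2 ∣ℤ x ⊎ ∃[ k ] x ≡ 1ℤ + + 2 * k → + 2 ∣ℤ y ⊎ ∃[ k ] y ≡ 1ℤ + + 2 * k → + 2 ∣ℤ y
        go _ (inj₁ 2∣y) = 2∣y
        go (inj₁ 2∣x) (inj₂ _) = prime-square-∣d*y² {d} d-squarefree prime[2] y
          (subst (+ 4 ∣ℤ_) (cancel (x * x) (+ d * (y * y)))
            (∣m∣n⇒∣m-n (∣-trans (*-monoʳ-∣ (+ 2) 2∣x)
              (subst (_∣ℤ x * x) (ℤₚ.*-comm x (+ 2)) (*-monoʳ-∣ x 2∣x))) 4∣N))
          where
          cancel : ∀ a b → a - (a - b) ≡ b
          cancel = solve-∀
        go (inj₂ (a , x≡)) (inj₂ (b , y≡)) = ⊥-elim (d≢1 (%4≡1 d (subst (+ 4 ∣ℤ_) (sym (collect (+ d) a b))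
          (∣m∣n⇒∣m-n (subst (+ 4 ∣ℤ_) (cong₂ (λ x y → x * x - + d * (y * y)) x≡ y≡) 4∣N)
            (∣m⇒∣m*n (a + a * a - + d * (b + b * b)) ∣-refl)))))
          where
          collect : ∀ d a b → 1ℤ - d ≡ ((1ℤ + + 2 * a) * (1ℤ + + 2 * a) - d *
            ((1ℤ + + 2 * b) * (1ℤ + + 2 * b))) - + 4 * (a + a * a - d * (b + b * b))
          collect = solve-∀

      q∣y : + q ∣ℤ y
      q∣y = go (shape d)
        where
        go : Shape d → + q ∣ℤ y
        go (quarter _ _ _ D≡) = prime-square-∣d*y² {d} d-squarefree q-prime y
          (subst (λ D → + q * + q ∣ℤ + D * (y * y)) D≡ q²∣Dy²)
        go (whole d≢1 t≡0 n≡ D≡) with q ℕₚ.≟ 2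
        ... | yes q≡2 = even-case d≢1 t≡0 n≡ q≡2
        ... | no q≢2 = prime-square-∣d*y² {d} d-squarefree q-prime y
          (prime-square-∣* q-prime (+ d * (y * y)) (+ 4) q∤4
              (subst (+ q * + q ∣ℤ_) (trans (cong (_* (y * y)) (trans (cong +_ D≡) (ℤₚ.pos-* 4 d)))
                (rotate (+ d) (y * y))) q²∣Dy²))
          where
          rotate : ∀ d z → + 4 * d * z ≡ d * z * + 4
          rotate = solve-∀
          q∤4 : ¬ + q ∣ℤ + 4
          q∤4 q∣4 = odd-prime-∤2 q-prime (≢2⇒odd q-prime q≢2) (prime-∣² q-prime (+ 2) q∣4)

  disc∣⇒∣trace : ∀ {q} → Prime q → + q ∣ℤ +disc → ∀ u → + q ∣ℤ norm u → + q ∣ℤ trace u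
  disc∣⇒∣trace {q} q-prime q∣D u q∣N =
    prime-∣² q-prime (trace u) (subst (+ q ∣ℤ_)
    (trans (cong (_+ + 4 * norm u) (sym (trace²-4norm≡disc u))) (cancel (trace u * trace u) (+ 4 * norm u)))
    (∣m∣n⇒∣m+n (∣m⇒∣m*n (proj₂ u * proj₂ u) q∣D) (∣n⇒∣m*n (+ 4) q∣N)))
    where
    cancel : ∀ a b → a - b + b ≡ a
    cancel = solve-∀

  Inert : ℕ → Set
  Inert q = ∀ u → + q ∣ℤ norm u → + q ∣ℤ proj₁ u × + q ∣ℤ proj₂ u

  -- For odd q, a norm divisible by q gives trace² ≡ disc y² modulo q, and disc is not a square
  -- there, so q ∣ y. For q = 2 the symbol and the shape of disc leave disc ≡ 5 mod 8; then the norm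
  -- is x² + x y + y² modulo 2, which is odd unless x and y are even.
  kronecker≡-1⇒inert : ∀ {q} → Prime q → kronecker +disc q ≡ -1ℤ → Inert q
  kronecker≡-1⇒inert {q} q-prime eq u@(x , y) q∣N = ∣im∣norm⇒∣re q-prime u q∣y q∣N , q∣y
    where
    odd-case : Odd q → + q ∣ℤ y
    odd-case odd = nonresidue q-prime +disc (trans (sym (kronecker-odd +disc odd)) eq) (trace u) y
      (subst (+ q ∣ℤ_) (trans (cancel (trace u * trace u) (+ 4 * norm u))
        (cong (_-_ (trace u * trace u)) (trace²-4norm≡disc u))) (∣n⇒∣m*n (+ 4) q∣N))
      where
      cancel : ∀ a b → b ≡ a - (a - b)
      cancel = solve-∀
    even-case : q ≡ 2 → + q ∣ℤ y
    even-case refl = go (shape d) (parity (nω d)) (kronecker₂≡-1⇒%8 +disc eq)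
      where
      2∤1 : ∀ {i} k → + 2 ∣ℤ i → 1ℤ ≡ i - + 2 * k → ⊥
      2∤1 k 2∣i 1≡ = prime-∤1 prime[2] (subst (+ 2 ∣ℤ_) (sym 1≡) (∣m∣n⇒∣m-n 2∣i (∣m⇒∣m*n k ∣-refl)))
      odd-norm : ∀ j → nω d ≡ 1ℤ + + 2 * j → trω d ≡ 1ℤ → + 2 ∣ℤ x ⊎ ∃[ k ] x ≡ 1ℤ + + 2 * k → + 2 ∣ℤ y ⊎
        ∃[ k ] y ≡ 1ℤ + + 2 * k → + 2 ∣ℤ y
      odd-norm j n≡ t≡1 x-parity y-parity = by-parity x-parity y-parity
        where
        reduce : ∀ x y j → x * x + 1ℤ * (x * y) + (1ℤ + + 2 * j) * (y * y) - + 2 * (j * (y * y)) ≡ x * (x + y)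
          + y * y
        reduce = solve-∀
        2∣E : + 2 ∣ℤ x * (x + y) + y * y
        2∣E = subst (+ 2 ∣ℤ_) (trans (cong (_- + 2 * (j * (y * y))) (trans (norm-coordinates u)
            (cong₂ (λ t n → x * x + t * (x * y) + n * (y * y)) t≡1 n≡))) (reduce x y j))
          (∣m∣n⇒∣m-n q∣N (∣m⇒∣m*n (j * (y * y)) ∣-refl))
        expand : ∀ a b → 1ℤ ≡ (1ℤ + + 2 * a) * (1ℤ + + 2 * a + (1ℤ + + 2 * b)) + (1ℤ + + 2 * b) *
          (1ℤ + + 2 * b)
          - + 2 * (1ℤ + + 3 * a + + 2 * (a * a) + + 3 * b + + 2 * (a * b) + + 2 * (b * b))
        expand = solve-∀
        by-parity : + 2 ∣ℤ x ⊎ ∃[ k ] x ≡ 1ℤ + + 2 * k → + 2 ∣ℤ y ⊎ ∃[ k ] y ≡ 1ℤ + + 2 * k → + 2 ∣ℤ y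
        by-parity _ (inj₁ 2∣y) = 2∣y
        by-parity (inj₁ 2∣x) (inj₂ _) = prime-∣² prime[2] y (∣m+n∣m⇒∣n 2∣E (∣m⇒∣m*n (x + y) 2∣x))
        by-parity (inj₂ (a , x≡)) (inj₂ (b , y≡)) = ⊥-elim (2∤1 _
          (subst (+ 2 ∣ℤ_) (cong₂ (λ x y → x * (x + y) + y * y) x≡ y≡) 2∣E) (expand a b))
      go : Shape d → + 2 ∣ℤ nω d ⊎ ∃[ k ] nω d ≡ 1ℤ + + 2 * k →
        ∃[ k ] (+disc ≡ + 3 + k * + 8 ⊎ +disc ≡ + 5 + k * + 8) → + 2 ∣ℤ y
      go (whole _ t≡0 n≡ D≡) _ (k , inj₁ D≡3) = ⊥-elim (2∤1 (1ℤ + + 4 * k) (∣m⇒∣m*n (+ 2 * + d) ∣-refl)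
        (trans (identity k) (cong (_- + 2 * (1ℤ + + 4 * k))
          (trans (sym D≡3) (trans (cong +_ D≡) (trans (ℤₚ.pos-* 4 d) (ℤₚ.*-assoc (+ 2) (+ 2) (+ d))))))))
        where
        identity : ∀ k → 1ℤ ≡ + 3 + k * + 8 - + 2 * (1ℤ + + 4 * k)
        identity = solve-∀
      go (whole _ t≡0 n≡ D≡) _ (k , inj₂ D≡5) = ⊥-elim (2∤1 (+ 2 + + 4 * k) (∣m⇒∣m*n (+ 2 * + d) ∣-refl)
        (trans (identity k) (cong (_- + 2 * (+ 2 + + 4 * k))
          (trans (sym D≡5) (trans (cong +_ D≡) (trans (ℤₚ.pos-* 4 d) (ℤₚ.*-assoc (+ 2) (+ 2) (+ d))))))))
        where
        identity : ∀ k → 1ℤ ≡ + 5 + k * + 8 - + 2 * (+ 2 + + 4 * k)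
        identity = solve-∀
      go (quarter _ _ d≡ D≡) _ (k , inj₁ D≡3) =
        ⊥-elim (from-no (4 ℕ∣.∣? 2) (∣⇒∣ᵤ (divides (- (nω d + + 2 * k))
        (trans (cancel₃ k) (trans (cong (_- (1ℤ + k * + 8)) (trans (sym D≡3) (trans (cong +_ D≡) d≡)))
          (collect₃ (nω d) k))))))
        where
        cancel₃ : ∀ k → + 2 ≡ + 3 + k * + 8 - (1ℤ + k * + 8)
        cancel₃ = solve-∀
        collect₃ : ∀ n k → 1ℤ - + 4 * n - (1ℤ + k * + 8) ≡ - (n + + 2 * k) * + 4
        collect₃ = solve-∀
      go (quarter _ _ d≡ D≡) (inj₁ (divides j n≡)) (k , inj₂ D≡5) =
        ⊥-elim (from-no (8 ℕ∣.∣? 4) (∣⇒∣ᵤ (divides (- (j + k))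
        (trans (cancel₅ k) (trans (cong (_- (1ℤ + k * + 8))
          (trans (sym D≡5) (trans (cong +_ D≡) (trans d≡ (cong (λ n → 1ℤ - + 4 * n) n≡)))))
          (collect₅ j k))))))
        where
        cancel₅ : ∀ k → + 4 ≡ + 5 + k * + 8 - (1ℤ + k * + 8)
        cancel₅ = solve-∀
        collect₅ : ∀ j k → 1ℤ - + 4 * (j * + 2) - (1ℤ + k * + 8) ≡ - (j + k) * + 8
        collect₅ = solve-∀
      go (quarter _ t≡1 _ _) (inj₂ (j , n≡)) (k , inj₂ _) = odd-norm j n≡ t≡1 (parity x) (parity y)
    q∣y : + q ∣ℤ y
    q∣y with q ℕₚ.≟ 2
    ... | yes q≡2 = even-case q≡2
    ... | no q≢2 = odd-case (≢2⇒odd q-prime q≢2)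

-- Ramified and inert primes, and elements of prime norm

module Primes (d : ℕ) where

  open Integers d public

  Divisible : ℕ → 𝒵 → Set
  Divisible q u = + q ∣ℤ proj₁ u × + q ∣ℤ proj₂ u

  quotient-by : ∀ {q} u → Divisible q u → ∃[ v ] u ≡ ⟦ + q ⟧ ∙ v × proj₂ u ≡ + q * proj₂ v
  quotient-by {q} u (divides x′ x≡ , divides y′ y≡) =
    (x′ , y′) , trans (cong₂ _,_ (trans x≡ (ℤₚ.*-comm x′ (+ q))) y≡′) (sym (⟦⟧-∙ (+ q) (x′ , y′))) , y≡′
    where
    y≡′ : proj₂ u ≡ + q * y′
    y≡′ = trans y≡ (ℤₚ.*-comm y′ (+ q))

  norm-quotient : ∀ m {u v} → u ≡ ⟦ m ⟧ ∙ v → norm u ≡ m * m * norm v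
  norm-quotient m {v = v} u≡ = trans (cong norm u≡) (norm-⟦⟧-∙ m v)

  abs-norm-∙ : ∀ u v → ∣ norm (u ∙ v) ∣ ≡ ∣ norm u ∣ ℕ.* ∣ norm v ∣
  abs-norm-∙ u v = trans (cong ∣_∣ (norm-∙ u v)) (ℤₚ.abs-* (norm u) (norm v))

  ramified-or-inert : ∀ {q} → Prime q → ¬ Split d q → Ramified d q ⊎ Inert q
  ramified-or-inert {q} q-prime ¬split = go (kronecker-values +disc q)
    where
    go : kronecker +disc q ≡ 0ℤ ⊎ kronecker +disc q ≡ 1ℤ ⊎ kronecker +disc q ≡ -1ℤ → Ramified d q ⊎ Inert q
    go (inj₁ eq) = inj₁ (q-prime , eq)
    go (inj₂ (inj₁ eq)) = ⊥-elim (¬split (q-prime , eq))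
    go (inj₂ (inj₂ eq)) = inj₂ (kronecker≡-1⇒inert q-prime eq)

  ramified⇒∣disc : ∀ {p} → Ramified d p → + p ∣ℤ +disc
  ramified⇒∣disc {p} (_ , eq) = kronecker≡0⇒∣ +disc p eq

  ramified⇒∣trace : ∀ {p} → Ramified d p → ∀ u → + p ∣ℤ norm u → + p ∣ℤ trace u
  ramified⇒∣trace p-ramified = disc∣⇒∣trace (proj₁ p-ramified) (ramified⇒∣disc p-ramified)

  odd-ramified⇒∣ : ∀ {p} → Ramified d p → Odd p → p ∣ d
  odd-ramified⇒∣ {p} p-ramified@(p-prime , _) odd = go disc≡c²d
    where
    go : ∃[ c ] c * c * + d ≡ +disc × c ≢ 0ℤ × (∀ q → Prime q → Odd q → ¬ + q ∣ℤ c) → p ∣ d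
    go (c , c²d≡D , _ , ∤c) = ∣⇒∣ᵤ
      (Sum.fromInj₂ (λ p∣c² → ⊥-elim (∤c p p-prime odd (prime-∣² p-prime c p∣c²)))
      (prime-∣* p-prime (c * c) (+ d) (subst (+ p ∣ℤ_) (sym c²d≡D) (ramified⇒∣disc p-ramified))))

  -- From norm w = ε p the condition is taken at α = -ε. Its first alternative contradicts trace² -
  -- 4 norm = disc y² after division by p, its second contradicts the same equation modulo q.
  residue-condition⇒no-norm : ∀ {p f f′} (p-prime : Prime p) → Ramified d p → f ≡ f′ ℕ.* p →
    (∀ α → IsSign α → ResidueCondition d f α p p-prime) → ∀ w → InOrder f′ w → ∣ norm w ∣ ≢ p
  residue-condition⇒no-norm {p} {f} {f′} p-prime p-ramified f≡f′p condition w@(x , y) (inOrder f′∣y) ∣Nw∣≡p =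
    go (∣i∣≡∣j∣⇒i≡±j (norm w) (+ p) ∣Nw∣≡p)
    where
    instance _ = prime⇒nonZero p-prime
    negate : ∀ {ε} → IsSign ε → IsSign (- ε)
    negate (inj₁ refl) = inj₂ refl
    negate (inj₂ refl) = inj₁ refl
    p∣N : + p ∣ℤ norm w
    p∣N = ∣ᵤ⇒∣ (subst (p ∣_) (sym ∣Nw∣≡p) ℕ∣.∣-refl)
    module _ (ε : ℤ) (Nw≡εp : norm w ≡ ε * + p) where
      -- Here trace w = T p. Cancelling p leaves p T² = c² d′ y² + 4 ε, and d′ times this reads (c y
      -- d′)² ≡ 4 (-ε d′) modulo p, although -ε d′ is not a square.
      local : Odd p → kronecker (- ε * + (d ℕ./ p)) p ≡ -1ℤ → ⊥
      local odd eq = go′ disc≡c²d (ramified⇒∣trace p-ramified w p∣N)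
        where
        d′ : ℤ
        d′ = + (d ℕ./ p)
        d≡ : + d ≡ d′ * + p
        d≡ = trans (cong +_ (sym (ℕ÷.m/n*n≡m (odd-ramified⇒∣ p-ramified odd)))) (ℤₚ.pos-* (d ℕ./ p) p)
        go′ : ∃[ c ] c * c * + d ≡ +disc × c ≢ 0ℤ × (∀ q → Prime q → Odd q → ¬ + q ∣ℤ c) → + p ∣ℤ trace w → ⊥
        go′ (c , c²d≡D , _ , _) (divides T T≡) =
          odd-prime-∤2 p-prime odd (nonresidue p-prime (- ε * d′)
          (trans (sym (kronecker-odd (- ε * d′) odd)) eq) (c * y * d′) (+ 2)
          (divides (d′ * (T * T)) (trans (collect c y d′ ε)
            (trans (cong (d′ *_) (sym pT²≡)) (sym (ℤₚ.*-assoc d′ (T * T) (+ p)))))))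
          where
          collect : ∀ c y d′ ε → c * y * d′ * (c * y * d′) - - ε * d′ * (+ 2 * + 2) ≡ d′ *
            (c * c * d′ * (y * y) + + 4 * ε)
          collect = solve-∀
          left : ∀ T p ε → T * p * (T * p) - + 4 * (ε * p) + p * (+ 4 * ε) ≡ p * (T * T * p)
          left = solve-∀
          right : ∀ c d′ p y ε → c * c * (d′ * p) * (y * y) + p * (+ 4 * ε) ≡ p *
            (c * c * d′ * (y * y) + + 4 * ε)
          right = solve-∀
          pT²≡ : T * T * + p ≡ c * c * d′ * (y * y) + + 4 * ε
          pT²≡ = ℤₚ.*-cancelˡ-≡ (+ p) _ _ (trans (sym (left T (+ p) ε)) (trans (cong (_+ + p * (+ 4 * ε))
            (trans (sym (cong₂ (λ T N → T * T - + 4 * N) T≡ Nw≡εp))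
              (trans (trace²-4norm≡disc w) (cong (_* (y * y)) (trans (sym c²d≡D) (cong (c * c *_) d≡))))))
            (right c d′ (+ p) y ε)))
      -- Every prime q ∣ d f divides disc y²: through disc if q ∣ d or q = p, through y if q ∣ f′,
      -- since w lies in the order of conductor f′. Then trace² ≡ 4 ε p modulo q.
      away : ∀ q → Prime q → Odd q → q ∣ d ℕ.* f → kronecker (- (- ε) * + p) q ≡ -1ℤ → ⊥
      away q q-prime odd q∣df eq = odd-prime-∤2 q-prime odd
        (nonresidue q-prime (- (- ε) * + p) (trans (sym (kronecker-odd (- (- ε) * + p) odd)) eq) (trace w)
        (+ 2)
        (subst (+ q ∣ℤ_) (trans (sym (trace²-4norm≡disc w))
          (trans (cong (λ N → trace w * trace w - + 4 * N) Nw≡εp) (rearrange (trace w * trace w) ε (+ p))))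
          q∣Dy²))
        where
        rearrange : ∀ S ε p → S - + 4 * (ε * p) ≡ S - - (- ε) * p * (+ 2 * + 2)
        rearrange = solve-∀
        q∣d⇒ : + q ∣ℤ + d → + q ∣ℤ +disc
        q∣d⇒ q∣d = let c , c²d≡D , _ = disc≡c²d in subst (+ q ∣ℤ_) c²d≡D (∣n⇒∣m*n (c * c) q∣d)
        q∣Dy² : + q ∣ℤ +disc * (y * y)
        q∣Dy² with euclidsLemma d f q-prime q∣df
        ... | inj₁ q∣d = ∣m⇒∣m*n (y * y) (q∣d⇒ (∣ᵤ⇒∣ q∣d))
        ... | inj₂ q∣f with euclidsLemma f′ p q-prime (subst (q ∣_) f≡f′p q∣f)
        ...   | inj₁ q∣f′ = ∣n⇒∣m*n +disc (∣m⇒∣m*n y (∣-trans {j = + f′} (∣ᵤ⇒∣ q∣f′) f′∣y))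
        ...   | inj₂ q∣p = ∣m⇒∣m*n (y * y) (∣-trans {j = + p} (∣ᵤ⇒∣ q∣p) (ramified⇒∣disc p-ramified))
    go : ∃[ ε ] IsSign ε × norm w ≡ ε * + p → ⊥
    go (ε , ε-sign , Nw≡εp) with condition (- ε) (negate ε-sign)
    ... | inj₁ (odd , eq) = local ε Nw≡εp odd eq
    ... | inj₂ (q , q-prime , odd , q∣df , eq) = away ε Nw≡εp q q-prime odd q∣df eq

  -- Such a v lies in the prime ideal above p but not in p times the maximal order. It seeds the
  -- element of norm p³ M constructed for the distance 2.
  ramified-element : ∀ {p} → Ramified d p → ∃[ v ] + p ∣ℤ norm v × ¬ + p ∣ℤ proj₂ v
  ramified-element {p} p-ramified@(p-prime , _) with p ℕₚ.≟ 2
  ... | yes refl = go (shape d)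
    where
    go : Shape d → ∃[ v ] + 2 ∣ℤ norm v × ¬ + 2 ∣ℤ proj₂ v
    go (quarter _ _ d≡ D≡) = ⊥-elim
      (prime-∤1 prime[2] (subst (+ 2 ∣ℤ_)
      (trans (cong (_+ + 4 * nω d) (trans (cong +_ D≡) d≡)) (cancel (nω d)))
        (∣m∣n⇒∣m+n (ramified⇒∣disc p-ramified) (∣m⇒∣m*n (nω d) (divides (+ 2) refl)))))
      where
      cancel : ∀ n → 1ℤ - + 4 * n + + 4 * n ≡ 1ℤ
      cancel = solve-∀
    -- For p = 2 the choice v = d + √d works for both parities of d, as its norm is d (d - 1).
    go (whole _ t≡0 n≡ _) = (+ d , 1ℤ) ,
      subst (+ 2 ∣ℤ_) (sym (trans (norm-coordinates (+ d , 1ℤ))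
      (trans (cong₂ (λ t n → + d * + d + t * (+ d * 1ℤ) + n * (1ℤ * 1ℤ)) t≡0 n≡) (simplify (+ d)))))
        (even (parity (+ d))) , prime-∤1 prime[2]
      where
      simplify : ∀ d → d * d + 0ℤ * (d * 1ℤ) + - d * (1ℤ * 1ℤ) ≡ d * (d - 1ℤ)
      simplify = solve-∀
      double : ∀ k → 1ℤ + + 2 * k - 1ℤ ≡ + 2 * k
      double = solve-∀
      even : + 2 ∣ℤ + d ⊎ ∃[ k ] + d ≡ 1ℤ + + 2 * k → + 2 ∣ℤ + d * (+ d - 1ℤ)
      even (inj₁ 2∣d) = ∣m⇒∣m*n (+ d - 1ℤ) 2∣d
      even (inj₂ (k , d≡)) = ∣n⇒∣m*n (+ d)
        (subst (+ 2 ∣ℤ_) (sym (trans (cong (_- 1ℤ) d≡) (double k))) (∣m⇒∣m*n k ∣-refl))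
  ... | no p≢2 = go (shape d)
    where
    odd : Odd p
    odd = ≢2⇒odd p-prime p≢2
    p∣-d : + p ∣ℤ - (+ d)
    p∣-d = ∣m⇒∣-m {m = + d} (∣ᵤ⇒∣ (odd-ramified⇒∣ p-ramified odd))
    -- In both cases v = √d.
    go : Shape d → ∃[ v ] + p ∣ℤ norm v × ¬ + p ∣ℤ proj₂ v
    go (quarter _ t≡1 d≡ _) = (-1ℤ , + 2) ,
      subst (+ p ∣ℤ_) (trans (cong -_ d≡)
      (sym (trans (norm-coordinates (-1ℤ , + 2))
      (trans (cong (λ t → -1ℤ * -1ℤ + t * (-1ℤ * + 2) + nω d * (+ 2 * + 2)) t≡1) (simplify (nω d)))))) p∣-d ,
      odd-prime-∤2 p-prime odd
      where
      simplify : ∀ n → -1ℤ * -1ℤ + 1ℤ * (-1ℤ * + 2) + n * (+ 2 * + 2) ≡ - (1ℤ - + 4 * n)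
      simplify = solve-∀
    go (whole _ t≡0 n≡ _) = (0ℤ , 1ℤ) ,
      subst (+ p ∣ℤ_) (sym (trans (norm-coordinates (0ℤ , 1ℤ))
      (trans (cong₂ (λ t n → 0ℤ * 0ℤ + t * (0ℤ * 1ℤ) + n * (1ℤ * 1ℤ)) t≡0 n≡) (simplify (+ d))))) p∣-d ,
      prime-∤1 p-prime
      where
      simplify : ∀ d → 0ℤ * 0ℤ + 0ℤ * (0ℤ * 1ℤ) + - d * (1ℤ * 1ℤ) ≡ - d
      simplify = solve-∀

  -- With y and s the coefficients of ω in u and γ, those of u conj γ and u γ have the product y²
  -- norm γ - s² norm u. So q divides one of these coefficients and then, its norm being divisible
  -- by q, the whole element. Hence γ or conj γ divides u.
  norm-prime⇒splits : ∀ {g q} → Prime q → ¬ q ∣ g → ∀ u → InOrder g u → + q ∣ℤ norm u →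
    ∀ γ → InOrder g γ → ∣ norm γ ∣ ≡ q → Splits g u (+ q)
  norm-prime⇒splits {g} {q} q-prime q∤g u u∈ q∣Nu γ γ∈ ∣Nγ∣≡q =
    go (∣i∣≡∣j∣⇒i≡±j (norm γ) (+ q) ∣Nγ∣≡q) (prime-∣* q-prime (proj₂ (u ∙ conj γ)) (proj₂ (u ∙ γ)) q∣product)
    where
    q∣Nγ : + q ∣ℤ norm γ
    q∣Nγ = ∣ᵤ⇒∣ (subst (q ∣_) (sym ∣Nγ∣≡q) ℕ∣.∣-refl)
    opaque
      unfolding _∙_
      product-identity : ∀ u γ → proj₂ (u ∙ conj γ) * proj₂ (u ∙ γ) ≡ proj₂ u * proj₂ u * norm γ - proj₂ γ *
        proj₂ γ * norm u
      product-identity (x , y) (r , s) = identity (trω d) (nω d) x y r s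
        where
        identity : ∀ t n x y r s → (x * - s + y * (r + t * s) + t * (y * - s)) * (x * s + y * r + t * (y * s))
          ≡ y * y * (r * r + t * (r * s) + n * (s * s)) - s * s * (x * x + t * (x * y) + n * (y * y))
        identity = solve-∀
    q∣product : + q ∣ℤ proj₂ (u ∙ conj γ) * proj₂ (u ∙ γ)
    q∣product = subst (+ q ∣ℤ_) (sym (product-identity u γ))
      (∣m∣n⇒∣m-n (∣n⇒∣m*n (proj₂ u * proj₂ u) q∣Nγ) (∣n⇒∣m*n (proj₂ γ * proj₂ γ) q∣Nu))
    -- Since γ₁ (conj γ₁) = ±q, conj γ₁ divides u if q divides u γ₁.
    factor : ∀ ε → IsSign ε → ∀ γ₁ → InOrder g γ₁ → norm γ₁ ≡ ε * + q → + q ∣ℤ proj₂ (u ∙ γ₁) →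
      Splits g u (+ q)
    factor ε ε-sign γ₁ γ₁∈ Nγ₁≡ q∣im =
      finish (quotient-by (u ∙ γ₁) (∣im∣norm⇒∣re q-prime (u ∙ γ₁) q∣im
      (subst (+ q ∣ℤ_) (sym (norm-∙ u γ₁)) (∣m⇒∣m*n (norm γ₁) q∣Nu)) , q∣im))
      where
      finish : ∃[ δ ] u ∙ γ₁ ≡ ⟦ + q ⟧ ∙ δ × proj₂ (u ∙ γ₁) ≡ + q * proj₂ δ → Splits g u (+ q)
      finish (δ , uγ₁≡qδ , im≡) = conj γ₁ , ⟦ ε ⟧ ∙ δ , conj-inOrder γ₁∈ , ∙-inOrder (⟦⟧-inOrder ε) δ∈ ,
        ⟦⟧-cancel (+ q) (+prime≢0 q-prime) _ _ (sym cancelled) ,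
          trans (cong ∣_∣ (trans (norm-conj γ₁) Nγ₁≡)) (abs-sign ε-sign)
        where
        open ≡-Reasoning
        abs-sign : ∀ {ε} → IsSign ε → ∣ ε * + q ∣ ≡ ∣ + q ∣
        abs-sign {ε} (inj₁ refl) = trans (ℤₚ.abs-* ε (+ q)) (ℕₚ.+-identityʳ q)
        abs-sign {ε} (inj₂ refl) = trans (ℤₚ.abs-* ε (+ q)) (ℕₚ.+-identityʳ q)
        -- q does not divide g, so division by q does not lead out of the order.
        δ∈ : InOrder g δ
        δ∈ = inOrder (∣-coprime-cancel (bezout₂ (+ g) (+ q) λ r r-prime r∣g r∣q →
          q∤g (subst (_∣ g) (prime-∣prime r-prime q-prime r∣q) (∣⇒∣ᵤ r∣g)))
          (subst (+ g ∣ℤ_) im≡ (InOrder.∣im (∙-inOrder u∈ γ₁∈))))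
        shuffle : ∀ q γ̄ e δ → q ∙ (γ̄ ∙ (e ∙ δ)) ≡ e ∙ γ̄ ∙ (q ∙ δ)
        shuffle = solve𝒵 4 (λ q γ̄ e δ → (q :* (γ̄ :* (e :* δ))) := (e :* γ̄ :* (q :* δ))) refl
        shuffle′ : ∀ e γ̄ u γ → e ∙ γ̄ ∙ (u ∙ γ) ≡ e ∙ (γ̄ ∙ γ) ∙ u
        shuffle′ = solve𝒵 4 (λ e γ̄ u γ → (e :* γ̄ :* (u :* γ)) := (e :* (γ̄ :* γ) :* u)) refl
        εε : ε * (ε * + q) ≡ + q
        εε = trans (sym (ℤₚ.*-assoc ε ε (+ q))) (trans (cong (_* + q) (sign² ε-sign)) (ℤₚ.*-identityˡ (+ q)))
        cancelled : ⟦ + q ⟧ ∙ (conj γ₁ ∙ (⟦ ε ⟧ ∙ δ)) ≡ ⟦ + q ⟧ ∙ u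
        cancelled = begin
          ⟦ + q ⟧ ∙ (conj γ₁ ∙ (⟦ ε ⟧ ∙ δ))  ≡⟨ shuffle ⟦ + q ⟧ (conj γ₁) ⟦ ε ⟧ δ ⟩
          ⟦ ε ⟧ ∙ conj γ₁ ∙ (⟦ + q ⟧ ∙ δ)    ≡⟨ cong (⟦ ε ⟧ ∙ conj γ₁ ∙_) uγ₁≡qδ ⟨
          ⟦ ε ⟧ ∙ conj γ₁ ∙ (u ∙ γ₁)         ≡⟨ shuffle′ ⟦ ε ⟧ (conj γ₁) u γ₁ ⟩
          ⟦ ε ⟧ ∙ (conj γ₁ ∙ γ₁) ∙ u         ≡⟨ cong (λ z → ⟦ ε ⟧ ∙ z ∙ u)
            (trans (conj-∙-self γ₁) (cong ⟦_⟧ Nγ₁≡)) ⟩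
          ⟦ ε ⟧ ∙ ⟦ ε * + q ⟧ ∙ u            ≡⟨ cong (_∙ u) (trans (⟦⟧-* ε (ε * + q)) (cong ⟦_⟧ εε)) ⟩
          ⟦ + q ⟧ ∙ u                        ∎
    go : ∃[ ε ] IsSign ε × norm γ ≡ ε * + q → + q ∣ℤ proj₂ (u ∙ conj γ) ⊎ + q ∣ℤ proj₂ (u ∙ γ) →
      Splits g u (+ q)
    go (ε , ε-sign , Nγ≡) (inj₁ q∣) = factor ε ε-sign (conj γ) (conj-inOrder γ∈) (trans (norm-conj γ) Nγ≡) q∣
    go (ε , ε-sign , Nγ≡) (inj₂ q∣) = factor ε ε-sign γ γ∈ Nγ≡ q∣

-- The field ℚ(√d)

toℚᵘ-/1 : ∀ i → toℚᵘ (i ℚ./ 1) ≃ᵘ mkℚᵘ i 0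
toℚᵘ-/1 i = ℚₚ.toℚᵘ-fromℚᵘ (mkℚᵘ i 0)

/1-injective : ∀ {i j} → i ℚ./ 1 ≡ j ℚ./ 1 → i ≡ j
/1-injective {i} {j} eq with ℚᵘₚ.≃-trans (ℚᵘₚ.≃-sym (toℚᵘ-/1 i))
  (ℚᵘₚ.≃-trans (ℚᵘₚ.≃-reflexive (cong toℚᵘ eq)) (toℚᵘ-/1 j))
... | *≡* i*1≡j*1 = trans (sym (ℤₚ.*-identityʳ i)) (trans i*1≡j*1 (ℤₚ.*-identityʳ j))

/1-+ : ∀ i j → (i + j) ℚ./ 1 ≡ i ℚ./ 1 ℚ.+ j ℚ./ 1
/1-+ i j = ℚₚ.toℚᵘ-injective (begin-equality
  toℚᵘ ((i + j) ℚ./ 1)                  ≃⟨ toℚᵘ-/1 (i + j) ⟩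
  mkℚᵘ (i + j) 0                        ≃⟨ *≡* (identity i j) ⟩
  mkℚᵘ i 0 ℚᵘ.+ mkℚᵘ j 0                ≃⟨ ℚᵘₚ.+-cong (toℚᵘ-/1 i) (toℚᵘ-/1 j) ⟨
  toℚᵘ (i ℚ./ 1) ℚᵘ.+ toℚᵘ (j ℚ./ 1)    ≃⟨ ℚₚ.toℚᵘ-homo-+ (i ℚ./ 1) (j ℚ./ 1) ⟨
  toℚᵘ (i ℚ./ 1 ℚ.+ j ℚ./ 1)            ∎)
  where
  open ℚᵘₚ.≤-Reasoning
  identity : ∀ i j → (i + j) * + 1 ≡ (i * + 1 + j * + 1) * + 1
  identity = solve-∀

/1-* : ∀ i j → (i * j) ℚ./ 1 ≡ (i ℚ./ 1) ℚ.* (j ℚ./ 1)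
/1-* i j = ℚₚ.toℚᵘ-injective (begin-equality
  toℚᵘ ((i * j) ℚ./ 1)                  ≃⟨ toℚᵘ-/1 (i * j) ⟩
  mkℚᵘ i 0 ℚᵘ.* mkℚᵘ j 0                ≃⟨ ℚᵘₚ.*-cong (toℚᵘ-/1 i) (toℚᵘ-/1 j) ⟨
  toℚᵘ (i ℚ./ 1) ℚᵘ.* toℚᵘ (j ℚ./ 1)    ≃⟨ ℚₚ.toℚᵘ-homo-* (i ℚ./ 1) (j ℚ./ 1) ⟨
  toℚᵘ ((i ℚ./ 1) ℚ.* (j ℚ./ 1))            ∎)
  where open ℚᵘₚ.≤-Reasoning

↧/1*p≡↥/1 : ∀ p → ((↧ p) ℚ./ 1) ℚ.* p ≡ (↥ p) ℚ./ 1
↧/1*p≡↥/1 p@(mkℚ n d-1 _) = ℚₚ.toℚᵘ-injective (begin-equality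
  toℚᵘ (((↧ p) ℚ./ 1) ℚ.* p)            ≃⟨ ℚₚ.toℚᵘ-homo-* ((↧ p) ℚ./ 1) p ⟩
  toℚᵘ ((↧ p) ℚ./ 1) ℚᵘ.* toℚᵘ p      ≃⟨ ℚᵘₚ.*-congʳ (toℚᵘ-/1 (↧ p)) ⟩
  mkℚᵘ (↧ p) 0 ℚᵘ.* toℚᵘ p            ≃⟨ *≡*
    (trans (identity (↧ p) n) (cong (n *_) (sym (ℤₚ.*-identityˡ (↧ p))))) ⟩
  mkℚᵘ n 0                            ≃⟨ toℚᵘ-/1 n ⟨
  toℚᵘ (n ℚ./ 1)                      ∎)
  where
  open ℚᵘₚ.≤-Reasoning
  identity : ∀ d n → d * n * + 1 ≡ n * d
  identity = solve-∀

/1-inverse : ∀ i → i ≢ 0ℤ → ∃[ q ] i ℚ./ 1 ℚ.* q ≡ 1ℚ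
/1-inverse i i≢0 = ℚ.1/ (i ℚ./ 1) , ℚₚ.*-inverseʳ (i ℚ./ 1)
  where instance _ = ℚ.≢-nonZero λ eq → i≢0 (/1-injective eq)

module _ where
  open +-*-Solver

  ℚ-rat-fromℤ-* : ∀ x D → x ≡ x ℚ.+ D ℚ.* (0ℚ ℚ.* 0ℚ)
  ℚ-rat-fromℤ-* = solve 2 (λ x D → x := x :+ D :* (con 0ℚ :* con 0ℚ)) refl

  ℚ-irr-fromℤ-* : ∀ i j → 0ℚ ≡ i ℚ.* 0ℚ ℚ.+ 0ℚ ℚ.* j
  ℚ-irr-fromℤ-* = solve 2 (λ i j → con 0ℚ := i :* con 0ℚ :+ con 0ℚ :* j) refl

  ℚ-ω²-rat-quarter : ∀ D ν → D ≡ 1ℚ ℚ.+ (+ 4 ℚ./ 1) ℚ.* ν →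
    ½ ℚ.* ½ ℚ.+ D ℚ.* (½ ℚ.* ½) ≡ 1ℚ ℚ.* ½ ℚ.+ D ℚ.* (0ℚ ℚ.* ½) ℚ.+ ν
  ℚ-ω²-rat-quarter _ ν refl = solve 1
    (λ ν → con ½ :* con ½ :+ (con 1ℚ :+ con (+ 4 ℚ./ 1) :* ν) :* (con ½ :* con ½)
    := con 1ℚ :* con ½ :+ (con 1ℚ :+ con (+ 4 ℚ./ 1) :* ν) :* (con 0ℚ :* con ½) :+ ν) refl ν

  ℚ-ω²-rat-whole : ∀ D → 0ℚ ℚ.* 0ℚ ℚ.+ D ℚ.* (1ℚ ℚ.* 1ℚ) ≡ 0ℚ ℚ.* 0ℚ ℚ.+ D ℚ.* (0ℚ ℚ.* 1ℚ) ℚ.+ D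
  ℚ-ω²-rat-whole = solve 1 (λ D →
    con 0ℚ :* con 0ℚ :+ D :* (con 1ℚ :* con 1ℚ) := con 0ℚ :* con 0ℚ :+ D :* (con 0ℚ :* con 1ℚ) :+ D) refl

  ℚ-√-rat-quarter : ∀ D → 0ℚ ≡ ℚ.- 1ℚ ℚ.+ ((+ 2 ℚ./ 1) ℚ.* ½ ℚ.+ D ℚ.* (0ℚ ℚ.* ½))
  ℚ-√-rat-quarter = solve 1 (λ D →
    con 0ℚ := con (ℚ.- 1ℚ) :+ (con (+ 2 ℚ./ 1) :* con ½ :+ D :* (con 0ℚ :* con ½))) refl

  ℚ-√-rat-whole : ∀ D → 0ℚ ≡ 0ℚ ℚ.+ (1ℚ ℚ.* 0ℚ ℚ.+ D ℚ.* (0ℚ ℚ.* 1ℚ))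
  ℚ-√-rat-whole = solve 1 (λ D → con 0ℚ := con 0ℚ :+ (con 1ℚ :* con 0ℚ :+ D :* (con 0ℚ :* con 1ℚ))) refl

  ℚ-split-rat : ∀ D a b → a ≡ a ℚ.+ (b ℚ.* 0ℚ ℚ.+ D ℚ.* (0ℚ ℚ.* 1ℚ))
  ℚ-split-rat = solve 3 (λ D a b → a := a :+ (b :* con 0ℚ :+ D :* (con 0ℚ :* con 1ℚ))) refl

  ℚ-split-irr : ∀ b → b ≡ 0ℚ ℚ.+ (b ℚ.* 1ℚ ℚ.+ 0ℚ ℚ.* 0ℚ)
  ℚ-split-irr = solve 1 (λ b → b := con 0ℚ :+ (b :* con 1ℚ :+ con 0ℚ :* con 0ℚ)) refl

ω-quarter : ∀ d → d ℕ.% 4 ≡ 1 → ω d ≡ ½ + ½ √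
ω-quarter d eq with d ℕ.% 4
ω-quarter d refl | .1 = refl

ω-whole : ∀ d → d ℕ.% 4 ≢ 1 → ω d ≡ 0ℚ + 1ℚ √
ω-whole d d≢1 with d ℕ.% 4
... | 0 = refl
... | 1 = contradiction refl d≢1
... | suc (suc _) = refl

module Field (d : ℕ) where

  open Primes d public
  open CommutativeRing (𝕂-commutativeRing {d}) public using () renaming
    ( *-assoc to ⊗-assoc; *-comm to ⊗-comm; *-identityˡ to ⊗-identityˡ; *-identityʳ to ⊗-identityʳ
    ; zeroˡ to ⊗-zeroˡ; zeroʳ to ⊗-zeroʳ; distribˡ to ⊗-distribˡ-⊕; distribʳ to ⊗-distribʳ-⊕
    ; +-identityˡ to ⊕-identityˡ; +-identityʳ to ⊕-identityʳ; +-comm to ⊕-comm)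
  open NaturalSolver (CommutativeRing.commutativeSemiring (𝕂-commutativeRing {d})) public
    using () renaming (solve to solve𝕂; _:=_ to _≔_; _:+_ to _⊹_; _:*_ to _×′_)

  fromℤ-+ : ∀ i j → fromℤ {d} (i + j) ≡ fromℤ i ⊕ fromℤ j
  fromℤ-+ i j = cong₂ _+_√ (/1-+ i j) (sym (ℚₚ.+-identityˡ 0ℚ))

  fromℤ-* : ∀ i j → fromℤ {d} (i * j) ≡ fromℤ i ⊗ fromℤ j
  fromℤ-* i j = cong₂ _+_√ (trans (/1-* i j) (ℚ-rat-fromℤ-* ((i ℚ./ 1) ℚ.* (j ℚ./ 1)) (+ d ℚ./ 1)))
    (ℚ-irr-fromℤ-* (i ℚ./ 1) (j ℚ./ 1))

  ω²≡ : ω d ⊗ ω d ≡ fromℤ (trω d) ⊗ ω d ⊕ fromℤ (- nω d)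
  ω²≡ = go (shape d)
    where
    go : Shape d → ω d ⊗ ω d ≡ fromℤ (trω d) ⊗ ω d ⊕ fromℤ (- nω d)
    go (quarter d%4≡1 t≡1 d≡ _) = subst₂ (λ w t → w ⊗ w ≡ fromℤ t ⊗ w ⊕ fromℤ (- nω d))
      (sym (ω-quarter d d%4≡1)) (sym t≡1)
      (cong₂ _+_√ (ℚ-ω²-rat-quarter (+ d ℚ./ 1) ((- nω d) ℚ./ 1) D≡) refl)
      where
      D≡ : + d ℚ./ 1 ≡ 1ℚ ℚ.+ (+ 4 ℚ./ 1) ℚ.* ((- nω d) ℚ./ 1)
      D≡ = trans (cong (ℚ._/ 1) (trans d≡ (cong (λ z → 1ℤ + z) (ℤₚ.neg-distribʳ-* (+ 4) (nω d)))))
        (trans (/1-+ 1ℤ (+ 4 * - nω d)) (cong (1ℚ ℚ.+_) (/1-* (+ 4) (- nω d))))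
    go (whole d%4≢1 t≡0 n≡ _) = subst₂ (λ w t → w ⊗ w ≡ fromℤ t ⊗ w ⊕ fromℤ (- nω d)) (sym (ω-whole d d%4≢1))
      (sym t≡0)
      (cong₂ _+_√ (trans (ℚ-ω²-rat-whole (+ d ℚ./ 1))
        (cong (λ ν → 0ℚ ℚ.* 0ℚ ℚ.+ (+ d ℚ./ 1) ℚ.* (0ℚ ℚ.* 1ℚ) ℚ.+ ν ℚ./ 1) d≡-n)) refl)
      where
      d≡-n : + d ≡ - nω d
      d≡-n = trans (sym (ℤₚ.neg-involutive (+ d))) (cong -_ (sym n≡))

  opaque
    emb : 𝒵 → 𝕂 d
    emb (x , y) = fromℤ x ⊕ fromℤ y ⊗ ω d

    emb-def : ∀ x y → emb (x , y) ≡ fromℤ x ⊕ fromℤ y ⊗ ω d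
    emb-def x y = refl

  emb-⟦⟧ : ∀ m → emb ⟦ m ⟧ ≡ fromℤ m
  emb-⟦⟧ m = trans (emb-def m 0ℤ) (trans (cong (fromℤ m ⊕_) (⊗-zeroˡ (ω d))) (⊕-identityʳ (fromℤ m)))

  emb-0 : emb ⟦ 0ℤ ⟧ ≡ 0𝕂
  emb-0 = emb-⟦⟧ 0ℤ

  emb-1 : emb ⟦ 1ℤ ⟧ ≡ 1𝕂
  emb-1 = emb-⟦⟧ 1ℤ

  opaque
    unfolding _∙_ emb

    emb-⊞ : ∀ u v → emb (u ⊞ v) ≡ emb u ⊕ emb v
    emb-⊞ (x , y) (x′ , y′) = trans (cong₂ (λ a b → a ⊕ b ⊗ ω d) (fromℤ-+ x x′) (fromℤ-+ y y′))
      (rearrange (fromℤ x) (fromℤ x′) (fromℤ y) (fromℤ y′) (ω d))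
      where
      rearrange : ∀ (x x′ y y′ w : 𝕂 d) → (x ⊕ x′) ⊕ (y ⊕ y′) ⊗ w ≡ (x ⊕ y ⊗ w) ⊕ (x′ ⊕ y′ ⊗ w)
      rearrange = solve𝕂 5 (λ x x′ y y′ w → ((x ⊹ x′) ⊹ (y ⊹ y′) ×′ w) ≔ ((x ⊹ y ×′ w) ⊹ (x′ ⊹ y′ ×′ w))) refl

    emb-∙ : ∀ u v → emb (u ∙ v) ≡ emb u ⊗ emb v
    emb-∙ (x , y) (x′ , y′) = begin
      fromℤ (x * x′ - nω d * (y * y′)) ⊕ fromℤ (x * y′ + y * x′ + trω d * (y * y′)) ⊗ ω d
        ≡⟨ cong₂ (λ a b → a ⊕ b ⊗ ω d) re im ⟩
      (X ⊗ X′ ⊕ ν ⊗ (Y ⊗ Y′)) ⊕ (X ⊗ Y′ ⊕ Y ⊗ X′ ⊕ t ⊗ (Y ⊗ Y′)) ⊗ ω d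
        ≡⟨ collect X Y X′ Y′ t ν (ω d) ⟩
      X ⊗ X′ ⊕ (X ⊗ Y′ ⊕ Y ⊗ X′) ⊗ ω d ⊕ Y ⊗ Y′ ⊗ (t ⊗ ω d ⊕ ν)
        ≡⟨ cong (λ z → X ⊗ X′ ⊕ (X ⊗ Y′ ⊕ Y ⊗ X′) ⊗ ω d ⊕ Y ⊗ Y′ ⊗ z) (sym ω²≡) ⟩
      X ⊗ X′ ⊕ (X ⊗ Y′ ⊕ Y ⊗ X′) ⊗ ω d ⊕ Y ⊗ Y′ ⊗ (ω d ⊗ ω d)
        ≡⟨ expand X Y X′ Y′ (ω d) ⟩
      (X ⊕ Y ⊗ ω d) ⊗ (X′ ⊕ Y′ ⊗ ω d) ∎
      where
      open ≡-Reasoning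
      X Y X′ Y′ t ν : 𝕂 d
      X = fromℤ x
      Y = fromℤ y
      X′ = fromℤ x′
      Y′ = fromℤ y′
      t = fromℤ (trω d)
      ν = fromℤ (- nω d)
      re : fromℤ (x * x′ - nω d * (y * y′)) ≡ X ⊗ X′ ⊕ ν ⊗ (Y ⊗ Y′)
      re = trans (cong fromℤ (cong (λ z → x * x′ + z) (ℤₚ.neg-distribˡ-* (nω d) (y * y′))))
        (trans (fromℤ-+ (x * x′) (- nω d * (y * y′)))
        (cong₂ _⊕_ (fromℤ-* x x′) (trans (fromℤ-* (- nω d) (y * y′)) (cong (ν ⊗_) (fromℤ-* y y′)))))
      im : fromℤ (x * y′ + y * x′ + trω d * (y * y′)) ≡ X ⊗ Y′ ⊕ Y ⊗ X′ ⊕ t ⊗ (Y ⊗ Y′)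
      im = trans (fromℤ-+ (x * y′ + y * x′) (trω d * (y * y′)))
        (cong₂ _⊕_ (trans (fromℤ-+ (x * y′) (y * x′)) (cong₂ _⊕_ (fromℤ-* x y′) (fromℤ-* y x′)))
          (trans (fromℤ-* (trω d) (y * y′)) (cong (t ⊗_) (fromℤ-* y y′))))
      collect : ∀ (x y x′ y′ t ν w : 𝕂 d) → (x ⊗ x′ ⊕ ν ⊗ (y ⊗ y′)) ⊕ (x ⊗ y′ ⊕ y ⊗ x′ ⊕ t ⊗ (y ⊗ y′)) ⊗ w
        ≡ x ⊗ x′ ⊕ (x ⊗ y′ ⊕ y ⊗ x′) ⊗ w ⊕ y ⊗ y′ ⊗ (t ⊗ w ⊕ ν)
      collect = solve𝕂 7 (λ x y x′ y′ t ν w →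
        ((x ×′ x′ ⊹ ν ×′ (y ×′ y′)) ⊹ (x ×′ y′ ⊹ y ×′ x′ ⊹ t ×′ (y ×′ y′)) ×′ w)
        ≔ (x ×′ x′ ⊹ (x ×′ y′ ⊹ y ×′ x′) ×′ w ⊹ y ×′ y′ ×′ (t ×′ w ⊹ ν))) refl
      expand : ∀ (x y x′ y′ w : 𝕂 d) → x ⊗ x′ ⊕ (x ⊗ y′ ⊕ y ⊗ x′) ⊗ w ⊕
        y ⊗ y′ ⊗ (w ⊗ w) ≡ (x ⊕ y ⊗ w) ⊗ (x′ ⊕ y′ ⊗ w)
      expand = solve𝕂 5 (λ x y x′ y′ w →
        (x ×′ x′ ⊹ (x ×′ y′ ⊹ y ×′ x′) ×′ w ⊹ y ×′ y′ ×′ (w ×′ w)) ≔ ((x ⊹ y ×′ w) ×′ (x′ ⊹ y′ ×′ w))) refl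

  emb-scale : ∀ m u → emb (⟦ m ⟧ ∙ u) ≡ fromℤ m ⊗ emb u
  emb-scale m u = trans (emb-∙ ⟦ m ⟧ u) (cong (_⊗ emb u) (emb-⟦⟧ m))

  ⊗-swap : ∀ (x y z : 𝕂 d) → x ⊗ (y ⊗ z) ≡ y ⊗ (x ⊗ z)
  ⊗-swap = solve𝕂 3 (λ x y z → (x ×′ (y ×′ z)) ≔ (y ×′ (x ×′ z))) refl

  ⊗-interchange : ∀ (x y z w : 𝕂 d) → (x ⊗ y) ⊗ (z ⊗ w) ≡ (x ⊗ z) ⊗ (y ⊗ w)
  ⊗-interchange = solve𝕂 4 (λ x y z w → ((x ×′ y) ×′ (z ×′ w)) ≔ ((x ×′ z) ×′ (y ×′ w))) refl

  Invertible : 𝕂 d → Set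
  Invertible x = ∃[ y ] x ⊗ y ≡ 1𝕂

  ⊗-cancelˡ : ∀ x {y z} → Invertible x → x ⊗ y ≡ x ⊗ z → y ≡ z
  ⊗-cancelˡ x {y} {z} (x⁻¹ , xx⁻¹≡1) xy≡xz = trans (sym (cancel y)) (trans (cong (x⁻¹ ⊗_) xy≡xz) (cancel z))
    where
    cancel : ∀ y → x⁻¹ ⊗ (x ⊗ y) ≡ y
    cancel y = trans (sym (⊗-assoc x⁻¹ x y))
      (trans (cong (_⊗ y) (trans (⊗-comm x⁻¹ x) xx⁻¹≡1)) (⊗-identityˡ y))

  Invertible-⊗ : ∀ x y → Invertible x → Invertible y → Invertible (x ⊗ y)
  Invertible-⊗ x y (x⁻¹ , xx⁻¹≡1) (y⁻¹ , yy⁻¹≡1) = x⁻¹ ⊗ y⁻¹ ,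
    trans (⊗-interchange x y x⁻¹ y⁻¹) (trans (cong₂ _⊗_ xx⁻¹≡1 yy⁻¹≡1) (⊗-identityˡ 1𝕂))

  fromℤ-invertible : ∀ {m} → m ≢ 0ℤ → Invertible (fromℤ m)
  fromℤ-invertible {m} m≢0 = let q , mq≡1 = /1-inverse m m≢0 in
    q + 0ℚ √ , cong₂ _+_√ (trans (sym (ℚ-rat-fromℤ-* ((m ℚ./ 1) ℚ.* q) (+ d ℚ./ 1))) mq≡1)
      (sym (ℚ-irr-fromℤ-* (m ℚ./ 1) q))

  emb-invertible : ∀ {u} → norm u ≢ 0ℤ → Invertible (emb u)
  emb-invertible {u} Nu≢0 = let n⁻¹ , nn⁻¹≡1 = fromℤ-invertible Nu≢0 in
    emb (conj u) ⊗ n⁻¹ , trans (sym (⊗-assoc (emb u) (emb (conj u)) n⁻¹))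
      (trans (cong (_⊗ n⁻¹) (trans (sym (emb-∙ u (conj u))) (trans (cong emb (∙-conj u)) (emb-⟦⟧ (norm u)))))
        nn⁻¹≡1)

  √∈ : ∃[ s ] 0ℚ + 1ℚ √ ≡ emb s
  √∈ = go (shape d)
    where
    go : Shape d → ∃[ s ] 0ℚ + 1ℚ √ ≡ emb s
    -- √d = 2 ω - 1.
    go (quarter d%4≡1 _ _ _) = (-1ℤ , + 2) ,
      sym (trans (emb-def -1ℤ (+ 2)) (trans (cong (λ w → fromℤ -1ℤ ⊕ fromℤ (+ 2) ⊗ w) (ω-quarter d d%4≡1))
      (cong₂ _+_√ (sym (ℚ-√-rat-quarter (+ d ℚ./ 1))) refl)))
    go (whole d%4≢1 _ _ _) = (0ℤ , 1ℤ) ,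
      sym (trans (emb-def 0ℤ 1ℤ) (trans (cong (λ w → fromℤ 0ℤ ⊕ fromℤ 1ℤ ⊗ w) (ω-whole d d%4≢1))
      (cong₂ _+_√ (sym (ℚ-√-rat-whole (+ d ℚ./ 1))) refl)))

  clear-denominator : ∀ z → ∃[ m ] ∃[ u ] m ≢ 0ℤ × fromℤ m ⊗ z ≡ emb u
  clear-denominator z@(a + b √) = let s , √≡ = √∈ in
    ↧ a * ↧ b , ⟦ ↥ a * ↧ b ⟧ ⊞ ⟦ ↥ b * ↧ a ⟧ ∙ s , ↧≢0 , (begin
      fromℤ (↧ a * ↧ b) ⊗ z                                       ≡⟨ cong₂ _⊗_ (fromℤ-* (↧ a) (↧ b)) split ⟩
      fromℤ (↧ a) ⊗ fromℤ (↧ b) ⊗ (A ⊕ B ⊗ 0ℚ+1ℚ√)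
        ≡⟨ distribute (fromℤ (↧ a)) (fromℤ (↧ b)) A B 0ℚ+1ℚ√ ⟩
      (fromℤ (↧ a) ⊗ A) ⊗ fromℤ (↧ b) ⊕ (fromℤ (↧ b) ⊗ B) ⊗ fromℤ (↧ a) ⊗ 0ℚ+1ℚ√
        ≡⟨ cong₂ _⊕_ (cong (_⊗ fromℤ (↧ b)) (scale a)) (cong₂ (λ x y → x ⊗ fromℤ (↧ a) ⊗ y) (scale b) √≡) ⟩
      fromℤ (↥ a) ⊗ fromℤ (↧ b) ⊕ fromℤ (↥ b) ⊗ fromℤ (↧ a) ⊗ emb s
        ≡⟨ cong₂ _⊕_ (trans (sym (fromℤ-* (↥ a) (↧ b))) (sym (emb-⟦⟧ (↥ a * ↧ b))))
          (trans (cong (_⊗ emb s) (sym (fromℤ-* (↥ b) (↧ a)))) (sym (emb-scale (↥ b * ↧ a) s))) ⟩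
      emb ⟦ ↥ a * ↧ b ⟧ ⊕ emb (⟦ ↥ b * ↧ a ⟧ ∙ s)                 ≡⟨ emb-⊞ _ _ ⟨
      emb (⟦ ↥ a * ↧ b ⟧ ⊞ ⟦ ↥ b * ↧ a ⟧ ∙ s)                     ∎)
    where
    open ≡-Reasoning
    A B 0ℚ+1ℚ√ : 𝕂 d
    A = a + 0ℚ √
    B = b + 0ℚ √
    0ℚ+1ℚ√ = 0ℚ + 1ℚ √
    ↧≢0 : ↧ a * ↧ b ≢ 0ℤ
    ↧≢0 ()
    split : z ≡ A ⊕ B ⊗ 0ℚ+1ℚ√
    split = cong₂ _+_√ (ℚ-split-rat (+ d ℚ./ 1) a b) (ℚ-split-irr b)
    scale : ∀ p → fromℤ (↧ p) ⊗ (p + 0ℚ √) ≡ fromℤ (↥ p)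
    scale p = cong₂ _+_√ (trans (sym (ℚ-rat-fromℤ-* (((↧ p) ℚ./ 1) ℚ.* p) (+ d ℚ./ 1))) (↧/1*p≡↥/1 p))
      (sym (ℚ-irr-fromℤ-* ((↧ p) ℚ./ 1) p))
    distribute : ∀ (m n a b s : 𝕂 d) → m ⊗ n ⊗ (a ⊕ b ⊗ s) ≡ (m ⊗ a) ⊗ n ⊕ (n ⊗ b) ⊗ m ⊗ s
    distribute = solve𝕂 5 (λ m n a b s → (m ×′ n ×′ (a ⊹ b ×′ s)) ≔ ((m ×′ a) ×′ n ⊹ (n ×′ b) ×′ m ×′ s)) refl

  𝒪⇒emb : ∀ {g z} → 𝒪 d g z → ∃[ u ] InOrder g u × z ≡ emb u
  𝒪⇒emb {g} (a , b , z≡) = (a , b * + g) , inOrder (divides b refl) ,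
    trans z≡ (sym (trans (emb-def a (b * + g))
    (cong (fromℤ a ⊕_) (trans (cong (_⊗ ω d) (fromℤ-* b (+ g))) (⊗-assoc (fromℤ b) (fromℤ (+ g)) (ω d))))))

  emb⇒𝒪 : ∀ {g u} → InOrder g u → 𝒪 d g (emb u)
  emb⇒𝒪 {g} {x , y} (inOrder (divides b y≡)) = x , b , trans (emb-def x y)
    (cong (fromℤ x ⊕_) (trans (cong (λ y → fromℤ y ⊗ ω d) y≡)
      (trans (cong (_⊗ ω d) (fromℤ-* b (+ g))) (⊗-assoc (fromℤ b) (fromℤ (+ g)) (ω d)))))

  module _ (2≤d : 2 ≤ d) (d-squarefree : Squarefree d) where

    emb≡0⇒≡0 : ∀ {u} → emb u ≡ 0𝕂 → u ≡ ⟦ 0ℤ ⟧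
    emb≡0⇒≡0 {u} eq = norm≡0⇒≡0 2≤d d-squarefree u (/1-injective (cong 𝕂.rat (begin
      fromℤ (norm u)            ≡⟨ emb-⟦⟧ (norm u) ⟨
      emb ⟦ norm u ⟧            ≡⟨ cong emb (∙-conj u) ⟨
      emb (u ∙ conj u)          ≡⟨ emb-∙ u (conj u) ⟩
      emb u ⊗ emb (conj u)      ≡⟨ cong (_⊗ emb (conj u)) eq ⟩
      0𝕂 ⊗ emb (conj u)         ≡⟨ ⊗-zeroˡ (emb (conj u)) ⟩
      0𝕂                        ∎)))
      where open ≡-Reasoning

    emb-injective : ∀ {u v} → emb u ≡ emb v → u ≡ v
    emb-injective {u} {v} eq = begin
      u                     ≡⟨ ⊞-identityˡ u ⟨
      ⟦ 0ℤ ⟧ ⊞ u            ≡⟨ cong (_⊞ u) (trans (⊞-comm v (neg v)) (⊞-inverseˡ v)) ⟨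
      v ⊞ neg v ⊞ u         ≡⟨ ⊞-assoc v (neg v) u ⟩
      v ⊞ (neg v ⊞ u)       ≡⟨ cong (v ⊞_)
        (emb≡0⇒≡0 (trans (emb-⊞ (neg v) u) (trans (cong (emb (neg v) ⊕_) eq)
                                 (trans (sym (emb-⊞ (neg v) v)) (trans (cong emb (⊞-inverseˡ v)) emb-0))))) ⟩
      v ⊞ ⟦ 0ℤ ⟧            ≡⟨ ⊞-comm v ⟦ 0ℤ ⟧ ⟩
      ⟦ 0ℤ ⟧ ⊞ v            ≡⟨ ⊞-identityˡ v ⟩
      v                     ∎
      where open ≡-Reasoning

    norm≢0 : ∀ {u} → emb u ≢ 0𝕂 → norm u ≢ 0ℤ
    norm≢0 {u} u≢0 Nu≡0 = u≢0 (trans (cong emb (norm≡0⇒≡0 2≤d d-squarefree u Nu≡0)) emb-0)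

-- Integral closure

^-distrib-* : ∀ i j k → (i * j) ^ k ≡ i ^ k * j ^ k
^-distrib-* i j zero = refl
^-distrib-* i j (suc k) = trans (cong (i * j *_) (^-distrib-* i j k)) (interchange i j (i ^ k) (j ^ k))
  where
  interchange : ∀ i j u v → i * j * (u * v) ≡ i * u * (j * v)
  interchange = solve-∀

^-nonzero : ∀ {i} k → i ≢ 0ℤ → i ^ k ≢ 0ℤ
^-nonzero {i} k i≢0 eq = i≢0 (ℤₚ.i^n≡0⇒i≡0 i k eq)

prime-∣^ : ∀ {q} → Prime q → ∀ i k → + q ∣ℤ i ^ k → + q ∣ℤ i
prime-∣^ q-prime i zero q∣1 = contradiction q∣1 (prime-∤1 q-prime)
prime-∣^ q-prime i (suc k) q∣ with prime-∣* q-prime i (i ^ k) q∣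
... | inj₁ q∣i = q∣i
... | inj₂ q∣i^k = prime-∣^ q-prime i k q∣i^k

∣-^ : ∀ {i j} k → i ∣ℤ j → i ^ k ∣ℤ j ^ k
∣-^ zero i∣j = ∣-refl
∣-^ {i} {j} (suc k) i∣j = ∣-trans (*-monoʳ-∣ i (∣-^ k i∣j))
  (subst₂ _∣ℤ_ (ℤₚ.*-comm (j ^ k) i) (ℤₚ.*-comm (j ^ k) j) (*-monoʳ-∣ (j ^ k) i∣j))

∣quotient∣< : ∀ {q} → Prime q → ∀ i j → j ≢ 0ℤ → j ≡ i * + q → ∣ i ∣ < ∣ j ∣
∣quotient∣< {q} q-prime i j j≢0 j≡ = subst (∣ i ∣ <_) (sym (trans (cong ∣_∣ j≡) (ℤₚ.abs-* i (+ q))))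
  (ℕₚ.m<m*n ∣ i ∣ q (ℕ.nonTrivial⇒n>1 q))
  where
  instance
    _ = prime⇒nonTrivial q-prime
    _ = ℕ.≢-nonZero {∣ i ∣} λ ∣i∣≡0 → j≢0 (trans j≡ (cong (_* + q) (ℤₚ.∣i∣≡0⇒i≡0 {i} ∣i∣≡0)))

-- q divides c b^j but not b, hence c; cancelling q leaves the same hypothesis for c / q, whose
-- absolute value is smaller. The exponent of b is left free so that the hypothesis survives this
-- shift of k.
unbounded-powers : ∀ {q} → Prime q → ∀ b → ¬ + q ∣ℤ b → ∀ n c → ∣ c ∣ ≤ n → c ≢ 0ℤ →
  ¬ (∀ k → ∃[ j ] (+ q) ^ k ∣ℤ c * b ^ j)
unbounded-powers q-prime b q∤b zero c ∣c∣≤0 c≢0 _ = c≢0 (ℤₚ.∣i∣≡0⇒i≡0 (ℕₚ.n≤0⇒n≡0 ∣c∣≤0))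
unbounded-powers {q} q-prime b q∤b (suc n) c ∣c∣≤1+n c≢0 powers = descend q∣c
  where
  q∣c : + q ∣ℤ c
  q∣c = let j , q∣cbʲ = powers 1 in
    Sum.fromInj₁ (λ q∣bʲ → contradiction (prime-∣^ q-prime b j q∣bʲ) q∤b)
      (prime-∣* q-prime c (b ^ j) (subst (_∣ℤ c * b ^ j) (ℤₚ.*-identityʳ (+ q)) q∣cbʲ))
  descend : + q ∣ℤ c → ⊥
  descend (divides c′ c≡) = unbounded-powers q-prime b q∤b n c′
    (ℕₚ.≤-pred (ℕₚ.≤-trans (∣quotient∣< q-prime c′ c c≢0 c≡) ∣c∣≤1+n))
    (λ c′≡0 → c≢0 (trans c≡ (cong (_* + q) c′≡0)))
    λ k → let j , divs = powers (suc k) in j ,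
      *-cancelˡ-∣ (+ q) (subst (+ q * (+ q) ^ k ∣ℤ_) (trans (cong (_* b ^ j) c≡) (rotate c′ (+ q) (b ^ j)))
      divs)
    where
    instance _ = ℤ.≢-nonZero (+prime≢0 q-prime)
    rotate : ∀ c q b → c * q * b ≡ q * (c * b)
    rotate = solve-∀

-- ℤ is completely integrally closed: if the powers of b / a have the common denominator c, then b /
-- a is an integer. Once the gcd is removed, a prime q ∣ a′ would satisfy q^k ∣ c b′^k for all k.
∣-from-powers : ∀ a b c → a ≢ 0ℤ → c ≢ 0ℤ → (∀ k → a ^ k ∣ℤ c * b ^ k) → a ∣ℤ b
∣-from-powers a b c a≢0 c≢0 powers = go (bezout-identity a b)
  where
  go : ∃[ g ] ∃[ r ] ∃[ s ] r * a + s * b ≡ + g × + g ∣ℤ a × + g ∣ℤ b → a ∣ℤ b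
  go (g , r , s , ra+sb≡g , divides a′ a≡ , divides b′ b≡) = case ∣ a′ ∣ ℕₚ.≟ 1 of λ
    { (yes ∣a′∣≡1) → ∣-trans (∣ᵤ⇒∣
      (ℕ∣.∣-reflexive (trans (cong ∣_∣ a≡)
      (trans (ℤₚ.abs-* a′ (+ g)) (trans (cong (ℕ._* g) ∣a′∣≡1) (ℕₚ.*-identityˡ g)))))) (divides {+ g} b′ b≡)
    ; (no ∣a′∣≢1) → let q , q-prime , q∣a′ = prime-divisor ∣ a′ ∣ ∣a′∣≢1 in
        ⊥-elim (unbounded-powers q-prime b′ (coprime q-prime (∣ᵤ⇒∣ q∣a′)) ∣ c ∣ c ℕₚ.≤-refl c≢0
          λ k → k , ∣-trans (∣-^ k (∣ᵤ⇒∣ q∣a′)) (a′ᵏ∣cb′ᵏ k)) }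
    where
    g≢0 : + g ≢ 0ℤ
    g≢0 g≡0 = a≢0 (trans a≡ (trans (cong (a′ *_) g≡0) (ℤₚ.*-zeroʳ a′)))
    collect : ∀ r a s b g → g * (r * a + s * b) ≡ r * (a * g) + s * (b * g)
    collect = solve-∀
    ra′+sb′≡1 : r * a′ + s * b′ ≡ 1ℤ
    ra′+sb′≡1 = ℤₚ.*-cancelˡ-≡ (+ g) _ _ (trans (collect r a′ s b′ (+ g))
      (trans (cong₂ (λ a b → r * a + s * b) (sym a≡) (sym b≡)) (trans ra+sb≡g (sym (ℤₚ.*-identityʳ (+ g))))))
      where instance _ = ℤ.≢-nonZero g≢0
    coprime : ∀ {q} → Prime q → + q ∣ℤ a′ → ¬ + q ∣ℤ b′
    coprime {q} q-prime q∣a′ q∣b′ =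
      prime-∤1 q-prime (subst (+ q ∣ℤ_) ra′+sb′≡1 (∣m∣n⇒∣m+n (∣n⇒∣m*n r q∣a′) (∣n⇒∣m*n s q∣b′)))
    a′ᵏ∣cb′ᵏ : ∀ k → a′ ^ k ∣ℤ c * b′ ^ k
    a′ᵏ∣cb′ᵏ k = *-cancelʳ-∣ ((+ g) ^ k) (subst₂ _∣ℤ_ (trans (cong (_^ k) a≡) (^-distrib-* a′ (+ g) k))
      (trans (cong (c *_) (trans (cong (_^ k) b≡) (^-distrib-* b′ (+ g) k)))
        (sym (ℤₚ.*-assoc c (b′ ^ k) ((+ g) ^ k)))) (powers k))
      where instance _ = ℤ.≢-nonZero (^-nonzero k g≢0)

module IntegralClosure (d : ℕ) (2≤d : 2 ≤ d) (d-squarefree : Squarefree d) where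

  open Field d

  -- `integrality` for composite e, one prime factor q at a time: u / q satisfies the hypotheses for
  -- e / q.
  integral-quotient : ∀ n e u → ∣ e ∣ ≤ n → e ≢ 0ℤ → e ∣ℤ trace u → e * e ∣ℤ norm u → ∃[ v ] u ≡ ⟦ e ⟧ ∙ v
  integral-quotient zero e u ∣e∣≤0 e≢0 _ _ = ⊥-elim (e≢0 (ℤₚ.∣i∣≡0⇒i≡0 (ℕₚ.n≤0⇒n≡0 ∣e∣≤0)))
  integral-quotient (suc n) e u ∣e∣≤1+n e≢0 e∣T e²∣N = case ∣ e ∣ ℕₚ.≟ 1 of λ
    { (yes ∣e∣≡1) → unit (∣i∣≡∣j∣⇒i≡±j e 1ℤ ∣e∣≡1)
    ; (no ∣e∣≢1) → let q , q-prime , q∣e = prime-divisor ∣ e ∣ ∣e∣≢1 in descend q-prime (∣ᵤ⇒∣ q∣e) }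
    where
    unit : ∃[ ε ] IsSign ε × e ≡ ε * 1ℤ → ∃[ v ] u ≡ ⟦ e ⟧ ∙ v
    unit (ε , ε-sign , e≡) = ⟦ ε ⟧ ∙ u ,
      sym (trans (cong (λ e → ⟦ e ⟧ ∙ (⟦ ε ⟧ ∙ u)) (trans e≡ (ℤₚ.*-identityʳ ε)))
      (trans (sym (∙-assoc ⟦ ε ⟧ ⟦ ε ⟧ u))
        (trans (cong (_∙ u) (trans (⟦⟧-* ε ε) (cong ⟦_⟧ (sign² ε-sign)))) (∙-identityˡ u))))
    descend : ∀ {q} → Prime q → + q ∣ℤ e → ∃[ v ] u ≡ ⟦ e ⟧ ∙ v
    descend {q} q-prime q∣e@(divides e′ e≡) =
      go (quotient-by u (integrality d-squarefree q-prime u (∣-trans q∣e e∣T) (∣-trans q²∣e² e²∣N)))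
      where
      instance
        _ = ℤ.≢-nonZero (+prime≢0 q-prime)
      squares : ∀ e q → e * q * (e * q) ≡ q * q * (e * e)
      squares = solve-∀
      q²∣e² : + q * + q ∣ℤ e * e
      q²∣e² = subst (+ q * + q ∣ℤ_) (trans (sym (squares e′ (+ q))) (sym (cong₂ _*_ e≡ e≡)))
        (∣m⇒∣m*n (e′ * e′) ∣-refl)
      go : ∃[ v ] u ≡ ⟦ + q ⟧ ∙ v × proj₂ u ≡ + q * proj₂ v → ∃[ v ] u ≡ ⟦ e ⟧ ∙ v
      go (v , u≡ , _) =
        let w , v≡ = integral-quotient n e′ v
              (ℕₚ.≤-pred (ℕₚ.≤-trans (∣quotient∣< q-prime e′ e e≢0 e≡) ∣e∣≤1+n))
              (λ e′≡0 → e≢0 (trans e≡ (cong (_* + q) e′≡0)))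
              (*-cancelˡ-∣ (+ q) (subst₂ _∣ℤ_ (trans e≡ (ℤₚ.*-comm e′ (+ q)))
                (trans (cong trace u≡) (trace-⟦⟧-∙ (+ q) v)) e∣T))
              (*-cancelˡ-∣ (+ q) (*-cancelˡ-∣ (+ q)
                (subst₂ _∣ℤ_ (trans (cong₂ _*_ e≡ e≡)
                (trans (squares e′ (+ q)) (ℤₚ.*-assoc (+ q) (+ q) (e′ * e′))))
                (trans (norm-quotient (+ q) u≡) (ℤₚ.*-assoc (+ q) (+ q) (norm v))) e²∣N)))
        in w , trans u≡ (trans (cong (⟦ + q ⟧ ∙_) v≡)
          (trans (sym (∙-assoc ⟦ + q ⟧ ⟦ e′ ⟧ w))
          (cong (_∙ w) (trans (⟦⟧-* (+ q) e′) (cong ⟦_⟧ (trans (ℤₚ.*-comm (+ q) e′) (sym e≡)))))))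

  infixr 9 _↑_ _⇡_
  _↑_ : 𝒵 → ℕ → 𝒵
  u ↑ zero  = ⟦ 1ℤ ⟧
  u ↑ suc k = u ∙ u ↑ k

  _⇡_ : 𝕂 d → ℕ → 𝕂 d
  x ⇡ zero  = 1𝕂
  x ⇡ suc k = x ⊗ x ⇡ k

  norm-↑ : ∀ u k → norm (u ↑ k) ≡ norm u ^ k
  norm-↑ u zero = norm-⟦⟧ 1ℤ
  norm-↑ u (suc k) = trans (norm-∙ u (u ↑ k)) (cong (norm u *_) (norm-↑ u k))

  emb-↑ : ∀ {e x u} → fromℤ e ⊗ x ≡ emb u → ∀ k → fromℤ (e ^ k) ⊗ x ⇡ k ≡ emb (u ↑ k)
  emb-↑ ex≡u zero = trans (⊗-identityʳ (fromℤ 1ℤ)) (sym emb-1)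
  emb-↑ {e} {x} {u} ex≡u (suc k) = begin
    fromℤ (e * e ^ k) ⊗ (x ⊗ x ⇡ k)              ≡⟨ cong (_⊗ (x ⊗ x ⇡ k)) (fromℤ-* e (e ^ k)) ⟩
    fromℤ e ⊗ fromℤ (e ^ k) ⊗ (x ⊗ x ⇡ k)        ≡⟨ ⊗-interchange (fromℤ e) (fromℤ (e ^ k)) x (x ⇡ k) ⟩
    (fromℤ e ⊗ x) ⊗ (fromℤ (e ^ k) ⊗ x ⇡ k)      ≡⟨ cong₂ _⊗_ ex≡u (emb-↑ ex≡u k) ⟩
    emb u ⊗ emb (u ↑ k)                          ≡⟨ emb-∙ u (u ↑ k) ⟨
    emb (u ∙ u ↑ k)                              ∎
    where
    open ≡-Reasoning

  -- Taking norms in c u^k = e^k w gives (e²)^k ∣ c² (norm u)^k for every k, so that `∣-from-powers`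
  -- applies.
  bounded-powers⇒²∣norm : ∀ {e c x u} → e ≢ 0ℤ → c ≢ 0ℤ → fromℤ e ⊗ x ≡ emb u →
    (∀ k → ∃[ w ] fromℤ c ⊗ x ⇡ k ≡ emb w) → e * e ∣ℤ norm u
  bounded-powers⇒²∣norm {e} {c} {x} {u} e≢0 c≢0 ex≡u bounded =
    ∣-from-powers (e * e) (norm u) (c * c) (*-nonzero e≢0 e≢0) (*-nonzero c≢0 c≢0) divides-powers
    where
    *-nonzero : ∀ {i j} → i ≢ 0ℤ → j ≢ 0ℤ → i * j ≢ 0ℤ
    *-nonzero {i} {j} i≢0 j≢0 ij≡0 with ℤₚ.i*j≡0⇒i≡0∨j≡0 i ij≡0
    ... | inj₁ i≡0 = i≢0 i≡0
    ... | inj₂ j≡0 = j≢0 j≡0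
    divides-powers : ∀ k → (e * e) ^ k ∣ℤ c * c * norm u ^ k
    divides-powers k = let w , cxᵏ≡w = bounded k in divides (norm w) (begin
      c * c * norm u ^ k                    ≡⟨ cong (c * c *_) (norm-↑ u k) ⟨
      c * c * norm (u ↑ k)                  ≡⟨ norm-⟦⟧-∙ c (u ↑ k) ⟨
      norm (⟦ c ⟧ ∙ u ↑ k)                  ≡⟨ cong norm (emb-injective 2≤d d-squarefree (eq w cxᵏ≡w)) ⟩
      norm (⟦ e ^ k ⟧ ∙ w)                  ≡⟨ norm-⟦⟧-∙ (e ^ k) w ⟩
      e ^ k * e ^ k * norm w                ≡⟨ ℤₚ.*-comm (e ^ k * e ^ k) (norm w) ⟩
      norm w * (e ^ k * e ^ k)              ≡⟨ cong (norm w *_) (^-distrib-* e e k) ⟨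
      norm w * (e * e) ^ k                  ∎)
      where
      open ≡-Reasoning
      eq : ∀ w → fromℤ c ⊗ x ⇡ k ≡ emb w → emb (⟦ c ⟧ ∙ u ↑ k) ≡ emb (⟦ e ^ k ⟧ ∙ w)
      eq w cxᵏ≡w = begin
        emb (⟦ c ⟧ ∙ u ↑ k)                  ≡⟨ emb-scale c (u ↑ k) ⟩
        fromℤ c ⊗ emb (u ↑ k)                ≡⟨ cong (fromℤ c ⊗_) (emb-↑ ex≡u k) ⟨
        fromℤ c ⊗ (fromℤ (e ^ k) ⊗ x ⇡ k)    ≡⟨ ⊗-swap (fromℤ c) (fromℤ (e ^ k)) (x ⇡ k) ⟩
        fromℤ (e ^ k) ⊗ (fromℤ c ⊗ x ⇡ k)    ≡⟨ cong (fromℤ (e ^ k) ⊗_) cxᵏ≡w ⟩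
        fromℤ (e ^ k) ⊗ emb w                ≡⟨ emb-scale (e ^ k) w ⟨
        emb (⟦ e ^ k ⟧ ∙ w)                  ∎

  module _ {x e u} (ex≡u : fromℤ e ⊗ x ≡ emb u) where

    -- For n the degree of a monic relation for x, these combinations of 1, x, ..., x^(n-1) contain
    -- every power of x, and e^n is a denominator for all of them.
    poly : ∀ {n} → Vec 𝒵 n → 𝕂 d
    poly = Vec.foldr′ (λ a v → emb a ⊕ x ⊗ v) 0𝕂

    poly-denominator : ∀ {n} (as : Vec 𝒵 n) → ∃[ w ] fromℤ (e ^ n) ⊗ poly as ≡ emb w
    poly-denominator [] = ⟦ 0ℤ ⟧ , trans (⊗-identityˡ 0𝕂) (sym emb-0)
    poly-denominator {suc n} (a ∷ as) = let w , eq = poly-denominator as in ⟦ e * e ^ n ⟧ ∙ a ⊞ u ∙ w , (begin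
      fromℤ (e * e ^ n) ⊗ (emb a ⊕ x ⊗ poly as)
        ≡⟨ ⊗-distribˡ-⊕ (fromℤ (e * e ^ n)) (emb a) (x ⊗ poly as) ⟩
      fromℤ (e * e ^ n) ⊗ emb a ⊕ fromℤ (e * e ^ n) ⊗ (x ⊗ poly as)
        ≡⟨ cong₂ _⊕_ (sym (emb-scale (e * e ^ n) a))
          (trans (cong (_⊗ (x ⊗ poly as)) (fromℤ-* e (e ^ n)))
          (⊗-interchange (fromℤ e) (fromℤ (e ^ n)) x (poly as))) ⟩
      emb (⟦ e * e ^ n ⟧ ∙ a) ⊕ (fromℤ e ⊗ x) ⊗ (fromℤ (e ^ n) ⊗ poly as)
        ≡⟨ cong (emb (⟦ e * e ^ n ⟧ ∙ a) ⊕_) (trans (cong₂ _⊗_ ex≡u eq) (sym (emb-∙ u w))) ⟩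
      emb (⟦ e * e ^ n ⟧ ∙ a) ⊕ emb (u ∙ w)
        ≡⟨ emb-⊞ _ _ ⟨
      emb (⟦ e * e ^ n ⟧ ∙ a ⊞ u ∙ w) ∎)
      where
      open ≡-Reasoning

    poly-⊕ : ∀ {n} (as bs : Vec 𝒵 n) → ∃[ cs ] poly {n} cs ≡ poly as ⊕ poly bs
    poly-⊕ [] [] = [] , sym (⊕-identityˡ 0𝕂)
    poly-⊕ (a ∷ as) (b ∷ bs) = let cs , eq = poly-⊕ as bs in
      a ⊞ b ∷ cs , trans (cong₂ (λ z w → z ⊕ x ⊗ w) (emb-⊞ a b) eq)
        (rearrange (emb a) (emb b) x (poly as) (poly bs))
      where
      rearrange : ∀ (a b x p q : 𝕂 d) → (a ⊕ b) ⊕ x ⊗ (p ⊕ q) ≡ (a ⊕ x ⊗ p) ⊕ (b ⊕ x ⊗ q)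
      rearrange = solve𝕂 5 (λ a b x p q → ((a ⊹ b) ⊹ x ×′ (p ⊹ q)) ≔ ((a ⊹ x ×′ p) ⊹ (b ⊹ x ×′ q))) refl

    -- Multiplying a polynomial by x and reducing its leading term by the
    -- monic polynomial cs; r is the coefficient carried into this position.
    poly-shift : ∀ cs r (as : Vec 𝒵 (List.length cs)) → ∃[ ℓ ] ∃[ bs ]
      poly {List.length cs} bs ⊕ emb ℓ ⊗ evalMonic cs x ≡ emb r ⊕ x ⊗ poly as
    poly-shift [] r [] = r , [] , trans (cong (0𝕂 ⊕_) (⊗-identityʳ (emb r)))
      (trans (⊕-comm 0𝕂 (emb r)) (cong (emb r ⊕_) (sym (⊗-zeroʳ x))))
    poly-shift (c ∷ cs) r (a ∷ as) = let ℓ , bs , eq = poly-shift cs a as in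
      ℓ , (r ⊞ neg (ℓ ∙ ⟦ c ⟧)) ∷ bs , (begin
        (emb (r ⊞ neg (ℓ ∙ ⟦ c ⟧)) ⊕ x ⊗ poly bs) ⊕ emb ℓ ⊗ (fromℤ c ⊕ x ⊗ evalMonic cs x)
          ≡⟨ rearrange (emb (r ⊞ neg (ℓ ∙ ⟦ c ⟧))) x (poly bs) (emb ℓ) (fromℤ c) (evalMonic cs x) ⟩
        (emb (r ⊞ neg (ℓ ∙ ⟦ c ⟧)) ⊕ emb ℓ ⊗ fromℤ c) ⊕ x ⊗ (poly bs ⊕ emb ℓ ⊗ evalMonic cs x)
          ≡⟨ cong₂ (λ z w → z ⊕ x ⊗ w) (cancelled ℓ) eq ⟩
        emb r ⊕ x ⊗ (emb a ⊕ x ⊗ poly as) ∎)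
      where
      open ≡-Reasoning
      rearrange : ∀ (a x p l c m : 𝕂 d) → (a ⊕ x ⊗ p) ⊕ l ⊗ (c ⊕ x ⊗ m) ≡ (a ⊕ l ⊗ c) ⊕ x ⊗ (p ⊕ l ⊗ m)
      rearrange = solve𝕂 6 (λ a x p l c m →
        ((a ⊹ x ×′ p) ⊹ l ×′ (c ⊹ x ×′ m)) ≔ ((a ⊹ l ×′ c) ⊹ x ×′ (p ⊹ l ×′ m))) refl
      cancelled : ∀ ℓ → emb (r ⊞ neg (ℓ ∙ ⟦ c ⟧)) ⊕ emb ℓ ⊗ fromℤ c ≡ emb r
      cancelled ℓ = begin
        emb (r ⊞ neg (ℓ ∙ ⟦ c ⟧)) ⊕ emb ℓ ⊗ fromℤ c
          ≡⟨ cong (λ z → emb (r ⊞ neg (ℓ ∙ ⟦ c ⟧)) ⊕ emb ℓ ⊗ z) (emb-⟦⟧ c) ⟨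
        emb (r ⊞ neg (ℓ ∙ ⟦ c ⟧)) ⊕ emb ℓ ⊗ emb ⟦ c ⟧
          ≡⟨ cong (emb (r ⊞ neg (ℓ ∙ ⟦ c ⟧)) ⊕_) (emb-∙ ℓ ⟦ c ⟧) ⟨
        emb (r ⊞ neg (ℓ ∙ ⟦ c ⟧)) ⊕ emb (ℓ ∙ ⟦ c ⟧)        ≡⟨ emb-⊞ _ _ ⟨
        emb (r ⊞ neg (ℓ ∙ ⟦ c ⟧) ⊞ ℓ ∙ ⟦ c ⟧)
          ≡⟨ cong emb (trans (⊞-assoc r _ _)
          (trans (cong (r ⊞_) (⊞-inverseˡ (ℓ ∙ ⟦ c ⟧))) (trans (⊞-comm r ⟦ 0ℤ ⟧) (⊞-identityˡ r)))) ⟩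
        emb r                                              ∎

    module _ {c cs} (root : evalMonic (c ∷ cs) x ≡ 0𝕂) where

      private
        n : ℕ
        n = List.length (c ∷ cs)

      IsPoly : 𝕂 d → Set
      IsPoly v = ∃[ as ] v ≡ poly {n} as

      1-isPoly : IsPoly 1𝕂
      1-isPoly = ⟦ 1ℤ ⟧ ∷ Vec.replicate _ ⟦ 0ℤ ⟧ ,
        sym (trans (cong₂ (λ z w → z ⊕ x ⊗ w) emb-1 (poly-0 (List.length cs)))
        (trans (cong (1𝕂 ⊕_) (⊗-zeroʳ x)) (⊕-identityʳ 1𝕂)))
        where
        poly-0 : ∀ k → poly (Vec.replicate k ⟦ 0ℤ ⟧) ≡ 0𝕂
        poly-0 zero = refl
        poly-0 (suc k) = trans (cong₂ (λ z w → z ⊕ x ⊗ w) emb-0 (poly-0 k))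
          (trans (cong (0𝕂 ⊕_) (⊗-zeroʳ x)) (⊕-identityʳ 0𝕂))

      x⊗-isPoly : ∀ {v} → IsPoly v → IsPoly (x ⊗ v)
      x⊗-isPoly {v} (as , v≡) = let ℓ , bs , eq = poly-shift (c ∷ cs) ⟦ 0ℤ ⟧ as in bs , (begin
        x ⊗ v                                       ≡⟨ cong (x ⊗_) v≡ ⟩
        x ⊗ poly as                                 ≡⟨ ⊕-identityˡ (x ⊗ poly as) ⟨
        0𝕂 ⊕ x ⊗ poly as                            ≡⟨ cong (_⊕ x ⊗ poly as) emb-0 ⟨
        emb ⟦ 0ℤ ⟧ ⊕ x ⊗ poly as                    ≡⟨ eq ⟨
        poly bs ⊕ emb ℓ ⊗ evalMonic (c ∷ cs) x      ≡⟨ cong (λ z → poly bs ⊕ emb ℓ ⊗ z) root ⟩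
        poly bs ⊕ emb ℓ ⊗ 0𝕂                        ≡⟨ cong (poly bs ⊕_) (⊗-zeroʳ (emb ℓ)) ⟩
        poly bs ⊕ 0𝕂                                ≡⟨ ⊕-identityʳ (poly bs) ⟩
        poly bs                                     ∎)
        where open ≡-Reasoning

      ⊕-isPoly : ∀ {v w} → IsPoly v → IsPoly w → IsPoly (v ⊕ w)
      ⊕-isPoly (as , v≡) (bs , w≡) = let cs , eq = poly-⊕ as bs in cs , trans (cong₂ _⊕_ v≡ w≡) (sym eq)

      powers-isPoly : ∀ k → IsPoly (x ⇡ k)
      powers-isPoly zero = 1-isPoly
      powers-isPoly (suc k) = x⊗-isPoly (powers-isPoly k)

      successor-powers-isPoly : ∀ k → IsPoly ((x ⊕ 1𝕂) ⇡ k)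
      successor-powers-isPoly zero = 1-isPoly
      successor-powers-isPoly (suc k) =
        subst IsPoly (sym (trans (⊗-distribʳ-⊕ ((x ⊕ 1𝕂) ⇡ k) x 1𝕂)
        (cong (x ⊗ (x ⊕ 1𝕂) ⇡ k ⊕_) (⊗-identityˡ ((x ⊕ 1𝕂) ⇡ k)))))
        (⊕-isPoly (x⊗-isPoly (successor-powers-isPoly k)) (successor-powers-isPoly k))

      isPoly-denominator : ∀ {v} → IsPoly v → ∃[ w ] fromℤ (e ^ n) ⊗ v ≡ emb w
      isPoly-denominator (as , v≡) = let w , eq = poly-denominator as in w ,
        trans (cong (fromℤ (e ^ n) ⊗_) v≡) eq

      -- The powers of x and of x + 1 have bounded denominators, so both norms are integers. Their
      -- difference norm (x + 1) - norm x - 1 is the trace of x, which is therefore an integer too.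
      -- Minimal polynomials do not enter.
      root⇒integer : e ≢ 0ℤ → ∃[ v ] x ≡ emb v
      root⇒integer e≢0 = let v , u≡ev = integral-quotient ∣ e ∣ e u ℕₚ.≤-refl e≢0 e∣T e²∣N in
        v , ⊗-cancelˡ (fromℤ e) (fromℤ-invertible e≢0) (trans ex≡u (trans (cong emb u≡ev) (emb-scale e v)))
        where
        e²∣N : e * e ∣ℤ norm u
        e²∣N = bounded-powers⇒²∣norm e≢0 (^-nonzero n e≢0) ex≡u (λ k → isPoly-denominator (powers-isPoly k))
        e[x+1]≡ : fromℤ e ⊗ (x ⊕ 1𝕂) ≡ emb (u ⊞ ⟦ e ⟧)
        e[x+1]≡ = trans (⊗-distribˡ-⊕ (fromℤ e) x 1𝕂)
          (trans (cong₂ _⊕_ ex≡u (trans (⊗-identityʳ (fromℤ e)) (sym (emb-⟦⟧ e)))) (sym (emb-⊞ u ⟦ e ⟧)))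
        e²∣N′ : e * e ∣ℤ norm (u ⊞ ⟦ e ⟧)
        e²∣N′ = bounded-powers⇒²∣norm e≢0 (^-nonzero n e≢0) e[x+1]≡
          (λ k → isPoly-denominator (successor-powers-isPoly k))
        N′≡ : norm (u ⊞ ⟦ e ⟧) ≡ norm u + e * trace u + e * e
        N′≡ = trans (norm-⊞ u ⟦ e ⟧) (cong₂ (λ T N → norm u + T + N)
          (trans (cong trace (trans (cong (u ∙_) (conj-⟦⟧ e)) (∙-comm u ⟦ e ⟧))) (trace-⟦⟧-∙ e u))
          (norm-⟦⟧ e))
        isolate : ∀ N t e → N + t + e - N - e ≡ t
        isolate = solve-∀
        e∣T : e ∣ℤ trace u
        e∣T = *-cancelˡ-∣ e (subst (e * e ∣ℤ_)
          (trans (cong (λ z → z - norm u - e * e) N′≡) (isolate (norm u) (e * trace u) (e * e)))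
          (∣m∣n⇒∣m-n (∣m∣n⇒∣m-n e²∣N′ e²∣N) ∣-refl))
          where instance _ = ℤ.≢-nonZero e≢0

  𝒪K⇒emb : ∀ {x} → 𝒪K d x → ∃[ u ] x ≡ emb u
  -- The empty list encodes the constant polynomial 1, which has no root.
  𝒪K⇒emb {x} ([] , 1≡0) = contradiction (emb-injective 2≤d d-squarefree (trans emb-1 (trans 1≡0 (sym emb-0))))
    λ ()
  𝒪K⇒emb {x} (c ∷ cs , root) = let e , u , e≢0 , ex≡u = clear-denominator x in root⇒integer {e = e} {u} ex≡u
    {c} {cs} root e≢0

  emb⇒𝒪K : ∀ u → 𝒪K d (emb u)
  emb⇒𝒪K u = norm u ∷ - trace u ∷ [] , (begin
    fromℤ (norm u) ⊕ emb u ⊗ (fromℤ (- trace u) ⊕ emb u ⊗ 1𝕂)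
      ≡⟨ cong₂ _⊕_ (emb-⟦⟧ (norm u))
        (cong (emb u ⊗_) (cong₂ _⊕_ (emb-⟦⟧ (- trace u)) (sym (⊗-identityʳ (emb u))))) ⟨
    emb ⟦ norm u ⟧ ⊕ emb u ⊗ (emb ⟦ - trace u ⟧ ⊕ emb u)
      ≡⟨ cong (emb ⟦ norm u ⟧ ⊕_) (trans (cong (emb u ⊗_) (sym (emb-⊞ _ _))) (sym (emb-∙ u _))) ⟩
    emb ⟦ norm u ⟧ ⊕ emb (u ∙ (⟦ - trace u ⟧ ⊞ u))
      ≡⟨ emb-⊞ _ _ ⟨
    emb (⟦ norm u ⟧ ⊞ u ∙ (⟦ - trace u ⟧ ⊞ u))
      ≡⟨ cong (λ z → emb (z ⊞ u ∙ (⟦ - trace u ⟧ ⊞ u))) (∙-conj u) ⟨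
    emb (u ∙ conj u ⊞ u ∙ (⟦ - trace u ⟧ ⊞ u))
      ≡⟨ cong emb (trans (collect u (conj u) ⟦ - trace u ⟧)
        (trans (cong (u ∙_) (trans (cong (_⊞ ⟦ - trace u ⟧) (⊞-conj u))
        (trans (⟦⟧-⊞ (trace u) (- trace u)) (cong ⟦_⟧ (ℤₚ.+-inverseʳ (trace u))))))
        (trans (∙-comm u ⟦ 0ℤ ⟧) (⟦⟧-∙ 0ℤ u)))) ⟩
    emb ⟦ 0ℤ ⟧
      ≡⟨ emb-0 ⟩
    0𝕂 ∎)
    where
    open ≡-Reasoning
    collect : ∀ u ū t → u ∙ ū ⊞ u ∙ (t ⊞ u) ≡ u ∙ ((u ⊞ ū) ⊞ t)
    collect = solve𝒵 3 (λ u ū t → (u :* ū :+ u :* (t :+ u)) := (u :* ((u :+ ū) :+ t))) refl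

-- Invertible ideals and their classes

module Ideals (d : ℕ) (2≤d : 2 ≤ d) (d-squarefree : Squarefree d) (g : ℕ) where

  open Field d

  I : 𝒵 → ℤ → Pred (𝕂 d) 0ℓ
  I a m z = ∃[ u ] ∃[ v ] InOrder g u × InOrder g v × z ≡ emb (a ∙ u ⊞ ⟦ m ⟧ ∙ v)

  -- The fractional ideal m⁻¹ (conj a , m), described through m z so that no quotient is formed.
  I⁻¹ : 𝒵 → ℤ → Pred (𝕂 d) 0ℓ
  I⁻¹ a m z = fromℤ m ⊗ z ∈ I (conj a) m

  ⟦0⟧∈ : InOrder g ⟦ 0ℤ ⟧
  ⟦0⟧∈ = ⟦⟧-inOrder 0ℤ

  ⟦1⟧∈ : InOrder g ⟦ 1ℤ ⟧
  ⟦1⟧∈ = ⟦⟧-inOrder 1ℤ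

  1≢0 : 1𝕂 {d} ≢ 0𝕂
  1≢0 ()

  ∙-identityʳ : ∀ u → u ∙ ⟦ 1ℤ ⟧ ≡ u
  ∙-identityʳ u = trans (∙-comm u ⟦ 1ℤ ⟧) (∙-identityˡ u)

  ∙-zeroʳ : ∀ u → u ∙ ⟦ 0ℤ ⟧ ≡ ⟦ 0ℤ ⟧
  ∙-zeroʳ u = trans (∙-comm u ⟦ 0ℤ ⟧) (⟦⟧-∙ 0ℤ u)

  ⊞-identityʳ : ∀ u → u ⊞ ⟦ 0ℤ ⟧ ≡ u
  ⊞-identityʳ u = trans (⊞-comm u ⟦ 0ℤ ⟧) (⊞-identityˡ u)

  combination-inOrder : ∀ {a u v} m → InOrder g a → InOrder g u → InOrder g v → InOrder g (a ∙ u ⊞ ⟦ m ⟧ ∙ v)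
  combination-inOrder m a∈ u∈ v∈ = ⊞-inOrder (∙-inOrder a∈ u∈) (∙-inOrder (⟦⟧-inOrder m) v∈)

  first-∈ : ∀ a m → emb a ∈ I a m
  first-∈ a m = ⟦ 1ℤ ⟧ , ⟦ 0ℤ ⟧ , ⟦1⟧∈ , ⟦0⟧∈ ,
    cong emb (sym (trans (cong₂ _⊞_ (∙-identityʳ a) (∙-zeroʳ ⟦ m ⟧)) (⊞-identityʳ a)))

  second-∈ : ∀ a m → emb ⟦ m ⟧ ∈ I a m
  second-∈ a m = ⟦ 0ℤ ⟧ , ⟦ 1ℤ ⟧ , ⟦0⟧∈ , ⟦1⟧∈ ,
    cong emb (sym (trans (cong₂ _⊞_ (∙-zeroʳ a) (∙-identityʳ ⟦ m ⟧)) (⊞-identityˡ ⟦ m ⟧)))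

  I-⊕-closed : ∀ {a m x y} → x ∈ I a m → y ∈ I a m → x ⊕ y ∈ I a m
  I-⊕-closed {a} {m} (u , v , u∈ , v∈ , x≡) (u′ , v′ , u′∈ , v′∈ , y≡) =
    u ⊞ u′ , v ⊞ v′ , ⊞-inOrder u∈ u′∈ , ⊞-inOrder v∈ v′∈ ,
    trans (cong₂ _⊕_ x≡ y≡) (trans (sym (emb-⊞ _ _)) (cong emb (rearrange a ⟦ m ⟧ u v u′ v′)))
    where
    rearrange : ∀ a m u v u′ v′ → (a ∙ u ⊞ m ∙ v) ⊞ (a ∙ u′ ⊞ m ∙ v′) ≡ a ∙ (u ⊞ u′) ⊞ m ∙ (v ⊞ v′)
    rearrange = solve𝒵 6 (λ a m u v u′ v′ →
      ((a :* u :+ m :* v) :+ (a :* u′ :+ m :* v′)) := (a :* (u :+ u′) :+ m :* (v :+ v′))) refl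

  I-⊗-closed : ∀ {a m ρ x} → InOrder g ρ → x ∈ I a m → emb ρ ⊗ x ∈ I a m
  I-⊗-closed {a} {m} {ρ} ρ∈ (u , v , u∈ , v∈ , x≡) = ρ ∙ u , ρ ∙ v , ∙-inOrder ρ∈ u∈ , ∙-inOrder ρ∈ v∈ ,
    trans (cong (emb ρ ⊗_) x≡) (trans (sym (emb-∙ _ _)) (cong emb (rearrange ρ a ⟦ m ⟧ u v)))
    where
    rearrange : ∀ ρ a m u v → ρ ∙ (a ∙ u ⊞ m ∙ v) ≡ a ∙ (ρ ∙ u) ⊞ m ∙ (ρ ∙ v)
    rearrange = solve𝒵 5 (λ ρ a m u v → (ρ :* (a :* u :+ m :* v)) := (a :* (ρ :* u) :+ m :* (ρ :* v))) refl

  0∈I : ∀ {a m} → 0𝕂 ∈ I a m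
  0∈I {a} {m} = ⟦ 0ℤ ⟧ , ⟦ 0ℤ ⟧ , ⟦0⟧∈ , ⟦0⟧∈ ,
    trans (sym emb-0) (cong emb (sym (trans (cong₂ _⊞_ (∙-zeroʳ a) (∙-zeroʳ ⟦ m ⟧)) (⊞-identityʳ ⟦ 0ℤ ⟧))))

  I⊆𝒪 : ∀ {a m} → InOrder g a → ∀ {z} → z ∈ I a m → ∃[ w ] InOrder g w × z ≡ emb w
  I⊆𝒪 {a} {m} a∈ (u , v , u∈ , v∈ , z≡) = a ∙ u ⊞ ⟦ m ⟧ ∙ v , combination-inOrder m a∈ u∈ v∈ , z≡

  module _ {a m} (P : Primitive g a m) where
    open Primitive P

    private
      R : Pred (𝕂 d) 0ℓ
      R = 𝒪 d g

      a∙ā : a ∙ conj a ≡ ⟦ m ⟧ ∙ ⟦ cofactor ⟧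
      a∙ā = trans (∙-conj a) (trans (cong ⟦_⟧ norm≡) (sym (⟦⟧-* m cofactor)))

      cancel-m : ∀ {x y} → fromℤ m ⊗ x ≡ fromℤ m ⊗ y → x ≡ y
      cancel-m = ⊗-cancelˡ (fromℤ m) (fromℤ-invertible nonzero)

    I-isFractional : IsFractionalIdeal R (I a m)
    I-isFractional = record
      { 0∈ = 0∈I
      ; ⊕-closed = I-⊕-closed
      ; ⊗-closed = λ {r} {x} r∈ x∈ →
        let ρ , ρ∈ , r≡ = 𝒪⇒emb r∈ in subst (λ r → r ⊗ x ∈ I a m) (sym r≡) (I-⊗-closed ρ∈ x∈)
      ; denominator = 1𝕂 , subst R emb-1 (emb⇒𝒪 ⟦1⟧∈) , 1≢0 , λ {x} x∈ →
          let w , w∈ , x≡ = I⊆𝒪 ∈order x∈ in subst R (sym (trans (⊗-identityˡ x) x≡)) (emb⇒𝒪 w∈)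
      }

    I⁻¹-isFractional : IsFractionalIdeal R (I⁻¹ a m)
    I⁻¹-isFractional = record
      { 0∈ = subst (_∈ I (conj a) m) (sym (⊗-zeroʳ (fromℤ m))) 0∈I
      ; ⊕-closed = λ {x} {y} x∈ y∈ →
        subst (_∈ I (conj a) m) (sym (⊗-distribˡ-⊕ (fromℤ m) x y)) (I-⊕-closed x∈ y∈)
      ; ⊗-closed = λ {r} {x} r∈ x∈ → let ρ , ρ∈ , r≡ = 𝒪⇒emb r∈ in
          subst (_∈ I (conj a) m) (trans (⊗-swap (emb ρ) (fromℤ m) x)
            (cong (λ r → fromℤ m ⊗ (r ⊗ x)) (sym r≡))) (I-⊗-closed ρ∈ x∈)
      ; denominator = fromℤ m , subst R (emb-⟦⟧ m) (emb⇒𝒪 {g} (⟦⟧-inOrder m)) ,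
        (λ m≡0 → nonzero (/1-injective (cong 𝕂.rat m≡0))) , λ {x} x∈ →
          let w , w∈ , x≡ = I⊆𝒪 (conj-inOrder ∈order) x∈ in subst R (sym x≡) (emb⇒𝒪 w∈)
      }

    -- After multiplication by m the product expands into terms that contain m or a conj a = m
    -- cofactor, so m can be cancelled.
    product-∈ : ∀ {x y} → x ∈ I a m → y ∈ I⁻¹ a m → ∃[ w ] InOrder g w × x ⊗ y ≡ emb w
    product-∈ {x} {y} (u , v , u∈ , v∈ , x≡) (u′ , v′ , u′∈ , v′∈ , my≡) =
      ⟦ cofactor ⟧ ∙ u ∙ u′ ⊞ a ∙ u ∙ v′ ⊞ conj a ∙ u′ ∙ v ⊞ ⟦ m ⟧ ∙ v ∙ v′ ,
      ⊞-inOrder (⊞-inOrder (⊞-inOrder (∙-inOrder (∙-inOrder (⟦⟧-inOrder cofactor) u∈) u′∈)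
        (∙-inOrder (∙-inOrder ∈order u∈) v′∈))
        (∙-inOrder (∙-inOrder (conj-inOrder ∈order) u′∈) v∈)) (∙-inOrder (∙-inOrder (⟦⟧-inOrder m) v∈) v′∈) ,
      cancel-m (begin
        fromℤ m ⊗ (x ⊗ y)                                          ≡⟨ ⊗-swap (fromℤ m) x y ⟩
        x ⊗ (fromℤ m ⊗ y)                                          ≡⟨ cong₂ _⊗_ x≡ my≡ ⟩
        emb (a ∙ u ⊞ ⟦ m ⟧ ∙ v) ⊗ emb (conj a ∙ u′ ⊞ ⟦ m ⟧ ∙ v′)   ≡⟨ emb-∙ _ _ ⟨
        emb ((a ∙ u ⊞ ⟦ m ⟧ ∙ v) ∙ (conj a ∙ u′ ⊞ ⟦ m ⟧ ∙ v′))
          ≡⟨ cong emb (trans (expand a (conj a) ⟦ m ⟧ u v u′ v′)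
          (trans (cong (λ z → z ∙ u ∙ u′ ⊞ (⟦ m ⟧ ∙ (a ∙ u ∙ v′ ⊞ conj a ∙ u′ ∙ v ⊞ ⟦ m ⟧ ∙ v ∙ v′))) a∙ā)
          (gather ⟦ m ⟧ ⟦ cofactor ⟧ a (conj a) u v u′ v′))) ⟩
        emb (⟦ m ⟧ ∙ (⟦ cofactor ⟧ ∙ u ∙ u′ ⊞ a ∙ u ∙ v′ ⊞ conj a ∙ u′ ∙ v ⊞ ⟦ m ⟧ ∙ v ∙ v′))
          ≡⟨ emb-scale m _ ⟩
        fromℤ m ⊗ emb (⟦ cofactor ⟧ ∙ u ∙ u′ ⊞ a ∙ u ∙ v′ ⊞ conj a ∙ u′ ∙ v ⊞ ⟦ m ⟧ ∙ v ∙ v′) ∎)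
      where
      open ≡-Reasoning
      expand : ∀ a ā m u v u′ v′ → (a ∙ u ⊞ m ∙ v) ∙ (ā ∙ u′ ⊞ m ∙ v′) ≡ a ∙ ā ∙ u ∙ u′ ⊞
        m ∙ (a ∙ u ∙ v′ ⊞ ā ∙ u′ ∙ v ⊞ m ∙ v ∙ v′)
      expand = solve𝒵 7 (λ a ā m u v u′ v′ →
        ((a :* u :+ m :* v) :* (ā :* u′ :+ m :* v′)) :=
        (a :* ā :* u :* u′ :+ m :* (a :* u :* v′ :+ ā :* u′ :* v :+ m :* v :* v′))) refl
      gather : ∀ m c a ā u v u′ v′ → m ∙ c ∙ u ∙ u′ ⊞
        m ∙ (a ∙ u ∙ v′ ⊞ ā ∙ u′ ∙ v ⊞ m ∙ v ∙ v′) ≡ m ∙ (c ∙ u ∙ u′ ⊞ a ∙ u ∙ v′ ⊞ ā ∙ u′ ∙ v ⊞ m ∙ v ∙ v′)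
      gather = solve𝒵 8 (λ m c a ā u v u′ v′ →
        (m :* c :* u :* u′ :+ m :* (a :* u :* v′ :+ ā :* u′ :* v :+ m :* v :* v′)) :=
        (m :* (c :* u :* u′ :+ a :* u :* v′ :+ ā :* u′ :* v :+ m :* v :* v′))) refl

    I·I⁻¹⊆ : ∀ {z} → z ∈ I a m · I⁻¹ a m → ∃[ w ] InOrder g w × z ≡ emb w
    I·I⁻¹⊆ zero = ⟦ 0ℤ ⟧ , ⟦0⟧∈ , sym emb-0
    I·I⁻¹⊆ (add x∈ y∈ z∈) =
      let w , w∈ , xy≡w = product-∈ x∈ y∈
          w′ , w′∈ , z≡w′ = I·I⁻¹⊆ z∈
      in w ⊞ w′ , ⊞-inOrder w∈ w′∈ , trans (cong₂ _⊕_ xy≡w z≡w′) (sym (emb-⊞ w w′))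

    -- The Bézout relation times ρ is (r m + s a) ρ · 1 + (k a + s m) ρ · (conj a / m), a sum of two
    -- products of an element of the ideal and an element of the inverse.
    ⊆I·I⁻¹ : ∀ {ρ} → InOrder g ρ → emb ρ ∈ I a m · I⁻¹ a m
    ⊆I·I⁻¹ {ρ} ρ∈ = subst (_∈ I a m · I⁻¹ a m) (sym ρ≡)
      (add {x = emb x₁} {y = 1𝕂} (⟦ s ⟧ ∙ ρ , ⟦ r ⟧ ∙ ρ , s∙ρ∈ , ∙-inOrder (⟦⟧-inOrder r) ρ∈ , refl)
        (subst (_∈ I (conj a) m) (trans (emb-⟦⟧ m) (sym (⊗-identityʳ (fromℤ m)))) (second-∈ (conj a) m))
      (add {x = emb x₂} {y = j} (⟦ k ⟧ ∙ ρ , ⟦ s ⟧ ∙ ρ , ∙-inOrder (⟦⟧-inOrder k) ρ∈ , s∙ρ∈ , refl)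
        (subst (_∈ I (conj a) m) (sym mj≡ā) (first-∈ (conj a) m)) zero))
      where
      open ≡-Reasoning
      s∙ρ∈ : InOrder g (⟦ s ⟧ ∙ ρ)
      s∙ρ∈ = ∙-inOrder (⟦⟧-inOrder s) ρ∈
      x₁ x₂ : 𝒵
      x₁ = a ∙ (⟦ s ⟧ ∙ ρ) ⊞ ⟦ m ⟧ ∙ (⟦ r ⟧ ∙ ρ)
      x₂ = a ∙ (⟦ k ⟧ ∙ ρ) ⊞ ⟦ m ⟧ ∙ (⟦ s ⟧ ∙ ρ)
      m⁻¹ j : 𝕂 d
      m⁻¹ = proj₁ (fromℤ-invertible nonzero)
      j = m⁻¹ ⊗ emb (conj a)
      mj≡ā : fromℤ m ⊗ j ≡ emb (conj a)
      mj≡ā = trans (sym (⊗-assoc (fromℤ m) m⁻¹ (emb (conj a))))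
        (trans (cong (_⊗ emb (conj a)) (proj₂ (fromℤ-invertible nonzero))) (⊗-identityˡ (emb (conj a))))
      regroup : ∀ (m x₁ x₂ j : 𝕂 d) → m ⊗ (x₁ ⊗ 1𝕂 ⊕ (x₂ ⊗ j ⊕ 0𝕂)) ≡ m ⊗ x₁ ⊕ x₂ ⊗ (m ⊗ j)
      regroup m x₁ x₂ j = trans (cong₂ (λ y z → m ⊗ (y ⊕ z)) (⊗-identityʳ x₁) (⊕-identityʳ (x₂ ⊗ j)))
        (identity m x₁ x₂ j)
        where
        identity : ∀ (m x₁ x₂ j : 𝕂 d) → m ⊗ (x₁ ⊕ x₂ ⊗ j) ≡ m ⊗ x₁ ⊕ x₂ ⊗ (m ⊗ j)
        identity = solve𝕂 4 (λ m x₁ x₂ j → (m ×′ (x₁ ⊹ x₂ ×′ j)) ≔ (m ×′ x₁ ⊹ x₂ ×′ (m ×′ j))) refl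
      expand : ∀ m r s k a ā ρ → m ∙ (a ∙ (s ∙ ρ) ⊞ m ∙ (r ∙ ρ)) ⊞
        (a ∙ (k ∙ ρ) ⊞ m ∙ (s ∙ ρ)) ∙ ā ≡ m ∙ ((r ∙ m ⊞ s ∙ (a ⊞ ā)) ∙ ρ) ⊞ a ∙ ā ∙ (k ∙ ρ)
      expand = solve𝒵 7 (λ m r s k a ā ρ →
        (m :* (a :* (s :* ρ) :+ m :* (r :* ρ)) :+ (a :* (k :* ρ) :+ m :* (s :* ρ)) :* ā) :=
        (m :* ((r :* m :+ s :* (a :+ ā)) :* ρ) :+ a :* ā :* (k :* ρ))) refl
      gather : ∀ m x c k ρ → m ∙ (x ∙ ρ) ⊞ m ∙ c ∙ (k ∙ ρ) ≡ m ∙ ((x ⊞ k ∙ c) ∙ ρ)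
      gather = solve𝒵 5 (λ m x c k ρ → (m :* (x :* ρ) :+ m :* c :* (k :* ρ)) := (m :* ((x :+ k :* c) :* ρ)))
        refl
      ρ≡ : emb ρ ≡ emb x₁ ⊗ 1𝕂 ⊕ (emb x₂ ⊗ j ⊕ 0𝕂)
      ρ≡ = cancel-m (sym (begin
        fromℤ m ⊗ (emb x₁ ⊗ 1𝕂 ⊕ (emb x₂ ⊗ j ⊕ 0𝕂))    ≡⟨ regroup (fromℤ m) (emb x₁) (emb x₂) j ⟩
        fromℤ m ⊗ emb x₁ ⊕ emb x₂ ⊗ (fromℤ m ⊗ j)
          ≡⟨ cong₂ _⊕_ (sym (emb-scale m x₁)) (trans (cong (emb x₂ ⊗_) mj≡ā) (sym (emb-∙ x₂ (conj a)))) ⟩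
        emb (⟦ m ⟧ ∙ x₁) ⊕ emb (x₂ ∙ conj a)           ≡⟨ emb-⊞ _ _ ⟨
        emb (⟦ m ⟧ ∙ x₁ ⊞ x₂ ∙ conj a)
          ≡⟨ cong emb (expand ⟦ m ⟧ ⟦ r ⟧ ⟦ s ⟧ ⟦ k ⟧ a (conj a) ρ) ⟩
        emb (⟦ m ⟧ ∙ ((⟦ r ⟧ ∙ ⟦ m ⟧ ⊞ ⟦ s ⟧ ∙ (a ⊞ conj a)) ∙ ρ) ⊞ a ∙ conj a ∙ (⟦ k ⟧ ∙ ρ))
          ≡⟨ cong (λ z → emb (⟦ m ⟧ ∙ ((⟦ r ⟧ ∙ ⟦ m ⟧ ⊞ ⟦ s ⟧ ∙ (a ⊞ conj a)) ∙ ρ) ⊞ z ∙ (⟦ k ⟧ ∙ ρ))) a∙ā ⟩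
        emb (⟦ m ⟧ ∙ ((⟦ r ⟧ ∙ ⟦ m ⟧ ⊞ ⟦ s ⟧ ∙ (a ⊞ conj a)) ∙ ρ) ⊞ ⟦ m ⟧ ∙ ⟦ cofactor ⟧ ∙ (⟦ k ⟧ ∙ ρ))
          ≡⟨ cong emb (gather ⟦ m ⟧ (⟦ r ⟧ ∙ ⟦ m ⟧ ⊞ ⟦ s ⟧ ∙ (a ⊞ conj a)) ⟦ cofactor ⟧ ⟦ k ⟧ ρ) ⟩
        emb (⟦ m ⟧ ∙ ((⟦ r ⟧ ∙ ⟦ m ⟧ ⊞ ⟦ s ⟧ ∙ (a ⊞ conj a) ⊞ ⟦ k ⟧ ∙ ⟦ cofactor ⟧) ∙ ρ))
          ≡⟨ cong (λ z → emb (⟦ m ⟧ ∙ (z ∙ ρ))) (bezout-⟦⟧ P) ⟨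
        emb (⟦ m ⟧ ∙ (⟦ 1ℤ ⟧ ∙ ρ))                     ≡⟨ cong (λ z → emb (⟦ m ⟧ ∙ z)) (∙-identityˡ ρ) ⟩
        emb (⟦ m ⟧ ∙ ρ)                                ≡⟨ emb-scale m ρ ⟩
        fromℤ m ⊗ emb ρ                                ∎))

    invertibleIdeal : InvertibleFractionalIdeal R
    invertibleIdeal = record
      { ideal = I a m
      ; isFractionalIdeal = I-isFractional
      ; inverse = I⁻¹ a m , I⁻¹-isFractional
                , (λ z∈ → let w , w∈ , z≡w = I·I⁻¹⊆ z∈ in subst R (sym z≡w) (emb⇒𝒪 w∈))
                , (λ z∈ → let ρ , ρ∈ , z≡ρ = 𝒪⇒emb z∈ in subst (_∈ I a m · I⁻¹ a m) (sym z≡ρ) (⊆I·I⁻¹ ρ∈))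
      }

    -- If a w₁ = m w₂ with w₁ , w₂ in the ideal, then w₁ / m lies in the
    -- order, since it is w₁ times a combination of 1 and (conj a) / m.
    colon : ∀ {w₁ w₂ p₁ q₁ p₂ q₂} → w₁ ≡ a ∙ p₁ ⊞ ⟦ m ⟧ ∙ q₁ → w₂ ≡ a ∙ p₂ ⊞ ⟦ m ⟧ ∙ q₂ →
      ⟦ m ⟧ ∙ w₂ ≡ a ∙ w₁ →
      w₁ ≡ ⟦ m ⟧ ∙ (⟦ r ⟧ ∙ w₁ ⊞ ⟦ s ⟧ ∙ w₂ ⊞ ⟦ s ⟧ ∙ (⟦ cofactor ⟧ ∙ p₁ ⊞ conj a ∙ q₁) ⊞
        ⟦ k ⟧ ∙ (⟦ cofactor ⟧ ∙ p₂ ⊞ conj a ∙ q₂))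
    colon {w₁} {w₂} {p₁} {q₁} {p₂} {q₂} w₁≡ w₂≡ mw₂≡aw₁ = sym (begin
      ⟦ m ⟧ ∙ (⟦ r ⟧ ∙ w₁ ⊞ ⟦ s ⟧ ∙ w₂ ⊞ ⟦ s ⟧ ∙ f₁ ⊞ ⟦ k ⟧ ∙ f₂)
        ≡⟨ distribute ⟦ m ⟧ ⟦ r ⟧ ⟦ s ⟧ ⟦ k ⟧ w₁ w₂ f₁ f₂ ⟩
      ⟦ r ⟧ ∙ ⟦ m ⟧ ∙ w₁ ⊞ ⟦ s ⟧ ∙ (⟦ m ⟧ ∙ w₂) ⊞ ⟦ s ⟧ ∙ (⟦ m ⟧ ∙ f₁) ⊞ ⟦ k ⟧ ∙ (⟦ m ⟧ ∙ f₂)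
        ≡⟨ cong₂ (λ x y → ⟦ r ⟧ ∙ ⟦ m ⟧ ∙ w₁ ⊞ ⟦ s ⟧ ∙ x ⊞ ⟦ s ⟧ ∙ y ⊞ ⟦ k ⟧ ∙ (⟦ m ⟧ ∙ f₂)) mw₂≡aw₁
          (conj-multiple p₁ q₁ w₁≡) ⟩
      ⟦ r ⟧ ∙ ⟦ m ⟧ ∙ w₁ ⊞ ⟦ s ⟧ ∙ (a ∙ w₁) ⊞ ⟦ s ⟧ ∙ (conj a ∙ w₁) ⊞ ⟦ k ⟧ ∙ (⟦ m ⟧ ∙ f₂)
        ≡⟨ cong (λ x → ⟦ r ⟧ ∙ ⟦ m ⟧ ∙ w₁ ⊞ ⟦ s ⟧ ∙ (a ∙ w₁) ⊞ ⟦ s ⟧ ∙ (conj a ∙ w₁) ⊞ ⟦ k ⟧ ∙ x)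
          (trans (conj-multiple p₂ q₂ w₂≡) āw₂≡) ⟩
      ⟦ r ⟧ ∙ ⟦ m ⟧ ∙ w₁ ⊞ ⟦ s ⟧ ∙ (a ∙ w₁) ⊞ ⟦ s ⟧ ∙ (conj a ∙ w₁) ⊞ ⟦ k ⟧ ∙ (⟦ cofactor ⟧ ∙ w₁)
        ≡⟨ factor ⟦ r ⟧ ⟦ m ⟧ ⟦ s ⟧ a (conj a) ⟦ k ⟧ ⟦ cofactor ⟧ w₁ ⟩
      (⟦ r ⟧ ∙ ⟦ m ⟧ ⊞ ⟦ s ⟧ ∙ (a ⊞ conj a) ⊞ ⟦ k ⟧ ∙ ⟦ cofactor ⟧) ∙ w₁
        ≡⟨ cong (_∙ w₁) (bezout-⟦⟧ P) ⟨
      ⟦ 1ℤ ⟧ ∙ w₁ ≡⟨ ∙-identityˡ w₁ ⟩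
      w₁ ∎)
      where
      open ≡-Reasoning
      f₁ f₂ : 𝒵
      f₁ = ⟦ cofactor ⟧ ∙ p₁ ⊞ conj a ∙ q₁
      f₂ = ⟦ cofactor ⟧ ∙ p₂ ⊞ conj a ∙ q₂
      distribute : ∀ m r s k w₁ w₂ f₁ f₂ → m ∙ (r ∙ w₁ ⊞ s ∙ w₂ ⊞ s ∙ f₁ ⊞ k ∙ f₂) ≡ r ∙ m ∙ w₁ ⊞
        s ∙ (m ∙ w₂) ⊞ s ∙ (m ∙ f₁) ⊞ k ∙ (m ∙ f₂)
      distribute = solve𝒵 8 (λ m r s k w₁ w₂ f₁ f₂ →
        (m :* (r :* w₁ :+ s :* w₂ :+ s :* f₁ :+ k :* f₂)) :=
        (r :* m :* w₁ :+ s :* (m :* w₂) :+ s :* (m :* f₁) :+ k :* (m :* f₂))) refl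
      factor : ∀ r m s a ā k c w → r ∙ m ∙ w ⊞ s ∙ (a ∙ w) ⊞ s ∙ (ā ∙ w) ⊞
        k ∙ (c ∙ w) ≡ (r ∙ m ⊞ s ∙ (a ⊞ ā) ⊞ k ∙ c) ∙ w
      factor = solve𝒵 8 (λ r m s a ā k c w →
        (r :* m :* w :+ s :* (a :* w) :+ s :* (ā :* w) :+ k :* (c :* w)) :=
        ((r :* m :+ s :* (a :+ ā) :+ k :* c) :* w)) refl
      conj-multiple : ∀ p q {w} → w ≡ a ∙ p ⊞ ⟦ m ⟧ ∙ q → ⟦ m ⟧ ∙ (⟦ cofactor ⟧ ∙ p ⊞ conj a ∙ q) ≡ conj a ∙ w
      conj-multiple p q {w} w≡ = begin
        ⟦ m ⟧ ∙ (⟦ cofactor ⟧ ∙ p ⊞ conj a ∙ q)          ≡⟨ split ⟦ m ⟧ ⟦ cofactor ⟧ (conj a) p q ⟩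
        ⟦ m ⟧ ∙ ⟦ cofactor ⟧ ∙ p ⊞ conj a ∙ (⟦ m ⟧ ∙ q)  ≡⟨ cong (λ z → z ∙ p ⊞ conj a ∙ (⟦ m ⟧ ∙ q)) a∙ā ⟨
        a ∙ conj a ∙ p ⊞ conj a ∙ (⟦ m ⟧ ∙ q)            ≡⟨ merge a (conj a) ⟦ m ⟧ p q ⟩
        conj a ∙ (a ∙ p ⊞ ⟦ m ⟧ ∙ q)                     ≡⟨ cong (conj a ∙_) w≡ ⟨
        conj a ∙ w                                       ∎
        where
        split : ∀ m c ā p q → m ∙ (c ∙ p ⊞ ā ∙ q) ≡ m ∙ c ∙ p ⊞ ā ∙ (m ∙ q)
        split = solve𝒵 5 (λ m c ā p q → (m :* (c :* p :+ ā :* q)) := (m :* c :* p :+ ā :* (m :* q))) refl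
        merge : ∀ a ā m p q → a ∙ ā ∙ p ⊞ ā ∙ (m ∙ q) ≡ ā ∙ (a ∙ p ⊞ m ∙ q)
        merge = solve𝒵 5 (λ a ā m p q → (a :* ā :* p :+ ā :* (m :* q)) := (ā :* (a :* p :+ m :* q))) refl
      āw₂≡ : conj a ∙ w₂ ≡ ⟦ cofactor ⟧ ∙ w₁
      āw₂≡ = ⟦⟧-cancel m nonzero _ _ (begin
        ⟦ m ⟧ ∙ (conj a ∙ w₂)         ≡⟨ ∙-swap ⟦ m ⟧ (conj a) w₂ ⟩
        conj a ∙ (⟦ m ⟧ ∙ w₂)         ≡⟨ cong (conj a ∙_) mw₂≡aw₁ ⟩
        conj a ∙ (a ∙ w₁)             ≡⟨ rotate′ (conj a) a w₁ ⟩
        a ∙ conj a ∙ w₁               ≡⟨ cong (_∙ w₁) a∙ā ⟩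
        ⟦ m ⟧ ∙ ⟦ cofactor ⟧ ∙ w₁     ≡⟨ ∙-assoc ⟦ m ⟧ ⟦ cofactor ⟧ w₁ ⟩
        ⟦ m ⟧ ∙ (⟦ cofactor ⟧ ∙ w₁)   ∎)
        where
        rotate′ : ∀ u v w → u ∙ (v ∙ w) ≡ v ∙ u ∙ w
        rotate′ = solve𝒵 3 (λ u v w → (u :* (v :* w)) := (v :* u :* w)) refl

-- Principal ideals and the two classes of an order

module ClassGroup (d : ℕ) (2≤d : 2 ≤ d) (d-squarefree : Squarefree d) (g : ℕ) where

  open Field d
  open Ideals d 2≤d d-squarefree g public

  infix 4 _∼_
  _∼_ : Pred (𝕂 d) 0ℓ → Pred (𝕂 d) 0ℓ → Set
  A ∼ B = ∃[ x ] Invertible x × A ≐ (x • B)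

  1-primitive : Primitive g ⟦ 1ℤ ⟧ 1ℤ
  1-primitive = record
    { ∈order = ⟦1⟧∈ ; nonzero = λ () ; cofactor = 1ℤ ; norm≡ = norm-⟦⟧ 1ℤ
    ; r = 1ℤ ; s = 0ℤ ; k = 0ℤ ; bezout = cong (λ z → 1ℤ + z + 0ℤ) (ℤₚ.*-zeroˡ (trace ⟦ 1ℤ ⟧)) }

  𝟙 : Pred (𝕂 d) 0ℓ
  𝟙 = I ⟦ 1ℤ ⟧ 1ℤ

  emb∈𝟙 : ∀ {w} → InOrder g w → emb w ∈ 𝟙
  emb∈𝟙 {w} w∈ = w , ⟦ 0ℤ ⟧ , w∈ , ⟦0⟧∈ ,
    cong emb (sym (trans (cong₂ _⊞_ (∙-identityˡ w) (∙-zeroʳ ⟦ 1ℤ ⟧)) (⊞-identityʳ w)))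

  1∈𝟙 : 1𝕂 ∈ 𝟙
  1∈𝟙 = subst (_∈ 𝟙) emb-1 (emb∈𝟙 ⟦1⟧∈)

  module _ {a m} (P : Primitive g a m) where

    -- The factor z lies in z 𝟙, hence in (a , m); it is therefore an element γ of the order, and a
    -- and m are multiples of it.
    principal⇒splits : I a m ∼ 𝟙 → Splits g a m
    principal⇒splits (z , _ , I⊆z𝟙 , z𝟙⊆I) =
      go (z𝟙⊆I (1𝕂 , 1∈𝟙 , refl)) (I⊆z𝟙 (first-∈ a m)) (I⊆z𝟙 (second-∈ a m))
      where
      go : z ⊗ 1𝕂 ∈ I a m → emb a ∈ (z • 𝟙) → emb ⟦ m ⟧ ∈ (z • 𝟙) → Splits g a m
      go (u , v , u∈ , v∈ , z1≡) (w , w∈ , a≡zw) (w′ , w′∈ , m≡zw′) =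
        let δ , δ∈ , w≡δ = I⊆𝒪 ⟦1⟧∈ w∈
            μ , _ , w′≡μ = I⊆𝒪 ⟦1⟧∈ w′∈
        in γ , δ , combination-inOrder m (Primitive.∈order P) u∈ v∈ , δ∈ , factor a≡zw w≡δ ,
          generator-norm P {u = u} {v} refl (factor a≡zw w≡δ) (factor m≡zw′ w′≡μ)
        where
        γ : 𝒵
        γ = a ∙ u ⊞ ⟦ m ⟧ ∙ v
        factor : ∀ {b w δ} → emb b ≡ z ⊗ w → w ≡ emb δ → b ≡ γ ∙ δ
        factor {b} {w} {δ} b≡zw w≡δ = emb-injective 2≤d d-squarefree
          (trans b≡zw (trans (cong₂ _⊗_ (trans (sym (⊗-identityʳ z)) z1≡) w≡δ) (sym (emb-∙ γ δ))))

    splits⇒principal : Splits g a m → I a m ∼ 𝟙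
    splits⇒principal S@(γ , δ , γ∈ , δ∈ , a≡γδ , ∣Nγ∣≡∣m∣) =
      let u , v , μ , u∈ , v∈ , μ∈ , γ≡ , m≡γμ = splits⇒generator P S in
      emb γ , emb-invertible (λ Nγ≡0 →
        Primitive.nonzero P (ℤₚ.∣i∣≡0⇒i≡0 (trans (sym ∣Nγ∣≡∣m∣) (cong ∣_∣ Nγ≡0)))) ,
      (λ { (p , q , p∈ , q∈ , z≡) → emb (δ ∙ p ⊞ μ ∙ q) ,
        emb∈𝟙 (⊞-inOrder (∙-inOrder δ∈ p∈) (∙-inOrder μ∈ q∈)) ,
        trans z≡ (trans (cong emb (trans (cong₂ (λ a m → a ∙ p ⊞ m ∙ q) a≡γδ m≡γμ) (factor γ δ μ p q)))
          (emb-∙ γ _)) }) ,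
      λ { (w , w∈ , z≡) → let ρ , ρ∈ , w≡ρ = I⊆𝒪 ⟦1⟧∈ w∈ in
        subst (_∈ I a m) (sym (trans z≡ (trans (⊗-comm (emb γ) w) (cong (_⊗ emb γ) w≡ρ))))
          (I-⊗-closed ρ∈ (u , v , u∈ , v∈ , cong emb γ≡)) }
      where
      factor : ∀ γ δ μ p q → γ ∙ δ ∙ p ⊞ γ ∙ μ ∙ q ≡ γ ∙ (δ ∙ p ⊞ μ ∙ q)
      factor = solve𝒵 5 (λ γ δ μ p q → (γ :* δ :* p :+ γ :* μ :* q) := (γ :* (δ :* p :+ μ :* q))) refl

  -- I a m₁ ∼ I a (m₁ m₂) amounts to I a m₂ being principal, as I a (m₁ m₂) = I a m₁ · I a m₂.
  same-class⇒splits : ∀ {a m₁ m₂} → Primitive g a m₁ → Primitive g a m₂ → Primitive g a (m₁ * m₂) →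
    I a m₁ ∼ I a (m₁ * m₂) → Splits g a m₂
  same-class⇒splits {a} {m₁} {m₂} P₁ P₂ P₁₂ (z , z-inv , I₁⊆zI₁₂ , zI₁₂⊆I₁) = go
    (I₁⊆zI₁₂ (second-∈ a m₁)) (I₁⊆zI₁₂ (first-∈ a m₁))
    (zI₁₂⊆I₁ (emb a , first-∈ a (m₁ * m₂) , refl))
    (zI₁₂⊆I₁ (emb ⟦ m₁ * m₂ ⟧ , second-∈ a (m₁ * m₂) , refl))
    (zI₁₂⊆I₁ (emb ⟦ m₂ ⟧ ⊗ emb a , I-⊗-closed (⟦⟧-inOrder m₂) (first-∈ a (m₁ * m₂)) , refl))
    where
    go : emb ⟦ m₁ ⟧ ∈ (z • I a (m₁ * m₂)) → emb a ∈ (z • I a (m₁ * m₂)) → z ⊗ emb a ∈ I a m₁ →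
      z ⊗ emb ⟦ m₁ * m₂ ⟧ ∈ I a m₁ → z ⊗ (emb ⟦ m₂ ⟧ ⊗ emb a) ∈ I a m₁ → Splits g a m₂
    go (_ , (u₁ , v₁ , u₁∈ , v₁∈ , refl) , m₁≡) (_ , (u₂ , v₂ , u₂∈ , v₂∈ , refl) , a≡)
      za∈ (p₁ , q₁ , p₁∈ , q₁∈ , zm₁m₂≡) (p₂ , q₂ , p₂∈ , q₂∈ , zm₂a≡) =
      let δ , δ∈ , za≡δ = I⊆𝒪 (Primitive.∈order P₁) za∈
          a≡γδ = emb-injective 2≤d d-squarefree
            (sym (trans (emb-∙ γ δ) (trans (cong (emb γ ⊗_) (sym za≡δ)) (γz-cancel (emb a)))))
      in γ , δ , subst (InOrder g) (sym γ≡) (combination-inOrder m₂ (Primitive.∈order P₁) U∈ V∈) , δ∈ , a≡γδ ,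
        generator-norm P₂ γ≡ a≡γδ m₂≡γμ
      where
      open ≡-Reasoning
      open Primitive P₁ using (r; s; k) renaming (cofactor to C₁)
      C₁₂ : ℤ
      C₁₂ = Primitive.cofactor P₁₂
      w₁ w₂ e₁ e₂ γ U V : 𝒵
      w₁ = a ∙ u₁ ⊞ ⟦ m₁ * m₂ ⟧ ∙ v₁
      w₂ = a ∙ u₂ ⊞ ⟦ m₁ * m₂ ⟧ ∙ v₂
      e₁ = a ∙ p₁ ⊞ ⟦ m₁ ⟧ ∙ q₁
      e₂ = a ∙ p₂ ⊞ ⟦ m₁ ⟧ ∙ q₂
      -- This is z⁻¹: m₁ = z w₁ and a = z w₂ give m₁ w₂ = a w₁, and then `colon` shows that w₁ / m₁
      -- lies in the order and has this expression.
      γ = ⟦ r ⟧ ∙ w₁ ⊞ ⟦ s ⟧ ∙ w₂ ⊞ ⟦ s ⟧ ∙ (⟦ C₁ ⟧ ∙ u₁ ⊞ conj a ∙ (⟦ m₂ ⟧ ∙ v₁)) ⊞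
        ⟦ k ⟧ ∙ (⟦ C₁ ⟧ ∙ u₂ ⊞ conj a ∙ (⟦ m₂ ⟧ ∙ v₂))
      U = ⟦ r ⟧ ∙ u₁ ⊞ ⟦ s ⟧ ∙ u₂
      V = ⟦ r ⟧ ∙ (⟦ m₁ ⟧ ∙ v₁) ⊞ ⟦ s ⟧ ∙ (⟦ m₁ ⟧ ∙ v₂) ⊞ ⟦ s ⟧ ∙ (⟦ C₁₂ ⟧ ∙ u₁ ⊞ conj a ∙ v₁) ⊞
        ⟦ k ⟧ ∙ (⟦ C₁₂ ⟧ ∙ u₂ ⊞ conj a ∙ v₂)
      ā∈ : InOrder g (conj a)
      ā∈ = conj-inOrder (Primitive.∈order P₁)
      scalar : ∀ i {u} → InOrder g u → InOrder g (⟦ i ⟧ ∙ u)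
      scalar i = ∙-inOrder (⟦⟧-inOrder i)
      U∈ : InOrder g U
      U∈ = ⊞-inOrder (scalar r u₁∈) (scalar s u₂∈)
      V∈ : InOrder g V
      V∈ = ⊞-inOrder (⊞-inOrder (⊞-inOrder (scalar r (scalar m₁ v₁∈)) (scalar s (scalar m₁ v₂∈)))
        (scalar s (⊞-inOrder (scalar C₁₂ u₁∈) (∙-inOrder ā∈ v₁∈))))
          (scalar k (⊞-inOrder (scalar C₁₂ u₂∈) (∙-inOrder ā∈ v₂∈)))
      C₁≡ : ⟦ C₁ ⟧ ≡ ⟦ m₂ ⟧ ∙ ⟦ C₁₂ ⟧
      C₁≡ = sym (trans (⟦⟧-* m₂ C₁₂) (cong ⟦_⟧ (ℤₚ.*-cancelˡ-≡ m₁ _ _ (trans (sym (ℤₚ.*-assoc m₁ m₂ C₁₂))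
        (trans (sym (Primitive.norm≡ P₁₂)) (Primitive.norm≡ P₁))))))
        where instance _ = ℤ.≢-nonZero (Primitive.nonzero P₁)
      w≡ : ∀ u v → a ∙ u ⊞ ⟦ m₁ * m₂ ⟧ ∙ v ≡ a ∙ u ⊞ ⟦ m₁ ⟧ ∙ (⟦ m₂ ⟧ ∙ v)
      w≡ u v = cong (a ∙ u ⊞_) (trans (cong (_∙ v) (sym (⟦⟧-* m₁ m₂))) (∙-assoc ⟦ m₁ ⟧ ⟦ m₂ ⟧ v))
      m₁w₂≡aw₁ : ⟦ m₁ ⟧ ∙ w₂ ≡ a ∙ w₁
      m₁w₂≡aw₁ = emb-injective 2≤d d-squarefree (⊗-cancelˡ z z-inv (begin
        z ⊗ emb (⟦ m₁ ⟧ ∙ w₂)           ≡⟨ cong (z ⊗_) (emb-∙ ⟦ m₁ ⟧ w₂) ⟩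
        z ⊗ (emb ⟦ m₁ ⟧ ⊗ emb w₂)       ≡⟨ ⊗-swap z (emb ⟦ m₁ ⟧) (emb w₂) ⟩
        emb ⟦ m₁ ⟧ ⊗ (z ⊗ emb w₂)       ≡⟨ cong₂ _⊗_ m₁≡ (sym a≡) ⟩
        z ⊗ emb w₁ ⊗ emb a              ≡⟨ rotate z (emb w₁) (emb a) ⟩
        z ⊗ (emb a ⊗ emb w₁)            ≡⟨ cong (z ⊗_) (emb-∙ a w₁) ⟨
        z ⊗ emb (a ∙ w₁)                ∎))
        where
        rotate : ∀ (a b c : 𝕂 d) → a ⊗ b ⊗ c ≡ a ⊗ (c ⊗ b)
        rotate = solve𝕂 3 (λ a b c → (a ×′ b ×′ c) ≔ (a ×′ (c ×′ b))) refl
      w₁≡m₁γ : w₁ ≡ ⟦ m₁ ⟧ ∙ γ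
      w₁≡m₁γ = colon P₁ (w≡ u₁ v₁) (w≡ u₂ v₂) m₁w₂≡aw₁
      -- γ belongs to (a , m₂) because w₁ and w₂ are combinations of a and m₁ m₂, and the remaining
      -- terms are multiples of m₂ by C₁ = m₂ C₁₂.
      γ≡ : γ ≡ a ∙ U ⊞ ⟦ m₂ ⟧ ∙ V
      γ≡ = trans (cong₂ (λ m c → ⟦ r ⟧ ∙ (a ∙ u₁ ⊞ m ∙ v₁) ⊞ ⟦ s ⟧ ∙ (a ∙ u₂ ⊞ m ∙ v₂) ⊞
        ⟦ s ⟧ ∙ (c ∙ u₁ ⊞ conj a ∙ (⟦ m₂ ⟧ ∙ v₁)) ⊞ ⟦ k ⟧ ∙ (c ∙ u₂ ⊞ conj a ∙ (⟦ m₂ ⟧ ∙ v₂)))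
          (sym (⟦⟧-* m₁ m₂)) C₁≡)
        (trans (cong (_⊞ last) (arrange a (conj a) ⟦ r ⟧ ⟦ s ⟧ ⟦ m₁ ⟧ ⟦ m₂ ⟧ ⟦ C₁₂ ⟧ u₁ v₁ u₂ v₂))
          (attach (a ∙ U) ⟦ m₂ ⟧ V′ ⟦ k ⟧ ⟦ C₁₂ ⟧ u₂ (conj a) v₂))
        where
        last V′ : 𝒵
        last = ⟦ k ⟧ ∙ (⟦ m₂ ⟧ ∙ ⟦ C₁₂ ⟧ ∙ u₂ ⊞ conj a ∙ (⟦ m₂ ⟧ ∙ v₂))
        V′ = ⟦ r ⟧ ∙ (⟦ m₁ ⟧ ∙ v₁) ⊞ ⟦ s ⟧ ∙ (⟦ m₁ ⟧ ∙ v₂) ⊞ ⟦ s ⟧ ∙ (⟦ C₁₂ ⟧ ∙ u₁ ⊞ conj a ∙ v₁)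
        arrange : ∀ a ā r s m₁ m₂ c u₁ v₁ u₂ v₂ →
          r ∙ (a ∙ u₁ ⊞ m₁ ∙ m₂ ∙ v₁) ⊞ s ∙ (a ∙ u₂ ⊞ m₁ ∙ m₂ ∙ v₂) ⊞ s ∙ (m₂ ∙ c ∙ u₁ ⊞ ā ∙ (m₂ ∙ v₁))
          ≡ a ∙ (r ∙ u₁ ⊞ s ∙ u₂) ⊞ m₂ ∙ (r ∙ (m₁ ∙ v₁) ⊞ s ∙ (m₁ ∙ v₂) ⊞ s ∙ (c ∙ u₁ ⊞ ā ∙ v₁))
        arrange = solve𝒵 11 (λ a ā r s m₁ m₂ c u₁ v₁ u₂ v₂ →
          (r :* (a :* u₁ :+ m₁ :* m₂ :* v₁) :+ s :* (a :* u₂ :+ m₁ :* m₂ :* v₂) :+ s :*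
            (m₂ :* c :* u₁ :+ ā :* (m₂ :* v₁)))
          := (a :* (r :* u₁ :+ s :* u₂) :+ m₂ :*
            (r :* (m₁ :* v₁) :+ s :* (m₁ :* v₂) :+ s :* (c :* u₁ :+ ā :* v₁)))) refl
        attach : ∀ x m v k c u ā w → x ⊞ m ∙ v ⊞ k ∙ (m ∙ c ∙ u ⊞ ā ∙ (m ∙ w)) ≡ x ⊞
          m ∙ (v ⊞ k ∙ (c ∙ u ⊞ ā ∙ w))
        attach = solve𝒵 8 (λ x m v k c u ā w →
          (x :+ m :* v :+ k :* (m :* c :* u :+ ā :* (m :* w))) := (x :+ m :* (v :+ k :* (c :* u :+ ā :* w))))
          refl
      zγ≡1 : z ⊗ emb γ ≡ 1𝕂
      zγ≡1 = ⊗-cancelˡ (fromℤ m₁) (fromℤ-invertible (Primitive.nonzero P₁)) (begin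
        fromℤ m₁ ⊗ (z ⊗ emb γ)       ≡⟨ ⊗-swap (fromℤ m₁) z (emb γ) ⟩
        z ⊗ (fromℤ m₁ ⊗ emb γ)       ≡⟨ cong (z ⊗_) (trans (sym (emb-scale m₁ γ)) (cong emb (sym w₁≡m₁γ))) ⟩
        z ⊗ emb w₁                   ≡⟨ m₁≡ ⟨
        emb ⟦ m₁ ⟧                   ≡⟨ emb-⟦⟧ m₁ ⟩
        fromℤ m₁                     ≡⟨ ⊗-identityʳ (fromℤ m₁) ⟨
        fromℤ m₁ ⊗ 1𝕂                ∎)
      γz-cancel : ∀ x → emb γ ⊗ (z ⊗ x) ≡ x
      γz-cancel x = trans (sym (⊗-assoc (emb γ) z x))
        (trans (cong (_⊗ x) (trans (⊗-comm (emb γ) z) zγ≡1)) (⊗-identityˡ x))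
      m₁e₂≡ae₁ : ⟦ m₁ ⟧ ∙ e₂ ≡ a ∙ e₁
      m₁e₂≡ae₁ = emb-injective 2≤d d-squarefree (begin
        emb (⟦ m₁ ⟧ ∙ e₂)                            ≡⟨ emb-∙ ⟦ m₁ ⟧ e₂ ⟩
        emb ⟦ m₁ ⟧ ⊗ emb e₂                          ≡⟨ cong (emb ⟦ m₁ ⟧ ⊗_) zm₂a≡ ⟨
        emb ⟦ m₁ ⟧ ⊗ (z ⊗ (emb ⟦ m₂ ⟧ ⊗ emb a))      ≡⟨ shuffle (emb ⟦ m₁ ⟧) z (emb ⟦ m₂ ⟧) (emb a) ⟩
        emb a ⊗ (z ⊗ (emb ⟦ m₁ ⟧ ⊗ emb ⟦ m₂ ⟧))
          ≡⟨ cong (λ x → emb a ⊗ (z ⊗ x)) (trans (sym (emb-∙ _ _)) (cong emb (⟦⟧-* m₁ m₂))) ⟩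
        emb a ⊗ (z ⊗ emb ⟦ m₁ * m₂ ⟧)                ≡⟨ cong (emb a ⊗_) zm₁m₂≡ ⟩
        emb a ⊗ emb e₁                               ≡⟨ emb-∙ a e₁ ⟨
        emb (a ∙ e₁)                                 ∎)
        where
        shuffle : ∀ (m₁ z m₂ a : 𝕂 d) → m₁ ⊗ (z ⊗ (m₂ ⊗ a)) ≡ a ⊗ (z ⊗ (m₁ ⊗ m₂))
        shuffle = solve𝕂 4 (λ m₁ z m₂ a → (m₁ ×′ (z ×′ (m₂ ×′ a))) ≔ (a ×′ (z ×′ (m₁ ×′ m₂)))) refl
      -- μ is z m₂ = e₁ / m₁, again in the order by `colon`: e₁ = z m₁ m₂ and e₂ = z m₂ a satisfy m₁
      -- e₂ = a e₁.
      μ : 𝒵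
      μ = ⟦ r ⟧ ∙ e₁ ⊞ ⟦ s ⟧ ∙ e₂ ⊞ ⟦ s ⟧ ∙ (⟦ C₁ ⟧ ∙ p₁ ⊞ conj a ∙ q₁) ⊞ ⟦ k ⟧ ∙ (⟦ C₁ ⟧ ∙ p₂ ⊞ conj a ∙ q₂)
      e₁≡m₁μ : e₁ ≡ ⟦ m₁ ⟧ ∙ μ
      e₁≡m₁μ = colon P₁ refl refl m₁e₂≡ae₁
      m₂≡γμ : ⟦ m₂ ⟧ ≡ γ ∙ μ
      m₂≡γμ = ⟦⟧-cancel m₁ (Primitive.nonzero P₁) _ _ (emb-injective 2≤d d-squarefree (sym (begin
        emb (⟦ m₁ ⟧ ∙ (γ ∙ μ))               ≡⟨ cong emb (∙-swap ⟦ m₁ ⟧ γ μ) ⟩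
        emb (γ ∙ (⟦ m₁ ⟧ ∙ μ))               ≡⟨ emb-∙ γ (⟦ m₁ ⟧ ∙ μ) ⟩
        emb γ ⊗ emb (⟦ m₁ ⟧ ∙ μ)             ≡⟨ cong (λ e → emb γ ⊗ emb e) e₁≡m₁μ ⟨
        emb γ ⊗ emb e₁                       ≡⟨ cong (emb γ ⊗_) zm₁m₂≡ ⟨
        emb γ ⊗ (z ⊗ emb ⟦ m₁ * m₂ ⟧)        ≡⟨ γz-cancel (emb ⟦ m₁ * m₂ ⟧) ⟩
        emb ⟦ m₁ * m₂ ⟧                      ≡⟨ cong emb (⟦⟧-* m₁ m₂) ⟨
        emb (⟦ m₁ ⟧ ∙ ⟦ m₂ ⟧)                ∎)))

  module _ (cardinality : HasCardinality (Pic (𝒪 d g)) 2) where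

    open Inverse cardinality using (to; from; inverseʳ)

    private
      module Pic𝒪 = Setoid (Pic (𝒪 d g))

      class : ∀ {a m} → Primitive g a m → Fin 2
      class P = to (invertibleIdeal P)

      to-injective : ∀ {X Y} → to X ≡ to Y → X Pic𝒪.≈ Y
      to-injective {X} {Y} eq = Pic𝒪.trans {X} {from (to X)} {Y}
        (Pic𝒪.sym {from (to X)} {X} (inverseʳ {X} refl)) (inverseʳ {Y} eq)

      to-cong : ∀ {X Y} → X Pic𝒪.≈ Y → to X ≡ to Y
      to-cong = Inverse.to-cong cardinality

      pigeonhole : ∀ {i j k : Fin 2} → i ≢ k → j ≢ k → i ≡ j
      pigeonhole {zero} {zero} _ _ = refl
      pigeonhole {suc zero} {suc zero} _ _ = refl
      pigeonhole {zero} {suc zero} {zero} i≢k _ = contradiction refl i≢k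
      pigeonhole {zero} {suc zero} {suc zero} _ j≢k = contradiction refl j≢k
      pigeonhole {suc zero} {zero} {zero} _ j≢k = contradiction refl j≢k
      pigeonhole {suc zero} {zero} {suc zero} i≢k _ = contradiction refl i≢k

    -- Decidable because the class of (a , m) is an element of `Fin 2`, which can be compared with
    -- the class of the order itself.
    splits? : ∀ {a m} → Primitive g a m → Dec (Splits g a m)
    splits? P = map′ (λ eq → principal⇒splits P
      (to-injective {invertibleIdeal P} {invertibleIdeal 1-primitive} eq))
      (λ S → to-cong {invertibleIdeal P} {invertibleIdeal 1-primitive} (splits⇒principal P S))
        (class P Finₚ.≟ class 1-primitive)

    two-classes : ∀ {a m b n} (P : Primitive g a m) → Primitive g b n → ¬ Splits g a m → I b n ∼ 𝟙 ⊎
      I b n ∼ I a m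
    two-classes {a} {m} {b} {n} P Q ¬splits = go (class Q Finₚ.≟ class 1-primitive)
      where
      go : Dec (class Q ≡ class 1-primitive) → I b n ∼ 𝟙 ⊎ I b n ∼ I a m
      go (yes eq) = inj₁ (to-injective {invertibleIdeal Q} {invertibleIdeal 1-primitive} eq)
      go (no neq) = inj₂ (to-injective {invertibleIdeal Q} {invertibleIdeal P} (pigeonhole neq λ eq →
        ¬splits (principal⇒splits P (to-injective {invertibleIdeal P} {invertibleIdeal 1-primitive} eq))))

    -- If (a , m₁ m₂) were not principal, the nonprincipal (a , m₁) would share its class, and their
    -- quotient (a , m₂) would be principal.
    product-splits : ∀ {a m₁ m₂} → Primitive g a m₁ → Primitive g a m₂ → Primitive g a (m₁ * m₂) →
      ¬ Splits g a m₁ → ¬ Splits g a m₂ → Splits g a (m₁ * m₂)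
    product-splits P₁ P₂ P₁₂ ¬S₁ ¬S₂ = decidable-stable (splits? P₁₂) λ ¬S₁₂ →
      Sum.[ (λ principal → ¬S₁ (principal⇒splits P₁ principal)) ,
        (λ same → ¬S₂ (same-class⇒splits P₁ P₂ P₁₂ same)) ]
        (two-classes P₁₂ P₁ ¬S₁₂)

-- Extension of ideals to the maximal order

squarefree-coprime : ∀ {f a b q} → Squarefree f → f ≡ a ℕ.* b → Prime q → q ∣ a → ¬ q ∣ b
squarefree-coprime {f} {a} {b} {q} f-squarefree f≡ab q-prime q∣a q∣b =
  prime-≢1 q-prime (f-squarefree q (subst (q ℕ.* q ∣_) (sym f≡ab) (ℕ∣.*-pres-∣ q∣a q∣b)))

-- Take f = y x g₂ such that a prime dividing y does not divide m, one dividing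
-- x divides m but not C, and one dividing g₂ divides both.
coprime-value : ∀ {f} → Squarefree f → ∀ m T C → (∀ r → Prime r → + r ∣ℤ m → + r ∣ℤ T → + r ∣ℤ C → ⊥) →
  ∃[ x ] ∃[ y ] (∀ r → Prime r → r ∣ f → ¬ + r ∣ℤ m * (x * x) + T * (x * y) + C * (y * y)) ×
    (∀ r → Prime r → + r ∣ℤ y → ¬ + r ∣ℤ m)
coprime-value {f} f-squarefree m T C coprime = go (gcd[m,n]∣n ∣ m ∣ f) (gcd[m,n]∣m g₁ ∣ C ∣)
  where
  g₁ g₂ : ℕ
  g₁ = gcd ∣ m ∣ f
  g₂ = gcd g₁ ∣ C ∣
  go : g₁ ∣ f → g₂ ∣ g₁ → ∃[ x ] ∃[ y ]
    (∀ r → Prime r → r ∣ f → ¬ + r ∣ℤ m * (x * x) + T * (x * y) + C * (y * y)) ×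
    (∀ r → Prime r → + r ∣ℤ y → ¬ + r ∣ℤ m)
  go (ℕ∣.divides y f≡yg₁) (ℕ∣.divides x g₁≡xg₂) = + x , + y , avoids , λ r r-prime r∣y →
    y-m r-prime (∣⇒∣ᵤ r∣y)
    where
    g₁∣f : g₁ ∣ f
    g₁∣f = ℕ∣.divides y f≡yg₁
    g₁-squarefree : Squarefree g₁
    g₁-squarefree k k²∣g₁ = f-squarefree k (ℕ∣.∣-trans k²∣g₁ g₁∣f)
    x∣g₁ : x ∣ g₁
    x∣g₁ = subst (x ∣_) (sym g₁≡xg₂) (ℕ∣.m∣m*n g₂)
    g₁∣m : ∀ {r} → r ∣ g₁ → + r ∣ℤ m
    g₁∣m r∣g₁ = ∣ᵤ⇒∣ (ℕ∣.∣-trans r∣g₁ (gcd[m,n]∣m ∣ m ∣ f))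
    y-g₁ : ∀ {r} → Prime r → r ∣ y → ¬ r ∣ g₁
    y-g₁ r-prime = squarefree-coprime {f} f-squarefree f≡yg₁ r-prime
    y-m : ∀ {r} → Prime r → r ∣ y → ¬ + r ∣ℤ m
    y-m r-prime r∣y r∣m = y-g₁ r-prime r∣y
      (gcd-greatest (∣⇒∣ᵤ r∣m) (ℕ∣.∣-trans r∣y (subst (y ∣_) (sym f≡yg₁) (ℕ∣.m∣m*n g₁))))
    X Y : ℤ
    X = + x
    Y = + y
    -- Modulo r the form reduces to m x², C y² or T x y according as r divides y, x or g₂, and in
    -- each case the construction keeps that term prime to r.
    module _ {r} (r-prime : Prime r) (r∣value : + r ∣ℤ m * (X * X) + T * (X * Y) + C * (Y * Y)) where
      case-y : r ∣ y → ⊥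
      case-y r∣y = Sum.[ y-m r-prime r∣y ,
        (λ r∣x² → y-g₁ r-prime r∣y (ℕ∣.∣-trans (∣⇒∣ᵤ (prime-∣² r-prime X r∣x²)) x∣g₁)) ]
        (prime-∣* r-prime m (X * X) (∣m+n∣n⇒∣m (∣m+n∣n⇒∣m r∣value (∣n⇒∣m*n C (∣n⇒∣m*n Y r∣Y)))
          (∣n⇒∣m*n T (∣n⇒∣m*n X r∣Y))))
        where
        r∣Y : + r ∣ℤ Y
        r∣Y = ∣ᵤ⇒∣ r∣y
      case-x : r ∣ x → ⊥
      case-x r∣x = Sum.[ (λ r∣C → squarefree-coprime {g₁} g₁-squarefree g₁≡xg₂ r-prime r∣x
        (gcd-greatest r∣g₁ (∣⇒∣ᵤ r∣C)))
          , (λ r∣y² → y-g₁ r-prime (∣⇒∣ᵤ (prime-∣² r-prime Y r∣y²)) r∣g₁) ]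
        (prime-∣* r-prime C (Y * Y) (∣m+n∣m⇒∣n r∣value
          (∣m∣n⇒∣m+n (∣n⇒∣m*n m (∣m⇒∣m*n X r∣X)) (∣n⇒∣m*n T (∣m⇒∣m*n Y r∣X)))))
        where
        r∣X : + r ∣ℤ X
        r∣X = ∣ᵤ⇒∣ r∣x
        r∣g₁ : r ∣ g₁
        r∣g₁ = ℕ∣.∣-trans r∣x x∣g₁
      case-g₂ : r ∣ g₂ → ⊥
      case-g₂ r∣g₂ = Sum.[ (λ r∣T → coprime r r-prime (g₁∣m r∣g₁) r∣T r∣C) , (λ r∣xy → Sum.[
            (λ r∣X → squarefree-coprime {g₁} g₁-squarefree g₁≡xg₂ r-prime (∣⇒∣ᵤ r∣X) r∣g₂) ,
              (λ r∣Y → y-g₁ r-prime (∣⇒∣ᵤ r∣Y) r∣g₁) ] (prime-∣* r-prime X Y r∣xy)) ]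
        (prime-∣* r-prime T (X * Y) (∣m+n∣m⇒∣n (∣m+n∣n⇒∣m r∣value (∣m⇒∣m*n (Y * Y) r∣C))
          (∣m⇒∣m*n (X * X) (g₁∣m r∣g₁))))
        where
        r∣g₁ : r ∣ g₁
        r∣g₁ = ℕ∣.∣-trans r∣g₂ (gcd[m,n]∣m g₁ ∣ C ∣)
        r∣C : + r ∣ℤ C
        r∣C = ∣ᵤ⇒∣ (ℕ∣.∣-trans r∣g₂ (gcd[m,n]∣n g₁ ∣ C ∣))
    avoids : ∀ r → Prime r → r ∣ f → ¬ + r ∣ℤ m * (X * X) + T * (X * Y) + C * (Y * Y)
    avoids r r-prime r∣f r∣value = Sum.[ case-y r-prime r∣value ,
      (λ r∣g₁ → Sum.[ case-x r-prime r∣value , case-g₂ r-prime r∣value ]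
        (euclidsLemma x g₂ r-prime (subst (r ∣_) g₁≡xg₂ r∣g₁))) ]
      (euclidsLemma y g₁ r-prime (subst (r ∣_) f≡yg₁ r∣f))

-- G need not be decidable, so a generator exists only up to double negation.
subgroup-generator : ∀ (G : ℤ → Set) → (∀ {x y} k → G x → G y → G (x - k * y)) →
  ∀ n N → ∣ N ∣ ≤ n → N ≢ 0ℤ → G N → ¬ ¬ (∃[ g ] g ≢ 0ℤ × G g × (∀ z → G z → g ∣ℤ z))
subgroup-generator G closed zero N ∣N∣≤0 N≢0 _ _ = N≢0 (ℤₚ.∣i∣≡0⇒i≡0 (ℕₚ.n≤0⇒n≡0 ∣N∣≤0))
subgroup-generator G closed (suc n) N ∣N∣≤1+n N≢0 GN k =
  k (N , N≢0 , GN , λ z Gz → decidable-stable (N ∣ℤ? z) (remainder z Gz))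
  where
  instance _ = ℕ.≢-nonZero {∣ N ∣} λ ∣N∣≡0 → N≢0 (ℤₚ.∣i∣≡0⇒i≡0 ∣N∣≡0)
  instance _ = ℤ.≢-nonZero N≢0
  subtract : ∀ z r k N → z ≡ r + k * N → z - k * N ≡ r
  subtract z r k N z≡ = trans (cong (_- k * N) z≡) (cancel r (k * N))
    where
    cancel : ∀ r m → r + m - m ≡ r
    cancel = solve-∀
  -- If some z in G is not a multiple of N, its nonzero remainder modulo N is a smaller element of
  -- G.
  remainder : ∀ z → G z → ¬ N ∣ℤ z → ⊥
  remainder z Gz N∤z = subgroup-generator G closed n (+ (z ℤ÷.% N))
    (ℕₚ.≤-pred (ℕₚ.≤-trans (ℤ÷.n%d<d z N) ∣N∣≤1+n))
    (λ r≡0 → N∤z (divides (z ℤ÷./ N)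
      (trans (ℤ÷.a≡a%n+[a/n]*n z N) (trans (cong (_+ z ℤ÷./ N * N) r≡0) (ℤₚ.+-identityˡ _)))))
    (subst G (subtract z (+ (z ℤ÷.% N)) (z ℤ÷./ N) N (ℤ÷.a≡a%n+[a/n]*n z N)) (closed (z ℤ÷./ N) Gz GN)) k

module Extension (d : ℕ) (2≤d : 2 ≤ d) (d-squarefree : Squarefree d) (f : ℕ) (f-squarefree : Squarefree f)
  where

  open Field d
  private
    module 𝒪₁ = Ideals d 2≤d d-squarefree 1
    module 𝒪f = ClassGroup d 2≤d d-squarefree f
  open 𝒪f using (_∼_)

  inOrder₁ : ∀ {u} → InOrder 1 u
  inOrder₁ {_ , y} = inOrder (divides y (sym (ℤₚ.*-identityʳ y)))

  primitive-coprime : ∀ {g a m} (P : Primitive g a m) r → Prime r → + r ∣ℤ m → + r ∣ℤ trace a →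
    ¬ + r ∣ℤ Primitive.cofactor P
  primitive-coprime P r r-prime r∣m r∣T r∣C = prime-∤1 r-prime (subst (+ r ∣ℤ_) (Primitive.bezout P)
    (∣m∣n⇒∣m+n (∣m∣n⇒∣m+n (∣n⇒∣m*n (Primitive.r P) r∣m) (∣n⇒∣m*n (Primitive.s P) r∣T))
      (∣n⇒∣m*n (Primitive.k P) r∣C)))

  IsGenerator : 𝒵 → ℤ → 𝕂 d → Set
  IsGenerator a m y = Invertible y × y ∈ 𝒪₁.I a m × (∃[ w ] emb a ≡ y ⊗ emb w) ×
    (∃[ w ] emb ⟦ m ⟧ ≡ y ⊗ emb w)

  -- Multiplication by f pushes a into the order of conductor f. As f is a unit modulo m, the ideal
  -- (f a , m) of that order extends back to (a , m): this is what makes extension of classes onto.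
  lift-primitive : ∀ {a m} → Primitive 1 a m → (∀ r → Prime r → r ∣ f → ¬ + r ∣ℤ m) →
    Primitive f (⟦ + f ⟧ ∙ a) m
  lift-primitive {a} {m} P coprime = mkPrimitive (+ f * + f * C)
    (inOrder (subst (+ f ∣ℤ_) (sym (cong proj₂ (⟦⟧-∙ (+ f) a))) (∣m⇒∣m*n (proj₂ a) ∣-refl)))
    (Primitive.nonzero P)
    (trans (norm-⟦⟧-∙ (+ f) a) (trans (cong (+ f * + f *_) (Primitive.norm≡ P)) (rotate (+ f * + f) m C)))
    λ r r-prime r∣m r∣T r∣f²C →
      let r∤f = λ r∣f → coprime r r-prime (∣⇒∣ᵤ r∣f) r∣m in
      primitive-coprime P r r-prime r∣m
        (Sum.fromInj₂ (λ r∣f → contradiction r∣f r∤f)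
          (prime-∣* r-prime (+ f) (trace a) (subst (+ r ∣ℤ_) (trace-⟦⟧-∙ (+ f) a) r∣T)))
        (Sum.fromInj₂ (λ r∣f² → contradiction (prime-∣² r-prime (+ f) r∣f²) r∤f)
          (prime-∣* r-prime (+ f * + f) C r∣f²C))
    where
    C : ℤ
    C = Primitive.cofactor P
    rotate : ∀ g m c → g * (m * c) ≡ m * (g * c)
    rotate = solve-∀

  module _ {a m} (P : Primitive 1 a m) (coprime : ∀ r → Prime r → r ∣ f → ¬ + r ∣ℤ m) where

    private
      b : 𝒵
      b = ⟦ + f ⟧ ∙ a

    lifted⊆ : ∀ {z} → z ∈ 𝒪f.I b m → z ∈ 𝒪₁.I a m
    lifted⊆ (u , v , _ , _ , z≡) = ⟦ + f ⟧ ∙ u , v , inOrder₁ , inOrder₁ ,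
      trans z≡ (cong emb (rearrange ⟦ + f ⟧ a u ⟦ m ⟧ v))
      where
      rearrange : ∀ f a u m v → f ∙ a ∙ u ⊞ m ∙ v ≡ a ∙ (f ∙ u) ⊞ m ∙ v
      rearrange = solve𝒵 5 (λ f a u m v → (f :* a :* u :+ m :* v) := (a :* (f :* u) :+ m :* v)) refl

    -- With h f + l m = 1, the element a = h (f a) + l a m is a multiple of y because f a and m are.
    generator-from-lift : ∀ {y} → Invertible y → y ∈ 𝒪₁.I a m →
      (∃[ w ] emb b ≡ y ⊗ emb w) → (∃[ w ] emb ⟦ m ⟧ ≡ y ⊗ emb w) → IsGenerator a m y
    generator-from-lift {y} y-inv y∈ (w₁ , b≡) (w₂ , m≡) = y-inv , y∈ ,
      go (bezout₂ (+ f) m λ r r-prime r∣f → coprime r r-prime (∣⇒∣ᵤ r∣f)) , (w₂ , m≡)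
      where
      open ≡-Reasoning
      go : ∃[ h ] ∃[ l ] h * + f + l * m ≡ 1ℤ → ∃[ w ] emb a ≡ y ⊗ emb w
      go (h , l , hf+lm≡1) = ⟦ h ⟧ ∙ w₁ ⊞ ⟦ l ⟧ ∙ a ∙ w₂ , (begin
        emb a                                                     ≡⟨ cong emb a≡ ⟩
        emb (⟦ h ⟧ ∙ b ⊞ ⟦ l ⟧ ∙ a ∙ ⟦ m ⟧)
          ≡⟨ trans (emb-⊞ _ _) (cong₂ _⊕_ (emb-∙ _ _) (emb-∙ _ _)) ⟩
        emb ⟦ h ⟧ ⊗ emb b ⊕ emb (⟦ l ⟧ ∙ a) ⊗ emb ⟦ m ⟧
          ≡⟨ cong₂ (λ b m → emb ⟦ h ⟧ ⊗ b ⊕ emb (⟦ l ⟧ ∙ a) ⊗ m) b≡ m≡ ⟩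
        emb ⟦ h ⟧ ⊗ (y ⊗ emb w₁) ⊕ emb (⟦ l ⟧ ∙ a) ⊗ (y ⊗ emb w₂)
          ≡⟨ factor (emb ⟦ h ⟧) y (emb w₁) (emb (⟦ l ⟧ ∙ a)) (emb w₂) ⟩
        y ⊗ (emb ⟦ h ⟧ ⊗ emb w₁ ⊕ emb (⟦ l ⟧ ∙ a) ⊗ emb w₂)
          ≡⟨ cong (y ⊗_) (trans (emb-⊞ _ _) (cong₂ _⊕_ (emb-∙ _ _) (emb-∙ _ _))) ⟨
        y ⊗ emb (⟦ h ⟧ ∙ w₁ ⊞ ⟦ l ⟧ ∙ a ∙ w₂)                      ∎)
        where
        factor : ∀ (h y u l v : 𝕂 d) → h ⊗ (y ⊗ u) ⊕ l ⊗ (y ⊗ v) ≡ y ⊗ (h ⊗ u ⊕ l ⊗ v)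
        factor = solve𝕂 5 (λ h y u l v → (h ×′ (y ×′ u) ⊹ l ×′ (y ×′ v)) ≔ (y ×′ (h ×′ u ⊹ l ×′ v))) refl
        rearrange : ∀ h f l m a → (h ∙ f ⊞ l ∙ m) ∙ a ≡ h ∙ (f ∙ a) ⊞ l ∙ a ∙ m
        rearrange = solve𝒵 5 (λ h f l m a → ((h :* f :+ l :* m) :* a) := (h :* (f :* a) :+ l :* a :* m)) refl
        a≡ : a ≡ ⟦ h ⟧ ∙ b ⊞ ⟦ l ⟧ ∙ a ∙ ⟦ m ⟧
        a≡ = begin
          a                                                  ≡⟨ ∙-identityˡ a ⟨
          ⟦ 1ℤ ⟧ ∙ a                                         ≡⟨ cong (λ z → ⟦ z ⟧ ∙ a) hf+lm≡1 ⟨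
          ⟦ h * + f + l * m ⟧ ∙ a                            ≡⟨ cong (_∙ a)
            (trans (cong₂ _⊞_ (⟦⟧-* h (+ f)) (⟦⟧-* l m)) (⟦⟧-⊞ _ _)) ⟨
          (⟦ h ⟧ ∙ ⟦ + f ⟧ ⊞ ⟦ l ⟧ ∙ ⟦ m ⟧) ∙ a              ≡⟨ rearrange ⟦ h ⟧ ⟦ + f ⟧ ⟦ l ⟧ ⟦ m ⟧ a ⟩
          ⟦ h ⟧ ∙ b ⊞ ⟦ l ⟧ ∙ a ∙ ⟦ m ⟧                      ∎

    generator-from-unit-class : 𝒪f.I b m ∼ 𝒪f.𝟙 → ∃[ y ] IsGenerator a m y
    generator-from-unit-class (z , z-inv , I⊆z𝟙 , z𝟙⊆I) = z , generator-from-lift z-inv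
      (subst (_∈ 𝒪₁.I a m) (⊗-identityʳ z) (lifted⊆ (z𝟙⊆I (1𝕂 , 𝒪f.1∈𝟙 , refl))))
      (integral (I⊆z𝟙 (𝒪f.first-∈ b m))) (integral (I⊆z𝟙 (𝒪f.second-∈ b m)))
      where
      integral : ∀ {x} → x ∈ (z • 𝒪f.𝟙) → ∃[ w ] x ≡ z ⊗ emb w
      integral (_ , (u , v , _ , _ , w≡) , x≡) = _ , trans x≡ (cong (z ⊗_) w≡)

    -- As q is coprime to norm w₀, the ideal (q w₀ , q²) extends to q in the maximal order.
    generator-from-extension-class : ∀ {a₀ q w₀} → + q ≢ 0ℤ → a₀ ≡ ⟦ + q ⟧ ∙ w₀ →
      ∃[ i ] ∃[ j ] i * norm w₀ + j * + q ≡ 1ℤ →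
      𝒪f.I b m ∼ 𝒪f.I a₀ (+ q * + q) → ∃[ y ] IsGenerator a m y
    generator-from-extension-class {a₀} {q} {w₀} q≢0 a₀≡qw₀ (i , j , iN+jq≡1) (z , z-inv , I⊆zI₀ , zI₀⊆I) =
      y , generator-from-lift (Invertible-⊗ z (emb ⟦ + q ⟧) z-inv
        (subst Invertible (sym (emb-⟦⟧ (+ q))) (fromℤ-invertible q≢0))) y∈
        (integral (I⊆zI₀ (𝒪f.first-∈ b m))) (integral (I⊆zI₀ (𝒪f.second-∈ b m)))
      where
      open ≡-Reasoning
      y : 𝕂 d
      y = z ⊗ emb ⟦ + q ⟧
      integral : ∀ {x} → x ∈ (z • 𝒪f.I a₀ (+ q * + q)) → ∃[ w ] x ≡ y ⊗ emb w
      integral {x} (_ , (u , v , _ , _ , w≡) , x≡) = w₀ ∙ u ⊞ ⟦ + q ⟧ ∙ v , (begin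
        x                                                       ≡⟨ trans x≡ (cong (z ⊗_) w≡) ⟩
        z ⊗ emb (a₀ ∙ u ⊞ ⟦ + q * + q ⟧ ∙ v)
          ≡⟨ cong (λ e → z ⊗ emb e) (cong₂ (λ a m → a ∙ u ⊞ m ∙ v) a₀≡qw₀ (sym (⟦⟧-* (+ q) (+ q)))) ⟩
        z ⊗ emb (⟦ + q ⟧ ∙ w₀ ∙ u ⊞ ⟦ + q ⟧ ∙ ⟦ + q ⟧ ∙ v)
          ≡⟨ cong (λ e → z ⊗ emb e) (factor ⟦ + q ⟧ w₀ u v) ⟩
        z ⊗ emb (⟦ + q ⟧ ∙ (w₀ ∙ u ⊞ ⟦ + q ⟧ ∙ v))              ≡⟨ cong (z ⊗_) (emb-∙ _ _) ⟩
        z ⊗ (emb ⟦ + q ⟧ ⊗ emb (w₀ ∙ u ⊞ ⟦ + q ⟧ ∙ v))          ≡⟨ ⊗-assoc z (emb ⟦ + q ⟧) _ ⟨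
        y ⊗ emb (w₀ ∙ u ⊞ ⟦ + q ⟧ ∙ v)                          ∎)
        where
        factor : ∀ q w u v → q ∙ w ∙ u ⊞ q ∙ q ∙ v ≡ q ∙ (w ∙ u ⊞ q ∙ v)
        factor = solve𝒵 4 (λ q w u v → (q :* w :* u :+ q :* q :* v) := (q :* (w :* u :+ q :* v))) refl
      one : ⟦ 1ℤ ⟧ ≡ ⟦ i ⟧ ∙ (w₀ ∙ conj w₀) ⊞ ⟦ j ⟧ ∙ ⟦ + q ⟧
      one = sym (trans (cong₂ _⊞_ (trans (cong (⟦ i ⟧ ∙_) (∙-conj w₀)) (⟦⟧-* i (norm w₀))) (⟦⟧-* j (+ q)))
        (trans (⟦⟧-⊞ _ _) (cong ⟦_⟧ iN+jq≡1)))
      y≡ : y ≡ emb (⟦ i ⟧ ∙ conj w₀) ⊗ (z ⊗ emb a₀) ⊕ emb ⟦ j ⟧ ⊗ (z ⊗ emb ⟦ + q * + q ⟧)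
      y≡ = begin
        z ⊗ emb ⟦ + q ⟧                                            ≡⟨ cong (λ e → z ⊗ emb e) q≡ ⟩
        z ⊗ emb (⟦ i ⟧ ∙ conj w₀ ∙ a₀ ⊞ ⟦ j ⟧ ∙ ⟦ + q * + q ⟧)
          ≡⟨ cong (z ⊗_) (trans (emb-⊞ _ _) (cong₂ _⊕_ (emb-∙ _ _) (emb-∙ _ _))) ⟩
        z ⊗ (emb (⟦ i ⟧ ∙ conj w₀) ⊗ emb a₀ ⊕ emb ⟦ j ⟧ ⊗ emb ⟦ + q * + q ⟧)
          ≡⟨ distribute z (emb (⟦ i ⟧ ∙ conj w₀)) (emb a₀) (emb ⟦ j ⟧) (emb ⟦ + q * + q ⟧) ⟩
        emb (⟦ i ⟧ ∙ conj w₀) ⊗ (z ⊗ emb a₀) ⊕ emb ⟦ j ⟧ ⊗ (z ⊗ emb ⟦ + q * + q ⟧) ∎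
        where
        distribute : ∀ (z u a v b : 𝕂 d) → z ⊗ (u ⊗ a ⊕ v ⊗ b) ≡ u ⊗ (z ⊗ a) ⊕ v ⊗ (z ⊗ b)
        distribute = solve𝕂 5 (λ z u a v b → (z ×′ (u ×′ a ⊹ v ×′ b)) ≔ (u ×′ (z ×′ a) ⊹ v ×′ (z ×′ b))) refl
        expand : ∀ q i w w̄ j → (i ∙ (w ∙ w̄) ⊞ j ∙ q) ∙ q ≡ i ∙ w̄ ∙ (q ∙ w) ⊞ j ∙ (q ∙ q)
        expand = solve𝒵 5 (λ q i w w̄ j →
          ((i :* (w :* w̄) :+ j :* q) :* q) := (i :* w̄ :* (q :* w) :+ j :* (q :* q))) refl
        q≡ : ⟦ + q ⟧ ≡ ⟦ i ⟧ ∙ conj w₀ ∙ a₀ ⊞ ⟦ j ⟧ ∙ ⟦ + q * + q ⟧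
        q≡ = begin
          ⟦ + q ⟧                                                           ≡⟨ ∙-identityˡ ⟦ + q ⟧ ⟨
          ⟦ 1ℤ ⟧ ∙ ⟦ + q ⟧                                                  ≡⟨ cong (_∙ ⟦ + q ⟧) one ⟩
          (⟦ i ⟧ ∙ (w₀ ∙ conj w₀) ⊞ ⟦ j ⟧ ∙ ⟦ + q ⟧) ∙ ⟦ + q ⟧
            ≡⟨ expand ⟦ + q ⟧ ⟦ i ⟧ w₀ (conj w₀) ⟦ j ⟧ ⟩
          ⟦ i ⟧ ∙ conj w₀ ∙ (⟦ + q ⟧ ∙ w₀) ⊞ ⟦ j ⟧ ∙ (⟦ + q ⟧ ∙ ⟦ + q ⟧)
            ≡⟨ cong₂ (λ a m → ⟦ i ⟧ ∙ conj w₀ ∙ a ⊞ ⟦ j ⟧ ∙ m) (sym a₀≡qw₀) (⟦⟧-* (+ q) (+ q)) ⟩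
          ⟦ i ⟧ ∙ conj w₀ ∙ a₀ ⊞ ⟦ j ⟧ ∙ ⟦ + q * + q ⟧                      ∎
      y∈ : y ∈ 𝒪₁.I a m
      y∈ = subst (_∈ 𝒪₁.I a m) (sym y≡) (𝒪₁.I-⊕-closed
        (𝒪₁.I-⊗-closed {ρ = ⟦ i ⟧ ∙ conj w₀} inOrder₁
          (lifted⊆ (zI₀⊆I (emb a₀ , 𝒪f.first-∈ a₀ (+ q * + q) , refl))))
        (𝒪₁.I-⊗-closed {ρ = ⟦ j ⟧} inOrder₁
          (lifted⊆ (zI₀⊆I (emb ⟦ + q * + q ⟧ , 𝒪f.second-∈ a₀ (+ q * + q) , refl)))))

  -- With β = x m + y a and norm β = m m′, conj β · (a , m) = m · (conj β , m′).
  module _ {a m} (P : Primitive 1 a m) {x y m′ : ℤ}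
    (m′≡ : m′ ≡ m * (x * x) + trace a * (x * y) + Primitive.cofactor P * (y * y))
    (y-m-coprime : ∀ r → Prime r → + r ∣ℤ y → ¬ + r ∣ℤ m) where

    private
      C : ℤ
      C = Primitive.cofactor P
      β : 𝒵
      β = ⟦ x ⟧ ∙ ⟦ m ⟧ ⊞ ⟦ y ⟧ ∙ a
      β̄ : 𝒵
      β̄ = conj β

    norm-β : norm β ≡ m * m′
    norm-β = begin
      norm β                                                        ≡⟨ norm-⊞ _ _ ⟩
      norm (⟦ x ⟧ ∙ ⟦ m ⟧) + trace (⟦ x ⟧ ∙ ⟦ m ⟧ ∙ conj (⟦ y ⟧ ∙ a)) + norm (⟦ y ⟧ ∙ a)
        ≡⟨ cong₂ _+_ (cong₂ _+_ (trans (norm-⟦⟧-∙ x ⟦ m ⟧) (cong (x * x *_) (norm-⟦⟧ m))) T≡)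
          (trans (norm-⟦⟧-∙ y a) (cong (y * y *_) (Primitive.norm≡ P))) ⟩
      x * x * (m * m) + x * m * (y * trace a) + y * y * (m * C)      ≡⟨ collect x m y (trace a) C ⟩
      m * (m * (x * x) + trace a * (x * y) + C * (y * y))           ≡⟨ cong (m *_) m′≡ ⟨
      m * m′                                                        ∎
      where
      open ≡-Reasoning
      collect : ∀ x m y T C → x * x * (m * m) + x * m * (y * T) + y * y * (m * C) ≡ m *
        (m * (x * x) + T * (x * y) + C * (y * y))
      collect = solve-∀
      T≡ : trace (⟦ x ⟧ ∙ ⟦ m ⟧ ∙ conj (⟦ y ⟧ ∙ a)) ≡ x * m * (y * trace a)
      T≡ = begin
        trace (⟦ x ⟧ ∙ ⟦ m ⟧ ∙ conj (⟦ y ⟧ ∙ a))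
          ≡⟨ cong (λ z → trace (z ∙ conj (⟦ y ⟧ ∙ a))) (⟦⟧-* x m) ⟩
        trace (⟦ x * m ⟧ ∙ conj (⟦ y ⟧ ∙ a))          ≡⟨ trace-⟦⟧-∙ (x * m) _ ⟩
        x * m * trace (conj (⟦ y ⟧ ∙ a))
          ≡⟨ cong (x * m *_) (trans (trace-conj _) (trace-⟦⟧-∙ y a)) ⟩
        x * m * (y * trace a)                         ∎

    β̄≡ : β̄ ≡ ⟦ x ⟧ ∙ ⟦ m ⟧ ⊞ ⟦ y ⟧ ∙ conj a
    β̄≡ = trans (conj-⊞ _ _) (cong₂ _⊞_ (trans (conj-∙ _ _) (cong₂ _∙_ (conj-⟦⟧ x) (conj-⟦⟧ m)))
      (trans (conj-∙ _ _) (cong (_∙ conj a) (conj-⟦⟧ y))))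

    transfer-generator : norm β ≢ 0ℤ → ∀ {y₀} → IsGenerator β̄ m′ y₀ → ∃[ y₁ ] IsGenerator a m y₁
    transfer-generator Nβ≢0 {y₀} (y₀-inv , (p , q , _ , _ , y₀≡) , (w₁ , β̄≡y₀w₁) , (w₂ , m′≡y₀w₂)) =
      t ⊗ y₀ , Invertible-⊗ t y₀ t-inv y₀-inv , (⟦ y ⟧ ∙ q , p ⊞ ⟦ x ⟧ ∙ q , inOrder₁ , inOrder₁ , ty₀≡) ,
      a∈ (bezout₂ y m y-m-coprime) ,
        (w₁ , trans (sym tβ̄≡m) (trans (cong (t ⊗_) β̄≡y₀w₁) (sym (⊗-assoc t y₀ (emb w₁)))))
      where
      open ≡-Reasoning
      β̄-inv : Invertible (emb β̄)
      β̄-inv = emb-invertible (λ eq → Nβ≢0 (trans (sym (norm-conj β)) eq))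
      -- Multiplication by t = m / β̄ carries (β̄ , m′) to (a , m), so t y₀ generates the latter.
      t : 𝕂 d
      t = emb ⟦ m ⟧ ⊗ proj₁ β̄-inv
      t-inv : Invertible t
      t-inv = Invertible-⊗ (emb ⟦ m ⟧) (proj₁ β̄-inv)
        (subst Invertible (sym (emb-⟦⟧ m)) (fromℤ-invertible (Primitive.nonzero P)))
        (emb β̄ , trans (⊗-comm (proj₁ β̄-inv) (emb β̄)) (proj₂ β̄-inv))
      tβ̄≡m : t ⊗ emb β̄ ≡ emb ⟦ m ⟧
      tβ̄≡m = trans (⊗-assoc (emb ⟦ m ⟧) (proj₁ β̄-inv) (emb β̄))
        (trans (cong (emb ⟦ m ⟧ ⊗_) (trans (⊗-comm (proj₁ β̄-inv) (emb β̄)) (proj₂ β̄-inv)))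
        (⊗-identityʳ (emb ⟦ m ⟧)))
      scale : ∀ {u v} → ⟦ m ⟧ ∙ u ≡ β̄ ∙ v → t ⊗ emb u ≡ emb v
      scale {u} {v} mu≡β̄v = ⊗-cancelˡ (emb β̄) β̄-inv (begin
        emb β̄ ⊗ (t ⊗ emb u)     ≡⟨ regroup (emb β̄) t (emb u) ⟩
        t ⊗ emb β̄ ⊗ emb u       ≡⟨ cong (_⊗ emb u) tβ̄≡m ⟩
        emb ⟦ m ⟧ ⊗ emb u       ≡⟨ trans (sym (emb-∙ _ _)) (trans (cong emb mu≡β̄v) (emb-∙ _ _)) ⟩
        emb β̄ ⊗ emb v           ∎)
        where
        regroup : ∀ (b t u : 𝕂 d) → b ⊗ (t ⊗ u) ≡ t ⊗ b ⊗ u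
        regroup = solve𝕂 3 (λ b t u → (b ×′ (t ×′ u)) ≔ (t ×′ b ×′ u)) refl
      ty₀≡ : t ⊗ y₀ ≡ emb (a ∙ (⟦ y ⟧ ∙ q) ⊞ ⟦ m ⟧ ∙ (p ⊞ ⟦ x ⟧ ∙ q))
      ty₀≡ = begin
        t ⊗ y₀                                          ≡⟨ cong (t ⊗_) y₀≡ ⟩
        t ⊗ emb (β̄ ∙ p ⊞ ⟦ m′ ⟧ ∙ q)                    ≡⟨ scale (sym (begin
            β̄ ∙ (⟦ m ⟧ ∙ p ⊞ β ∙ q)                     ≡⟨ expand β̄ ⟦ m ⟧ p β q ⟩
            ⟦ m ⟧ ∙ (β̄ ∙ p) ⊞ β̄ ∙ β ∙ q                 ≡⟨ cong (λ z → ⟦ m ⟧ ∙ (β̄ ∙ p) ⊞ z ∙ q)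
              (trans (conj-∙-self β) (trans (cong ⟦_⟧ norm-β) (sym (⟦⟧-* m m′)))) ⟩
            ⟦ m ⟧ ∙ (β̄ ∙ p) ⊞ ⟦ m ⟧ ∙ ⟦ m′ ⟧ ∙ q         ≡⟨ factor ⟦ m ⟧ β̄ p ⟦ m′ ⟧ q ⟩
            ⟦ m ⟧ ∙ (β̄ ∙ p ⊞ ⟦ m′ ⟧ ∙ q)                ∎)) ⟩
        emb (⟦ m ⟧ ∙ p ⊞ β ∙ q)                         ≡⟨ cong emb (arrange ⟦ m ⟧ p ⟦ x ⟧ ⟦ y ⟧ a q) ⟩
        emb (a ∙ (⟦ y ⟧ ∙ q) ⊞ ⟦ m ⟧ ∙ (p ⊞ ⟦ x ⟧ ∙ q)) ∎
        where
        expand : ∀ β̄ m p β q → β̄ ∙ (m ∙ p ⊞ β ∙ q) ≡ m ∙ (β̄ ∙ p) ⊞ β̄ ∙ β ∙ q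
        expand = solve𝒵 5 (λ β̄ m p β q → (β̄ :* (m :* p :+ β :* q)) := (m :* (β̄ :* p) :+ β̄ :* β :* q)) refl
        factor : ∀ m β̄ p m′ q → m ∙ (β̄ ∙ p) ⊞ m ∙ m′ ∙ q ≡ m ∙ (β̄ ∙ p ⊞ m′ ∙ q)
        factor = solve𝒵 5 (λ m β̄ p m′ q → (m :* (β̄ :* p) :+ m :* m′ :* q) := (m :* (β̄ :* p :+ m′ :* q)))
          refl
        arrange : ∀ m p x y a q → m ∙ p ⊞ (x ∙ m ⊞ y ∙ a) ∙ q ≡ a ∙ (y ∙ q) ⊞ m ∙ (p ⊞ x ∙ q)
        arrange = solve𝒵 6 (λ m p x y a q →
          (m :* p :+ (x :* m :+ y :* a) :* q) := (a :* (y :* q) :+ m :* (p :+ x :* q))) refl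
      -- ξ is β̄ a / m, hence t ξ = a. By y ξ + x β̄ = m′ and m ξ = β̄ a, both y ξ and m ξ lie in
      -- (β̄ , m′), and coprimality of y and m puts ξ there too.
      ξ : 𝒵
      ξ = ⟦ x ⟧ ∙ a ⊞ ⟦ y ⟧ ∙ ⟦ C ⟧
      a∙ā : a ∙ conj a ≡ ⟦ m ⟧ ∙ ⟦ C ⟧
      a∙ā = trans (∙-conj a) (trans (cong ⟦_⟧ (Primitive.norm≡ P)) (sym (⟦⟧-* m C)))
      mξ≡β̄a : ⟦ m ⟧ ∙ ξ ≡ β̄ ∙ a
      mξ≡β̄a = sym (begin
        β̄ ∙ a                                                   ≡⟨ cong (_∙ a) β̄≡ ⟩
        (⟦ x ⟧ ∙ ⟦ m ⟧ ⊞ ⟦ y ⟧ ∙ conj a) ∙ a                    ≡⟨ expand ⟦ x ⟧ ⟦ m ⟧ ⟦ y ⟧ (conj a) a ⟩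
        ⟦ m ⟧ ∙ (⟦ x ⟧ ∙ a) ⊞ ⟦ y ⟧ ∙ (a ∙ conj a)
          ≡⟨ cong (λ z → ⟦ m ⟧ ∙ (⟦ x ⟧ ∙ a) ⊞ ⟦ y ⟧ ∙ z) a∙ā ⟩
        ⟦ m ⟧ ∙ (⟦ x ⟧ ∙ a) ⊞ ⟦ y ⟧ ∙ (⟦ m ⟧ ∙ ⟦ C ⟧)           ≡⟨ factor ⟦ m ⟧ ⟦ x ⟧ a ⟦ y ⟧ ⟦ C ⟧ ⟩
        ⟦ m ⟧ ∙ ξ                                               ∎)
        where
        expand : ∀ x m y ā a → (x ∙ m ⊞ y ∙ ā) ∙ a ≡ m ∙ (x ∙ a) ⊞ y ∙ (a ∙ ā)
        expand = solve𝒵 5 (λ x m y ā a → ((x :* m :+ y :* ā) :* a) := (m :* (x :* a) :+ y :* (a :* ā))) refl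
        factor : ∀ m x a y c → m ∙ (x ∙ a) ⊞ y ∙ (m ∙ c) ≡ m ∙ (x ∙ a ⊞ y ∙ c)
        factor = solve𝒵 5 (λ m x a y c → (m :* (x :* a) :+ y :* (m :* c)) := (m :* (x :* a :+ y :* c))) refl
      yξ+xβ̄≡m′ : ⟦ y ⟧ ∙ ξ ⊞ ⟦ x ⟧ ∙ β̄ ≡ ⟦ m′ ⟧
      yξ+xβ̄≡m′ = begin
        ⟦ y ⟧ ∙ ξ ⊞ ⟦ x ⟧ ∙ β̄                                               ≡⟨
          cong (λ z → ⟦ y ⟧ ∙ ξ ⊞ ⟦ x ⟧ ∙ z) β̄≡ ⟩
        ⟦ y ⟧ ∙ ξ ⊞ ⟦ x ⟧ ∙ (⟦ x ⟧ ∙ ⟦ m ⟧ ⊞ ⟦ y ⟧ ∙ conj a)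
          ≡⟨ collect ⟦ x ⟧ ⟦ y ⟧ ⟦ m ⟧ a (conj a) ⟦ C ⟧ ⟩
        ⟦ m ⟧ ∙ (⟦ x ⟧ ∙ ⟦ x ⟧) ⊞ (a ⊞ conj a) ∙ (⟦ x ⟧ ∙ ⟦ y ⟧) ⊞ ⟦ C ⟧ ∙ (⟦ y ⟧ ∙ ⟦ y ⟧)
          ≡⟨ cong₂ _⊞_ (cong₂ _⊞_ (trans (cong (⟦ m ⟧ ∙_) (⟦⟧-* x x)) (⟦⟧-* m (x * x)))
            (trans (cong₂ _∙_ (⊞-conj a) (⟦⟧-* x y)) (⟦⟧-* (trace a) (x * y))))
            (trans (cong (⟦ C ⟧ ∙_) (⟦⟧-* y y)) (⟦⟧-* C (y * y))) ⟩
        ⟦ m * (x * x) ⟧ ⊞ ⟦ trace a * (x * y) ⟧ ⊞ ⟦ C * (y * y) ⟧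
          ≡⟨ trans (cong (_⊞ ⟦ C * (y * y) ⟧) (⟦⟧-⊞ _ _)) (⟦⟧-⊞ _ _) ⟩
        ⟦ m * (x * x) + trace a * (x * y) + C * (y * y) ⟧                    ≡⟨ cong ⟦_⟧ m′≡ ⟨
        ⟦ m′ ⟧                                                              ∎
        where
        collect : ∀ x y m a ā c → y ∙ (x ∙ a ⊞ y ∙ c) ⊞ x ∙ (x ∙ m ⊞ y ∙ ā) ≡ m ∙ (x ∙ x) ⊞
          (a ⊞ ā) ∙ (x ∙ y) ⊞ c ∙ (y ∙ y)
        collect = solve𝒵 6 (λ x y m a ā c →
          (y :* (x :* a :+ y :* c) :+ x :* (x :* m :+ y :* ā)) :=
          (m :* (x :* x) :+ (a :+ ā) :* (x :* y) :+ c :* (y :* y))) refl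
      a∈ : ∃[ h ] ∃[ k ] h * y + k * m ≡ 1ℤ → ∃[ w ] emb a ≡ t ⊗ y₀ ⊗ emb w
      a∈ (h , k , hy+km≡1) = ⟦ h ⟧ ∙ w₂ ⊞ (⟦ k ⟧ ∙ a ⊞ neg (⟦ h ⟧ ∙ ⟦ x ⟧)) ∙ w₁ , (begin
        emb a                                                                           ≡⟨ scale mξ≡β̄a ⟨
        t ⊗ emb ξ                                                                       ≡⟨
          cong (λ z → t ⊗ emb z) ξ≡ ⟩
        t ⊗ emb (⟦ h ⟧ ∙ ⟦ m′ ⟧ ⊞ κ ∙ β̄)
          ≡⟨ cong (t ⊗_) (trans (emb-⊞ _ _) (cong₂ _⊕_ (emb-∙ _ _) (emb-∙ _ _))) ⟩
        t ⊗ (emb ⟦ h ⟧ ⊗ emb ⟦ m′ ⟧ ⊕ emb κ ⊗ emb β̄)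
          ≡⟨ cong₂ (λ m b → t ⊗ (emb ⟦ h ⟧ ⊗ m ⊕ emb κ ⊗ b)) m′≡y₀w₂ β̄≡y₀w₁ ⟩
        t ⊗ (emb ⟦ h ⟧ ⊗ (y₀ ⊗ emb w₂) ⊕ emb κ ⊗ (y₀ ⊗ emb w₁))
          ≡⟨ factor t (emb ⟦ h ⟧) y₀ (emb w₂) (emb κ) (emb w₁) ⟩
        t ⊗ y₀ ⊗ (emb ⟦ h ⟧ ⊗ emb w₂ ⊕ emb κ ⊗ emb w₁)
          ≡⟨ cong (t ⊗ y₀ ⊗_) (trans (emb-⊞ _ _) (cong₂ _⊕_ (emb-∙ _ _) (emb-∙ _ _))) ⟨
        t ⊗ y₀ ⊗ emb (⟦ h ⟧ ∙ w₂ ⊞ κ ∙ w₁)                                              ∎)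
        where
        κ : 𝒵
        κ = ⟦ k ⟧ ∙ a ⊞ neg (⟦ h ⟧ ∙ ⟦ x ⟧)
        factor : ∀ (t h y u k v : 𝕂 d) → t ⊗ (h ⊗ (y ⊗ u) ⊕ k ⊗ (y ⊗ v)) ≡ t ⊗ y ⊗ (h ⊗ u ⊕ k ⊗ v)
        factor = solve𝕂 6 (λ t h y u k v →
          (t ×′ (h ×′ (y ×′ u) ⊹ k ×′ (y ×′ v))) ≔ (t ×′ y ×′ (h ×′ u ⊹ k ×′ v))) refl
        spread : ∀ h y k m ξ → (h ∙ y ⊞ k ∙ m) ∙ ξ ≡ h ∙ (y ∙ ξ) ⊞ k ∙ (m ∙ ξ)
        spread = solve𝒵 5 (λ h y k m ξ → ((h :* y :+ k :* m) :* ξ) := (h :* (y :* ξ) :+ k :* (m :* ξ))) refl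
        cancel : ∀ h y x n b k c → (n ⊞ h ∙ x) ∙ b ⊞ (h ∙ y ⊞ k ∙ (b ∙ c)) ≡ h ∙ (y ⊞ x ∙ b) ⊞ (k ∙ c ⊞ n) ∙ b
        cancel = solve𝒵 7 (λ h y x n b k c →
          ((n :+ h :* x) :* b :+ (h :* y :+ k :* (b :* c))) := (h :* (y :+ x :* b) :+ (k :* c :+ n) :* b))
          refl
        ξ≡ : ξ ≡ ⟦ h ⟧ ∙ ⟦ m′ ⟧ ⊞ κ ∙ β̄
        ξ≡ = begin
          ξ                                                             ≡⟨ ∙-identityˡ ξ ⟨
          ⟦ 1ℤ ⟧ ∙ ξ                                                    ≡⟨ cong (λ z → ⟦ z ⟧ ∙ ξ) hy+km≡1 ⟨
          ⟦ h * y + k * m ⟧ ∙ ξ                                         ≡⟨ cong (_∙ ξ)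
            (trans (cong₂ _⊞_ (⟦⟧-* h y) (⟦⟧-* k m)) (⟦⟧-⊞ _ _)) ⟨
          (⟦ h ⟧ ∙ ⟦ y ⟧ ⊞ ⟦ k ⟧ ∙ ⟦ m ⟧) ∙ ξ                           ≡⟨ spread ⟦ h ⟧ ⟦ y ⟧ ⟦ k ⟧ ⟦ m ⟧ ξ ⟩
          ⟦ h ⟧ ∙ (⟦ y ⟧ ∙ ξ) ⊞ ⟦ k ⟧ ∙ (⟦ m ⟧ ∙ ξ)
            ≡⟨ cong (λ z → ⟦ h ⟧ ∙ (⟦ y ⟧ ∙ ξ) ⊞ ⟦ k ⟧ ∙ z) mξ≡β̄a ⟩
          ⟦ h ⟧ ∙ (⟦ y ⟧ ∙ ξ) ⊞ ⟦ k ⟧ ∙ (β̄ ∙ a)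
            ≡⟨ trans (cong (_⊞ (⟦ h ⟧ ∙ (⟦ y ⟧ ∙ ξ) ⊞ ⟦ k ⟧ ∙ (β̄ ∙ a)))
            (trans (cong (_∙ β̄) (⊞-inverseˡ (⟦ h ⟧ ∙ ⟦ x ⟧))) (⟦⟧-∙ 0ℤ β̄))) (⊞-identityˡ _) ⟨
          (neg (⟦ h ⟧ ∙ ⟦ x ⟧) ⊞ ⟦ h ⟧ ∙ ⟦ x ⟧) ∙ β̄ ⊞ (⟦ h ⟧ ∙ (⟦ y ⟧ ∙ ξ) ⊞ ⟦ k ⟧ ∙ (β̄ ∙ a))
            ≡⟨ cancel ⟦ h ⟧ (⟦ y ⟧ ∙ ξ) ⟦ x ⟧ (neg (⟦ h ⟧ ∙ ⟦ x ⟧)) β̄ ⟦ k ⟧ a ⟩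
          ⟦ h ⟧ ∙ (⟦ y ⟧ ∙ ξ ⊞ ⟦ x ⟧ ∙ β̄) ⊞ κ ∙ β̄
            ≡⟨ cong (λ z → ⟦ h ⟧ ∙ z ⊞ κ ∙ β̄) yξ+xβ̄≡m′ ⟩
          ⟦ h ⟧ ∙ ⟦ m′ ⟧ ⊞ κ ∙ β̄                                        ∎

-- Lattice bases of ideals of the maximal order

module HermiteForm (d : ℕ) (d-squarefree : Squarefree d) where

  open Integers d

  opaque
    unfolding _∙_

    ⊞-coordinates : ∀ u v → u ⊞ v ≡ (proj₁ u + proj₁ v , proj₂ u + proj₂ v)
    ⊞-coordinates u v = refl

    ω∙-coordinates : ∀ u → proj₂ ((0ℤ , 1ℤ) ∙ u) ≡ proj₁ u + trω d * proj₂ u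
    ω∙-coordinates (x , y) = identity x y (trω d)
      where
      identity : ∀ x y t → 0ℤ * y + 1ℤ * x + t * (1ℤ * y) ≡ x + t * y
      identity = solve-∀

  -- e generates the second coordinates of L, and a₀ = m e its rational integers. Since ω (x + y ω)
  -- has the second coordinate x + t y, multiplication by ω shows that e divides a₀ and the first
  -- coordinate b₀ belonging to e, so e can be taken out of L.
  hermite-form : (L : 𝒵 → Set) → (∀ {u v} → L u → L v → L (u ⊞ v)) → (∀ ρ {u} → L u → L (ρ ∙ u)) →
    ∀ N → N ≢ 0ℤ → L ⟦ N ⟧ →
    ¬ ¬ (∃[ e ] ∃[ b ] ∃[ m ] e ≢ 0ℤ × Primitive 1 (b , 1ℤ) m
      × (∀ p q → L (⟦ e ⟧ ∙ ((b , 1ℤ) ∙ p ⊞ ⟦ m ⟧ ∙ q)))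
      × (∀ u → L u → ∃[ p ] ∃[ q ] u ≡ ⟦ e ⟧ ∙ ((b , 1ℤ) ∙ p ⊞ ⟦ m ⟧ ∙ q)))
  hermite-form L ⊞-closed ∙-closed N N≢0 LN k =
    subgroup-generator G₁ G₁-closed ∣ N ∣ N ℕₚ.≤-refl N≢0 G₁N λ { (e , e≢0 , (b₀ , Lb₀) , e∣) →
    subgroup-generator G₂ G₂-closed ∣ N ∣ N ℕₚ.≤-refl N≢0 LN λ { (a₀ , a₀≢0 , La₀ , a₀∣) →
    conclude e e≢0 b₀ Lb₀ e∣ a₀ a₀≢0 La₀ a₀∣ } }
    where
    combine : ∀ {u v} k → L u → L v → L (proj₁ u - k * proj₁ v , proj₂ u - k * proj₂ v)
    combine {u} {v} k Lu Lv = subst L (trans (⊞-coordinates u (⟦ - k ⟧ ∙ v)) (cong₂ _,_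
        (cong (λ z → proj₁ u + z) (trans (cong proj₁ (⟦⟧-∙ (- k) v)) (sym (ℤₚ.neg-distribˡ-* k (proj₁ v)))))
        (cong (λ z → proj₂ u + z) (trans (cong proj₂ (⟦⟧-∙ (- k) v)) (sym (ℤₚ.neg-distribˡ-* k (proj₂ v)))))))
      (⊞-closed Lu (∙-closed ⟦ - k ⟧ Lv))
    G₁ G₂ : ℤ → Set
    G₁ y = ∃[ x ] L (x , y)
    G₂ x = L ⟦ x ⟧
    G₁-closed : ∀ {x y} k → G₁ x → G₁ y → G₁ (x - k * y)
    G₁-closed k (x , Lx) (y , Ly) = x - k * y , combine k Lx Ly
    G₂-closed : ∀ {x y} k → G₂ x → G₂ y → G₂ (x - k * y)
    G₂-closed {x} {y} k Lx Ly = subst (λ z → L (x - k * y , z)) (identity k) (combine k Lx Ly)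
      where
      identity : ∀ k → 0ℤ - k * 0ℤ ≡ 0ℤ
      identity = solve-∀
    ω∈ : ∀ {x y} → L (x , y) → G₁ (x + trω d * y)
    ω∈ {x} {y} Lu = proj₁ ((0ℤ , 1ℤ) ∙ (x , y)) ,
      subst (λ z → L (proj₁ ((0ℤ , 1ℤ) ∙ (x , y)) , z)) (ω∙-coordinates (x , y)) (∙-closed (0ℤ , 1ℤ) Lu)
    drop : ∀ x → x + trω d * 0ℤ ≡ x
    drop x = trans (cong (λ z → x + z) (ℤₚ.*-zeroʳ (trω d))) (ℤₚ.+-identityʳ x)
    G₁N : G₁ N
    G₁N = subst G₁ (drop N) (ω∈ LN)
    conclude : ∀ e → e ≢ 0ℤ → ∀ b₀ → L (b₀ , e) → (∀ z → G₁ z → e ∣ℤ z) → ∀ a₀ → a₀ ≢ 0ℤ → L ⟦ a₀ ⟧ →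
      (∀ z → G₂ z → a₀ ∣ℤ z) → ⊥
    conclude e e≢0 b₀ Lb₀ e∣ a₀ a₀≢0 La₀ a₀∣ = go (e∣ a₀ (subst G₁ (drop a₀) (ω∈ La₀)))
      (∣m+n∣n⇒∣m (e∣ (b₀ + trω d * e) (ω∈ Lb₀)) (∣n⇒∣m*n (trω d) ∣-refl))
      where
      instance _ = ℤ.≢-nonZero e≢0
      go : e ∣ℤ a₀ → e ∣ℤ b₀ → ⊥
      go (divides m a₀≡) (divides b b₀≡) = k (e , b , m , e≢0 , P m∣norm , contains , contained)
        where
        a : 𝒵
        a = b , 1ℤ
        ea≡ : ⟦ e ⟧ ∙ a ≡ (b₀ , e)
        ea≡ = trans (⟦⟧-∙ e a) (cong₂ _,_ (trans (ℤₚ.*-comm e b) (sym b₀≡)) (ℤₚ.*-identityʳ e))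
        em≡ : ⟦ e ⟧ ∙ ⟦ m ⟧ ≡ ⟦ a₀ ⟧
        em≡ = trans (⟦⟧-* e m) (cong ⟦_⟧ (trans (ℤₚ.*-comm e m) (sym a₀≡)))
        Lea : L (⟦ e ⟧ ∙ a)
        Lea = subst L (sym ea≡) Lb₀
        -- conj a times e a is the integer e norm a of L, hence a multiple of a₀ = e m.
        m∣norm : m ∣ℤ norm a
        m∣norm = *-cancelˡ-∣ e (subst₂ _∣ℤ_ (trans a₀≡ (ℤₚ.*-comm m e)) refl (a₀∣ (e * norm a) (subst L (begin
          conj a ∙ (⟦ e ⟧ ∙ a)      ≡⟨ rotate (conj a) ⟦ e ⟧ a ⟩
          ⟦ e ⟧ ∙ (a ∙ conj a)      ≡⟨ cong (⟦ e ⟧ ∙_) (∙-conj a) ⟩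
          ⟦ e ⟧ ∙ ⟦ norm a ⟧        ≡⟨ ⟦⟧-* e (norm a) ⟩
          ⟦ e * norm a ⟧            ∎) (∙-closed (conj a) Lea))))
          where
          open ≡-Reasoning
          rotate : ∀ u v w → u ∙ (v ∙ w) ≡ v ∙ (w ∙ u)
          rotate = solve𝒵 3 (λ u v w → (u :* (v :* w)) := (v :* (w :* u))) refl
        P : m ∣ℤ norm a → Primitive 1 a m
        P (divides C norm≡) = mkPrimitive C (inOrder (divides 1ℤ refl))
          (λ m≡0 → a₀≢0 (trans a₀≡ (cong (_* e) m≡0))) (trans norm≡ (ℤₚ.*-comm C m))
          -- For a common prime r, r² ∣ m C = norm a and r ∣ trace a, so `integrality` would make r
          -- divide the second coordinate 1 of a. This is where maximality of the order is used.
          λ r r-prime r∣m r∣T r∣C → prime-∤1 r-prime (proj₂ (integrality d-squarefree r-prime a r∣T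
            (subst (+ r * + r ∣ℤ_) (sym norm≡)
              (∣-trans (*-monoʳ-∣ (+ r) r∣m)
              (subst₂ _∣ℤ_ (ℤₚ.*-comm m (+ r)) (ℤₚ.*-comm m C) (*-monoʳ-∣ m r∣C))))))
        contains : ∀ p q → L (⟦ e ⟧ ∙ (a ∙ p ⊞ ⟦ m ⟧ ∙ q))
        contains p q = subst L (rearrange ⟦ e ⟧ a ⟦ m ⟧ p q)
          (⊞-closed (∙-closed p Lea) (∙-closed q (subst L (sym em≡) La₀)))
          where
          rearrange : ∀ e a m p q → p ∙ (e ∙ a) ⊞ q ∙ (e ∙ m) ≡ e ∙ (a ∙ p ⊞ m ∙ q)
          rearrange = solve𝒵 5 (λ e a m p q → (p :* (e :* a) :+ q :* (e :* m)) := (e :* (a :* p :+ m :* q)))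
            refl
        contained : ∀ u → L u → ∃[ p ] ∃[ q ] u ≡ ⟦ e ⟧ ∙ (a ∙ p ⊞ ⟦ m ⟧ ∙ q)
        contained (x , y) Lu = from-coordinates (e∣ y (x , Lu))
          where
          open ≡-Reasoning
          from-coordinates : e ∣ℤ y → ∃[ p ] ∃[ q ] (x , y) ≡ ⟦ e ⟧ ∙ (a ∙ p ⊞ ⟦ m ⟧ ∙ q)
          from-coordinates (divides y′ y≡) =
            finish (a₀∣ (x - y′ * b₀) (subst (λ z → L (x - y′ * b₀ , z))
            (trans (cong (_- y′ * e) y≡) (ℤₚ.+-inverseʳ (y′ * e))) (combine y′ Lu Lb₀)))
            where
            finish : a₀ ∣ℤ x - y′ * b₀ → ∃[ p ] ∃[ q ] (x , y) ≡ ⟦ e ⟧ ∙ (a ∙ p ⊞ ⟦ m ⟧ ∙ q)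
            finish (divides l l≡) = ⟦ y′ ⟧ , ⟦ l ⟧ , sym (begin
              ⟦ e ⟧ ∙ (a ∙ ⟦ y′ ⟧ ⊞ ⟦ m ⟧ ∙ ⟦ l ⟧)
                ≡⟨ rearrange ⟦ e ⟧ a ⟦ y′ ⟧ ⟦ m ⟧ ⟦ l ⟧ ⟩
              ⟦ y′ ⟧ ∙ (⟦ e ⟧ ∙ a) ⊞ ⟦ l ⟧ ∙ (⟦ e ⟧ ∙ ⟦ m ⟧)
                ≡⟨ cong₂ (λ v w → ⟦ y′ ⟧ ∙ v ⊞ ⟦ l ⟧ ∙ w) ea≡ em≡ ⟩
              ⟦ y′ ⟧ ∙ (b₀ , e) ⊞ ⟦ l ⟧ ∙ ⟦ a₀ ⟧
                ≡⟨ cong₂ _⊞_ (⟦⟧-∙ y′ (b₀ , e)) (⟦⟧-* l a₀) ⟩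
              (y′ * b₀ , y′ * e) ⊞ ⟦ l * a₀ ⟧                         ≡⟨ ⊞-coordinates _ _ ⟩
              (y′ * b₀ + l * a₀ , y′ * e + 0ℤ)
                ≡⟨ cong₂ _,_ (trans (cong (λ z → y′ * b₀ + z) (sym l≡)) (add-back (y′ * b₀) x))
                (trans (ℤₚ.+-identityʳ (y′ * e)) (sym y≡)) ⟩
              (x , y)                                                 ∎)
              where
              add-back : ∀ c x → c + (x - c) ≡ x
              add-back = solve-∀
              rearrange : ∀ e a y m l → e ∙ (a ∙ y ⊞ m ∙ l) ≡ y ∙ (e ∙ a) ⊞ l ∙ (e ∙ m)
              rearrange = solve𝒵 5 (λ e a y m l →
                (e :* (a :* y :+ m :* l)) := (y :* (e :* a) :+ l :* (e :* m))) refl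

-- Ideals of norm q² at conductor primes and the class number of the maximal order

module SquareBlock (d : ℕ) (2≤d : 2 ≤ d) (d-squarefree : Squarefree d) (f : ℕ) (f-squarefree : Squarefree f)
  (card-f : HasCardinality (Pic (𝒪 d f)) 2) (card-K : HasCardinality (Pic (𝒪K d)) 2) where

  open Field d
  open IntegralClosure d 2≤d d-squarefree using (𝒪K⇒emb; emb⇒𝒪K)
  open HermiteForm d d-squarefree using (hermite-form; ⊞-coordinates)
  open Extension d 2≤d d-squarefree f f-squarefree
  private
    module 𝒪f = ClassGroup d 2≤d d-squarefree f

  module _ (q : ℕ) (q-prime : Prime q) (q∣f : q ∣ f)
    (all-generated : ∀ {a m} → Primitive 1 a m → (∀ r → Prime r → r ∣ f → ¬ + r ∣ℤ m) →
      ∃[ y ] IsGenerator a m y) where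

    -- The form m x² + trace a x y + C y² takes a value m′ prime to f, and (a , m) is equivalent to
    -- (conj β , m′) for the corresponding β. So every class is met by an ideal prime to f.
    all-generated′ : ∀ {b m} → Primitive 1 (b , 1ℤ) m → ∃[ y ] IsGenerator (b , 1ℤ) m y
    all-generated′ {b} {m} P = go (coprime-value {f} f-squarefree m (trace a) C (primitive-coprime P))
      where
      a : 𝒵
      a = b , 1ℤ
      C : ℤ
      C = Primitive.cofactor P
      go : ∃[ x ] ∃[ y ] (∀ r → Prime r → r ∣ f → ¬ + r ∣ℤ m * (x * x) + trace a * (x * y) + C * (y * y)) ×
        (∀ r → Prime r → + r ∣ℤ y → ¬ + r ∣ℤ m) →
        ∃[ y ] IsGenerator a m y
      go (x , y , f-coprime , m-coprime) =
        transfer-generator P {x} {y} refl m-coprime Nβ≢0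
          (proj₂ (all-generated (mkPrimitive m inOrder₁ m′≢0
          (trans (norm-conj β) (trans norm-β′ (ℤₚ.*-comm m m′))) β̄-coprime) f-coprime))
        where
        m′ : ℤ
        m′ = m * (x * x) + trace a * (x * y) + C * (y * y)
        β : 𝒵
        β = ⟦ x ⟧ ∙ ⟦ m ⟧ ⊞ ⟦ y ⟧ ∙ a
        norm-β′ : norm β ≡ m * m′
        norm-β′ = norm-β P {x} {y} refl m-coprime
        m′≢0 : m′ ≢ 0ℤ
        m′≢0 m′≡0 = f-coprime q q-prime q∣f (subst (+ q ∣ℤ_) (sym m′≡0) (divides 0ℤ refl))
        Nβ≢0 : norm β ≢ 0ℤ
        Nβ≢0 Nβ≡0 = Sum.[ Primitive.nonzero P , m′≢0 ] (ℤₚ.i*j≡0⇒i≡0∨j≡0 m (trans (sym norm-β′) Nβ≡0))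
        im-β : proj₂ β ≡ y
        im-β = trans (cong proj₂ (trans (cong₂ _⊞_ (⟦⟧-* x m) (⟦⟧-∙ y a)) (⊞-coordinates _ _)))
          (trans (ℤₚ.+-identityˡ (y * 1ℤ)) (ℤₚ.*-identityʳ y))
        β̄-coprime : ∀ r → Prime r → + r ∣ℤ m′ → + r ∣ℤ trace (conj β) → + r ∣ℤ m → ⊥
        β̄-coprime r r-prime r∣m′ r∣T r∣m =
          m-coprime r r-prime (subst (+ r ∣ℤ_) im-β (proj₂ (integrality d-squarefree r-prime β
          (subst (+ r ∣ℤ_) (trace-conj β) r∣T)
          (subst (+ r * + r ∣ℤ_) (sym norm-β′)
            (∣-trans (*-monoʳ-∣ (+ r) r∣m′)
            (subst (_∣ℤ m * m′) (ℤₚ.*-comm m′ (+ r))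
            (subst (m′ * + r ∣ℤ_) (ℤₚ.*-comm m′ m) (*-monoʳ-∣ m′ r∣m)))))))) r∣m

    Principal : Pred (𝕂 d) 0ℓ → Set
    Principal A = ∃[ x ] Invertible x × A ≐ (x • 𝒪K d)

    -- For a denominator c of A, the ideal c A of 𝒪_K gets a basis e (a , m) by `hermite-form`, and
    -- a generator of (a , m) yields one of A. The double negation is inherited from `hermite-form`,
    -- as membership in A need not be decidable.
    invertible⇒principal : (X : InvertibleFractionalIdeal (𝒪K d)) → ¬ ¬ Principal (ideal X)
    invertible⇒principal X not-principal =
      from-denominators denominator (IsFractionalIdeal.denominator B-fractional)
      where
      open InvertibleFractionalIdeal X using (isFractionalIdeal; inverse) renaming (ideal to A)
      open IsFractionalIdeal isFractionalIdeal using (⊕-closed; ⊗-closed; denominator)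
      B : Pred (𝕂 d) 0ℓ
      B = proj₁ inverse
      B-fractional : IsFractionalIdeal (𝒪K d) B
      B-fractional = proj₁ (proj₂ inverse)
      from-denominators : ∃[ c ] c ∈ 𝒪K d × c ≢ 0𝕂 × (∀ {x} → x ∈ A → c ⊗ x ∈ 𝒪K d) →
        ∃[ c ] c ∈ 𝒪K d × c ≢ 0𝕂 × (∀ {x} → x ∈ B → c ⊗ x ∈ 𝒪K d) → ⊥
      from-denominators (c , c∈ , c≢0 , cA⊆) (c′ , c′∈ , c′≢0 , c′B⊆) = with-integers (𝒪K⇒emb c∈) (𝒪K⇒emb c′∈)
        where
        c′AB⊆A : ∀ {z} → z ∈ A · B → c′ ⊗ z ∈ A
        c′AB⊆A zero = subst A (sym (⊗-zeroʳ c′)) (IsFractionalIdeal.0∈ isFractionalIdeal)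
        c′AB⊆A (add {x} {y} {z} x∈ y∈ z∈) =
          subst A (sym (rearrange c′ x y z)) (⊕-closed (⊗-closed {c′ ⊗ y} {x} (c′B⊆ y∈) x∈) (c′AB⊆A z∈))
          where
          rearrange : ∀ (c x y z : 𝕂 d) → c ⊗ (x ⊗ y ⊕ z) ≡ (c ⊗ y) ⊗ x ⊕ c ⊗ z
          rearrange = solve𝕂 4 (λ c x y z → (c ×′ (x ×′ y ⊹ z)) ≔ ((c ×′ y) ×′ x ⊹ c ×′ z)) refl
        -- 1 ∈ A B and c′ B ⊆ 𝒪_K give c′ = c′ · 1 ∈ c′ A B ⊆ A. So c c′ lies in c A, and its norm
        -- is the nonzero integer that `hermite-form` asks for.
        c′∈A : c′ ∈ A
        c′∈A = subst A (⊗-identityʳ c′)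
          (c′AB⊆A (proj₂ (proj₂ (proj₂ inverse)) (subst (𝒪K d) emb-1 (emb⇒𝒪K ⟦ 1ℤ ⟧))))
        L : 𝒵 → Set
        L u = ∃[ z ] z ∈ A × emb u ≡ c ⊗ z
        L-⊞ : ∀ {u v} → L u → L v → L (u ⊞ v)
        L-⊞ {u} {v} (z , z∈ , u≡) (z′ , z′∈ , v≡) = z ⊕ z′ , ⊕-closed z∈ z′∈ ,
          trans (emb-⊞ u v) (trans (cong₂ _⊕_ u≡ v≡) (sym (⊗-distribˡ-⊕ c z z′)))
        L-∙ : ∀ ρ {u} → L u → L (ρ ∙ u)
        L-∙ ρ {u} (z , z∈ , u≡) = emb ρ ⊗ z , ⊗-closed {emb ρ} {z} (emb⇒𝒪K ρ) z∈ ,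
          trans (emb-∙ ρ u) (trans (cong (emb ρ ⊗_) u≡) (⊗-swap (emb ρ) c z))
        with-integers : ∃[ γ ] c ≡ emb γ → ∃[ γ′ ] c′ ≡ emb γ′ → ⊥
        with-integers (γ , c≡γ) (γ′ , c′≡γ′) =
          hermite-form L L-⊞ L-∙ (norm (γ ∙ γ′)) N≢0 LN λ { (e , b , m , e≢0 , P , contains , contained) →
            principal e e≢0 P contains contained (all-generated′ P) }
          where
          Nγ≢0 : norm γ ≢ 0ℤ
          Nγ≢0 = norm≢0 2≤d d-squarefree (λ eq → c≢0 (trans c≡γ eq))
          Nγ′≢0 : norm γ′ ≢ 0ℤ
          Nγ′≢0 = norm≢0 2≤d d-squarefree (λ eq → c′≢0 (trans c′≡γ′ eq))
          N≢0 : norm (γ ∙ γ′) ≢ 0ℤ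
          N≢0 eq = Sum.[ Nγ≢0 , Nγ′≢0 ] (ℤₚ.i*j≡0⇒i≡0∨j≡0 (norm γ) (trans (sym (norm-∙ γ γ′)) eq))
          LN : L ⟦ norm (γ ∙ γ′) ⟧
          LN = subst L (conj-∙-self (γ ∙ γ′))
            (L-∙ (conj (γ ∙ γ′)) (c′ , c′∈A , trans (emb-∙ γ γ′) (cong₂ _⊗_ (sym c≡γ) (sym c′≡γ′))))
          c-inv : Invertible c
          c-inv = subst Invertible (sym c≡γ) (emb-invertible Nγ≢0)
          principal : ∀ e → e ≢ 0ℤ → ∀ {b m} → Primitive 1 (b , 1ℤ) m →
            (∀ p q → L (⟦ e ⟧ ∙ ((b , 1ℤ) ∙ p ⊞ ⟦ m ⟧ ∙ q))) →
            (∀ u → L u → ∃[ p ] ∃[ q ] u ≡ ⟦ e ⟧ ∙ ((b , 1ℤ) ∙ p ⊞ ⟦ m ⟧ ∙ q)) →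
            ∃[ y ] IsGenerator (b , 1ℤ) m y → ⊥
          principal e e≢0 {b} {m} P contains contained (y , y-inv , (p₀ , q₀ , _ , _ , y≡) , (w₁ , a≡yw₁) ,
            (w₂ , m≡yw₂)) =
            not-principal (x , x-inv , (λ z∈ → A⊆ z∈ (𝒪K⇒emb (cA⊆ z∈))) ,
              λ { (w , w∈ , z≡) → subst A (sym z≡) (⊆A (𝒪K⇒emb w∈)) })
            where
            open ≡-Reasoning
            a : 𝒵
            a = b , 1ℤ
            c⁻¹ x : 𝕂 d
            c⁻¹ = proj₁ c-inv
            x = c⁻¹ ⊗ (emb ⟦ e ⟧ ⊗ y)
            x-inv : Invertible x
            x-inv = Invertible-⊗ c⁻¹ (emb ⟦ e ⟧ ⊗ y) (c , trans (⊗-comm c⁻¹ c) (proj₂ c-inv))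
              (Invertible-⊗ (emb ⟦ e ⟧) y (subst Invertible (sym (emb-⟦⟧ e)) (fromℤ-invertible e≢0)) y-inv)
            cx≡ : ∀ w → c ⊗ (x ⊗ w) ≡ emb ⟦ e ⟧ ⊗ (y ⊗ w)
            cx≡ w = trans (regroup c c⁻¹ (emb ⟦ e ⟧) y w)
              (trans (cong (_⊗ (emb ⟦ e ⟧ ⊗ (y ⊗ w))) (proj₂ c-inv)) (⊗-identityˡ _))
              where
              regroup : ∀ (c i e y w : 𝕂 d) → c ⊗ (i ⊗ (e ⊗ y) ⊗ w) ≡ (c ⊗ i) ⊗ (e ⊗ (y ⊗ w))
              regroup = solve𝕂 5 (λ c i e y w → (c ×′ (i ×′ (e ×′ y) ×′ w)) ≔ ((c ×′ i) ×′ (e ×′ (y ×′ w))))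
                refl
            A⊆ : ∀ {z} → z ∈ A → ∃[ u ] c ⊗ z ≡ emb u → z ∈ (x • 𝒪K d)
            A⊆ {z} z∈ (u , cz≡u) = let p , q , u≡ = contained u (z , z∈ , sym cz≡u) in
              emb (w₁ ∙ p ⊞ w₂ ∙ q) , emb⇒𝒪K _ , ⊗-cancelˡ c c-inv (begin
                c ⊗ z                                            ≡⟨ cz≡u ⟩
                emb u                                            ≡⟨ cong emb u≡ ⟩
                emb (⟦ e ⟧ ∙ (a ∙ p ⊞ ⟦ m ⟧ ∙ q))                ≡⟨ emb-∙ _ _ ⟩
                emb ⟦ e ⟧ ⊗ emb (a ∙ p ⊞ ⟦ m ⟧ ∙ q)              ≡⟨ cong (emb ⟦ e ⟧ ⊗_) (begin
                  emb (a ∙ p ⊞ ⟦ m ⟧ ∙ q)                        ≡⟨ trans (emb-⊞ _ _)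
                    (cong₂ _⊕_ (emb-∙ a p) (emb-∙ ⟦ m ⟧ q)) ⟩
                  emb a ⊗ emb p ⊕ emb ⟦ m ⟧ ⊗ emb q
                    ≡⟨ cong₂ (λ a m → a ⊗ emb p ⊕ m ⊗ emb q) a≡yw₁ m≡yw₂ ⟩
                  y ⊗ emb w₁ ⊗ emb p ⊕ y ⊗ emb w₂ ⊗ emb q
                    ≡⟨ factor y (emb w₁) (emb p) (emb w₂) (emb q) ⟩
                  y ⊗ (emb w₁ ⊗ emb p ⊕ emb w₂ ⊗ emb q)
                    ≡⟨ cong (y ⊗_) (trans (emb-⊞ _ _) (cong₂ _⊕_ (emb-∙ w₁ p) (emb-∙ w₂ q))) ⟨
                  y ⊗ emb (w₁ ∙ p ⊞ w₂ ∙ q)                      ∎) ⟩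
                emb ⟦ e ⟧ ⊗ (y ⊗ emb (w₁ ∙ p ⊞ w₂ ∙ q))          ≡⟨ cx≡ _ ⟨
                c ⊗ (x ⊗ emb (w₁ ∙ p ⊞ w₂ ∙ q))                  ∎)
              where
              factor : ∀ (y u p v q : 𝕂 d) → y ⊗ u ⊗ p ⊕ y ⊗ v ⊗ q ≡ y ⊗ (u ⊗ p ⊕ v ⊗ q)
              factor = solve𝕂 5 (λ y u p v q → (y ×′ u ×′ p ⊹ y ×′ v ×′ q) ≔ (y ×′ (u ×′ p ⊹ v ×′ q))) refl
            ⊆A : ∀ {w} → ∃[ ρ ] w ≡ emb ρ → x ⊗ w ∈ A
            ⊆A {w} (ρ , w≡ρ) = from-L (subst L (rearrange ⟦ e ⟧ a p₀ ⟦ m ⟧ q₀ ρ) (L-∙ ρ (contains p₀ q₀)))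
              where
              rearrange : ∀ e a p m q ρ → ρ ∙ (e ∙ (a ∙ p ⊞ m ∙ q)) ≡ e ∙ ((a ∙ p ⊞ m ∙ q) ∙ ρ)
              rearrange = solve𝒵 6 (λ e a p m q ρ →
                (ρ :* (e :* (a :* p :+ m :* q))) := (e :* ((a :* p :+ m :* q) :* ρ))) refl
              from-L : L (⟦ e ⟧ ∙ ((a ∙ p₀ ⊞ ⟦ m ⟧ ∙ q₀) ∙ ρ)) → x ⊗ w ∈ A
              from-L (z , z∈ , eyρ≡cz) = subst A (⊗-cancelˡ c c-inv (begin
                c ⊗ z                                                  ≡⟨ eyρ≡cz ⟨
                emb (⟦ e ⟧ ∙ ((a ∙ p₀ ⊞ ⟦ m ⟧ ∙ q₀) ∙ ρ))
                  ≡⟨ trans (emb-∙ _ _) (cong (emb ⟦ e ⟧ ⊗_) (emb-∙ _ _)) ⟩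
                emb ⟦ e ⟧ ⊗ (emb (a ∙ p₀ ⊞ ⟦ m ⟧ ∙ q₀) ⊗ emb ρ)
                  ≡⟨ cong₂ (λ y w → emb ⟦ e ⟧ ⊗ (y ⊗ w)) (sym y≡) (sym w≡ρ) ⟩
                emb ⟦ e ⟧ ⊗ (y ⊗ w)                                    ≡⟨ cx≡ w ⟨
                c ⊗ (x ⊗ w)                                            ∎)) z∈

    principal-equivalent : ∀ {X Y : InvertibleFractionalIdeal (𝒪K d)} → Principal (ideal X) →
      Principal (ideal Y) → Setoid._≈_ (Pic (𝒪K d)) X Y
    principal-equivalent {X} {Y} (x , x-inv , X⊆ , ⊆X) (y , y-inv@(y⁻¹ , yy⁻¹≡1) , Y⊆ , ⊆Y) =
      x ⊗ y⁻¹ , Invertible-⊗ x y⁻¹ x-inv (y , trans (⊗-comm y⁻¹ y) yy⁻¹≡1) ,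
      (λ z∈ → let w , w∈ , z≡ = X⊆ z∈ in y ⊗ w , ⊆Y (w , w∈ , refl) , trans z≡ (sym (cancel w))) ,
      λ { (z , z∈ , refl) → let w , w∈ , z≡ = Y⊆ z∈ in ⊆X (w , w∈ , trans (cong (x ⊗ y⁻¹ ⊗_) z≡) (cancel w)) }
      where
      cancel : ∀ w → x ⊗ y⁻¹ ⊗ (y ⊗ w) ≡ x ⊗ w
      cancel w = trans (regroup x y⁻¹ y w) (trans (cong (_⊗ (x ⊗ w)) yy⁻¹≡1) (⊗-identityˡ (x ⊗ w)))
        where
        regroup : ∀ (x i y w : 𝕂 d) → x ⊗ i ⊗ (y ⊗ w) ≡ (y ⊗ i) ⊗ (x ⊗ w)
        regroup = solve𝕂 4 (λ x i y w → (x ×′ i ×′ (y ×′ w)) ≔ ((y ×′ i) ×′ (x ×′ w))) refl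

    -- Up to double negation all invertible ideals of 𝒪_K are principal, hence equivalent, while
    -- `card-K` provides two inequivalent ones.
    class-number-contradiction : ⊥
    class-number-contradiction = invertible⇒principal X₀ λ X₀-principal →
      invertible⇒principal X₁ λ X₁-principal →
      0≢1 (trans (sym (inverseˡ {x = zero} {y = X₀} (Setoid.refl (Pic (𝒪K d)) {X₀})))
        (trans (to-cong {X₀} {X₁} (principal-equivalent {X₀} {X₁} X₀-principal X₁-principal))
          (inverseˡ {x = suc zero} {y = X₁} (Setoid.refl (Pic (𝒪K d)) {X₁}))))
      where
      open Inverse card-K using (from; to-cong; inverseˡ)
      X₀ X₁ : InvertibleFractionalIdeal (𝒪K d)
      X₀ = from zero
      X₁ = from (suc zero)
      0≢1 : ¬ (zero {1} ≡ suc zero)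
      0≢1 ()

  -- The ideal (q w , q²) extends to q in the maximal order.  If it were not principal then,
  -- as |Pic 𝒪_f| = 2, every class of 𝒪_f would extend to the principal class.
  square-splits : ∀ {q a w} → Prime q → q ∣ f → a ≡ ⟦ + q ⟧ ∙ w → ¬ + q ∣ℤ norm w →
    Primitive f a (+ q * + q) → Splits f a (+ q * + q)
  square-splits {q} {a} {w} q-prime q∣f a≡qw q∤Nw P = decidable-stable (𝒪f.splits? card-f P) λ ¬splits →
    class-number-contradiction q q-prime q∣f λ Q coprime →
      Sum.[ generator-from-unit-class Q coprime
          , generator-from-extension-class Q coprime (+prime≢0 q-prime) a≡qw (∤⇒bezout q-prime q∤Nw) ]
        (𝒪f.two-classes card-f P (lift-primitive Q coprime) ¬splits)

-- Weights of atoms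

module Atoms (d : ℕ) (2≤d : 2 ≤ d) (d-squarefree : Squarefree d) (f : ℕ) where

  open Field d

  D : Pred (𝕂 d) 0ℓ
  D = 𝒪 d f

  abs-norm-⟦⟧ : ∀ q → ∣ norm ⟦ + q ⟧ ∣ ≡ q ℕ.* q
  abs-norm-⟦⟧ q = trans (cong ∣_∣ (norm-⟦⟧ (+ q))) (ℤₚ.abs-* (+ q) (+ q))

  unit⇒norm : ∀ {u} → IsUnit D (emb u) → ∣ norm u ∣ ≡ 1
  unit⇒norm {u} (_ , y , y∈ , uy≡1) = let v , _ , y≡v = 𝒪⇒emb {f} y∈ in
    ℕₚ.m*n≡1⇒m≡1 ∣ norm u ∣ ∣ norm v ∣ (trans (sym (abs-norm-∙ u v)) (trans (cong (λ w → ∣ norm w ∣)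
      (emb-injective 2≤d d-squarefree
        (trans (emb-∙ u v) (trans (cong (emb u ⊗_) (sym y≡v)) (trans uy≡1 (sym emb-1))))))
        (cong ∣_∣ (norm-⟦⟧ 1ℤ))))

  norm⇒unit : ∀ {u} → InOrder f u → ∣ norm u ∣ ≡ 1 → IsUnit D (emb u)
  norm⇒unit {u} u∈ ∣Nu∣≡1 = emb⇒𝒪 u∈ , go (∣i∣≡∣j∣⇒i≡±j (norm u) 1ℤ ∣Nu∣≡1)
    where
    go : ∃[ ε ] IsSign ε × norm u ≡ ε * 1ℤ → ∃[ y ] y ∈ D × emb u ⊗ y ≡ 1𝕂
    go (ε , ε-sign , Nu≡ε) = emb (conj u ∙ ⟦ ε ⟧) , emb⇒𝒪 (∙-inOrder (conj-inOrder u∈) (⟦⟧-inOrder ε)) ,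
      trans (sym (emb-∙ u _)) (trans
        (cong emb (trans (sym (∙-assoc u (conj u) ⟦ ε ⟧))
        (trans (cong (_∙ ⟦ ε ⟧) (trans (∙-conj u) (cong ⟦_⟧ (trans Nu≡ε (ℤₚ.*-identityʳ ε)))))
        (trans (⟦⟧-* ε ε) (cong ⟦_⟧ (sign² ε-sign)))))) emb-1)

  Irreducible : 𝒵 → Set
  Irreducible u = norm u ≢ 0ℤ × ∣ norm u ∣ ≢ 1 ×
    (∀ v w → InOrder f v → InOrder f w → u ≡ v ∙ w → ∣ norm v ∣ ≢ 1 → ∣ norm w ∣ ≡ 1)

  nonUnit : ∀ {u} → InOrder f u → ∣ norm u ∣ ≢ 1 → NonUnit D (emb u)
  nonUnit u∈ ∣Nu∣≢1 = emb⇒𝒪 u∈ , λ unit → ∣Nu∣≢1 (unit⇒norm unit)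

  atom⇒irreducible : ∀ {u} → InOrder f u → IsAtom D (emb u) → Irreducible u
  atom⇒irreducible {u} u∈ ((_ , ¬unit) , u≢0 , indecomposable) = norm≢0 2≤d d-squarefree u≢0 ,
    (λ ∣Nu∣≡1 → ¬unit (norm⇒unit u∈ ∣Nu∣≡1)) ,
    λ v w v∈ w∈ u≡vw ∣Nv∣≢1 → decidable-stable (∣ norm w ∣ ℕₚ.≟ 1) λ ∣Nw∣≢1 →
      indecomposable (emb v , emb w , nonUnit v∈ ∣Nv∣≢1 , nonUnit w∈ ∣Nw∣≢1 ,
        trans (cong emb u≡vw) (emb-∙ v w))

  norm⇒atom : ∀ {u} → InOrder f u → norm u ≢ 0ℤ → ∣ norm u ∣ ≢ 1 →
    (∀ v w → InOrder f v → InOrder f w → ∣ norm v ∣ ℕ.* ∣ norm w ∣ ≡ ∣ norm u ∣ → ∣ norm v ∣ ≡ 1 ⊎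
      ∣ norm w ∣ ≡ 1) →
    IsAtom D (emb u)
  norm⇒atom {u} u∈ Nu≢0 ∣Nu∣≢1 factors = nonUnit u∈ ∣Nu∣≢1 ,
    (λ u≡0 → Nu≢0 (trans (cong norm (emb≡0⇒≡0 2≤d d-squarefree u≡0)) (norm-⟦⟧ 0ℤ))) ,
    λ { (a , b , (a∈ , ¬a-unit) , (b∈ , ¬b-unit) , u≡ab) →
      decompose (𝒪⇒emb a∈) (𝒪⇒emb b∈) ¬a-unit ¬b-unit u≡ab }
    where
    decompose : ∀ {a b} → ∃[ v ] InOrder f v × a ≡ emb v → ∃[ w ] InOrder f w × b ≡ emb w →
      ¬ IsUnit D a → ¬ IsUnit D b → emb u ≡ a ⊗ b → ⊥
    decompose (v , v∈ , refl) (w , w∈ , refl) ¬v-unit ¬w-unit u≡vw =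
      Sum.[ (λ ∣Nv∣≡1 → ¬v-unit (norm⇒unit v∈ ∣Nv∣≡1)) , (λ ∣Nw∣≡1 → ¬w-unit (norm⇒unit w∈ ∣Nw∣≡1)) ]
        (factors v w v∈ w∈ (trans (sym (abs-norm-∙ v w))
          (cong (λ z → ∣ norm z ∣) (sym (emb-injective 2≤d d-squarefree (trans u≡vw (sym (emb-∙ v w))))))))

-- Elements whose norm is divisible by a conductor prime

module ConductorPrime (d : ℕ) (f f′ q : ℕ) (q-prime : Prime q) (f≡f′q : f ≡ f′ ℕ.* q) where

  open Primes d

  q∣f : q ∣ f
  q∣f = ℕ∣.divides f′ f≡f′q

  private
    instance _ = ℤ.≢-nonZero (+prime≢0 q-prime)

  -- q ∣ f divides the second coordinate, so modulo q the norm is the square of the first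
  -- coordinate, and q divides both.
  quotient-inOrder : ∀ u → InOrder f u → + q ∣ℤ norm u →
    ∃[ w ] InOrder f′ w × u ≡ ⟦ + q ⟧ ∙ w
  quotient-inOrder u (inOrder f∣y) q∣N = go (quotient-by u (∣im∣norm⇒∣re q-prime u q∣y q∣N , q∣y))
    where
    q∣y : + q ∣ℤ proj₂ u
    q∣y = ∣-trans {j = + f} (∣ᵤ⇒∣ q∣f) f∣y
    go : ∃[ w ] u ≡ ⟦ + q ⟧ ∙ w × proj₂ u ≡ + q * proj₂ w → ∃[ w ] InOrder f′ w × u ≡ ⟦ + q ⟧ ∙ w
    go (w , u≡qw , y≡) = w , inOrder
      (*-cancelˡ-∣ (+ q) (subst₂ _∣ℤ_ (trans (cong +_ f≡f′q) (trans (ℤₚ.pos-* f′ q) (ℤₚ.*-comm (+ f′) (+ q))))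
      y≡ f∣y)) , u≡qw

  abs-norm-quotient : ∀ {u w} → u ≡ ⟦ + q ⟧ ∙ w → ∣ norm u ∣ ≡ q ℕ.* q ℕ.* ∣ norm w ∣
  abs-norm-quotient {w = w} u≡qw =
    trans (cong ∣_∣ (norm-quotient (+ q) u≡qw))
    (trans (ℤₚ.abs-* (+ q * + q) (norm w)) (cong (ℕ._* ∣ norm w ∣) (ℤₚ.abs-* (+ q) (+ q))))

  -- A norm from the order of conductor f that is divisible by q is even divisible by q².
  norm-≢q : ∀ γ → InOrder f γ → ∣ norm γ ∣ ≢ q
  norm-≢q γ γ∈ ∣Nγ∣≡q = go (quotient-inOrder γ γ∈ (∣ᵤ⇒∣ (subst (q ∣_) (sym ∣Nγ∣≡q) ℕ∣.∣-refl)))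
    where
    instance _ = ℕ.≢-nonZero {q} λ q≡0 → +prime≢0 q-prime (cong +_ q≡0)
    go : ∃[ w ] InOrder f′ w × γ ≡ ⟦ + q ⟧ ∙ w → ⊥
    go (w , _ , γ≡qw) = prime-≢1 q-prime (ℕₚ.m*n≡1⇒m≡1 q ∣ norm w ∣ (ℕₚ.*-cancelˡ-≡ (q ℕ.* ∣ norm w ∣) 1 q
      (trans (sym (ℕₚ.*-assoc q q ∣ norm w ∣))
        (trans (sym (abs-norm-quotient γ≡qw)) (trans ∣Nγ∣≡q (sym (ℕₚ.*-identityʳ q)))))))

module Weights (d : ℕ) (2≤d : 2 ≤ d) (d-squarefree : Squarefree d) (f : ℕ) (f-squarefree : Squarefree f)
  (no-split : ∀ p → Split d p → ¬ p ∣ f)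
  (card-f : HasCardinality (Pic (𝒪 d f)) 2) (card-K : HasCardinality (Pic (𝒪K d)) 2)
  (no-ramified-norm : ∀ {p f′} → Ramified d p → f ≡ f′ ℕ.* p → ∀ w → Integers.InOrder d f′ w →
    ∣ Integers.norm d w ∣ ≢ p) where

  open Field d
  open Atoms d 2≤d d-squarefree f
  open ClassGroup d 2≤d d-squarefree f using (splits?; product-splits)
  open SquareBlock d 2≤d d-squarefree f f-squarefree card-f card-K using (square-splits)

  NormPrime : ℕ → Set
  NormPrime q = ∃[ γ ] InOrder f γ × ∣ norm γ ∣ ≡ q

  -- A nonprincipal prime ideal of norm q counts 1 if it is prime to the
  -- conductor and 3 ≡ -1 (mod 4) otherwise, a principal one counts 2.
  -- Modulo 4, the norm of an atom then has total weight 2.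
  data Weight (q : ℕ) : ℕ → Set where
    principal : NormPrime q → Weight q 2
    ramified  : ¬ NormPrime q → q ∣ f × Ramified d q → Weight q 3
    ordinary  : ¬ NormPrime q → ¬ (q ∣ f × Ramified d q) → Weight q 1

  Weight-unique : ∀ {q v w} → Weight q v → Weight q w → v ≡ w
  Weight-unique (principal _) (principal _) = refl
  Weight-unique (principal q-norm) (ramified ¬q-norm _) = contradiction q-norm ¬q-norm
  Weight-unique (principal q-norm) (ordinary ¬q-norm _) = contradiction q-norm ¬q-norm
  Weight-unique (ramified ¬q-norm _) (principal q-norm) = contradiction q-norm ¬q-norm
  Weight-unique (ramified _ _) (ramified _ _) = refl
  Weight-unique (ramified _ r) (ordinary _ ¬r) = contradiction r ¬r
  Weight-unique (ordinary ¬q-norm _) (principal q-norm) = contradiction q-norm ¬q-norm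
  Weight-unique (ordinary _ ¬r) (ramified _ r) = contradiction r ¬r
  Weight-unique (ordinary _ _) (ordinary _ _) = refl

  data Weigh : List ℕ → ℕ → Set where
    []  : Weigh [] 0
    _∷_ : ∀ {q v qs w} → Weight q v → Weigh qs w → Weigh (q ∷ qs) (v ℕ.+ w)

  Weigh-unique : ∀ {qs v w} → Weigh qs v → Weigh qs w → v ≡ w
  Weigh-unique [] [] = refl
  Weigh-unique (x ∷ xs) (y ∷ ys) = cong₂ ℕ._+_ (Weight-unique x y) (Weigh-unique xs ys)

  Weigh-++ : ∀ {ps qs v w} → Weigh ps v → Weigh qs w → Weigh (ps ++ qs) (v ℕ.+ w)
  Weigh-++ [] ys = ys
  Weigh-++ {w = w} (_∷_ {v = v} {w = v′} x xs) ys =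
    subst (Weigh _) (sym (ℕₚ.+-assoc v v′ w)) (x ∷ Weigh-++ xs ys)

  Weigh-↭ : ∀ {ps qs w} → ps ↭ qs → Weigh ps w → Weigh qs w
  Weigh-↭ Perm.refl xs = xs
  Weigh-↭ (Perm.prep _ ps↭qs) (x ∷ xs) = x ∷ Weigh-↭ ps↭qs xs
  Weigh-↭ (Perm.swap _ _ ps↭qs) (_∷_ {v = v} x (_∷_ {v = v′} {w = w} y xs)) =
    subst (Weigh _) (exchange v v′ w) (y ∷ (x ∷ Weigh-↭ ps↭qs xs))
    where
    exchange : ∀ v v′ w → v′ ℕ.+ (v ℕ.+ w) ≡ v ℕ.+ (v′ ℕ.+ w)
    exchange = ℕ-solve-∀
  Weigh-↭ (Perm.trans ps↭qs qs↭rs) xs = Weigh-↭ qs↭rs (Weigh-↭ ps↭qs xs)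

  -- A relation and not a function, because `NormPrime` is decided only for primes that arise from
  -- an element at hand. Unique factorisation in ℕ makes the weight unique where it exists.
  HasWeight : ℕ → ℕ → Set
  HasWeight n w = ∃[ ps ] n ≡ product ps × All Prime ps × Weigh ps w

  HasWeight-unique : ∀ {n v w} → HasWeight n v → HasWeight n w → v ≡ w
  HasWeight-unique (ps , n≡ , ps-prime , xs) (qs , n≡′ , qs-prime , ys) = Weigh-unique
    (Weigh-↭ (factorisationUnique (record { factors = ps ; isFactorisation = n≡ ; factorsPrime = ps-prime })
      (record { factors = qs ; isFactorisation = n≡′ ; factorsPrime = qs-prime })) xs) ys

  HasWeight-1 : HasWeight 1 0
  HasWeight-1 = [] , refl , [] , []

  HasWeight-prime : ∀ {q w} → Prime q → Weight q w → HasWeight q w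
  HasWeight-prime {q} {w} q-prime x = q ∷ [] , sym (ℕₚ.*-identityʳ q) , q-prime ∷ [] ,
    subst (Weigh _) (ℕₚ.+-identityʳ w) (x ∷ [])

  HasWeight-* : ∀ {m n v w} → HasWeight m v → HasWeight n w → HasWeight (m ℕ.* n) (v ℕ.+ w)
  HasWeight-* (ps , m≡ , ps-prime , xs) (qs , n≡ , qs-prime , ys) =
    ps ++ qs , trans (cong₂ ℕ._*_ m≡ n≡) (sym (product-++ ps qs)) , Allₚ.++⁺ ps-prime qs-prime ,
      Weigh-++ xs ys

  Balanced : ℕ → Set
  Balanced n = ∃[ j ] HasWeight n (2 ℕ.+ 4 ℕ.* j)

  -- The alternatives 1 and 3 share the oddness that squares need: twice an odd weight is 2 modulo
  -- 4.
  odd-weight : ∀ {q} → ¬ NormPrime q → ∃[ i ] Weight q (1 ℕ.+ 2 ℕ.* i)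
  odd-weight {q} ¬norm with q ℕ∣.∣? f | prime? q | kronecker (+ discriminant d) q ℤₚ.≟ 0ℤ
  ... | yes q∣f | yes q-prime | yes eq = 1 , ramified ¬norm (q∣f , q-prime , eq)
  ... | no q∤f | _ | _ = 0 , ordinary ¬norm (λ (q∣f , _) → q∤f q∣f)
  ... | yes _ | no ¬prime | _ = 0 , ordinary ¬norm (λ (_ , q-prime , _) → ¬prime q-prime)
  ... | yes _ | yes _ | no neq = 0 , ordinary ¬norm (λ (_ , _ , eq) → neq eq)

  square-balanced : ∀ {q} → Prime q → ¬ NormPrime q → Balanced (q ℕ.* q)
  square-balanced {q} q-prime ¬norm = let i , x = odd-weight ¬norm in
    i , subst (HasWeight (q ℕ.* q)) (double i)
      (HasWeight-* (HasWeight-prime q-prime x) (HasWeight-prime q-prime x))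
    where
    double : ∀ i → (1 ℕ.+ 2 ℕ.* i) ℕ.+ (1 ℕ.+ 2 ℕ.* i) ≡ 2 ℕ.+ 4 ℕ.* i
    double = ℕ-solve-∀

  conductor-prime-not-norm : ∀ {q} → Prime q → q ∣ f → ¬ NormPrime q
  conductor-prime-not-norm {q} q-prime (ℕ∣.divides f′ f≡f′q) (γ , γ∈ , ∣Nγ∣≡q) =
    ConductorPrime.norm-≢q d f f′ q q-prime f≡f′q γ γ∈ ∣Nγ∣≡q

  -- Such a γ would be q v with v in the order of conductor f / q and norm v = ±q, which the residue
  -- conditions exclude.
  ramified-cube-not-norm : ∀ {q} → Ramified d q → q ∣ f → ∀ γ → InOrder f γ → ∣ norm γ ∣ ≢ q ℕ.* q ℕ.* q
  ramified-cube-not-norm {q} q-ramified@(q-prime , _) (ℕ∣.divides f′ f≡f′q) γ γ∈ ∣Nγ∣≡q³ =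
    descend (quotient-inOrder γ γ∈ (∣ᵤ⇒∣ (subst (q ∣_) (sym ∣Nγ∣≡q³) (ℕ∣.n∣m*n (q ℕ.* q)))))
    where
    open ConductorPrime d f f′ q q-prime f≡f′q
    instance
      _ = prime⇒nonZero q-prime
      _ = ℕₚ.m*n≢0 q q
    descend : ∃[ v ] InOrder f′ v × γ ≡ ⟦ + q ⟧ ∙ v → ⊥
    descend (v , v∈ , γ≡qv) = no-ramified-norm q-ramified f≡f′q v v∈
      (ℕₚ.*-cancelˡ-≡ ∣ norm v ∣ q (q ℕ.* q) (trans (sym (abs-norm-quotient γ≡qv)) ∣Nγ∣≡q³))

  module _ {u} (u∈ : InOrder f u) (u-irreducible : Irreducible u) where

    private
      Nu≢0 : norm u ≢ 0ℤ
      Nu≢0 = proj₁ u-irreducible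
      ∣Nu∣≢1 : ∣ norm u ∣ ≢ 1
      ∣Nu∣≢1 = proj₁ (proj₂ u-irreducible)
      cofactor-unit : ∀ v w → InOrder f v → InOrder f w → u ≡ v ∙ w → ∣ norm v ∣ ≢ 1 → ∣ norm w ∣ ≡ 1
      cofactor-unit = proj₂ (proj₂ u-irreducible)

    -- In u = γ δ the factor γ is not a unit, so irreducibility makes δ one.
    splits⇒norm : ∀ {m} → m ≢ 1 → Splits f u (+ m) → ∣ norm u ∣ ≡ m
    splits⇒norm {m} m≢1 (γ , δ , γ∈ , δ∈ , u≡γδ , ∣Nγ∣≡m) =
      trans (cong (λ z → ∣ norm z ∣) u≡γδ) (trans (abs-norm-∙ γ δ)
      (trans (cong₂ ℕ._*_ ∣Nγ∣≡m (cofactor-unit γ δ γ∈ δ∈ u≡γδ λ eq → m≢1 (trans (sym ∣Nγ∣≡m) eq)))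
        (ℕₚ.*-identityʳ m)))

    -- Irreducibility makes v a unit, so |norm u| = q². If ±q were a norm γ conj γ, then γ would
    -- split q and with it u into nonunits.
    integer-factor⇒balanced : ∀ {q v} → Prime q → InOrder f v → u ≡ ⟦ + q ⟧ ∙ v → Balanced ∣ norm u ∣
    integer-factor⇒balanced {q} {v} q-prime v∈ u≡qv =
      subst Balanced (sym ∣Nu∣≡q²) (square-balanced q-prime not-norm)
      where
      q≢1 : q ≢ 1
      q≢1 = prime-≢1 q-prime
      ∣Nv∣≡1 : ∣ norm v ∣ ≡ 1
      ∣Nv∣≡1 = cofactor-unit ⟦ + q ⟧ v (⟦⟧-inOrder (+ q)) v∈ u≡qv λ eq →
        q≢1 (ℕₚ.m*n≡1⇒m≡1 q q (trans (sym (abs-norm-⟦⟧ q)) eq))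
      ∣Nu∣≡q² : ∣ norm u ∣ ≡ q ℕ.* q
      ∣Nu∣≡q² = trans (cong (λ z → ∣ norm z ∣) u≡qv)
        (trans (abs-norm-∙ ⟦ + q ⟧ v) (trans (cong₂ ℕ._*_ (abs-norm-⟦⟧ q) ∣Nv∣≡1) (ℕₚ.*-identityʳ (q ℕ.* q))))
      not-norm : ¬ NormPrime q
      not-norm (γ , γ∈ , ∣Nγ∣≡q) = go (∣i∣≡∣j∣⇒i≡±j (norm γ) (+ q) ∣Nγ∣≡q)
        where
        rearrange : ∀ γ γ̄ ε v → γ ∙ (γ̄ ∙ (ε ∙ v)) ≡ ε ∙ (γ ∙ γ̄) ∙ v
        rearrange = solve𝒵 4 (λ γ γ̄ ε v → (γ :* (γ̄ :* (ε :* v))) := (ε :* (γ :* γ̄) :* v)) refl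
        go : ∃[ ε ] IsSign ε × norm γ ≡ ε * + q → ⊥
        go (ε , ε-sign , Nγ≡εq) = q≢1 (ℕₚ.m*n≡1⇒m≡1 q ∣ norm (⟦ ε ⟧ ∙ v) ∣
          (trans (cong (ℕ._* ∣ norm (⟦ ε ⟧ ∙ v) ∣) (sym (trans (cong ∣_∣ (norm-conj γ)) ∣Nγ∣≡q)))
          (trans (sym (abs-norm-∙ (conj γ) (⟦ ε ⟧ ∙ v)))
            (cofactor-unit γ (conj γ ∙ (⟦ ε ⟧ ∙ v)) γ∈
            (∙-inOrder (conj-inOrder γ∈) (∙-inOrder (⟦⟧-inOrder ε) v∈)) u≡ λ eq →
            q≢1 (trans (sym ∣Nγ∣≡q) eq)))))
          where
          εεq≡q : ε * (ε * + q) ≡ + q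
          εεq≡q = trans (sym (ℤₚ.*-assoc ε ε (+ q)))
            (trans (cong (_* + q) (sign² ε-sign)) (ℤₚ.*-identityˡ (+ q)))
          u≡ : u ≡ γ ∙ (conj γ ∙ (⟦ ε ⟧ ∙ v))
          u≡ = trans u≡qv (sym (trans (rearrange γ (conj γ) ⟦ ε ⟧ v)
            (cong (_∙ v) (trans (cong (⟦ ε ⟧ ∙_) (trans (∙-conj γ) (cong ⟦_⟧ Nγ≡εq)))
            (trans (⟦⟧-* ε (ε * + q)) (cong ⟦_⟧ εεq≡q))))))

    -- (u , modulus) is a nonprincipal invertible ideal, primary for the prime above q that contains u.
    record Block (q : ℕ) : Set where
      field
        modulus      : ℕ
        cofactor     : ℤ
        norm≡        : norm u ≡ + modulus * cofactor
        q∣modulus    : q ∣ modulus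
        radical      : ∀ r → Prime r → + r ∣ℤ + modulus → r ≡ q
        -- The spare factor m lets this field serve also when the modulus of a second block has been
        -- divided out.
        coprime      : ∀ m c → norm u ≡ + modulus * m * c → + q ∣ℤ trace u → ¬ + q ∣ℤ c
        weight       : ∃[ i ] HasWeight modulus (1 ℕ.+ 4 ℕ.* i)
        kind         : (¬ q ∣ f × modulus ≡ q) ⊎ (q ∣ f × ¬ + q ∣ℤ cofactor)
        nonprincipal : ¬ Splits f u (+ modulus)

    module _ {q} (q-prime : Prime q) (q∣Nu : + q ∣ℤ norm u) where

      -- If q ∣ u then u has an integer factor. Otherwise (u , q) is primitive: when principal it
      -- equals (u), and |norm u| = q is a norm of weight 2; when not, it is a block of weight 1.
      away-from-conductor : ¬ q ∣ f → Balanced ∣ norm u ∣ ⊎ Block q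
      away-from-conductor q∤f = case (+ q ∣ℤ? proj₁ u) ×-dec (+ q ∣ℤ? proj₂ u) of λ
        { (yes q∣u) → inj₁ (let v , u≡qv , y≡ = quotient-by u q∣u in integer-factor⇒balanced q-prime
          (inOrder (∣-coprime-cancel f-q-coprime (subst (+ f ∣ℤ_) y≡ (InOrder.∣im u∈)))) u≡qv)
        ; (no q∤u) → go q∤u q∣Nu }
        where
        f-q-coprime : ∃[ r ] ∃[ s ] r * + f + s * + q ≡ 1ℤ
        f-q-coprime = ∤⇒bezout q-prime λ q∣f → q∤f (∣⇒∣ᵤ q∣f)
        go : ¬ (+ q ∣ℤ proj₁ u × + q ∣ℤ proj₂ u) → + q ∣ℤ norm u → Balanced ∣ norm u ∣ ⊎ Block q
        go q∤u (divides C N≡Cq) = decide (splits? card-f P)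
          where
          N≡ : norm u ≡ + q * C
          N≡ = trans N≡Cq (ℤₚ.*-comm C (+ q))
          regroup : ∀ q m c → q * m * (c * q) ≡ q * q * (m * c)
          regroup = solve-∀
          q-coprime : ∀ m c → norm u ≡ + q * m * c → + q ∣ℤ trace u → ¬ + q ∣ℤ c
          q-coprime m c N≡′ q∣T (divides c′ c≡) = q∤u (integrality d-squarefree q-prime u q∣T
            (subst (+ q * + q ∣ℤ_) (sym (trans N≡′ (trans (cong (+ q * m *_) c≡) (regroup (+ q) m c′))))
              (∣m⇒∣m*n (m * c′) ∣-refl)))
          r≡q : ∀ r → Prime r → + r ∣ℤ + q → r ≡ q
          r≡q r r-prime = prime-∣prime r-prime q-prime
          P : Primitive f u (+ q)
          P = mkPrimitive C u∈ (+prime≢0 q-prime) N≡ λ r r-prime r∣q r∣T r∣C → let q≡ = r≡q r r-prime r∣q in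
            q-coprime 1ℤ C (trans N≡ (cong (_* C) (sym (ℤₚ.*-identityʳ (+ q)))))
              (subst (λ r → + r ∣ℤ trace u) q≡ r∣T) (subst (λ r → + r ∣ℤ C) q≡ r∣C)
          decide : Dec (Splits f u (+ q)) → Balanced ∣ norm u ∣ ⊎ Block q
          decide (yes S@(γ , _ , γ∈ , _ , _ , ∣Nγ∣≡q)) =
            inj₁ (0 , subst (λ n → HasWeight n 2) (sym (splits⇒norm (prime-≢1 q-prime) S))
            (HasWeight-prime q-prime (principal (γ , γ∈ , ∣Nγ∣≡q))))
          decide (no ¬S) = inj₂ record
            { modulus = q ; cofactor = C ; norm≡ = N≡ ; q∣modulus = ℕ∣.∣-refl ; radical = r≡q ; coprime =
              q-coprime
            ; weight = 0 , HasWeight-prime q-prime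
              (ordinary (λ (γ , γ∈ , ∣Nγ∣≡q) → ¬S (norm-prime⇒splits q-prime q∤f u u∈ q∣Nu γ γ∈ ∣Nγ∣≡q))
              (λ (q∣f , _) → q∤f q∣f))
            ; kind = inj₁ (q∤f , refl) ; nonprincipal = ¬S }

      -- Write u = q w. If q divides the second coordinate of w, then w lies in 𝒪_f and q is an
      -- integer factor. If q ∤ norm w, then (u , q²) is principal by `square-splits`. Otherwise q
      -- is not inert, hence ramified, and (u , q³) is a block.
      at-conductor : ∀ f′ → f ≡ f′ ℕ.* q → Balanced ∣ norm u ∣ ⊎ Block q
      at-conductor f′ f≡f′q = go (quotient-inOrder u u∈ q∣Nu)
        where
        open ConductorPrime d f f′ q q-prime f≡f′q
        go : ∃[ w ] InOrder f′ w × u ≡ ⟦ + q ⟧ ∙ w → Balanced ∣ norm u ∣ ⊎ Block q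
        go (w , w∈ , u≡qw) = case (+ q ∣ℤ? proj₂ w) of λ
          { (yes q∣im) → inj₁ (integer-factor⇒balanced q-prime (inOrder (f∣ q∣im)) u≡qw)
          ; (no q∤im) → case (+ q ∣ℤ? norm w) of λ
            { (no q∤Nw) → inj₁ (square q∤Nw)
            ; (yes q∣Nw) → inj₂ (cube q∤im q∣Nw
              (Sum.fromInj₁ (λ inert → contradiction (proj₂ (inert w q∣Nw)) q∤im)
              (ramified-or-inert q-prime (λ split → no-split q split q∣f)))) } }
          where
          f′-q-coprime : ∃[ r ] ∃[ s ] r * + f′ + s * + q ≡ 1ℤ
          f′-q-coprime = ∤⇒bezout q-prime λ q∣f′ →
            squarefree-coprime {f} f-squarefree f≡f′q q-prime (∣⇒∣ᵤ q∣f′) ℕ∣.∣-refl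
          f∣ : + q ∣ℤ proj₂ w → + f ∣ℤ proj₂ w
          f∣ (divides k im≡) = subst₂ _∣ℤ_
            (trans (sym (ℤₚ.pos-* q f′)) (cong +_ (trans (ℕₚ.*-comm q f′) (sym f≡f′q))))
            (trans (ℤₚ.*-comm (+ q) k) (sym im≡))
            (*-monoʳ-∣ (+ q) (∣-coprime-cancel f′-q-coprime
              (subst (+ f′ ∣ℤ_) (trans im≡ (ℤₚ.*-comm k (+ q))) (InOrder.∣im w∈))))
          square : ¬ + q ∣ℤ norm w → Balanced ∣ norm u ∣
          square q∤Nw = subst Balanced (sym (splits⇒norm (λ eq → prime-≢1 q-prime (ℕₚ.m*n≡1⇒m≡1 q q eq))
              (subst (Splits f u) (sym (ℤₚ.pos-* q q)) (square-splits q-prime q∣f u≡qw q∤Nw P))))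
            (square-balanced q-prime (conductor-prime-not-norm q-prime q∣f))
            where
            P : Primitive f u (+ q * + q)
            P = mkPrimitive (norm w) u∈ (λ eq → Sum.[ +prime≢0 q-prime ,
              +prime≢0 q-prime ] (ℤₚ.i*j≡0⇒i≡0∨j≡0 (+ q) eq)) (norm-quotient (+ q) u≡qw)
              λ r r-prime r∣q² _ r∣Nw → q∤Nw
                (subst (λ r → + r ∣ℤ norm w) (prime-∣prime r-prime q-prime (prime-∣² r-prime (+ q) r∣q²))
                r∣Nw)
          cube : ¬ + q ∣ℤ proj₂ w → + q ∣ℤ norm w → Ramified d q → Block q
          cube q∤im q∣Nw@(divides C Nw≡) q-ramified = record
            { modulus = q ℕ.* q ℕ.* q ; cofactor = C ; norm≡ = N≡ ; q∣modulus = ℕ∣.n∣m*n (q ℕ.* q)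
            ; radical = λ r r-prime r∣q³ →
              prime-∣prime r-prime q-prime (r∣q r-prime (subst (+ r ∣ℤ_) +q³ r∣q³))
            ; coprime = λ m c N≡′ _ q∣c → q∤C
              (subst (+ q ∣ℤ_) (sym (ℤₚ.*-cancelˡ-≡ (+ (q ℕ.* q ℕ.* q)) C (m * c)
              (trans (sym N≡) (trans N≡′ (ℤₚ.*-assoc (+ (q ℕ.* q ℕ.* q)) m c))))) (∣n⇒∣m*n m q∣c))
            -- Three copies of weight 3: 9 = 1 + 4 · 2.
            ; weight = 2 , HasWeight-* (HasWeight-* q-weight q-weight) q-weight
            ; kind = inj₂ (q∣f , q∤C) ; nonprincipal = nonprincipal }
            where
            +q³ : + (q ℕ.* q ℕ.* q) ≡ + q * + q * + q
            +q³ = trans (ℤₚ.pos-* (q ℕ.* q) q) (cong (_* + q) (ℤₚ.pos-* q q))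
            instance
              _ = ℤ.≢-nonZero {+ (q ℕ.* q ℕ.* q)} λ eq →
                Sum.[ (λ eq → Sum.[ +prime≢0 q-prime , +prime≢0 q-prime ] (ℤₚ.i*j≡0⇒i≡0∨j≡0 (+ q) eq)) ,
                +prime≢0 q-prime ] (ℤₚ.i*j≡0⇒i≡0∨j≡0 (+ q * + q) (trans (sym +q³) eq))
            r∣q : ∀ {r} → Prime r → + r ∣ℤ + q * + q * + q → + r ∣ℤ + q
            r∣q r-prime r∣q³ = Sum.[ prime-∣² r-prime (+ q) ,
              (λ r∣q → r∣q) ] (prime-∣* r-prime (+ q * + q) (+ q) r∣q³)
            rotate : ∀ q c → q * q * (c * q) ≡ q * q * q * c
            rotate = solve-∀
            N≡ : norm u ≡ + (q ℕ.* q ℕ.* q) * C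
            N≡ = trans (norm-quotient (+ q) u≡qw)
              (trans (cong (+ q * + q *_) Nw≡) (trans (rotate (+ q) C) (cong (_* C) (sym +q³))))
            -- q² ∣ norm w together with q ∣ trace w would make q divide w.
            q∤C : ¬ + q ∣ℤ C
            q∤C q∣C = q∤im (proj₂ (integrality d-squarefree q-prime w (ramified⇒∣trace q-ramified w q∣Nw)
              (subst (+ q * + q ∣ℤ_) (trans (ℤₚ.*-comm (+ q) C) (sym Nw≡)) (*-monoʳ-∣ (+ q) q∣C))))
            q-weight : HasWeight q 3
            q-weight = HasWeight-prime q-prime
              (ramified (conductor-prime-not-norm q-prime q∣f) (q∣f , q-ramified))
            nonprincipal : ¬ Splits f u (+ (q ℕ.* q ℕ.* q))
            nonprincipal (γ , _ , γ∈ , _ , _ , ∣Nγ∣≡q³) = ramified-cube-not-norm q-ramified q∣f γ γ∈ ∣Nγ∣≡q³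

      analyse : Balanced ∣ norm u ∣ ⊎ Block q
      analyse = case q ℕ∣.∣? f of λ
        { (yes (ℕ∣.divides f′ f≡f′q)) → at-conductor f′ f≡f′q
        ; (no q∤f) → away-from-conductor q∤f }

    block-primitive : ∀ {q} (B : Block q) → Primitive f u (+ Block.modulus B)
    block-primitive {q} B = mkPrimitive cofactor u∈ (λ m≡0 → Nu≢0 (trans norm≡ (cong (_* cofactor) m≡0)))
      norm≡
      λ r r-prime r∣m r∣T r∣C → let r≡q = radical r r-prime r∣m in
        coprime 1ℤ cofactor (trans norm≡ (cong (_* cofactor) (sym (ℤₚ.*-identityʳ (+ modulus)))))
          (subst (λ r → + r ∣ℤ trace u) r≡q r∣T) (subst (λ r → + r ∣ℤ cofactor) r≡q r∣C)
      where open Block B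

    -- Once n divides the cofactor of A, the ideal (u , m n) is the product of the nonprincipal (u ,
    -- m) and (u , n), hence principal, and irreducibility gives |norm u| = m n.
    two-blocks⇒balanced : ∀ {p q} → Prime p → Prime q → (A : Block p) (B : Block q) →
      + q ∣ℤ Block.cofactor A → Balanced ∣ norm u ∣
    two-blocks⇒balanced {p} {q} p-prime q-prime A B q∣C = go n∣C
      where
      open Block A using () renaming (modulus to m; cofactor to C)
      open Block B using () renaming (modulus to n)
      coprime-case : q ≢ p → + n ∣ℤ C
      coprime-case q≢p = ∣-coprime-cancel
        (bezout₂ (+ n) (+ m) λ r r-prime r∣n r∣m →
        q≢p (trans (sym (Block.radical B r r-prime r∣n)) (Block.radical A r r-prime r∣m)))
        (subst (+ n ∣ℤ_) (trans (sym (Block.norm≡ B)) (Block.norm≡ A)) (∣m⇒∣m*n (Block.cofactor B) ∣-refl))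
      -- If q ∤ f, then n = q divides C by assumption. If q ∣ f, then q ≠ p, because the cofactor of
      -- a block at a conductor prime is prime to it, and the two moduli are coprime.
      n∣C : + n ∣ℤ C
      n∣C = case Block.kind B of λ
        { (inj₁ (_ , n≡q)) → subst (λ n → + n ∣ℤ C) (sym n≡q) q∣C
        ; (inj₂ (q∣f , _)) → coprime-case λ q≡p → case Block.kind A of λ
          { (inj₁ (p∤f , _)) → p∤f (subst (_∣ f) q≡p q∣f)
          ; (inj₂ (_ , p∤C)) → p∤C (subst (λ q → + q ∣ℤ C) q≡p q∣C) } }
      go : + n ∣ℤ C → Balanced ∣ norm u ∣
      go (divides c C≡cn) = combine (Block.weight A) (Block.weight B)
        where
        N≡mnc : norm u ≡ + m * + n * c
        N≡mnc = trans (Block.norm≡ A) (trans (cong (+ m *_) C≡cn) (rotate (+ m) c (+ n)))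
          where
          rotate : ∀ m c n → m * (c * n) ≡ m * n * c
          rotate = solve-∀
        N≡nmc : norm u ≡ + n * + m * c
        N≡nmc = trans N≡mnc (cong (_* c) (ℤₚ.*-comm (+ m) (+ n)))
        P : Primitive f u (+ m * + n)
        P = mkPrimitive c u∈ (λ mn≡0 → Nu≢0 (trans N≡mnc (cong (_* c) mn≡0))) N≡mnc λ r r-prime r∣mn r∣T r∣c →
          Sum.[
            (λ r∣m → let r≡p = Block.radical A r r-prime r∣m in Block.coprime A (+ n) c N≡mnc
              (subst (λ r → + r ∣ℤ trace u) r≡p r∣T) (subst (λ r → + r ∣ℤ c) r≡p r∣c)) ,
            (λ r∣n → let r≡q = Block.radical B r r-prime r∣n in Block.coprime B (+ m) c N≡nmc
              (subst (λ r → + r ∣ℤ trace u) r≡q r∣T) (subst (λ r → + r ∣ℤ c) r≡q r∣c)) ]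
          (prime-∣* r-prime (+ m) (+ n) r∣mn)
        ∣Nu∣≡mn : ∣ norm u ∣ ≡ m ℕ.* n
        ∣Nu∣≡mn = splits⇒norm (λ mn≡1 →
          prime-≢1 p-prime (ℕ∣.∣1⇒≡1 (subst (p ∣_) mn≡1 (ℕ∣.∣m⇒∣m*n n (Block.q∣modulus A)))))
          (subst (Splits f u) (sym (ℤₚ.pos-* m n))
            (product-splits card-f (block-primitive A) (block-primitive B) P (Block.nonprincipal A)
            (Block.nonprincipal B)))
        combine : ∃[ i ] HasWeight m (1 ℕ.+ 4 ℕ.* i) → ∃[ j ] HasWeight n (1 ℕ.+ 4 ℕ.* j) →
          Balanced ∣ norm u ∣
        combine (i , x) (j , y) = i ℕ.+ j , subst₂ HasWeight (sym ∣Nu∣≡mn) (total i j) (HasWeight-* x y)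
          where
          total : ∀ i j → (1 ℕ.+ 4 ℕ.* i) ℕ.+ (1 ℕ.+ 4 ℕ.* j) ≡ 2 ℕ.+ 4 ℕ.* (i ℕ.+ j)
          total = ℕ-solve-∀

    -- One block cannot exhaust the norm: with cofactor ±1 the factorisation u = u · 1 would make (u
    -- , modulus) principal. So a prime divides the cofactor, and its analysis ends in balance or in
    -- a second block.
    irreducible⇒balanced : Balanced ∣ norm u ∣
    irreducible⇒balanced = first (prime-divisor ∣ norm u ∣ ∣Nu∣≢1)
      where
      first : ∃[ p ] Prime p × p ∣ ∣ norm u ∣ → Balanced ∣ norm u ∣
      first (p , p-prime , p∣Nu) = Sum.[ (λ balanced → balanced) , second ] (analyse p-prime (∣ᵤ⇒∣ p∣Nu))
        where
        second : Block p → Balanced ∣ norm u ∣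
        second A = case ∣ Block.cofactor A ∣ ℕₚ.≟ 1 of λ
          { (yes ∣C∣≡1) → contradiction (u , ⟦ 1ℤ ⟧ , u∈ , ⟦⟧-inOrder 1ℤ ,
            sym (trans (∙-comm u ⟦ 1ℤ ⟧) (∙-identityˡ u)) ,
              trans (cong ∣_∣ (Block.norm≡ A))
                (trans (ℤₚ.abs-* (+ Block.modulus A) (Block.cofactor A))
                (trans (cong (Block.modulus A ℕ.*_) ∣C∣≡1) (ℕₚ.*-identityʳ (Block.modulus A)))))
                (Block.nonprincipal A)
          ; (no ∣C∣≢1) → let q , q-prime , q∣C = prime-divisor ∣ Block.cofactor A ∣ ∣C∣≢1 in
              Sum.[ (λ balanced → balanced) , (λ B → two-blocks⇒balanced p-prime q-prime A B (∣ᵤ⇒∣ q∣C)) ]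
                (analyse q-prime (subst (+ q ∣ℤ_) (sym (Block.norm≡ A))
                  (∣n⇒∣m*n (+ Block.modulus A) (∣ᵤ⇒∣ q∣C)))) }

  product-weight : ∀ {k} (us : Vec (𝕂 d) k) → VecAll.All (IsAtom D) us →
    ∃[ β ] InOrder f β × Vec.foldr′ _⊗_ 1𝕂 us ≡ emb β × ∃[ j ] HasWeight ∣ norm β ∣ (2 ℕ.* k ℕ.+ 4 ℕ.* j)
  product-weight [] VecAll.[] = ⟦ 1ℤ ⟧ , ⟦⟧-inOrder 1ℤ , sym emb-1 , 0 ,
    subst (λ n → HasWeight n 0) (sym (cong ∣_∣ (norm-⟦⟧ 1ℤ))) HasWeight-1
  product-weight {suc k} (a ∷ us) (a-atom VecAll.∷ us-atoms) =
    extend (𝒪⇒emb (proj₁ (proj₁ a-atom))) (product-weight us us-atoms)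
    where
    extend : ∃[ α ] InOrder f α × a ≡ emb α →
      ∃[ β ] InOrder f β × Vec.foldr′ _⊗_ 1𝕂 us ≡ emb β × ∃[ j ] HasWeight ∣ norm β ∣ (2 ℕ.* k ℕ.+ 4 ℕ.* j) →
      ∃[ β ] InOrder f β × Vec.foldr′ _⊗_ 1𝕂 (a ∷ us) ≡ emb β ×
        ∃[ j ] HasWeight ∣ norm β ∣ (2 ℕ.* suc k ℕ.+ 4 ℕ.* j)
    extend (α , α∈ , a≡α) (β , β∈ , us≡β , j , x) =
      let i , y = irreducible⇒balanced α∈ (atom⇒irreducible α∈ (subst (IsAtom D) a≡α a-atom)) in
      α ∙ β , ∙-inOrder α∈ β∈ , trans (cong₂ _⊗_ a≡α us≡β) (sym (emb-∙ α β)) , i ℕ.+ j ,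
      subst₂ HasWeight (sym (abs-norm-∙ α β)) (total i j k) (HasWeight-* y x)
      where
      total : ∀ i j k → (2 ℕ.+ 4 ℕ.* i) ℕ.+ (2 ℕ.* k ℕ.+ 4 ℕ.* j) ≡ 2 ℕ.* suc k ℕ.+ 4 ℕ.* (i ℕ.+ j)
      total = ℕ-solve-∀

  length-weight : ∀ {α k} → 𝖫 D (emb α) k → ∃[ j ] HasWeight ∣ norm α ∣ (2 ℕ.* k ℕ.+ 4 ℕ.* j)
  length-weight {α} {k} (η , us , η-unit , us-atoms , α≡) =
    go (𝒪⇒emb (proj₁ η-unit)) (product-weight us us-atoms)
    where
    go : ∃[ υ ] InOrder f υ × η ≡ emb υ →
      ∃[ β ] InOrder f β × Vec.foldr′ _⊗_ 1𝕂 us ≡ emb β × ∃[ j ] HasWeight ∣ norm β ∣ (2 ℕ.* k ℕ.+ 4 ℕ.* j) →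
      ∃[ j ] HasWeight ∣ norm α ∣ (2 ℕ.* k ℕ.+ 4 ℕ.* j)
    go (υ , _ , η≡υ) (β , _ , us≡β , j , x) = j , subst (λ n → HasWeight n (2 ℕ.* k ℕ.+ 4 ℕ.* j)) (sym (begin
      ∣ norm α ∣                       ≡⟨ cong (λ z → ∣ norm z ∣)
        (emb-injective 2≤d d-squarefree (trans α≡ (trans (cong₂ _⊗_ η≡υ us≡β) (sym (emb-∙ υ β))))) ⟩
      ∣ norm (υ ∙ β) ∣                 ≡⟨ abs-norm-∙ υ β ⟩
      ∣ norm υ ∣ ℕ.* ∣ norm β ∣        ≡⟨ cong (ℕ._* ∣ norm β ∣) (unit⇒norm (subst (IsUnit D) η≡υ η-unit)) ⟩
      1 ℕ.* ∣ norm β ∣                 ≡⟨ ℕₚ.*-identityˡ ∣ norm β ∣ ⟩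
      ∣ norm β ∣                       ∎)) x
      where open ≡-Reasoning

  -- Lengths k and k + 1 would give one norm the weights 2 k + 4 i and 2 (k + 1) + 4 j, which differ
  -- modulo 4.
  no-consecutive-lengths : ∀ {a k} → a ∈ D → 𝖫 D a k → ¬ 𝖫 D a (suc k)
  no-consecutive-lengths {a} {k} a∈ k∈L 1+k∈L = go (𝒪⇒emb a∈)
    where
    even≢odd : ∀ i j → 2 ℕ.* i ≢ 1 ℕ.+ 2 ℕ.* j
    even≢odd i j eq = contradiction
      (ℕ∣.∣1⇒≡1 (ℕ∣.∣m+n∣m⇒∣n {2} {2 ℕ.* j} {1} (subst (2 ∣_) (trans eq (ℕₚ.+-comm 1 (2 ℕ.* j))) (ℕ∣.m∣m*n i))
      (ℕ∣.m∣m*n j))) λ ()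
    halve : ∀ i j → 2 ℕ.* k ℕ.+ 4 ℕ.* i ≡ 2 ℕ.* suc k ℕ.+ 4 ℕ.* j → 2 ℕ.* i ≡ 1 ℕ.+ 2 ℕ.* j
    halve i j eq = ℕₚ.*-cancelˡ-≡ (2 ℕ.* i) (1 ℕ.+ 2 ℕ.* j) 2
      (ℕₚ.+-cancelˡ-≡ (2 ℕ.* k) _ _ (trans (left k i) (trans eq (right k j))))
      where
      left : ∀ k i → 2 ℕ.* k ℕ.+ 2 ℕ.* (2 ℕ.* i) ≡ 2 ℕ.* k ℕ.+ 4 ℕ.* i
      left = ℕ-solve-∀
      right : ∀ k j → 2 ℕ.* suc k ℕ.+ 4 ℕ.* j ≡ 2 ℕ.* k ℕ.+ 2 ℕ.* (1 ℕ.+ 2 ℕ.* j)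
      right = ℕ-solve-∀
    go : ∃[ α ] InOrder f α × a ≡ emb α → ⊥
    go (α , _ , a≡α) =
      let i , x = length-weight (subst (λ a → 𝖫 D a k) a≡α k∈L)
          j , y = length-weight (subst (λ a → 𝖫 D a (suc k)) a≡α 1+k∈L)
      in even≢odd i j (halve i j (HasWeight-unique x y))

-- An element with factorisations of lengths 2 and 4

module Existence (d : ℕ) (2≤d : 2 ≤ d) (d-squarefree : Squarefree d) (f : ℕ) (f-squarefree : Squarefree f)
  (no-split : ∀ p → Split d p → ¬ p ∣ f)
  (card-f : HasCardinality (Pic (𝒪 d f)) 2) (card-K : HasCardinality (Pic (𝒪K d)) 2)
  (no-ramified-norm : ∀ {p f′} → Ramified d p → f ≡ f′ ℕ.* p → ∀ w → Integers.InOrder d f′ w →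
    ∣ Integers.norm d w ∣ ≢ p)
  (p f′ : ℕ) (p-ramified : Ramified d p) (f≡f′p : f ≡ f′ ℕ.* p) where

  open Field d
  open Atoms d 2≤d d-squarefree f
  open ClassGroup d 2≤d d-squarefree f using (splits?; product-splits)
  open Weights d 2≤d d-squarefree f f-squarefree no-split card-f card-K no-ramified-norm

  private
    p-prime : Prime p
    p-prime = proj₁ p-ramified
    open ConductorPrime d f f′ p p-prime f≡f′p renaming (q∣f to p∣f)

    p³ : ℕ
    p³ = p ℕ.* p ℕ.* p

    +p³ : + p³ ≡ + p * + p * + p
    +p³ = trans (ℤₚ.pos-* (p ℕ.* p) p) (cong (_* + p) (ℤₚ.pos-* p p))

    instance
      _ = prime⇒nonZero p-prime
      _ = ℕₚ.m*n≢0 p p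
      _ = ℕₚ.m*n≢0 (p ℕ.* p) p

    ∣p³⇒≡p : ∀ {r} → Prime r → + r ∣ℤ + p³ → r ≡ p
    ∣p³⇒≡p {r} r-prime r∣p³ = prime-∣prime r-prime p-prime (Sum.[ prime-∣² r-prime (+ p) , (λ r∣p → r∣p) ]
      (prime-∣* r-prime (+ p * + p) (+ p) (subst (+ r ∣ℤ_) +p³ r∣p³)))

    PrimeToConductor : ℤ → Set
    PrimeToConductor M = ∀ r → Prime r → r ∣ f → ¬ + r ∣ℤ M

  -- β = p w with w = p + f′ v and v from `ramified-element`. The second coordinate of β is then a
  -- multiple of f, p divides norm w exactly once, and norm w ≡ p² modulo every prime r ∣ f′, so
  -- that M is prime to f.
  starting-element : ∃[ β ] ∃[ M ] InOrder f β × norm β ≡ + p³ * M × PrimeToConductor M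
  starting-element = from-v (ramified-element p-ramified)
    where
    from-v : ∃[ v ] + p ∣ℤ norm v × ¬ + p ∣ℤ proj₂ v → ∃[ β ] ∃[ M ] InOrder f β × norm β ≡ + p³ * M ×
      PrimeToConductor M
    from-v (v , p∣Nv , p∤im) = from-M p∣Nw
      where
      w : 𝒵
      w = ⟦ + p ⟧ ⊞ ⟦ + f′ ⟧ ∙ v
      T : 𝒵
      T = conj (⟦ + f′ ⟧ ∙ v)
      im-w : proj₂ w ≡ + f′ * proj₂ v
      im-w = trans (cong proj₂ (trans (cong (⟦ + p ⟧ ⊞_) (⟦⟧-∙ (+ f′) v))
        (HermiteForm.⊞-coordinates d d-squarefree _ _))) (ℤₚ.+-identityˡ _)
      Nw≡ : norm w ≡ + p * + p + + p * (+ f′ * trace v) + + f′ * + f′ * norm v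
      Nw≡ = trans (norm-⊞ _ _) (cong₂ _+_
        (cong₂ _+_ (norm-⟦⟧ (+ p)) (trans (trace-⟦⟧-∙ (+ p) T)
        (cong (+ p *_) (trans (trace-conj _) (trace-⟦⟧-∙ (+ f′) v))))) (norm-⟦⟧-∙ (+ f′) v))
      p∣Nw : + p ∣ℤ norm w
      p∣Nw = subst (+ p ∣ℤ_) (sym Nw≡)
        (∣m∣n⇒∣m+n (∣m∣n⇒∣m+n (∣m⇒∣m*n (+ p) ∣-refl) (∣m⇒∣m*n (+ f′ * trace v) ∣-refl))
        (∣n⇒∣m*n (+ f′ * + f′) p∣Nv))
      p∤f′ : ¬ p ∣ f′
      p∤f′ p∣f′ = squarefree-coprime {f} f-squarefree f≡f′p p-prime p∣f′ ℕ∣.∣-refl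
      from-M : + p ∣ℤ norm w → ∃[ β ] ∃[ M ] InOrder f β × norm β ≡ + p³ * M × PrimeToConductor M
      from-M p∣N@(divides M Nw≡Mp) = ⟦ + p ⟧ ∙ w , M , inOrder (divides (proj₂ v) im-β) , norm-β≡ , coprime
        where
        im-β : proj₂ (⟦ + p ⟧ ∙ w) ≡ proj₂ v * + f
        im-β = trans (cong proj₂ (⟦⟧-∙ (+ p) w))
          (trans (cong (+ p *_) im-w) (trans (rotate (+ p) (+ f′) (proj₂ v))
          (cong (proj₂ v *_) (trans (sym (ℤₚ.pos-* f′ p)) (cong +_ (sym f≡f′p))))))
          where
          rotate : ∀ p f y → p * (f * y) ≡ y * (f * p)
          rotate = solve-∀
        norm-β≡ : norm (⟦ + p ⟧ ∙ w) ≡ + p³ * M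
        norm-β≡ = trans (norm-⟦⟧-∙ (+ p) w)
          (trans (cong (+ p * + p *_) Nw≡Mp) (trans (rotate (+ p) M) (cong (_* M) (sym +p³))))
          where
          rotate : ∀ p m → p * p * (m * p) ≡ p * p * p * m
          rotate = solve-∀
        -- p² ∣ norm w and p ∣ trace w would give p ∣ w, but the second coordinate of w is f′ times
        -- that of v, both prime to p.
        p∤M : ¬ + p ∣ℤ M
        p∤M p∣M = Sum.[ (λ p∣f′ → p∤f′ (∣⇒∣ᵤ p∣f′)) ,
          p∤im ] (prime-∣* p-prime (+ f′) (proj₂ v) (subst (+ p ∣ℤ_) im-w
          (proj₂ (integrality d-squarefree p-prime w (ramified⇒∣trace p-ramified w p∣N)
            (subst (+ p * + p ∣ℤ_) (trans (ℤₚ.*-comm (+ p) M) (sym Nw≡Mp)) (*-monoʳ-∣ (+ p) p∣M))))))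
        coprime : PrimeToConductor M
        coprime r r-prime r∣f r∣M = Sum.[ at-f′ ,
          (λ r∣p → p∤M (subst (λ r → + r ∣ℤ M) (prime-∣prime r-prime p-prime (∣ᵤ⇒∣ r∣p)) r∣M)) ]
          (euclidsLemma f′ p r-prime (subst (r ∣_) f≡f′p r∣f))
          where
          at-f′ : ¬ r ∣ f′
          at-f′ r∣f′ = p∤f′ (subst (_∣ f′) (prime-∣prime r-prime p-prime (prime-∣² r-prime (+ p)
            (∣m+n∣n⇒∣m (∣m+n∣n⇒∣m (subst (+ r ∣ℤ_) Nw≡ (subst (+ r ∣ℤ_) (sym Nw≡Mp) (∣m⇒∣m*n (+ p) r∣M)))
              (∣m⇒∣m*n (norm v) (∣m⇒∣m*n (+ f′) r∣F))) (∣n⇒∣m*n (+ p) (∣m⇒∣m*n (trace v) r∣F))))) r∣f′)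
            where
            r∣F : + r ∣ℤ + f′
            r∣F = ∣ᵤ⇒∣ r∣f′

  CubeTimesPrime : Set
  CubeTimesPrime = ∃[ x ] ∃[ q ] InOrder f x × Prime q × q ≢ p × ¬ NormPrime q × ∣ norm x ∣ ≡ p³ ℕ.* q

  -- Divide out prime factors of M that are norms until one appears that is not.
  descend : ∀ n M β → ∣ M ∣ ≤ n → InOrder f β → norm β ≡ + p³ * M → PrimeToConductor M → CubeTimesPrime
  descend n M β ∣M∣≤n β∈ Nβ≡ M-coprime = case ∣ M ∣ ℕₚ.≟ 1 of λ
    -- M = ±1 would make ±p³ a norm from 𝒪_f, so the descent cannot run out of primes before it
    -- meets one that is not a norm.
    { (yes ∣M∣≡1) → contradiction (trans (cong ∣_∣ Nβ≡)
      (trans (ℤₚ.abs-* (+ p³) M) (trans (cong (p³ ℕ.*_) ∣M∣≡1) (ℕₚ.*-identityʳ p³))))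
      (ramified-cube-not-norm p-ramified p∣f β β∈)
    ; (no ∣M∣≢1) → let q , q-prime , q∣M = prime-divisor ∣ M ∣ ∣M∣≢1 in at-prime n ∣M∣≤n q-prime (∣ᵤ⇒∣ q∣M) }
    where
    M≢0 : M ≢ 0ℤ
    M≢0 M≡0 = M-coprime p p-prime p∣f (subst (+ p ∣ℤ_) (sym M≡0) (divides 0ℤ refl))
    +p³≢0 : + p³ ≢ 0ℤ
    +p³≢0 eq = ℕ.≢-nonZero⁻¹ p³ (ℤₚ.+-injective eq)
    at-prime : ∀ n {q} → ∣ M ∣ ≤ n → Prime q → + q ∣ℤ M → CubeTimesPrime
    at-prime zero ∣M∣≤0 _ _ = contradiction (ℤₚ.∣i∣≡0⇒i≡0 (ℕₚ.n≤0⇒n≡0 ∣M∣≤0)) M≢0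
    at-prime (suc n) {q} ∣M∣≤1+n q-prime q∣M@(divides M₁ M≡M₁q) =
      case (+ q ∣ℤ? proj₁ β) ×-dec (+ q ∣ℤ? proj₂ β) of λ
      { (yes q∣β) → divisible (quotient-by β q∣β)
      ; (no q∤β) → case splits? card-f (q-primitive q∤β) of λ
        { (yes S) → split S
        -- (β , p³) is nonprincipal because ±p³ is not a norm; with (β , q) nonprincipal as well, (β
        -- , p³ q) has a generator, and its norm is ±p³ q.
        ; (no ¬S) → combine ¬S (product-splits card-f p³-primitive (q-primitive q∤β) (p³q-primitive q∤β)
            (λ { (γ , _ , γ∈ , _ , _ , ∣Nγ∣≡p³) → ramified-cube-not-norm p-ramified p∣f γ γ∈ ∣Nγ∣≡p³ }) ¬S) }
              }
      where
      instance _ = ℤ.≢-nonZero (+prime≢0 q-prime)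
      q∤f : ¬ q ∣ f
      q∤f q∣f = M-coprime q q-prime q∣f q∣M
      q≢p : q ≢ p
      q≢p refl = q∤f p∣f
      ∣M₁∣≤n : ∣ M₁ ∣ ≤ n
      ∣M₁∣≤n = ℕₚ.≤-pred (ℕₚ.≤-trans (∣quotient∣< q-prime M₁ M M≢0 M≡M₁q) ∣M∣≤1+n)
      M₁∣M : M₁ ∣ℤ M
      M₁∣M = divides (+ q) (trans M≡M₁q (ℤₚ.*-comm M₁ (+ q)))
      Nβ≡qp³M₁ : norm β ≡ + q * (+ p³ * M₁)
      Nβ≡qp³M₁ = trans Nβ≡ (trans (cong (+ p³ *_) M≡M₁q) (rotate (+ p³) M₁ (+ q)))
        where
        rotate : ∀ a b c → a * (b * c) ≡ c * (a * b)
        rotate = solve-∀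
      divisible : ∃[ v ] β ≡ ⟦ + q ⟧ ∙ v × proj₂ β ≡ + q * proj₂ v → CubeTimesPrime
      -- β / q has the norm p³ M / q²; since q ≠ p, both factors q are taken from M.
      divisible (v , β≡qv , im≡) = go (Sum.fromInj₂ (λ q∣p³ → contradiction (∣p³⇒≡p q-prime q∣p³) q≢p)
          (prime-∣* q-prime (+ p³) M₁ (subst (+ q ∣ℤ_) qNv≡ (∣m⇒∣m*n (norm v) ∣-refl))))
        where
        qNv≡ : + q * norm v ≡ + p³ * M₁
        qNv≡ = ℤₚ.*-cancelˡ-≡ (+ q) _ _
          (trans (sym (ℤₚ.*-assoc (+ q) (+ q) (norm v))) (trans (sym (norm-quotient (+ q) β≡qv)) Nβ≡qp³M₁))
        v∈ : InOrder f v
        v∈ = inOrder (∣-coprime-cancel (∤⇒bezout q-prime λ q∣f → q∤f (∣⇒∣ᵤ q∣f))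
          (subst (+ f ∣ℤ_) im≡ (InOrder.∣im β∈)))
        go : + q ∣ℤ M₁ → CubeTimesPrime
        go (divides M₂ M₁≡M₂q) = descend n M₂ v (ℕₚ.≤-trans ∣M₂∣≤∣M₁∣ ∣M₁∣≤n) v∈
          (ℤₚ.*-cancelˡ-≡ (+ q) _ _ (trans qNv≡ (trans (cong (+ p³ *_) M₁≡M₂q) (rotate (+ p³) M₂ (+ q)))))
          λ r r-prime r∣f r∣M₂ → M-coprime r r-prime r∣f (∣-trans r∣M₂ (∣-trans M₂∣M₁ M₁∣M))
          where
          rotate : ∀ a b c → a * (b * c) ≡ c * (a * b)
          rotate = solve-∀
          M₂∣M₁ : M₂ ∣ℤ M₁
          M₂∣M₁ = divides (+ q) (trans M₁≡M₂q (ℤₚ.*-comm M₂ (+ q)))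
          M₁≢0 : M₁ ≢ 0ℤ
          M₁≢0 M₁≡0 = M≢0 (trans M≡M₁q (cong (_* + q) M₁≡0))
          ∣M₂∣≤∣M₁∣ : ∣ M₂ ∣ ≤ ∣ M₁ ∣
          ∣M₂∣≤∣M₁∣ = ℕₚ.<⇒≤ (∣quotient∣< q-prime M₂ M₁ M₁≢0 M₁≡M₂q)
      r≡q : ∀ {r} → Prime r → + r ∣ℤ + q → r ≡ q
      r≡q r-prime = prime-∣prime r-prime q-prime
      not-divisible : ¬ (+ q ∣ℤ proj₁ β × + q ∣ℤ proj₂ β) → + q ∣ℤ trace β → ¬ + q ∣ℤ + p³ * M₁
      not-divisible q∤β q∣T q∣C = q∤β
        (integrality d-squarefree q-prime β q∣T (subst (+ q * + q ∣ℤ_) (sym Nβ≡qp³M₁) (*-monoʳ-∣ (+ q) q∣C)))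
      q-primitive : ¬ (+ q ∣ℤ proj₁ β × + q ∣ℤ proj₂ β) → Primitive f β (+ q)
      q-primitive q∤β = mkPrimitive (+ p³ * M₁) β∈ (+prime≢0 q-prime) Nβ≡qp³M₁ λ r r-prime r∣q r∣T r∣C →
        not-divisible q∤β (subst (λ r → + r ∣ℤ trace β) (r≡q r-prime r∣q) r∣T)
          (subst (λ r → + r ∣ℤ + p³ * M₁) (r≡q r-prime r∣q) r∣C)
      p³-primitive : Primitive f β (+ p³)
      p³-primitive = mkPrimitive M β∈ +p³≢0 Nβ≡ λ r r-prime r∣p³ _ r∣M →
        M-coprime p p-prime p∣f (subst (λ r → + r ∣ℤ M) (∣p³⇒≡p r-prime r∣p³) r∣M)
      p³q-primitive : ¬ (+ q ∣ℤ proj₁ β × + q ∣ℤ proj₂ β) → Primitive f β (+ p³ * + q)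
      p³q-primitive q∤β = mkPrimitive M₁ β∈
        (λ eq → Sum.[ +p³≢0 , +prime≢0 q-prime ] (ℤₚ.i*j≡0⇒i≡0∨j≡0 (+ p³) eq))
        (trans Nβ≡qp³M₁ (rotate (+ q) (+ p³) M₁)) λ r r-prime r∣p³q r∣T r∣M₁ → Sum.[
          (λ r∣p³ → M-coprime p p-prime p∣f
            (∣-trans (subst (λ r → + r ∣ℤ M₁) (∣p³⇒≡p r-prime r∣p³) r∣M₁) M₁∣M)) ,
          (λ r∣q → not-divisible q∤β (subst (λ r → + r ∣ℤ trace β) (r≡q r-prime r∣q) r∣T)
            (∣n⇒∣m*n (+ p³) (subst (λ r → + r ∣ℤ M₁) (r≡q r-prime r∣q) r∣M₁))) ]
        (prime-∣* r-prime (+ p³) (+ q) r∣p³q)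
        where
        rotate : ∀ a b c → a * (b * c) ≡ b * a * c
        rotate = solve-∀
      split : Splits f β (+ q) → CubeTimesPrime
      split (γ , δ , γ∈ , δ∈ , β≡γδ , ∣Nγ∣≡q) = go (∣i∣≡∣j∣⇒i≡±j (norm γ) (+ q) ∣Nγ∣≡q)
        where
        go : ∃[ ε ] IsSign ε × norm γ ≡ ε * + q → CubeTimesPrime
        go (ε , ε-sign , Nγ≡εq) = descend n (ε * M₁) δ (subst (_≤ n) (sym (abs-sign ε-sign)) ∣M₁∣≤n) δ∈ Nδ≡
          λ r r-prime r∣f r∣εM₁ → M-coprime r r-prime r∣f
            (∣-trans (subst (+ r ∣ℤ_) εεM₁≡M₁ (∣n⇒∣m*n ε r∣εM₁)) M₁∣M)
          where
          abs-sign : ∀ {ε} → IsSign ε → ∣ ε * M₁ ∣ ≡ ∣ M₁ ∣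
          abs-sign {ε} (inj₁ refl) = trans (ℤₚ.abs-* ε M₁) (ℕₚ.+-identityʳ ∣ M₁ ∣)
          abs-sign {ε} (inj₂ refl) = trans (ℤₚ.abs-* ε M₁) (ℕₚ.+-identityʳ ∣ M₁ ∣)
          involutive : ∀ i → ε * (ε * i) ≡ i
          involutive i = trans (sym (ℤₚ.*-assoc ε ε i))
            (trans (cong (_* i) (sign² ε-sign)) (ℤₚ.*-identityˡ i))
          εεM₁≡M₁ : ε * (ε * M₁) ≡ M₁
          εεM₁≡M₁ = involutive M₁
          qεNδ≡ : + q * (ε * norm δ) ≡ + q * (+ p³ * M₁)
          qεNδ≡ = trans (rotate (+ q) ε (norm δ))
            (trans (cong (_* norm δ) (sym Nγ≡εq))
            (trans (sym (norm-∙ γ δ)) (trans (cong norm (sym β≡γδ)) Nβ≡qp³M₁)))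
            where
            rotate : ∀ a b c → a * (b * c) ≡ b * a * c
            rotate = solve-∀
          Nδ≡ : norm δ ≡ + p³ * (ε * M₁)
          Nδ≡ = trans (sym (involutive (norm δ)))
            (trans (cong (ε *_) (ℤₚ.*-cancelˡ-≡ (+ q) _ _ qεNδ≡)) (swap′ ε (+ p³) M₁))
            where
            swap′ : ∀ a b c → a * (b * c) ≡ b * (a * c)
            swap′ = solve-∀
      combine : ¬ Splits f β (+ q) → Splits f β (+ p³ * + q) → CubeTimesPrime
      combine ¬S (γ , _ , γ∈ , _ , _ , ∣Nγ∣≡p³q) = γ , q , γ∈ , q-prime , q≢p ,
        (λ { (γ′ , γ′∈ , ∣Nγ′∣≡q) → ¬S
          (norm-prime⇒splits q-prime q∤f β β∈ (subst (+ q ∣ℤ_) (sym Nβ≡qp³M₁) (∣m⇒∣m*n (+ p³ * M₁) ∣-refl)) γ′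
          γ′∈ ∣Nγ′∣≡q) }) ,
        trans ∣Nγ∣≡p³q (ℤₚ.abs-* (+ p³) (+ q))

  cube-times-prime : CubeTimesPrime
  cube-times-prime = let β , M , β∈ , Nβ≡ , M-coprime = starting-element in descend ∣ M ∣ M β ℕₚ.≤-refl β∈ Nβ≡
    M-coprime

  module _ {x q} (x∈ : InOrder f x) (q-prime : Prime q) (q≢p : q ≢ p) (q-not-norm : ¬ NormPrime q)
    (∣Nx∣≡p³q : ∣ norm x ∣ ≡ p³ ℕ.* q) where

    private
      instance _ = prime⇒nonZero q-prime

      p∣norm⇒p²∣norm : ∀ {v} → InOrder f v → p ∣ ∣ norm v ∣ → p ℕ.* p ∣ ∣ norm v ∣
      p∣norm⇒p²∣norm {v} v∈ p∣Nv = let w , _ , v≡pw = quotient-inOrder v v∈ (∣ᵤ⇒∣ p∣Nv) in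
        subst (p ℕ.* p ∣_) (sym (abs-norm-quotient v≡pw)) (ℕ∣.m∣m*n ∣ norm w ∣)

      only-prime-divisor : ∀ {r n} → Prime r → n ≢ 1 → (∀ s → Prime s → s ∣ n → s ≡ r) → r ∣ n
      only-prime-divisor {r} {n} r-prime n≢1 only =
        let s , s-prime , s∣n = prime-divisor n n≢1 in subst (_∣ n) (only s s-prime s∣n) s∣n

      ∣prime² : ∀ {r s} → Prime r → Prime s → s ∣ r ℕ.* r → s ≡ r
      ∣prime² {r} r-prime s-prime s∣r² =
        prime-∣prime s-prime r-prime (∣ᵤ⇒∣ (Sum.reduce (euclidsLemma r r s-prime s∣r²)))

      -- A norm from 𝒪_f divisible by p is divisible by p², so p³ cannot be shared
      -- between v and w; and if p³ ∣ norm w, then norm v = ±q.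
      x-factors : ∀ {v w} → InOrder f v → InOrder f w → ∣ norm v ∣ ℕ.* ∣ norm w ∣ ≡ p³ ℕ.* q →
        q ∣ ∣ norm v ∣ → ∣ norm w ∣ ≡ 1
      x-factors {v} {w} v∈ w∈ VW≡ (ℕ∣.divides A V≡Aq) = decidable-stable (∣ norm w ∣ ℕₚ.≟ 1) λ W≢1 →
        p²∣W (p∣norm⇒p²∣norm w∈ (only-prime-divisor p-prime W≢1 λ s s-prime s∣W →
          ∣p³⇒≡p s-prime (∣ᵤ⇒∣ (subst (s ∣_) AW≡p³ (ℕ∣.∣n⇒∣m*n A s∣W)))))
        where
        AW≡p³ : A ℕ.* ∣ norm w ∣ ≡ p³
        AW≡p³ = ℕₚ.*-cancelʳ-≡ _ _ q (trans (rotate A ∣ norm w ∣ q)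
          (trans (cong (ℕ._* ∣ norm w ∣) (sym V≡Aq)) VW≡))
          where
          rotate : ∀ a b c → a ℕ.* b ℕ.* c ≡ a ℕ.* c ℕ.* b
          rotate = ℕ-solve-∀
        p²∣W : ¬ p ℕ.* p ∣ ∣ norm w ∣
        p²∣W (ℕ∣.divides B W≡Bp²) = Sum.[ A≡1 ,
          A≡p ] (prime⇒irreducible p-prime (ℕ∣.divides B (trans (sym AB≡p) (ℕₚ.*-comm A B))))
          where
          AB≡p : A ℕ.* B ≡ p
          AB≡p = ℕₚ.*-cancelʳ-≡ _ _ (p ℕ.* p)
            (trans (ℕₚ.*-assoc A B (p ℕ.* p))
            (trans (cong (A ℕ.*_) (sym W≡Bp²)) (trans AW≡p³ (ℕₚ.*-comm (p ℕ.* p) p))))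
          A≡1 : A ≢ 1
          A≡1 A≡1 = q-not-norm (v , v∈ , trans V≡Aq (trans (cong (ℕ._* q) A≡1) (ℕₚ.*-identityˡ q)))
          A≡p : A ≢ p
          A≡p A≡p = q≢p (sym (prime-∣prime p-prime q-prime (∣ᵤ⇒∣ (ℕ∣.*-cancelˡ-∣ p (subst (p ℕ.* p ∣_) V≡pq
            (p∣norm⇒p²∣norm v∈ (subst (p ∣_) (sym V≡pq) (ℕ∣.m∣m*n q))))))))
            where
            V≡pq : ∣ norm v ∣ ≡ p ℕ.* q
            V≡pq = trans V≡Aq (cong (ℕ._* q) A≡p)

    norm-p³q⇒atom : ∀ {y} → InOrder f y → ∣ norm y ∣ ≡ p³ ℕ.* q → IsAtom D (emb y)
    norm-p³q⇒atom {y} y∈ ∣Ny∣≡ = norm⇒atom y∈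
      (λ Ny≡0 → ℕ.≢-nonZero⁻¹ (p³ ℕ.* q) {{ℕₚ.m*n≢0 p³ q}} (trans (sym ∣Ny∣≡) (cong ∣_∣ Ny≡0)))
      (λ ∣Ny∣≡1 → prime-≢1 q-prime (ℕₚ.m*n≡1⇒n≡1 p³ q (trans (sym ∣Ny∣≡) ∣Ny∣≡1)))
      λ v w v∈ w∈ VW≡ → let VW≡p³q = trans VW≡ ∣Ny∣≡ in Sum.[
          (λ q∣V → inj₂ (x-factors v∈ w∈ VW≡p³q q∣V)) ,
          (λ q∣W → inj₁ (x-factors w∈ v∈ (trans (ℕₚ.*-comm ∣ norm w ∣ ∣ norm v ∣) VW≡p³q) q∣W)) ]
        (euclidsLemma ∣ norm v ∣ ∣ norm w ∣ q-prime (subst (q ∣_) (sym VW≡p³q) (ℕ∣.n∣m*n p³)))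

    -- The norm of r is r², so two nonunits with product r would both have norm ±r.
    prime⇒atom : ∀ {r} → Prime r → (∀ {v} → InOrder f v → r ∣ ∣ norm v ∣ → ∣ norm v ∣ ≢ r) →
      IsAtom D (emb ⟦ + r ⟧)
    prime⇒atom {r} r-prime not-norm = norm⇒atom (⟦⟧-inOrder (+ r))
      (λ Nr≡0 → Sum.[ +prime≢0 r-prime ,
        +prime≢0 r-prime ] (ℤₚ.i*j≡0⇒i≡0∨j≡0 (+ r) (trans (sym (norm-⟦⟧ (+ r))) Nr≡0)))
      (λ ∣Nr∣≡1 → prime-≢1 r-prime (ℕₚ.m*n≡1⇒m≡1 r r (trans (sym (abs-norm-⟦⟧ r)) ∣Nr∣≡1)))
      λ v w v∈ w∈ VW≡ → factors v w v∈ w∈ (trans VW≡ (abs-norm-⟦⟧ r))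
      where
      instance _ = prime⇒nonZero r-prime
      factors : ∀ v w → InOrder f v → InOrder f w → ∣ norm v ∣ ℕ.* ∣ norm w ∣ ≡ r ℕ.* r → ∣ norm v ∣ ≡ 1 ⊎
        ∣ norm w ∣ ≡ 1
      factors v w v∈ w∈ VW≡r² = case ∣ norm v ∣ ℕₚ.≟ 1 of λ
        { (yes V≡1) → inj₁ V≡1
        ; (no V≢1) → inj₂ (go (only-prime-divisor r-prime V≢1 λ s s-prime s∣V →
          ∣prime² r-prime s-prime (subst (s ∣_) VW≡r² (ℕ∣.∣m⇒∣m*n ∣ norm w ∣ s∣V)))) }
        where
        go : r ∣ ∣ norm v ∣ → ∣ norm w ∣ ≡ 1
        go r∣V@(ℕ∣.divides A V≡Ar) = Sum.[
          (λ A≡1 → contradiction (trans V≡Ar (trans (cong (ℕ._* r) A≡1) (ℕₚ.*-identityˡ r)))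
          (not-norm v∈ r∣V)) , A≡r⇒W≡1 ]
            (prime⇒irreducible r-prime (ℕ∣.divides ∣ norm w ∣ (trans (sym AW≡r) (ℕₚ.*-comm A ∣ norm w ∣))))
          where
          AW≡r : A ℕ.* ∣ norm w ∣ ≡ r
          AW≡r = ℕₚ.*-cancelʳ-≡ _ _ r (trans (rotate A ∣ norm w ∣ r)
            (trans (cong (ℕ._* ∣ norm w ∣) (sym V≡Ar)) VW≡r²))
            where
            rotate : ∀ a b c → a ℕ.* b ℕ.* c ≡ a ℕ.* c ℕ.* b
            rotate = ℕ-solve-∀
          A≡r⇒W≡1 : A ≡ r → ∣ norm w ∣ ≡ 1
          A≡r⇒W≡1 A≡r = ℕₚ.*-cancelˡ-≡ _ _ r
            (trans (trans (cong (ℕ._* ∣ norm w ∣) (sym A≡r)) AW≡r) (sym (ℕₚ.*-identityʳ r)))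

    p-atom : IsAtom D (emb ⟦ + p ⟧)
    p-atom = prime⇒atom p-prime λ {v} v∈ _ → norm-≢q v v∈

    q-atom : IsAtom D (emb ⟦ + q ⟧)
    q-atom = prime⇒atom q-prime λ {v} v∈ _ V≡q → q-not-norm (v , v∈ , V≡q)

    2∈L : 𝖫 D (emb ⟦ norm x ⟧) 2
    2∈L = 1𝕂 , emb x ∷ emb (conj x) ∷ [] ,
      subst (IsUnit D) emb-1 (norm⇒unit (⟦⟧-inOrder 1ℤ) (cong ∣_∣ (norm-⟦⟧ 1ℤ))) ,
      norm-p³q⇒atom x∈ ∣Nx∣≡p³q VecAll.∷ norm-p³q⇒atom (conj-inOrder x∈)
        (trans (cong ∣_∣ (norm-conj x)) ∣Nx∣≡p³q) VecAll.∷ VecAll.[] ,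
      trans (cong emb (sym (∙-conj x)))
        (trans (emb-∙ x (conj x)) (sym
        (trans (⊗-identityˡ _) (cong (emb x ⊗_) (⊗-identityʳ (emb (conj x)))))))

    4∈L : 𝖫 D (emb ⟦ norm x ⟧) 4
    4∈L = go (∣i∣≡∣j∣⇒i≡±j (norm x) (+ p * (+ p * (+ p * + q))) (trans ∣Nx∣≡p³q (sym abs-product)))
      where
      abs-product : ∣ + p * (+ p * (+ p * + q)) ∣ ≡ p³ ℕ.* q
      abs-product = trans (ℤₚ.abs-* (+ p) _)
        (trans (cong (p ℕ.*_) (trans (ℤₚ.abs-* (+ p) _) (cong (p ℕ.*_) (ℤₚ.abs-* (+ p) (+ q)))))
        (regroup p q))
        where
        regroup : ∀ p q → p ℕ.* (p ℕ.* (p ℕ.* q)) ≡ p ℕ.* p ℕ.* p ℕ.* q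
        regroup = ℕ-solve-∀
      go : ∃[ ε ] IsSign ε × norm x ≡ ε * (+ p * (+ p * (+ p * + q))) → 𝖫 D (emb ⟦ norm x ⟧) 4
      go (ε , ε-sign , Nx≡) = emb ⟦ ε ⟧ , emb ⟦ + p ⟧ ∷ emb ⟦ + p ⟧ ∷ emb ⟦ + p ⟧ ∷ emb ⟦ + q ⟧ ∷ [] ,
        norm⇒unit (⟦⟧-inOrder ε) (cong ∣_∣ (trans (norm-⟦⟧ ε) (sign² ε-sign))) ,
        p-atom VecAll.∷ p-atom VecAll.∷ p-atom VecAll.∷ q-atom VecAll.∷ VecAll.[] ,
        trans (cong (λ n → emb ⟦ n ⟧) Nx≡)
          (multiply ε (multiply (+ p) (multiply (+ p) (multiply (+ p) (sym (⊗-identityʳ _))))))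
        where
        multiply : ∀ i {j z} → emb ⟦ j ⟧ ≡ z → emb ⟦ i * j ⟧ ≡ emb ⟦ i ⟧ ⊗ z
        multiply i {j} eq = trans (cong emb (sym (⟦⟧-* i j)))
          (trans (emb-∙ ⟦ i ⟧ ⟦ j ⟧) (cong (emb ⟦ i ⟧ ⊗_) eq))

    2∈Δ : 2 ∈ Δ D
    2∈Δ = emb ⟦ norm x ⟧ , emb⇒𝒪 a∈ , a≢0 , s≤s z≤n , 2 , 4 , s≤s (s≤s (s≤s z≤n)) , 2∈L , 4∈L , refl , gap
      where
      a∈ : InOrder f ⟦ norm x ⟧
      a∈ = ⟦⟧-inOrder (norm x)
      a≢0 : emb ⟦ norm x ⟧ ≢ 0𝕂
      a≢0 eq = ℕ.≢-nonZero⁻¹ (p³ ℕ.* q) {{ℕₚ.m*n≢0 p³ q}}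
        (trans (sym ∣Nx∣≡p³q) (cong (λ z → ∣ proj₁ z ∣) (emb≡0⇒≡0 2≤d d-squarefree eq)))
      -- Only m = 3 lies in between, and it cannot be a length next to 2.
      gap : ∀ m → 2 < m → m < 4 → ¬ 𝖫 D (emb ⟦ norm x ⟧) m
      gap m 2<m m<4 m∈L = no-consecutive-lengths (emb⇒𝒪 {f} a∈) 2∈L
        (subst (𝖫 D (emb ⟦ norm x ⟧)) (ℕₚ.≤-antisym (ℕₚ.≤-pred m<4) 2<m) m∈L)

proposition3p6 : (d f : ℕ) → 2 ≤ d → Squarefree d → 1 ≤ f → Squarefree f →
    (∃[ p ] Ramified d p × p ∣ f) →
    (∀ p → Split d p → ¬ p ∣ f) →
    HasCardinality (Pic (𝒪 d f)) 2 →
    HasCardinality (Pic (𝒪K d)) 2 →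
    (∀ (α : ℤ) → α ≡ -1ℤ ⊎ α ≡ 1ℤ →
    ∀ p (p-prime : Prime p) → Ramified d p → p ∣ f → ResidueCondition d f α p p-prime) →
    MinΔ≡ (𝒪 d f) 2
proposition3p6 d f 2≤d d-squarefree _ f-squarefree (p , p-ramified , ℕ∣.divides f′ f≡f′p) no-split card-f
  card-K condition =
  inj₁ (let x , q , x∈ , q-prime , q≢p , q-not-norm , ∣Nx∣≡p³q = cube-times-prime in
    2∈Δ x∈ q-prime q≢p q-not-norm ∣Nx∣≡p³q , lower-bound)
  where
  no-ramified-norm : ∀ {p f′} → Ramified d p → f ≡ f′ ℕ.* p → ∀ w → Integers.InOrder d f′ w →
    ∣ Integers.norm d w ∣ ≢ p
  no-ramified-norm {p} {f′} p-ramified@(p-prime , _) f≡f′p =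
    Primes.residue-condition⇒no-norm d p-prime p-ramified f≡f′p λ α α-sign →
      condition α α-sign p p-prime p-ramified (ℕ∣.divides f′ f≡f′p)
  open Existence d 2≤d d-squarefree f f-squarefree no-split card-f card-K no-ramified-norm p f′ p-ramified
    f≡f′p
  open Weights d 2≤d d-squarefree f f-squarefree no-split card-f card-K no-ramified-norm using
    (no-consecutive-lengths)
  lower-bound : ∀ n → n ∈ Δ (𝒪 d f) → 2 ≤ n
  -- The value 0 is excluded by the condition 1 ≤ n in `Distances`; a distance 1 would join
  -- consecutive lengths.
  lower-bound (suc (suc n)) _ = s≤s (s≤s z≤n)
  lower-bound 1 (a , a∈ , _ , _ , k , ℓ , _ , k∈L , ℓ∈L , ℓ≡k+1 , _) =
    contradiction (subst (𝖫 (𝒪 d f) a) (trans ℓ≡k+1 (ℕₚ.+-comm k 1)) ℓ∈L) (no-consecutive-lengths a∈ k∈L)
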